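{- Let $D$ be a symmetric $(81,16,3)$ design (if one exists), and let $G=\mathrm{Aut}(D)$ be its full automorphism group. Then $|G|=2^{\alpha}3^{\beta}5^{\gamma}13^{\sigma}$ for some non-negative integers $\alpha,\beta,\gamma,\sigma$ with $\gamma\leq 1$ and $\sigma\leq 1$. Moreover, $G$ has no subgroup of order $65$, $G$ has no elements of order $10$ or of order $26$, and $G$ does not contain any abelian $2$-subgroup of rank greater than $3$.
   Context: A symmetric $(v,k,\lambda)$ design, for integers $v>k>\lambda\geq 0$, is a pair $D=(V,\mathcal{B})$ where $V$ is a set of $v$ points and $\mathcal{B}$ is a set of $k$-subsets of $V$ (blocks) such that $|\mathcal{B}|=v$, every point lies in exactly $k$ blocks, any two distinct blocks meet in exactly $\lambda$ points, and any two distinct points lie in exactly $\lambda$ common blocks. An automorphism of $D$ is a permutation of $V$ mapping blocks to blocks; $\mathrm{Aut}(D)$ is the group of all automorphisms under composition. The existence of a symmetric $(81,16,3)$ design is unknown. -}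

module Defs where

open import Data.Nat using (ℕ; zero; suc; _≤_; _*_; _^_)
open import Data.Bool using (true)
open import Data.Fin using (Fin)
open import Data.Fin.Subset using (Subset; _∈_; _∩_; ∣_∣)
open import Data.Vec using (Vec; lookup; tabulate; allFin)
open import Data.List using (List; length)
open import Data.List.Membership.Propositional using () renaming (_∈_ to _∈ₗ_)
open import Data.List.Relation.Unary.Unique.Propositional using (Unique)
open import Data.List.Relation.Unary.All using (All)
open import Data.Product using (Σ; ∃; ∃-syntax; _×_)
open import Function.Bundles using (_⇔_)
open import Function.Definitions using (Injective)
open import Relation.Binary.PropositionalEquality using (_≡_; _≢_)
open import Relation.Nullary using (¬_)

-- Symmetric (v,k,λ) designs on the point set Fin v.
-- The v blocks are given as an injectively indexed family of subsets of
-- the point set (so the block set B is the image of `block`, |B| = v).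

blocksThrough : ∀ {v} → (Fin v → Subset v) → Fin v → Subset v
blocksThrough block x = tabulate (λ i → lookup (block i) x)

record SymmetricDesign (v k lam : ℕ) : Set where
  field
    block              : Fin v → Subset v
    blocks-distinct    : ∀ i j → block i ≡ block j → i ≡ j
    block-size         : ∀ i → ∣ block i ∣ ≡ k
    point-degree       : ∀ x → ∣ blocksThrough block x ∣ ≡ k
    block-intersection : ∀ i j → i ≢ j → ∣ block i ∩ block j ∣ ≡ lam
    point-pair         : ∀ x y → x ≢ y →
                         ∣ blocksThrough block x ∩ blocksThrough block y ∣ ≡ lam

Perm : ℕ → Set
Perm n = Vec (Fin n) n

IsPerm : ∀ {n} → Perm n → Set
IsPerm σ = Injective _≡_ _≡_ (lookup σ)   -- injective self-map of a finite set

idPerm : ∀ {n} → Perm n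
idPerm = allFin _

_∘ₚ_ : ∀ {n} → Perm n → Perm n → Perm n
σ ∘ₚ τ = tabulate (λ x → lookup σ (lookup τ x))

_^ₚ_ : ∀ {n} → Perm n → ℕ → Perm n
σ ^ₚ zero  = idPerm
σ ^ₚ suc m = σ ∘ₚ (σ ^ₚ m)

IsAut : ∀ {v k lam} → SymmetricDesign v k lam → Perm v → Set
IsAut {v} D σ =
  IsPerm σ ×
  (∀ i → ∃[ j ] (∀ (x : Fin v) → (x ∈ block i) ⇔ (lookup σ x ∈ block j)))
  where open SymmetricDesign D

AutOrder : ∀ {v k lam} → SymmetricDesign v k lam → ℕ → Set
AutOrder {v} D n = Σ (List (Perm v)) λ L →
  Unique L × (∀ σ → (σ ∈ₗ L) ⇔ IsAut D σ) × length L ≡ n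

HasOrder : ∀ {n} → Perm n → ℕ → Set
HasOrder σ m = (1 ≤ m) × (σ ^ₚ m ≡ idPerm) ×
               (∀ j → 1 ≤ j → suc j ≤ m → σ ^ₚ j ≢ idPerm)

HasElementOfOrder : ∀ {v k lam} → SymmetricDesign v k lam → ℕ → Set
HasElementOfOrder {v} D m = Σ (Perm v) λ σ → IsAut D σ × HasOrder σ m

IsSubgroup : ∀ {v k lam} → SymmetricDesign v k lam → List (Perm v) → Set
IsSubgroup D H =
  Unique H × All (IsAut D) H × (idPerm ∈ₗ H) ×
  (∀ σ τ → σ ∈ₗ H → τ ∈ₗ H → (σ ∘ₚ τ) ∈ₗ H) ×
  (∀ σ → σ ∈ₗ H → ∃[ τ ] ((τ ∈ₗ H) × (τ ∘ₚ σ ≡ idPerm)))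

HasSubgroupOfOrder : ∀ {v k lam} → SymmetricDesign v k lam → ℕ → Set
HasSubgroupOfOrder {v} D m =
  Σ (List (Perm v)) λ H → IsSubgroup D H × length H ≡ m

IsAbelian : ∀ {n} → List (Perm n) → Set
IsAbelian H = ∀ σ τ → σ ∈ₗ H → τ ∈ₗ H → σ ∘ₚ τ ≡ τ ∘ₚ σ

-- the subgroup generated by a list S of permutations (in a finite
-- permutation group, closure under identity and composition is the
-- generated subgroup, since inverses are positive powers)
data Gen {n} (S : List (Perm n)) : Perm n → Set where
  gen-id   : Gen S idPerm
  gen-mem  : ∀ {σ} → σ ∈ₗ S → Gen S σ
  gen-comp : ∀ {σ τ} → Gen S σ → Gen S τ → Gen S (σ ∘ₚ τ)

RankAtMost : ∀ {n} → ℕ → List (Perm n) → Set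
RankAtMost {n} r H = Σ (List (Perm n)) λ S →
  length S ≤ r × All (_∈ₗ H) S × (∀ σ → (σ ∈ₗ H) ⇔ Gen S σ)

HasAbelian2SubgroupOfRankAbove : ∀ {v k lam} → SymmetricDesign v k lam → ℕ → Set
HasAbelian2SubgroupOfRankAbove {v} D r = Σ (List (Perm v)) λ H →
  IsSubgroup D H × IsAbelian H × (∃[ a ] length H ≡ 2 ^ a) × ¬ RankAtMost r H

{-# OPTIONS --safe #-}
-- For an automorphism the numbers of fixed points and of fixed blocks agree. For prime order p > 3 the blocks joining
-- two fixed points are fixed, and counting the moved points on fixed blocks leaves p = 5 with one fixed point and p = 13
-- with three; point stabilisers then exclude 25 and 169, and elements of order 65, 10, 26 are excluded by comparing fixed
-- points of their commuting parts modulo 2, 5 and 13. An involution fixes 9, 13 or 17 points: the first and second moments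
-- of s, the number of fixed blocks through a point, bound f, and f ≡ 3 mod 4 would give an integer matrix of odd order
-- with W Wᵀ = 13 I, which is impossible since 13 is not a square (Bruck and Ryser).
-- An abelian 2-group that is not generated by three elements contains an elementary abelian group E of order 16. As E fixes
-- at least 3 points, a subgroup K of order 8 fixes two blocks meeting in three points that lie together in no third block.
-- Since K fixes at most 7 points, it fixes five points and five blocks with incidence matrix J − I. A group of order 4 in K fixes
-- at most 9 points, hence fixes only these five blocks; an involution in K fixes 17 blocks, 9 and 13 being impossible by counting
-- incidences around the five blocks. The twelve others fixed
-- by each of the seven involutions are all distinct, so 7 · 12 ≤ 81 − 5, a contradiction.
module Submission where

open import Defs
open import Data.Nat using (ℕ; zero; suc; _+_; _*_; _∸_; _^_; _≤_; _<_; z≤n; s≤s; NonZero; _≤?_; _<?_; _%_)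
open import Data.Nat.Properties using (+-comm; +-identityʳ; +-suc; *-comm; *-assoc; *-distribˡ-+; *-distribʳ-+; *-identityʳ; *-identityˡ; *-zeroʳ; ≤-refl; ≤-trans; ≤-reflexive; ≤-antisym; ≤-total; <-trans; <-irrefl; <⇒≢; ≤-<-trans; ≰⇒>; ≮⇒≥; <⇒≤; <⇒≱; n<1+n; n≤1+n; m≤m+n; m≤n+m; +-mono-≤; +-monoʳ-≤; +-monoˡ-≤; *-mono-≤; *-monoʳ-≤; *-monoˡ-≤; +-cancelˡ-≡; +-cancelʳ-≡; m+[n∸m]≡n; m∸n+n≡m; *-cancelʳ-≡; *-cancelˡ-≡; suc-injective; m≤n⇒m<n∨m≡n; 1+n≰n)
open import Data.Nat.Divisibility using (_∣_; divides; ∣m∣n⇒∣m+n; ∣m+n∣m⇒∣n; ∣-trans; ∣⇒≤; _∣?_; n∣m*n; m∣m*n; ∣m⇒∣m*n; ∣-refl; _∣0; *-cancelˡ-∣; *-monoʳ-∣)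
open import Data.Nat.Primality using (Prime; prime?; euclidsLemma; prime⇒irreducible; prime⇒nonZero; prime⇒nonTrivial; ¬prime[0]; ¬prime[1])
open import Data.Nat.Primality.Factorisation using (PrimeFactorisation; factorise)
open import Data.Nat.DivMod using ([m+kn]%n≡m%n)
open import Data.Nat.Coprimality using (Coprime; prime⇒coprime; coprime-Bézout)
open import Data.Nat.GCD using (module Bézout)
open import Data.Nat.ListAction using (product)
open import Data.Nat.ListAction.Properties using (∈⇒∣product)
open import Data.Nat.Induction using (<-wellFounded)
open import Induction.WellFounded using (Acc; acc)
open import Data.Nat.Tactic.RingSolver using (solve-∀)
import Data.Nat as ℕ
open import Data.Integer using (ℤ; 0ℤ; 1ℤ) renaming (+_ to pos)
import Data.Integer as ℤ
import Data.Integer.Properties as ℤₚ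
import Data.Integer.Tactic.RingSolver as ℤ-Solver
import Data.Nat.Properties as ℕₚ
open import Data.Bool using (Bool; true; false; not; _∧_; _xor_; if_then_else_)
import Data.Bool.Properties as Boolₚ
open import Data.Fin using (Fin; zero; suc; toℕ)
import Data.Fin as Fin
import Data.Fin.Properties as Finₚ
open import Data.Fin.Patterns using (0F; 1F; 2F; 3F; 4F)
open import Data.Fin.Properties using (all?; any?; ¬∀⟶∃¬)
open import Data.Fin.Subset using (Subset; ∣_∣; _∩_)
open import Data.Vec using (Vec; []; _∷_; lookup; tabulate; zipWith; replicate)
import Data.Vec as Vec
import Data.Vec.Properties as Vecₚ
open import Data.List using (List; []; _∷_; length; map; filter; _++_; cartesianProduct; allFin; upTo)
import Data.List as List
import Data.List.Properties as Listₚ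
open import Data.List.Membership.Propositional using (_∈_; _∉_; find)
open import Data.List.Membership.Propositional.Properties using (∈-map⁺; ∈-map⁻; ∈-filter⁺; ∈-filter⁻; ∈-++⁺ˡ; ∈-++⁺ʳ; ∈-++⁻; ∈-allFin; ∈-cartesianProduct⁺; ∈-cartesianProduct⁻; ∈-∃++; ∈-cartesianProductWith⁺; ∈-cartesianProductWith⁻; ∈-upTo⁺; ∈-upTo⁻)
open import Data.List.Relation.Unary.Any using (Any; here; there)
import Data.List.Relation.Unary.Any as Any
open import Data.List.Relation.Unary.All using (All; []; _∷_)
import Data.List.Relation.Unary.All as All
import Data.List.Relation.Unary.All.Properties as Allₚ
open import Data.List.Relation.Unary.AllPairs using ([]; _∷_)
open import Data.List.Relation.Unary.Unique.Propositional using (Unique)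
import Data.List.Relation.Unary.Unique.Propositional.Properties as Uniqueₚ
open import Data.Product using (∃; ∃-syntax; _×_; _,_; proj₁; proj₂)
open import Data.Sum using (_⊎_; inj₁; inj₂; [_,_]′)
open import Data.Empty using (⊥; ⊥-elim)
open import Data.Unit using (⊤; tt)
open import Function using (_∘_; id; case_of_; _⇔_; Equivalence; mk⇔; Injective)
open import Relation.Nullary using (¬_; Dec; yes; no; contradiction)
open import Relation.Nullary.Decidable using (_×-dec_; _⊎-dec_; ¬?; _→-dec_; map′; toWitness; True; does; decidable-stable)
open import Relation.Unary using (Decidable)
open import Relation.Binary.Definitions using (DecidableEquality; tri<; tri≈; tri>)
open import Relation.Binary.PropositionalEquality using (_≡_; _≢_; refl; sym; trans; cong; cong₂; subst; subst₂; module ≡-Reasoning)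

-- Finite sums and counting

-- The bounds on the fixed points of 2-groups come from two moments: with s the number of fixed
-- blocks through a point, Σ s = 16 f and Σ s² = 3 f² + 13 f. Parity restricts s (even at a point
-- fixed by the group, 0, 1 or 3 at any other point), and a quadratic that is nonnegative on the
-- allowed values, such as (s - 4)(s - 6) or (s - 1)(s - 3), turns the moments into an inequality in
-- f. The obstacle is that these moments need as many fixed blocks as fixed points, and the counting
-- argument for a single automorphism does not reach the common fixed points of a noncyclic group.
-- For an elementary abelian 2-group the equality is recovered from ranks over F₂, where the fixed
-- part of the incidence matrix has Gram matrix J - I. A moved point on two or more fixed blocks has
-- a stabiliser of index two. Counting such points by their stabilisers carries bounds from groups
-- of order 2ⁿ to groups of order 2ⁿ⁺¹. The setting is self-dual in points and blocks, so a lemma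
-- proved for one is applied to the other.

infix 4 _≡_mod-via_

opaque
  ∑ : ∀ {n} → (Fin n → ℕ) → ℕ
  ∑ {zero}  f = 0
  ∑ {suc n} f = f zero + ∑ (λ i → f (suc i))

  ∑-cong : ∀ {n} {f g : Fin n → ℕ} → (∀ i → f i ≡ g i) → ∑ f ≡ ∑ g
  ∑-cong {zero}  h = refl
  ∑-cong {suc n} h = cong₂ _+_ (h zero) (∑-cong (λ i → h (suc i)))

  ∑-mono : ∀ {n} {f g : Fin n → ℕ} → (∀ i → f i ≤ g i) → ∑ f ≤ ∑ g
  ∑-mono {zero}  h = z≤n
  ∑-mono {suc n} h = +-mono-≤ (h zero) (∑-mono (λ i → h (suc i)))

  ∑-+ : ∀ {n} (f g : Fin n → ℕ) → ∑ (λ i → f i + g i) ≡ ∑ f + ∑ g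
  ∑-+ {zero}  f g = refl
  ∑-+ {suc n} f g rewrite ∑-+ (λ i → f (suc i)) (λ i → g (suc i)) =
    swap (f zero) (g zero) (∑ (λ i → f (suc i))) (∑ (λ i → g (suc i)))
    where
    swap : ∀ a b c d → a + b + (c + d) ≡ a + c + (b + d)
    swap = solve-∀

  ∑-*ˡ : ∀ {n} c (f : Fin n → ℕ) → ∑ (λ i → c * f i) ≡ c * ∑ f
  ∑-*ˡ {zero}  c f = sym (*-zeroʳ c)
  ∑-*ˡ {suc n} c f rewrite ∑-*ˡ c (λ i → f (suc i)) = sym (*-distribˡ-+ c (f zero) _)

  ∑-const : ∀ n c → ∑ {n} (λ _ → c) ≡ n * c
  ∑-const zero    c = refl
  ∑-const (suc n) c = cong (c +_) (∑-const n c)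

  ∑-zero : ∀ {n} {f : Fin n → ℕ} → (∀ i → f i ≡ 0) → ∑ f ≡ 0
  ∑-zero {n} h = trans (∑-cong h) (trans (∑-const n 0) (*-zeroʳ n))

  ∑-swap : ∀ {m n} (f : Fin m → Fin n → ℕ) → ∑ (λ i → ∑ (f i)) ≡ ∑ (λ j → ∑ (λ i → f i j))
  ∑-swap {zero}  {n} f = sym (trans (∑-const n 0) (*-zeroʳ n))
  ∑-swap {suc m} {n} f rewrite ∑-swap (λ i → f (suc i)) =
    sym (∑-+ (f zero) (λ j → ∑ (λ i → f (suc i) j)))

  term≤∑ : ∀ {n} (f : Fin n → ℕ) i → f i ≤ ∑ f
  term≤∑ f zero    = m≤m+n _ _
  term≤∑ f (suc i) = ≤-trans (term≤∑ (λ j → f (suc j)) i) (m≤n+m _ _)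

ι : ∀ {P : Set} → Dec P → ℕ
ι (yes _) = 1
ι (no _)  = 0

ι-cong : ∀ {P Q : Set} (p : Dec P) (q : Dec Q) → (P → Q) → (Q → P) → ι p ≡ ι q
ι-cong (yes _) (yes _) _ _ = refl
ι-cong (yes p) (no ¬q) f _ = contradiction (f p) ¬q
ι-cong (no ¬p) (yes q) _ g = contradiction (g q) ¬p
ι-cong (no _)  (no _)  _ _ = refl

ι-mono : ∀ {P Q : Set} (p : Dec P) (q : Dec Q) → (P → Q) → ι p ≤ ι q
ι-mono (yes _) (yes _) _ = ≤-refl
ι-mono (yes p) (no ¬q) f = contradiction (f p) ¬q
ι-mono (no _)  _       _ = z≤n

ι-yes : ∀ {P : Set} (p : Dec P) → P → ι p ≡ 1
ι-yes (yes _) _ = refl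
ι-yes (no ¬p) p = contradiction p ¬p

ι-no : ∀ {P : Set} (p : Dec P) → ¬ P → ι p ≡ 0
ι-no (yes p) ¬p = contradiction p ¬p
ι-no (no _)  _  = refl

ι≤1 : ∀ {P : Set} (p : Dec P) → ι p ≤ 1
ι≤1 (yes _) = ≤-refl
ι≤1 (no _)  = z≤n

ι-× : ∀ {P Q : Set} (p : Dec P) (q : Dec Q) → ι (p ×-dec q) ≡ ι p * ι q
ι-× (yes _) (yes _) = refl
ι-× (yes _) (no _)  = refl
ι-× (no _)  (yes _) = refl
ι-× (no _)  (no _)  = refl

ι-split : ∀ {P Q : Set} (p : Dec P) (q : Dec Q) → ι p ≡ ι (p ×-dec q) + ι (p ×-dec ¬? q)
ι-split (yes _) (yes _) = refl
ι-split (yes _) (no _)  = refl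
ι-split (no _)  (yes _) = refl
ι-split (no _)  (no _)  = refl

# : ∀ {n} {P : Fin n → Set} → Decidable P → ℕ
# P? = ∑ (λ x → ι (P? x))

#-cong : ∀ {n} {P Q : Fin n → Set} (P? : Decidable P) (Q? : Decidable Q) →
         (∀ {x} → P x → Q x) → (∀ {x} → Q x → P x) → # P? ≡ # Q?
#-cong P? Q? f g = ∑-cong (λ x → ι-cong (P? x) (Q? x) f g)

#-mono : ∀ {n} {P Q : Fin n → Set} (P? : Decidable P) (Q? : Decidable Q) →
         (∀ {x} → P x → Q x) → # P? ≤ # Q?
#-mono P? Q? f = ∑-mono (λ x → ι-mono (P? x) (Q? x) f)

#-split : ∀ {n} {P Q : Fin n → Set} (P? : Decidable P) (Q? : Decidable Q) →
          # P? ≡ # (λ x → P? x ×-dec Q? x) + # (λ x → P? x ×-dec ¬? (Q? x))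
#-split P? Q? = trans (∑-cong (λ x → ι-split (P? x) (Q? x))) (∑-+ _ _)

opaque
  unfolding ∑

  #-≡ : ∀ {n} (j : Fin n) → # (Finₚ._≟ j) ≡ 1
  #-≡ {suc n} zero = cong suc (∑-zero {n} (λ i → ι-no (suc i Finₚ.≟ zero) (λ ())))
  #-≡ {suc n} (suc j) = trans
    (cong₂ _+_ (ι-no (zero Finₚ.≟ suc j) (λ ()))
               (∑-cong (λ i → ι-cong (suc i Finₚ.≟ suc j) (i Finₚ.≟ j) Finₚ.suc-injective (cong suc))))
    (#-≡ j)

#-remove : ∀ {n} {P : Fin n → Set} (P? : Decidable P) x → P x →
           # P? ≡ suc (# (λ y → P? y ×-dec ¬? (y Finₚ.≟ x)))
#-remove P? x px = trans (#-split P? (Finₚ._≟ x))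
  (cong (_+ # (λ y → P? y ×-dec ¬? (y Finₚ.≟ x)))
    (trans (#-cong _ (Finₚ._≟ x) proj₂ (λ { refl → px , refl })) (#-≡ x)))

#-pos : ∀ {n} {P : Fin n → Set} (P? : Decidable P) {x} → P x → 1 ≤ # P?
#-pos P? {x} px = subst (1 ≤_) (sym (#-remove P? x px)) (s≤s z≤n)

#-none : ∀ {n} {P : Fin n → Set} (P? : Decidable P) → (∀ x → ¬ P x) → # P? ≡ 0
#-none P? h = ∑-zero (λ x → ι-no (P? x) (h x))

#-witness : ∀ {n} {P : Fin n → Set} (P? : Decidable P) → 1 ≤ # P? → ∃ P
#-witness P? le with any? P?
... | yes w = w
... | no ¬w = contradiction (subst (1 ≤_) (#-none P? (λ x px → ¬w (x , px))) le) (λ ())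

#-zero⇒ : ∀ {n} {P : Fin n → Set} (P? : Decidable P) → # P? ≡ 0 → ∀ x → ¬ P x
#-zero⇒ P? e x px with subst (1 ≤_) e (#-pos P? px)
... | ()

#-all : ∀ {n} {P : Fin n → Set} (P? : Decidable P) → (∀ x → P x) → # P? ≡ n
#-all {n} P? h = trans (∑-cong (λ x → ι-yes (P? x) (h x))) (trans (∑-const n 1) (*-identityʳ n))

#≤n : ∀ {n} {P : Fin n → Set} (P? : Decidable P) → # P? ≤ n
#≤n {n} P? = ≤-trans (∑-mono (λ x → ι≤1 (P? x))) (≤-reflexive (trans (∑-const n 1) (*-identityʳ n)))

#-full⇒ : ∀ {n} {P : Fin n → Set} (P? : Decidable P) → # P? ≡ n → ∀ x → P x
#-full⇒ {n} P? e x = decidable-stable (P? x) λ ¬px → <-irrefl e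
  (subst (suc (# P?) ≤_) (#-all {n} {λ _ → ⊤} (λ _ → yes tt) (λ _ → tt))
    (subst (suc (# P?) ≤_) (sym (#-remove (λ _ → yes tt) x tt))
      (s≤s (#-mono P? _ (λ py → tt , λ { refl → ¬px py })))))

#-split≤ : ∀ {n} {P Q R : Fin n → Set} (P? : Decidable P) (Q? : Decidable Q) (R? : Decidable R) →
           (∀ {x} → P x → R x) → (∀ {x} → Q x → R x) → (∀ {x} → P x → ¬ Q x) → # P? + # Q? ≤ # R?
#-split≤ P? Q? R? f g d = subst (_≤ # R?) (∑-+ _ _) (∑-mono le)
  where
  le : ∀ x → ι (P? x) + ι (Q? x) ≤ ι (R? x)
  le x with P? x | Q? x | R? x
  ... | yes p | yes q | _      = contradiction q (d p)
  ... | yes p | no _  | yes _  = ≤-refl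
  ... | yes p | no _  | no ¬r  = contradiction (f p) ¬r
  ... | no _  | yes q | yes _  = ≤-refl
  ... | no _  | yes q | no ¬r  = contradiction (g q) ¬r
  ... | no _  | no _  | _      = z≤n

opaque
  unfolding ∑

  ∑<n : ∀ {m} (g : Fin m → ℕ) → (∀ i → g i ≤ 1) → ∀ i → g i ≡ 0 → suc (∑ g) ≤ ∑ {m} (λ _ → 1)
  ∑<n g le zero e rewrite e = s≤s (∑-mono (λ i → le (suc i)))
  ∑<n g le (suc i) e = ≤-trans (≤-reflexive (sym (+-suc _ _))) (+-mono-≤ (le zero) (∑<n (λ j → g (suc j)) (λ j → le (suc j)) i e))

-- The values σ x are pairwise distinct, so each y is hit at most once; as there are n of them, exactly once.
∑-reindex : ∀ {n} (σ : Fin n → Fin n) → Injective _≡_ _≡_ σ → (f : Fin n → ℕ) → ∑ (f ∘ σ) ≡ ∑ f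
∑-reindex {n} σ inj f = begin
    ∑ (λ x → f (σ x))
  ≡⟨ ∑-cong (λ x → sym (δ (σ x))) ⟩
    ∑ (λ x → ∑ (λ y → ι (y Finₚ.≟ σ x) * f y))
  ≡⟨ ∑-swap _ ⟩
    ∑ (λ y → ∑ (λ x → ι (y Finₚ.≟ σ x) * f y))
  ≡⟨ ∑-cong (λ y → trans (∑-cong (λ x → *-comm (ι (y Finₚ.≟ σ x)) (f y))) (trans (∑-*ˡ (f y) _) (trans (cong (f y *_) (hit y)) (*-identityʳ _)))) ⟩
    ∑ f ∎
  where
  open ≡-Reasoning
  δ : ∀ j → ∑ (λ y → ι (y Finₚ.≟ j) * f y) ≡ f j
  δ j = trans (∑-cong (λ y → at y)) (trans (∑-*ˡ (f j) _) (trans (cong (f j *_) (#-≡ j)) (*-identityʳ _)))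
    where
    at : ∀ y → ι (y Finₚ.≟ j) * f y ≡ f j * ι (y Finₚ.≟ j)
    at y with y Finₚ.≟ j
    ... | yes refl = *-comm 1 (f j)
    ... | no _     = sym (*-zeroʳ (f j))
  hits : Fin n → ℕ
  hits y = # (λ x → y Finₚ.≟ σ x)
  hits≤1 : ∀ y → hits y ≤ 1
  hits≤1 y with 1 ≤? hits y
  ... | no ¬p = <⇒≤ (≰⇒> ¬p)
  ... | yes p with #-witness (λ x → y Finₚ.≟ σ x) p
  ...   | x , refl = ≤-reflexive (trans (#-cong _ (Finₚ._≟ x) (λ e → sym (inj e)) (λ { refl → refl })) (#-≡ x))
  total : ∑ hits ≡ n
  total = trans (sym (∑-swap (λ x y → ι (y Finₚ.≟ σ x))))
    (trans (∑-cong (λ x → #-≡ (σ x))) (trans (∑-const n 1) (*-identityʳ n)))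
  squeeze : ∀ {m} (g : Fin m → ℕ) → (∀ i → g i ≤ 1) → ∑ g ≡ m → ∀ i → g i ≡ 1
  squeeze {m} g le e i with g i in eq
  ... | suc zero = refl
  ... | suc (suc k) = contradiction (subst (_≤ 1) eq (le i)) (λ { (s≤s ()) })
  ... | zero = contradiction (subst₂ _≤_ (cong (1 +_) e) (trans (∑-const m 1) (*-identityʳ m)) (∑<n g le i eq)) 1+n≰n
  hit : ∀ y → hits y ≡ 1
  hit = squeeze hits hits≤1 total

-- One-sided: forces n ≤ m.
_≡_mod-via_ : ℕ → ℕ → ℕ → Set
m ≡ n mod-via d = ∃ λ q → m ≡ n + q * d

mod-trans : ∀ {d m n o} → m ≡ n mod-via d → n ≡ o mod-via d → m ≡ o mod-via d
mod-trans {d} {o = o} (q , refl) (r , refl) = r + q , lemma o q r d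
  where
  lemma : ∀ o q r d → o + r * d + q * d ≡ o + (r + q) * d
  lemma = solve-∀

module _ {n} {P : Fin n → Set} (P? : Decidable P) (τ : Fin n → Fin n)
         (inv : ∀ {x} → P x → P (τ x)) (τ² : ∀ {x} → P x → τ (τ x) ≡ x) where

  private
    -- Extended by the identity outside `P`, the involution becomes a permutation of all of `Fin n`,
    -- to which `∑-reindex` applies.
    τ′ : Fin n → Fin n
    τ′ x = if does (P? x) then τ x else x

    τ′-yes : ∀ {x} → P x → τ′ x ≡ τ x
    τ′-yes {x} p with P? x
    ... | yes _ = refl
    ... | no ¬p = contradiction p ¬p

    τ′-no : ∀ {x} → ¬ P x → τ′ x ≡ x
    τ′-no {x} ¬p with P? x
    ... | yes p = contradiction p ¬p
    ... | no _  = refl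

    τ′² : ∀ x → τ′ (τ′ x) ≡ x
    τ′² x with P? x
    ... | yes p = trans (τ′-yes (inv p)) (τ² p)
    ... | no ¬p = τ′-no ¬p

    τ′-inj : Injective _≡_ _≡_ τ′
    τ′-inj {x} {y} e = trans (sym (τ′² x)) (trans (cong τ′ e) (τ′² y))

    lt? : Decidable (λ x → P x × x Fin.< τ x)
    lt? x = P? x ×-dec (x Finₚ.<? τ x)
    gt? : Decidable (λ x → P x × τ x Fin.< x)
    gt? x = P? x ×-dec (τ x Finₚ.<? x)

  -- `τ` exchanges the points of `P` below their image with those above it.
  involution-halves : # lt? ≡ # gt?
  involution-halves = trans (sym (∑-reindex τ′ τ′-inj (λ x → ι (lt? x)))) (∑-cong pt)
    where
    fw : ∀ {x} → (P (τ′ x) × τ′ x Fin.< τ (τ′ x)) → P x × τ x Fin.< x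
    fw {x} (p , l) with P? x
    ... | yes q = q , subst (τ x Fin.<_) (τ² q) l
    ... | no ¬q = contradiction p ¬q
    bw : ∀ {x} → P x × τ x Fin.< x → P (τ′ x) × τ′ x Fin.< τ (τ′ x)
    bw {x} (p , l) rewrite τ′-yes p = inv p , subst (τ x Fin.<_) (sym (τ² p)) l
    pt : ∀ x → ι (lt? (τ′ x)) ≡ ι (gt? x)
    pt x = ι-cong (lt? (τ′ x)) (gt? x) fw bw

  involution-fixed : # P? ≡ # (λ x → P? x ×-dec (τ x Finₚ.≟ x)) + # lt? * 2
  involution-fixed = begin
      # P?
    ≡⟨ ∑-cong tri ⟩
      ∑ (λ x → ι (P? x ×-dec (τ x Finₚ.≟ x)) + (ι (lt? x) + ι (gt? x)))
    ≡⟨ trans (∑-+ _ _) (cong (# (λ x → P? x ×-dec (τ x Finₚ.≟ x)) +_) (∑-+ _ _)) ⟩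
      # (λ x → P? x ×-dec (τ x Finₚ.≟ x)) + (# lt? + # gt?)
    ≡⟨ cong (λ z → # (λ x → P? x ×-dec (τ x Finₚ.≟ x)) + (# lt? + z)) (sym involution-halves) ⟩
      # (λ x → P? x ×-dec (τ x Finₚ.≟ x)) + (# lt? + # lt?)
    ≡⟨ cong (# (λ x → P? x ×-dec (τ x Finₚ.≟ x)) +_) (double (# lt?)) ⟩
      # (λ x → P? x ×-dec (τ x Finₚ.≟ x)) + # lt? * 2 ∎
    where
    open ≡-Reasoning
    double : ∀ m → m + m ≡ m * 2
    double = solve-∀
    tri : ∀ x → ι (P? x) ≡ ι (P? x ×-dec (τ x Finₚ.≟ x)) + (ι (lt? x) + ι (gt? x))
    tri x with P? x
    ... | no _ = refl
    ... | yes _ with x Finₚ.<? τ x | τ x Finₚ.<? x | τ x Finₚ.≟ x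
    ...   | yes l | yes g | _      = contradiction g (Finₚ.<-asym l)
    ...   | yes l | no _  | yes e  = contradiction (sym e) (Finₚ.<⇒≢ l)
    ...   | yes l | no _  | no _   = refl
    ...   | no _  | yes g | yes e  = contradiction e (Finₚ.<⇒≢ g)
    ...   | no _  | yes g | no _   = refl
    ...   | no _  | no _  | yes _  = refl
    ...   | no ¬l | no ¬g | no ¬e with Finₚ.<-cmp x (τ x)
    ...     | tri< l _ _ = contradiction l ¬l
    ...     | tri≈ _ e _ = contradiction (sym e) ¬e
    ...     | tri> _ _ g = contradiction g ¬g

  involution-mod2 : # P? ≡ # (λ x → P? x ×-dec (τ x Finₚ.≟ x)) mod-via 2
  involution-mod2 = # lt? , involution-fixed

-- Linear arithmetic over ℕ by Farkas certificates: the multiples c of the hypotheses l ≤ r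
-- add up to an inequality whose left side exceeds the right side coefficientwise.
data Lin (n : ℕ) : Set where
  con  : ℕ → Lin n
  var  : Fin n → Lin n
  _:+_ : Lin n → Lin n → Lin n
  _:*_ : ℕ → Lin n → Lin n

infixl 6 _:+_
infixl 7 _:*_

eval : ∀ {n} → Vec ℕ n → Lin n → ℕ
eval ρ (con c)  = c
eval ρ (var i)  = lookup ρ i
eval ρ (a :+ b) = eval ρ a + eval ρ b
eval ρ (c :* a) = c * eval ρ a

coef : ∀ {n} → Lin n → Fin n → ℕ
coef (con c)  i = 0
coef (var j)  i = ι (j Finₚ.≟ i)
coef (a :+ b) i = coef a i + coef b i
coef (c :* a) i = c * coef a i

const : ∀ {n} → Lin n → ℕ
const (con c)  = c
const (var j)  = 0
const (a :+ b) = const a + const b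
const (c :* a) = c * const a

eval-normal : ∀ {n} (ρ : Vec ℕ n) a → eval ρ a ≡ const a + ∑ (λ i → coef a i * lookup ρ i)
eval-normal ρ (con c) = sym (trans (cong (c +_) (∑-zero {f = λ i → 0 * lookup ρ i} (λ _ → refl))) (+-identityʳ c))
eval-normal ρ (var j) = sym (trans (∑-cong at) (trans (∑-*ˡ (lookup ρ j) _) (trans (cong (lookup ρ j *_) (#-≡ j)) (*-identityʳ _))))
  where
  at : ∀ i → ι (j Finₚ.≟ i) * lookup ρ i ≡ lookup ρ j * ι (i Finₚ.≟ j)
  at i with j Finₚ.≟ i | i Finₚ.≟ j
  ... | yes refl | yes _ = *-comm 1 _
  ... | yes e    | no ¬e = contradiction (sym e) ¬e
  ... | no ¬e    | yes e = contradiction (sym e) ¬e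
  ... | no _     | no _  = sym (*-zeroʳ (lookup ρ j))
eval-normal ρ (a :+ b) rewrite eval-normal ρ a | eval-normal ρ b = trans
  (shuffle (const a) _ (const b) _)
  (cong (const a + const b +_) (trans (sym (∑-+ _ _)) (∑-cong (λ i → sym (*-distribʳ-+ (lookup ρ i) (coef a i) (coef b i))))))
  where
  shuffle : ∀ p q r s → p + q + (r + s) ≡ p + r + (q + s)
  shuffle = solve-∀
eval-normal ρ (c :* a) rewrite eval-normal ρ a = trans (*-distribˡ-+ c (const a) _)
  (cong (c * const a +_) (trans (sym (∑-*ˡ c _)) (∑-cong (λ i → sym (*-assoc c (coef a i) (lookup ρ i))))))

record Hyp {n} (ρ : Vec ℕ n) : Set where
  constructor hyp
  field
    mult    : ℕ
    lhs rhs : Lin n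
    holds   : eval ρ lhs ≤ eval ρ rhs

module _ {n} {ρ : Vec ℕ n} where
  open Hyp

  sumL sumR : List (Hyp ρ) → Lin n
  sumL []       = con 0
  sumL (h ∷ hs) = mult h :* lhs h :+ sumL hs
  sumR []       = con 0
  sumR (h ∷ hs) = mult h :* rhs h :+ sumR hs

  sum-≤ : ∀ hs → eval ρ (sumL hs) ≤ eval ρ (sumR hs)
  sum-≤ []       = ≤-refl
  sum-≤ (h ∷ hs) = +-mono-≤ (*-monoʳ-≤ (mult h) (holds h)) (sum-≤ hs)

  Refutes : List (Hyp ρ) → Set
  Refutes hs = const (sumR hs) < const (sumL hs) × (∀ i → coef (sumR hs) i ≤ coef (sumL hs) i)

  refutes? : ∀ hs → Dec (Refutes hs)
  refutes? hs = (_ <? _) ×-dec all? (λ i → _ ≤? _)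

  absurd : ∀ hs {_ : True (refutes? hs)} → ⊥
  absurd hs {t} with toWitness t
  ... | c , cs = <-irrefl refl (≤-<-trans (sum-≤ hs)
    (subst₂ _<_ (sym (eval-normal ρ (sumR hs))) (sym (eval-normal ρ (sumL hs)))
      (+-mono-≤ c (∑-mono (λ i → *-monoˡ-≤ (lookup ρ i) (cs i))))))

v0 : ∀ {n} → Lin (1 + n)
v0 = var zero
v1 : ∀ {n} → Lin (2 + n)
v1 = var (suc zero)
v2 : ∀ {n} → Lin (3 + n)
v2 = var (suc (suc zero))
v3 : ∀ {n} → Lin (4 + n)
v3 = var (suc (suc (suc zero)))
v4 : ∀ {n} → Lin (5 + n)
v4 = var (suc (suc (suc (suc zero))))
v5 : ∀ {n} → Lin (6 + n)
v5 = var (suc (suc (suc (suc (suc zero)))))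

≡⇒≤ : ∀ {m n : ℕ} → m ≡ n → m ≤ n
≡⇒≤ = ≤-reflexive

≡⇒≥ : ∀ {m n : ℕ} → m ≡ n → n ≤ m
≡⇒≥ e = ≤-reflexive (sym e)

-- Counting in lists: equivalence classes and cycles of prime length

module _ {A : Set} where

  ⊆-length : ∀ {xs ys : List A} → Unique xs → (∀ {x} → x ∈ xs → x ∈ ys) → length xs ≤ length ys
  ⊆-length {[]}     _        _ = z≤n
  ⊆-length {x ∷ xs} (px ∷ u) s with ∈-∃++ (s (here refl))
  ... | as , bs , refl = ≤-trans (s≤s (⊆-length u rest))
    (≤-reflexive (trans (cong suc (Listₚ.length-++ as)) (trans (sym (+-suc (length as) (length bs))) (sym (Listₚ.length-++ as)))))
    where
    rest : ∀ {y} → y ∈ xs → y ∈ as ++ bs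
    rest {y} y∈ with ∈-++⁻ as (s (there y∈))
    ... | inj₁ p           = ∈-++⁺ˡ p
    ... | inj₂ (there p)   = ∈-++⁺ʳ as p
    ... | inj₂ (here refl) = contradiction refl (All.lookup px y∈)

  ≈-length : ∀ {xs ys : List A} → Unique xs → Unique ys → (∀ {x} → x ∈ xs → x ∈ ys) → (∀ {x} → x ∈ ys → x ∈ xs) →
             length xs ≡ length ys
  ≈-length u w f g = ≤-antisym (⊆-length u f) (⊆-length w g)

  map-unique : ∀ {B : Set} (f : A → B) {xs : List A} → (∀ {x y} → x ∈ xs → y ∈ xs → f x ≡ f y → x ≡ y) → Unique xs → Unique (map f xs)
  map-unique f {[]}     inj []       = []
  map-unique f {x ∷ xs} inj (px ∷ u) =
    All.tabulate (λ {b} b∈ e → let (y , y∈ , e′) = ∈-map⁻ f b∈ in All.lookup px y∈ (inj (here refl) (there y∈) (trans e e′)))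
    ∷ map-unique f (λ x∈ y∈ → inj (there x∈) (there y∈)) u

  filter-split : ∀ {P : A → Set} (P? : Decidable P) (xs : List A) →
                 length xs ≡ length (filter P? xs) + length (filter (¬? ∘ P?) xs)
  filter-split P? [] = refl
  filter-split P? (x ∷ xs) with P? x
  ... | yes _ = cong suc (filter-split P? xs)
  ... | no _  = trans (cong suc (filter-split P? xs)) (sym (+-suc _ _))

  filter-filter : ∀ {P Q : A → Set} (P? : Decidable P) (Q? : Decidable Q) (xs : List A) →
                  (∀ {z} → z ∈ xs → P z → Q z) → length (filter P? (filter Q? xs)) ≡ length (filter P? xs)
  filter-filter P? Q? [] h = refl
  filter-filter P? Q? (x ∷ xs) h with Q? x | P? x in eq
  ... | yes q | yes p rewrite eq = cong suc (filter-filter P? Q? xs (h ∘ there))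
  ... | yes q | no _  rewrite eq = filter-filter P? Q? xs (h ∘ there)
  ... | no ¬q | yes p = contradiction (h (here refl) p) ¬q
  ... | no ¬q | no _  = filter-filter P? Q? xs (h ∘ there)

  module _ (d : ℕ) {R : A → A → Set} (R? : ∀ x → Decidable (R x)) where

    private
      go : ∀ X → Acc _<_ (length X) → (∀ {x} → x ∈ X → R x x) →
           (∀ {x y z} → x ∈ X → y ∈ X → z ∈ X → R x z → R y z → R x y) →
           (∀ {x} → x ∈ X → d ∣ length (filter (R? x) X)) → d ∣ length X
      go [] _ _ _ _ = d ∣0
      go X@(x ∷ xs) (acc rec) rfl eucl div = subst (d ∣_) (sym (filter-split (R? x) X))
        (∣m∣n⇒∣m+n (div (here refl)) (go X′ (rec shorter) (rfl ∘ sub) (λ a b c → eucl (sub a) (sub b) (sub c)) div′))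
        where
        X′ : List A
        X′ = filter (¬? ∘ R? x) X
        sub : ∀ {y} → y ∈ X′ → y ∈ X
        sub y∈ = proj₁ (∈-filter⁻ (¬? ∘ R? x) {xs = X} y∈)
        shorter : length X′ < length X
        shorter with R? x x
        ... | yes _ = s≤s (Listₚ.length-filter (¬? ∘ R? x) xs)
        ... | no ¬r = contradiction (rfl (here refl)) ¬r
        div′ : ∀ {y} → y ∈ X′ → d ∣ length (filter (R? y) X′)
        div′ {y} y∈ = subst (d ∣_)
          (sym (filter-filter (R? y) (¬? ∘ R? x) X
            (λ z∈ ryz rxz → proj₂ (∈-filter⁻ (¬? ∘ R? x) {xs = X} y∈) (eucl (here refl) (sub y∈) z∈ rxz ryz))))
          (div (sub y∈))

    -- Remove the class of the first element and recurse. The Euclidean form of transitivity keeps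
    -- the other classes intact: an element shared with the removed class would put its whole class
    -- there.
    ∣-classes : ∀ X → (∀ {x} → x ∈ X → R x x) →
                (∀ {x y z} → x ∈ X → y ∈ X → z ∈ X → R x z → R y z → R x y) →
                (∀ {x} → x ∈ X → d ∣ length (filter (R? x) X)) → d ∣ length X
    ∣-classes X = go X (<-wellFounded _)

iter : ∀ {A : Set} → (A → A) → ℕ → A → A
iter f zero    x = x
iter f (suc n) x = f (iter f n x)

module _ {A : Set} (f : A → A) where

  iter-+ : ∀ m n x → iter f (m + n) x ≡ iter f m (iter f n x)
  iter-+ zero    n x = refl
  iter-+ (suc m) n x = cong f (iter-+ m n x)

  iter-* : ∀ m n {x} → iter f n x ≡ x → iter f (m * n) x ≡ x
  iter-* zero    n e = refl
  iter-* (suc m) n {x} e = trans (iter-+ n (m * n) x) (trans (cong (iter f n) (iter-* m n e)) e)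

  iter-comm : ∀ m n x → iter f m (iter f n x) ≡ iter f n (iter f m x)
  iter-comm m n x = trans (sym (iter-+ m n x)) (trans (cong (λ k → iter f k x) (+-comm m n)) (iter-+ n m x))

  iter-coprime : ∀ {p k x} → Coprime p k → iter f p x ≡ x → iter f k x ≡ x → f x ≡ x
  iter-coprime {p} {k} {x} c ep ek with coprime-Bézout c
  ... | Bézout.+- a b e = trans (cong f (sym (iter-* b k ek))) (trans (cong (λ n → iter f n x) e) (iter-* a p ep))
  ... | Bézout.-+ a b e = trans (cong f (sym (iter-* a p ep))) (trans (cong (λ n → iter f n x) e) (iter-* b k ek))

  module _ (_≟_ : DecidableEquality A) {p} (pp : Prime p) where

    -- Applying `f` another p - i times returns the left side to x, so j - i is a period of x; it is
    -- prime to p. Going forward around the cycle stands in for cancelling `f`.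
    iter-return : ∀ {x i j} → iter f p x ≡ x → i < j → j < p → iter f i x ≡ iter f j x → f x ≡ x
    iter-return {x} {i} {j} ep i<j j<p e = iter-coprime (prime⇒coprime pp {{ℕ.>-nonZero (ℕₚ.m<n⇒0<n∸m i<j)}} (≤-<-trans (ℕₚ.m∸n≤m j i) j<p)) ep back
      where
      q = p ∸ i
      back : iter f (j ∸ i) x ≡ x
      back = trans (cong (iter f (j ∸ i)) (sym ep)) (trans (sym (iter-+ (j ∸ i) p x))
        (trans (cong (λ n → iter f n x) arith) (trans (iter-+ q j x) (trans (cong (iter f q) (sym e)) (trans (sym (iter-+ q i x))
          (trans (cong (λ n → iter f n x) (m∸n+n≡m (<⇒≤ (<-trans i<j j<p)))) ep))))))
        where
        arith : (j ∸ i) + p ≡ q + j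
        arith = trans (cong ((j ∸ i) +_) (sym (m∸n+n≡m (<⇒≤ (<-trans i<j j<p)))))
          (trans (rot (j ∸ i) q i) (cong (q +_) (m∸n+n≡m (<⇒≤ i<j))))
          where
          rot : ∀ a b c → a + (b + c) ≡ b + (a + c)
          rot = solve-∀

    iter-distinct : ∀ {x i j} → iter f p x ≡ x → f x ≢ x → i < p → j < p → iter f i x ≡ iter f j x → i ≡ j
    iter-distinct {x} {i} {j} ep ne i<p j<p e with ℕₚ.<-cmp i j
    ... | tri≈ _ e′ _ = e′
    ... | tri< i<j _ _ = ⊥-elim (ne (iter-return ep i<j j<p e))
    ... | tri> _ _ j<i = ⊥-elim (ne (iter-return ep j<i i<p (sym e)))

    private
      0<p : 0 < p
      0<p = ℕ.>-nonZero⁻¹ p {{prime⇒nonZero pp}}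

    orbit : A → List A
    orbit x = map (λ i → iter f i x) (upTo p)

    -- On the non-fixed points the cycles of f all have length p.
    prime-cycles : ∀ X → Unique X → (∀ {x} → x ∈ X → f x ∈ X) → (∀ {x} → x ∈ X → iter f p x ≡ x) →
                   ∃ λ q → length X ≡ length (filter (λ x → f x ≟ x) X) + q * p
    prime-cycles X u inv fp with div
      where
      moved? : Decidable (λ x → f x ≢ x)
      moved? x = ¬? (f x ≟ x)
      Y : List A
      Y = filter moved? X
      Y⊆ : ∀ {x} → x ∈ Y → x ∈ X × f x ≢ x
      Y⊆ = ∈-filter⁻ moved? {xs = X}
      -- If `f x` were fixed, applying `f` another p - 1 times would give x = f x.
      invY : ∀ {x} → x ∈ Y → f x ∈ Y
      invY {x} x∈ = ∈-filter⁺ moved? (inv (proj₁ (Y⊆ x∈))) λ e → proj₂ (Y⊆ x∈)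
        (trans (sym (cong f (fp (proj₁ (Y⊆ x∈))))) (trans (iter-comm 1 p x) (trans (sym (shift e)) (fp (proj₁ (Y⊆ x∈))))))
        where
        shift : f (f x) ≡ f x → iter f p x ≡ iter f p (f x)
        shift e = subst (λ n → iter f n x ≡ iter f n (f x)) (m∸n+n≡m 0<p)
          (trans (iter-+ (p ∸ 1) 1 x) (trans (cong (iter f (p ∸ 1)) (sym e)) (sym (iter-+ (p ∸ 1) 1 (f x)))))
      iterY : ∀ n {x} → x ∈ Y → iter f n x ∈ Y
      iterY zero    x∈ = x∈
      iterY (suc n) x∈ = invY (iterY n x∈)
      R? : ∀ x → Decidable (λ y → y ∈ orbit x)
      R? x y = Any.any? (y ≟_) (orbit x)
      back : ∀ {x y} → x ∈ Y → y ∈ orbit x → x ∈ orbit y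
      back {x} {y} x∈ y∈ with ∈-map⁻ (λ i → iter f i x) y∈
      ... | zero , i∈ , refl = ∈-map⁺ (λ i → iter f i x) i∈
      ... | suc i , i∈ , refl = subst (_∈ orbit (iter f (suc i) x)) e
              (∈-map⁺ (λ j → iter f j (iter f (suc i) x)) (∈-upTo⁺ {i = p ∸ suc i} (less 0<p)))
        where
        less : ∀ {p i} → 0 < p → p ∸ suc i < p
        less {suc p} {i} _ = s≤s (ℕₚ.m∸n≤m p i)
        e : iter f (p ∸ suc i) (iter f (suc i) x) ≡ x
        e = trans (sym (iter-+ (p ∸ suc i) (suc i) x)) (trans (cong (λ n → iter f n x) (m∸n+n≡m (<⇒≤ (∈-upTo⁻ i∈)))) (fp (proj₁ (Y⊆ x∈))))
      step : ∀ {x y} n → x ∈ Y → y ∈ orbit x → iter f n y ∈ orbit x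
      step zero x∈ y∈ = y∈
      step {x} (suc n) x∈ y∈ with ∈-map⁻ (λ i → iter f i x) (step n x∈ y∈)
      ... | i , i∈ , e with suc i <? p
      ...   | yes l = subst (_∈ orbit x) (cong f (sym e)) (∈-map⁺ (λ i → iter f i x) (∈-upTo⁺ l))
      ...   | no ¬l = subst (_∈ orbit x) (sym (trans (cong f e) (trans (cong (λ n → iter f n x) (≤-antisym (∈-upTo⁻ i∈) (≮⇒≥ ¬l))) (fp (proj₁ (Y⊆ x∈))))))
                        (∈-map⁺ (λ i → iter f i x) (∈-upTo⁺ 0<p))
      eucl : ∀ {x y z} → x ∈ Y → y ∈ Y → z ∈ Y → z ∈ orbit x → z ∈ orbit y → y ∈ orbit x
      eucl {x} {y} {z} x∈ y∈ z∈ zx zy with ∈-map⁻ (λ i → iter f i z) (back y∈ zy)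
      ... | i , _ , refl = step i x∈ zx
      orbit-length : ∀ x → length (orbit x) ≡ p
      orbit-length x = trans (Listₚ.length-map _ (upTo p)) (Listₚ.length-upTo p)
      size : ∀ {x} → x ∈ Y → length (filter (R? x) Y) ≡ p
      size {x} x∈ = trans (≈-length (Uniqueₚ.filter⁺ (R? x) (Uniqueₚ.filter⁺ moved? u))
          (map-unique (λ i → iter f i x) (λ i∈ j∈ → iter-distinct (fp (proj₁ (Y⊆ x∈))) (proj₂ (Y⊆ x∈)) (∈-upTo⁻ i∈) (∈-upTo⁻ j∈)) (Uniqueₚ.upTo⁺ p))
          (λ y∈ → proj₂ (∈-filter⁻ (R? x) {xs = Y} y∈))
          (λ y∈ → ∈-filter⁺ (R? x) (member y∈) y∈)) (orbit-length x)
        where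
        member : ∀ {y} → y ∈ orbit x → y ∈ Y
        member y∈ with ∈-map⁻ (λ i → iter f i x) y∈
        ... | i , _ , refl = iterY i x∈
      div : p ∣ length Y
      div = ∣-classes p R? Y (λ {x} x∈ → ∈-map⁺ (λ i → iter f i x) (∈-upTo⁺ 0<p)) eucl (λ x∈ → subst (p ∣_) (sym (size x∈)) ∣-refl)
    ... | divides q e = q , trans (filter-split (λ x → f x ≟ x) X) (cong (length (filter (λ x → f x ≟ x) X) +_) e)

opaque
  unfolding ∑

  filter-tabulate : ∀ {A : Set} {n} {P : A → Set} (P? : Decidable P) (g : Fin n → A) →
                    length (filter P? (List.tabulate g)) ≡ ∑ (λ i → ι (P? (g i)))
  filter-tabulate {n = zero}  P? g = refl
  filter-tabulate {n = suc n} P? g with P? (g zero)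
  ... | yes _ = cong suc (filter-tabulate P? (λ i → g (suc i)))
  ... | no _  = filter-tabulate P? (λ i → g (suc i))

#-length : ∀ {n} {P : Fin n → Set} (P? : Decidable P) → length (filter P? (allFin n)) ≡ # P?
#-length P? = filter-tabulate P? id

prime-mod : ∀ {n p} → Prime p → {P : Fin n → Set} (P? : Decidable P) (f : Fin n → Fin n) →
            (∀ {x} → P x → P (f x)) → (∀ {x} → P x → iter f p x ≡ x) →
            # P? ≡ # (λ x → P? x ×-dec (f x Finₚ.≟ x)) mod-via p
prime-mod {n} {p} pp {P} P? f inv fp
  with prime-cycles f Finₚ._≟_ pp (filter P? (allFin n)) (Uniqueₚ.filter⁺ P? (Uniqueₚ.allFin⁺ n))
       (λ x∈ → ∈-filter⁺ P? (∈-allFin _) (inv (proj₂ (∈-filter⁻ P? {xs = allFin n} x∈))))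
       (λ x∈ → fp (proj₂ (∈-filter⁻ P? {xs = allFin n} x∈)))
... | q , e = q , trans (sym (#-length P?)) (trans e (cong (_+ q * p) (trans (fuse (allFin n)) (#-length (λ x → P? x ×-dec (f x Finₚ.≟ x))))))
  where
  fuse : ∀ xs → length (filter (λ x → f x Finₚ.≟ x) (filter P? xs)) ≡ length (filter (λ x → P? x ×-dec (f x Finₚ.≟ x)) xs)
  fuse [] = refl
  fuse (x ∷ xs) with P? x
  ... | no _ = fuse xs
  ... | yes _ with f x Finₚ.≟ x
  ...   | yes _ = cong suc (fuse xs)
  ...   | no _  = fuse xs

length-product : ∀ {A B C : Set} {f : A → B → C} xs ys → length (List.cartesianProductWith f xs ys) ≡ length xs * length ys
length-product []       ys = refl
length-product {f = f} (x ∷ xs) ys = trans (Listₚ.length-++ (map (f x) ys)) (cong₂ _+_ (Listₚ.length-map (f x) ys) (length-product xs ys))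

-- Permutation groups

module _ {n : ℕ} where

  infix 4 _≟ₚ_
  infixl 7 _·_
  infixl 8 _^^_

  perm-ext : {σ τ : Perm n} → (∀ x → lookup σ x ≡ lookup τ x) → σ ≡ τ
  perm-ext {σ} {τ} h = trans (sym (Vecₚ.tabulate∘lookup σ)) (trans (Vecₚ.tabulate-cong h) (Vecₚ.tabulate∘lookup τ))

  opaque
    _·_ : Perm n → Perm n → Perm n
    _·_ = _∘ₚ_

    𝟏 : Perm n
    𝟏 = idPerm

    ·-def : (σ τ : Perm n) → σ · τ ≡ σ ∘ₚ τ
    ·-def σ τ = refl

    𝟏-def : 𝟏 ≡ idPerm
    𝟏-def = refl

    lookup-∘ : (σ τ : Perm n) (x : Fin n) → lookup (σ · τ) x ≡ lookup σ (lookup τ x)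
    lookup-∘ σ τ = Vecₚ.lookup∘tabulate _

    lookup-id : (x : Fin n) → lookup 𝟏 x ≡ x
    lookup-id = Vecₚ.lookup-allFin

  _^^_ : Perm n → ℕ → Perm n
  σ ^^ zero  = 𝟏
  σ ^^ suc m = σ · σ ^^ m

  ^^-def : (σ : Perm n) (m : ℕ) → σ ^^ m ≡ σ ^ₚ m
  ^^-def σ zero    = 𝟏-def
  ^^-def σ (suc m) = trans (·-def σ (σ ^^ m)) (cong (σ ∘ₚ_) (^^-def σ m))

  lookup-^ : (σ : Perm n) (m : ℕ) (x : Fin n) → lookup (σ ^^ m) x ≡ iter (lookup σ) m x
  lookup-^ σ zero    x = lookup-id x
  lookup-^ σ (suc m) x = trans (lookup-∘ σ (σ ^^ m) x) (cong (lookup σ) (lookup-^ σ m x))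

  _≟ₚ_ : DecidableEquality (Perm n)
  _≟ₚ_ = Vecₚ.≡-dec Finₚ._≟_

  ∘-assoc : (ρ σ τ : Perm n) → (ρ · σ) · τ ≡ ρ · (σ · τ)
  ∘-assoc ρ σ τ = perm-ext λ x → trans (lookup-∘ (ρ · σ) τ x) (trans (lookup-∘ ρ σ _)
    (sym (trans (lookup-∘ ρ (σ · τ) x) (cong (lookup ρ) (lookup-∘ σ τ x)))))

  ∘-idˡ : (σ : Perm n) → 𝟏 · σ ≡ σ
  ∘-idˡ σ = perm-ext λ x → trans (lookup-∘ 𝟏 σ x) (lookup-id _)

  ∘-idʳ : (σ : Perm n) → σ · 𝟏 ≡ σ
  ∘-idʳ σ = perm-ext λ x → trans (lookup-∘ σ 𝟏 x) (cong (lookup σ) (lookup-id x))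

  ^-+ : (σ : Perm n) (a b : ℕ) → σ ^^ (a + b) ≡ (σ ^^ a) · (σ ^^ b)
  ^-+ σ zero    b = sym (∘-idˡ _)
  ^-+ σ (suc a) b = trans (cong (σ ·_) (^-+ σ a b)) (sym (∘-assoc σ _ _))

  ^-* : (σ : Perm n) (a b : ℕ) → (σ ^^ a) ^^ b ≡ σ ^^ (b * a)
  ^-* σ a zero    = refl
  ^-* σ a (suc b) = trans (cong ((σ ^^ a) ·_) (^-* σ a b)) (sym (^-+ σ a (b * a)))

  id^ : (m : ℕ) → 𝟏 ^^ m ≡ 𝟏
  id^ zero    = refl
  id^ (suc m) = trans (∘-idˡ _) (id^ m)

  ∘-cancelˡ : (σ : Perm n) → IsPerm σ → ∀ {ρ τ} → σ · ρ ≡ σ · τ → ρ ≡ τ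
  ∘-cancelˡ σ inj {ρ} {τ} e = perm-ext λ x → inj (trans (sym (lookup-∘ σ ρ x)) (trans (cong (λ π → lookup π x) e) (lookup-∘ σ τ x)))

  record IsGroup (G : List (Perm n)) : Set where
    field
      unique : Unique G
      perms  : ∀ {σ} → σ ∈ G → IsPerm σ
      id∈    : 𝟏 ∈ G
      comp   : ∀ {σ τ} → σ ∈ G → τ ∈ G → σ · τ ∈ G

  least : {P : ℕ → Set} → Decidable P → ∀ m → P m → ∃ λ k → P k × (∀ j → j < k → ¬ P j)
  least {P} P? m pm = go m (<-wellFounded m) pm
    where
    go : ∀ m → Acc _<_ m → P m → ∃ λ k → P k × (∀ j → j < k → ¬ P j)
    go m (acc rec) pm with ℕₚ.anyUpTo? P? m
    ... | yes (k , k<m , pk) = go k (rec k<m) pk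
    ... | no ¬any = m , pm , λ j j<m pj → ¬any (j , j<m , pj)

  module GroupTheory {G : List (Perm n)} (isG : IsGroup G) where
    open IsGroup isG public

    ^∈ : ∀ {σ} → σ ∈ G → ∀ m → σ ^^ m ∈ G
    ^∈ σ∈ zero    = id∈
    ^∈ σ∈ (suc m) = comp σ∈ (^∈ σ∈ m)

    finite-order : ∀ {σ} → σ ∈ G → ∃ λ m → σ ^^ suc m ≡ 𝟏
    finite-order {σ} σ∈ with Finₚ.pigeonhole (n<1+n (length G)) (λ i → Any.index (^∈ σ∈ (toℕ i)))
    ... | i , j , i<j , e = toℕ j ∸ suc (toℕ i) , ∘-cancelˡ (σ ^^ toℕ i) (perms (^∈ σ∈ (toℕ i)))
          (trans (sym (^-+ σ (toℕ i) _)) (trans (cong (σ ^^_) arith) (trans (sym (same e)) (sym (∘-idʳ _)))))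
      where
      same : Any.index (^∈ σ∈ (toℕ i)) ≡ Any.index (^∈ σ∈ (toℕ j)) → σ ^^ toℕ i ≡ σ ^^ toℕ j
      same e = trans (Anyₚ-lookup (^∈ σ∈ (toℕ i))) (trans (cong (List.lookup G) e) (sym (Anyₚ-lookup (^∈ σ∈ (toℕ j)))))
        where
        Anyₚ-lookup : ∀ {x} {xs : List (Perm n)} (p : x ∈ xs) → x ≡ List.lookup xs (Any.index p)
        Anyₚ-lookup (here e)  = e
        Anyₚ-lookup (there p) = Anyₚ-lookup p
      arith : toℕ i + suc (toℕ j ∸ suc (toℕ i)) ≡ toℕ j
      arith = trans (+-suc (toℕ i) _) (m+[n∸m]≡n i<j)

    -- In a finite set of permutations closed under composition the inverse is a power.
    inverse : ∀ {σ} → σ ∈ G → ∃ λ τ → τ ∈ G × σ · τ ≡ 𝟏 × τ · σ ≡ 𝟏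
    inverse {σ} σ∈ with finite-order σ∈
    ... | m , e = σ ^^ m , ^∈ σ∈ m , e , trans (cong ((σ ^^ m) ·_) (sym (∘-idʳ σ)))
          (trans (sym (^-+ σ m 1)) (trans (cong (σ ^^_) (+-comm m 1)) e))

    -- Left translation by σ permutes G in cycles whose length is the order of σ.
    order-∣ : ∀ {σ} → σ ∈ G → σ ^^ length G ≡ 𝟏
    order-∣ {σ} σ∈ with least (λ m → σ ^^ suc m ≟ₚ 𝟏) (proj₁ (finite-order σ∈)) (proj₂ (finite-order σ∈))
    ... | m , e , min with divs
      where
      orb : Perm n → List (Perm n)
      orb x = map (λ i → (σ ^^ i) · x) (upTo (suc m))
      R? : ∀ x → Decidable (_∈ orb x)
      R? x y = Any.any? (y ≟ₚ_) (orb x)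
      reduce : ∀ k → ∃ λ i → i < suc m × σ ^^ k ≡ σ ^^ i
      reduce zero = 0 , s≤s z≤n , refl
      reduce (suc k) with reduce k
      ... | i , i<m , q with suc i <? suc m
      ...   | yes l = suc i , l , cong (σ ·_) q
      ...   | no ¬l = 0 , s≤s z≤n , trans (cong (σ ·_) q) (trans (cong (σ ^^_) (≤-antisym i<m (≮⇒≥ ¬l))) e)
      member : ∀ {x} k → (σ ^^ k) · x ∈ orb x
      member {x} k with reduce k
      ... | i , l , q = subst (λ π → π · x ∈ orb x) (sym q) (∈-map⁺ (λ i → (σ ^^ i) · x) (∈-upTo⁺ l))
      eucl : ∀ {x y z} → x ∈ G → y ∈ G → z ∈ G → z ∈ orb x → z ∈ orb y → y ∈ orb x
      eucl {x} {y} _ _ _ zx zy with ∈-map⁻ (λ i → (σ ^^ i) · x) {xs = upTo (suc m)} zx | ∈-map⁻ (λ i → (σ ^^ i) · y) {xs = upTo (suc m)} zy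
      ... | i , _ , refl | j , j∈ , q = subst (_∈ orb x) lemma (member (suc m ∸ j + i))
        where
        lemma : (σ ^^ (suc m ∸ j + i)) · x ≡ y
        lemma = trans (cong (_· x) (^-+ σ (suc m ∸ j) i)) (trans (∘-assoc _ _ _) (trans (cong ((σ ^^ (suc m ∸ j)) ·_) q)
          (trans (sym (∘-assoc _ _ _)) (trans (cong (_· y) (trans (sym (^-+ σ (suc m ∸ j) j))
            (trans (cong (σ ^^_) (m∸n+n≡m (<⇒≤ (∈-upTo⁻ j∈)))) e))) (∘-idˡ y)))))
      distinct : ∀ {i j} → i < j → j < suc m → σ ^^ i ≢ σ ^^ j
      distinct {i} {j} i<j j<m q = min (j ∸ suc i) (s≤s⁻ (≤-<-trans (≤-reflexive (sym (ℕₚ.+-∸-assoc 1 i<j))) (≤-<-trans (ℕₚ.m∸n≤m j i) j<m)))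
        (∘-cancelˡ (σ ^^ i) (perms (^∈ σ∈ i)) (trans (sym (^-+ σ i _)) (trans (cong (σ ^^_) (trans (+-suc i _) (m+[n∸m]≡n i<j))) (trans (sym q) (sym (∘-idʳ _))))))
        where
        s≤s⁻ : ∀ {a b} → suc a < suc b → a < b
        s≤s⁻ (s≤s l) = l
      inj : ∀ {x i j} → x ∈ G → i ∈ upTo (suc m) → j ∈ upTo (suc m) → (σ ^^ i) · x ≡ (σ ^^ j) · x → i ≡ j
      inj {x} {i} {j} x∈ i∈ j∈ q with inverse x∈
      ... | x⁻¹ , _ , xx⁻¹ , _ with cancel
        where
        strip : ∀ i → ((σ ^^ i) · x) · x⁻¹ ≡ σ ^^ i
        strip i = trans (∘-assoc _ _ _) (trans (cong ((σ ^^ i) ·_) xx⁻¹) (∘-idʳ _))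
        cancel : σ ^^ i ≡ σ ^^ j
        cancel = trans (sym (strip i)) (trans (cong (_· x⁻¹) q) (strip j))
      ... | c with ℕₚ.<-cmp i j
      ...   | tri< l _ _ = contradiction c (distinct l (∈-upTo⁻ j∈))
      ...   | tri≈ _ r _ = r
      ...   | tri> _ _ l = contradiction (sym c) (distinct l (∈-upTo⁻ i∈))
      size : ∀ {x} → x ∈ G → length (filter (R? x) G) ≡ suc m
      size {x} x∈ = trans (≈-length (Uniqueₚ.filter⁺ (R? x) unique)
          (map-unique (λ i → (σ ^^ i) · x) (inj x∈) (Uniqueₚ.upTo⁺ (suc m)))
          (λ y∈ → proj₂ (∈-filter⁻ (R? x) {xs = G} y∈)) (λ y∈ → ∈-filter⁺ (R? x) (inG y∈) y∈))
          (trans (Listₚ.length-map _ (upTo (suc m))) (Listₚ.length-upTo (suc m)))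
        where
        inG : ∀ {y} → y ∈ orb x → y ∈ G
        inG y∈ with ∈-map⁻ (λ i → (σ ^^ i) · x) {xs = upTo (suc m)} y∈
        ... | i , _ , refl = comp (^∈ σ∈ i) x∈
      divs : suc m ∣ length G
      divs = ∣-classes (suc m) R? G (λ {x} _ → subst (_∈ orb x) (∘-idˡ x) (member 0)) eucl (λ x∈ → subst (suc m ∣_) (sym (size x∈)) ∣-refl)
    ... | divides q eq = trans (cong (σ ^^_) eq) (trans (sym (^-* σ (suc m) q)) (trans (cong (_^^ q) e) (id^ q)))

    stab? : (x : Fin n) → Decidable (λ g → lookup g x ≡ x)
    stab? x g = lookup g x Finₚ.≟ x

    Stab : Fin n → List (Perm n)
    Stab x = filter (stab? x) G

    ∈Stab : ∀ x {g} → g ∈ Stab x → g ∈ G × lookup g x ≡ x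
    ∈Stab x = ∈-filter⁻ (stab? x) {xs = G}

    stab-group : ∀ x → IsGroup (Stab x)
    stab-group x = record
      { unique = Uniqueₚ.filter⁺ (stab? x) unique
      ; perms  = λ σ∈ → perms (proj₁ (∈Stab x σ∈))
      ; id∈    = ∈-filter⁺ (stab? x) id∈ (lookup-id x)
      ; comp   = λ {σ} {τ} σ∈ τ∈ → ∈-filter⁺ (stab? x) (comp (proj₁ (∈Stab x σ∈)) (proj₁ (∈Stab x τ∈)))
                   (trans (lookup-∘ σ τ x) (trans (cong (lookup σ) (proj₂ (∈Stab x τ∈))) (proj₂ (∈Stab x σ∈))))
      }

    Orb : Fin n → Fin n → Set
    Orb x y = Any (λ g → lookup g x ≡ y) G

    orb? : ∀ x → Decidable (Orb x)
    orb? x y = Any.any? (λ g → lookup g x Finₚ.≟ y) G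

    private
      to-orb : ∀ {x y g} → g ∈ G → lookup g x ≡ y → Orb x y
      to-orb g∈ e = Any.map (λ { refl → e }) g∈
      from-orb : ∀ {x y} → Orb x y → ∃ λ g → g ∈ G × lookup g x ≡ y
      from-orb = find

    -- The elements taking x to y form the coset `h · Stab x` of any one of them.
    fibre : ∀ {x y} → Orb x y → length (filter (λ g → lookup g x Finₚ.≟ y) G) ≡ length (Stab x)
    fibre {x} {y} o with from-orb o
    ... | h , h∈ , refl with inverse h∈
    ...   | h⁻¹ , h⁻¹∈ , hh⁻¹ , h⁻¹h = sym (trans (sym (Listₚ.length-map (h ·_) (Stab x)))
              (≈-length (map-unique (h ·_) (λ _ _ → ∘-cancelˡ h (perms h∈)) (Uniqueₚ.filter⁺ (stab? x) unique))
                (Uniqueₚ.filter⁺ (λ g → lookup g x Finₚ.≟ lookup h x) unique) fw bw))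
      where
      fw : ∀ {g} → g ∈ map (h ·_) (Stab x) → g ∈ filter (λ g → lookup g x Finₚ.≟ lookup h x) G
      fw g∈ with ∈-map⁻ (h ·_) g∈
      ... | s , s∈ , refl = ∈-filter⁺ (λ g → lookup g x Finₚ.≟ lookup h x) (comp h∈ (proj₁ (∈Stab x s∈)))
                              (trans (lookup-∘ h s x) (cong (lookup h) (proj₂ (∈Stab x s∈))))
      bw : ∀ {g} → g ∈ filter (λ g → lookup g x Finₚ.≟ lookup h x) G → g ∈ map (h ·_) (Stab x)
      bw {g} g∈ with ∈-filter⁻ (λ g → lookup g x Finₚ.≟ lookup h x) {xs = G} g∈
      ... | g∈G , e = subst (_∈ map (h ·_) (Stab x)) (trans (sym (∘-assoc h h⁻¹ g)) (trans (cong (_· g) hh⁻¹) (∘-idˡ g)))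
            (∈-map⁺ (h ·_) (∈-filter⁺ (stab? x) (comp h⁻¹∈ g∈G)
              (trans (lookup-∘ h⁻¹ g x) (trans (cong (lookup h⁻¹) e) (trans (sym (lookup-∘ h⁻¹ h x)) (trans (cong (λ π → lookup π x) h⁻¹h) (lookup-id x)))))))

    orbit-stabilizer : ∀ x → length G ≡ # (orb? x) * length (Stab x)
    orbit-stabilizer x = trans (fibres G) (trans (∑-cong at) (trans (∑-*ˡ (length (Stab x)) _) (*-comm (length (Stab x)) _)))
      where
      fibres : ∀ L → length L ≡ ∑ (λ y → length (filter (λ g → lookup g x Finₚ.≟ y) L))
      fibres [] = sym (∑-zero (λ _ → refl))
      fibres (g ∷ L) = trans (cong₂ _+_ (sym (#-≡ (lookup g x))) (fibres L)) (trans (sym (∑-+ _ _)) (∑-cong step))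
        where
        step : ∀ y → ι (y Finₚ.≟ lookup g x) + length (filter (λ g → lookup g x Finₚ.≟ y) L)
                     ≡ length (filter (λ g → lookup g x Finₚ.≟ y) (g ∷ L))
        step y with lookup g x Finₚ.≟ y | y Finₚ.≟ lookup g x
        ... | yes _ | yes _ = refl
        ... | yes e | no ¬e = contradiction (sym e) ¬e
        ... | no ¬e | yes e = contradiction (sym e) ¬e
        ... | no _  | no _  = refl
      at : ∀ y → length (filter (λ g → lookup g x Finₚ.≟ y) G) ≡ length (Stab x) * ι (orb? x y)
      at y with orb? x y
      ... | yes o = trans (fibre o) (sym (*-identityʳ _))
      ... | no ¬o = trans (cong length (Listₚ.filter-none (λ g → lookup g x Finₚ.≟ y) (All.tabulate (λ g∈ e → ¬o (to-orb g∈ e))))) (sym (*-zeroʳ (length (Stab x))))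

    module _ {X : Fin n → Set} (X? : Decidable X) (inv : ∀ {g x} → g ∈ G → X x → X (lookup g x)) where

      ∣-orbits : ∀ d → (∀ {x} → X x → d ∣ # (orb? x)) → d ∣ # X?
      ∣-orbits d div = subst (d ∣_) (#-length X?) (∣-classes d orb? (filter X? (allFin n))
          (λ {x} _ → to-orb id∈ (lookup-id x)) (λ _ _ _ → eucl) (λ x∈ → subst (d ∣_) (sym (size (mem x∈))) (div (mem x∈))))
        where
        mem : ∀ {x} → x ∈ filter X? (allFin n) → X x
        mem x∈ = proj₂ (∈-filter⁻ X? {xs = allFin n} x∈)
        eucl : ∀ {x y z} → Orb x z → Orb y z → Orb x y
        eucl {x} {y} oxz oyz with from-orb oxz | from-orb oyz
        ... | g , g∈ , refl | h , h∈ , e with inverse h∈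
        ...   | h⁻¹ , h⁻¹∈ , _ , h⁻¹h = to-orb (comp h⁻¹∈ g∈) (trans (lookup-∘ h⁻¹ g x) (trans (cong (lookup h⁻¹) (sym e))
                  (trans (sym (lookup-∘ h⁻¹ h y)) (trans (cong (λ π → lookup π y) h⁻¹h) (lookup-id y)))))
        size : ∀ {x} → X x → length (filter (orb? x) (filter X? (allFin n))) ≡ # (orb? x)
        size {x} px = trans (filter-filter (orb? x) X? (allFin n) sub) (#-length (orb? x))
          where
          sub : ∀ {z} → z ∈ allFin n → Orb x z → X z
          sub _ o with from-orb o
          ... | g , g∈ , refl = inv g∈ px

      module _ {p} (pp : Prime p) (p²∣ : p * p ∣ length G) where

        private
          coprime-part : ∀ {a b} → ¬ (p ∣ a) → p * p ∣ a * b → p * p ∣ b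
          coprime-part {a} {b} ¬p∣a d with euclidsLemma a b pp (∣-trans (m∣m*n p) d)
          ... | inj₁ p∣a = contradiction p∣a ¬p∣a
          ... | inj₂ (divides c refl) with euclidsLemma a c pp (*-cancelˡ-∣ p {{prime⇒nonZero pp}} (subst (p * p ∣_) (rot a c p) d))
            where
            rot : ∀ a c p → a * (c * p) ≡ p * (a * c)
            rot = solve-∀
          ...   | inj₁ p∣a = contradiction p∣a ¬p∣a
          ...   | inj₂ p∣c = subst (p * p ∣_) (*-comm p c) (*-monoʳ-∣ p p∣c)

        -- If no stabiliser had order divisible by p², then p would divide every orbit length in X
        -- and so the size of X.
        point-stabilizer : ¬ (p ∣ # X?) → ∃ λ x → X x × p * p ∣ length (Stab x)
        point-stabilizer ¬p∣X with any? (λ x → X? x ×-dec (p * p ∣? length (Stab x)))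
        ... | yes w = w
        ... | no none = contradiction (∣-orbits p div) ¬p∣X
          where
          div : ∀ {x} → X x → p ∣ # (orb? x)
          div {x} px with p ∣? # (orb? x)
          ... | yes d = d
          ... | no ¬d = contradiction (x , px , coprime-part ¬d (subst (p * p ∣_) (orbit-stabilizer x) p²∣)) none

        -- When the stabilisers have order prime to p, the whole factor p² falls on the orbit
        -- lengths.
        p′-stabilizers : (∀ {x} → X x → ¬ (p ∣ length (Stab x))) → p * p ∣ # X?
        p′-stabilizers ¬d = ∣-orbits (p * p) λ {x} px →
          coprime-part (¬d px) (subst (p * p ∣_) (trans (orbit-stabilizer x) (*-comm (# (orb? x)) _)) p²∣)

    -- McKay: the cyclic shift acts on the p-tuples of elements of G with product 1.
    module _ {p} (pp : Prime p) where

      private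
        prod : List (Perm n) → Perm n
        prod []       = 𝟏
        prod (σ ∷ σs) = σ · prod σs

        prod-snoc : ∀ σs σ → prod (σs ++ σ ∷ []) ≡ prod σs · σ
        prod-snoc []       σ = trans (∘-idʳ σ) (sym (∘-idˡ σ))
        prod-snoc (τ ∷ σs) σ = trans (cong (τ ·_) (prod-snoc σs σ)) (sym (∘-assoc τ _ σ))

        prod∈ : ∀ {σs} → All (_∈ G) σs → prod σs ∈ G
        prod∈ []       = id∈
        prod∈ (p ∷ ps) = comp p (prod∈ ps)

        prod-replicate : ∀ m σ → prod (List.replicate m σ) ≡ σ ^^ m
        prod-replicate zero    σ = refl
        prod-replicate (suc m) σ = cong (σ ·_) (prod-replicate m σ)

        inv : Perm n → Perm n
        inv σ with Any.any? (λ τ → τ · σ ≟ₚ 𝟏) G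
        ... | yes a = proj₁ (find a)
        ... | no _  = 𝟏

        inv∈ : ∀ {σ} → σ ∈ G → inv σ ∈ G × inv σ · σ ≡ 𝟏
        inv∈ {σ} σ∈ with Any.any? (λ τ → τ · σ ≟ₚ 𝟏) G
        ... | yes a = proj₁ (proj₂ (find a)) , proj₂ (proj₂ (find a))
        ... | no ¬a with inverse σ∈
        ...   | τ , τ∈ , _ , e = contradiction (Any.map (λ { refl → e }) τ∈) ¬a

        inv-unique : ∀ {σ τ} → σ ∈ G → τ ∈ G → τ · σ ≡ 𝟏 → τ ≡ inv σ
        inv-unique {σ} {τ} σ∈ τ∈ e with inverse σ∈
        ... | ρ , _ , σρ , _ = trans (eq e) (sym (eq (proj₂ (inv∈ σ∈))))
          where
          eq : ∀ {τ} → τ · σ ≡ 𝟏 → τ ≡ ρ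
          eq {τ} e = trans (sym (∘-idʳ τ)) (trans (cong (τ ·_) (sym σρ)) (trans (sym (∘-assoc τ σ ρ)) (trans (cong (_· ρ) e) (∘-idˡ ρ))))

        tuples : ℕ → List (List (Perm n))
        tuples zero    = [] ∷ []
        tuples (suc k) = List.cartesianProductWith _∷_ G (tuples k)

        length-tuples : ∀ k → length (tuples k) ≡ length G ^ k
        length-tuples zero    = refl
        length-tuples (suc k) = trans (length-product G (tuples k)) (cong (length G *_) (length-tuples k))

        unique-tuples : ∀ k → Unique (tuples k)
        unique-tuples zero    = [] ∷ []
        unique-tuples (suc k) = Uniqueₚ.cartesianProductWith⁺ _∷_ Listₚ.∷-injective unique (unique-tuples k)

        ∈-tuples⁻ : ∀ k {w} → w ∈ tuples k → length w ≡ k × All (_∈ G) w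
        ∈-tuples⁻ zero    (here refl) = refl , []
        ∈-tuples⁻ (suc k) w∈ with ∈-cartesianProductWith⁻ _∷_ G (tuples k) w∈
        ... | a , v , a∈ , v∈ , refl with ∈-tuples⁻ k v∈
        ...   | l , all = cong suc l , a∈ ∷ all

        ∈-tuples⁺ : ∀ {w} → All (_∈ G) w → w ∈ tuples (length w)
        ∈-tuples⁺ []       = here refl
        ∈-tuples⁺ (a ∷ as) = ∈-cartesianProductWith⁺ _∷_ a (∈-tuples⁺ as)

        -- The first entry of a tuple with product 1 is forced by the others, so there are |G|ᵏ such
        -- tuples of length k + 1.
        close : List (Perm n) → List (Perm n)
        close w = inv (prod w) ∷ w

        X : ℕ → List (List (Perm n))
        X k = map close (tuples k)

        ∈X⁻ : ∀ {k w} → w ∈ X k → length w ≡ suc k × All (_∈ G) w × prod w ≡ 𝟏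
        ∈X⁻ {k} w∈ with ∈-map⁻ close w∈
        ... | v , v∈ , refl with ∈-tuples⁻ k v∈
        ...   | l , all = cong suc l , proj₁ (inv∈ (prod∈ all)) ∷ all , proj₂ (inv∈ (prod∈ all))

        ∈X⁺ : ∀ {k w} → length w ≡ suc k → All (_∈ G) w → prod w ≡ 𝟏 → w ∈ X k
        ∈X⁺ {w = a ∷ w} refl (a∈ ∷ all) e = subst (λ z → z ∷ w ∈ X (length w)) (sym (inv-unique (prod∈ all) a∈ e)) (∈-map⁺ close (∈-tuples⁺ all))

        rot : List (Perm n) → List (Perm n)
        rot []       = []
        rot (σ ∷ σs) = σs ++ σ ∷ []

        iter-rot : ∀ xs ys → iter rot (length xs) (xs ++ ys) ≡ ys ++ xs
        iter-rot []       ys = sym (Listₚ.++-identityʳ ys)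
        iter-rot (x ∷ xs) ys = trans (iter-comm rot 1 (length xs) (x ∷ xs ++ ys)) (trans (cong (iter rot (length xs)) (Listₚ.++-assoc xs ys (x ∷ [])))
          (trans (iter-rot xs (ys ++ x ∷ [])) (Listₚ.++-assoc ys (x ∷ []) xs)))

        rot-fixed : ∀ (x : Perm n) xs → xs ++ x ∷ [] ≡ x ∷ xs → xs ≡ List.replicate (length xs) x
        rot-fixed x []       e = refl
        rot-fixed x (y ∷ ys) e with Listₚ.∷-injective e
        ... | refl , e′ = cong (y ∷_) (rot-fixed y ys e′)

      cauchy′ : ∀ k → p ≡ suc (suc k) → p ∣ length G → ∃ λ g → g ∈ G × g ^^ p ≡ 𝟏 × g ≢ 𝟏
      cauchy′ k refl p∣G with prime-cycles rot (Listₚ.≡-dec _≟ₚ_) pp (X (suc k))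
          (map-unique close (λ _ _ e → proj₂ (Listₚ.∷-injective e)) (unique-tuples (suc k)))
          rot∈ (λ w∈ → cyc (∈X⁻ w∈))
        where
        rot∈′ : ∀ w → length w ≡ suc (suc k) × All (_∈ G) w × prod w ≡ 𝟏 → rot w ∈ X (suc k)
        rot∈′ (a ∷ v) (l , a∈ ∷ all , e) = ∈X⁺ (trans (Listₚ.length-++ v) (trans (+-comm (length v) 1) l)) (Allₚ.++⁺ all (a∈ ∷ []))
              (trans (prod-snoc v a) conj)
          where
          -- From a · w = 1 follows w = a⁻¹, hence also w · a = 1.
          conj : prod v · a ≡ 𝟏
          conj with inverse a∈
          ... | b , _ , ab , ba = trans (cong (_· a) (∘-cancelˡ a (perms a∈) (trans e (sym ab)))) ba
        rot∈ : ∀ {w} → w ∈ X (suc k) → rot w ∈ X (suc k)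
        rot∈ {w} w∈ = rot∈′ w (∈X⁻ w∈)
        cyc : ∀ {w} → length w ≡ suc (suc k) × All (_∈ G) w × prod w ≡ 𝟏 → iter rot (suc (suc k)) w ≡ w
        cyc {w} (l , _ , _) = subst (λ m → iter rot m w ≡ w) l (trans (cong (iter rot (length w)) (sym (Listₚ.++-identityʳ w))) (iter-rot w []))
      ... | q , e = conclude (Any.any? (λ w → ¬? (Listₚ.≡-dec _≟ₚ_ w triv)) F)
        where
        fix? : Decidable (λ w → rot w ≡ w)
        fix? w = Listₚ.≡-dec _≟ₚ_ (rot w) w
        F : List (List (Perm n))
        F = filter fix? (X (suc k))
        triv : List (Perm n)
        triv = List.replicate (suc (suc k)) 𝟏
        triv∈ : triv ∈ F
        triv∈ = ∈-filter⁺ fix? (∈X⁺ (Listₚ.length-replicate (suc (suc k))) (Allₚ.replicate⁺ (suc (suc k)) id∈) (trans (prod-replicate (suc (suc k)) 𝟏) (id^ (suc (suc k)))))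
                  (snoc (suc k))
          where
          snoc : ∀ m → List.replicate m 𝟏 ++ 𝟏 ∷ [] ≡ 𝟏 ∷ List.replicate m 𝟏
          snoc zero    = refl
          snoc (suc m) = cong (𝟏 ∷_) (snoc m)
        p∣F : suc (suc k) ∣ length F
        p∣F = ∣m+n∣m⇒∣n (subst (suc (suc k) ∣_) (trans e (+-comm (length F) _)) p∣X) (n∣m*n q)
          where
          p∣X : suc (suc k) ∣ length (X (suc k))
          p∣X = subst (suc (suc k) ∣_) (sym (trans (Listₚ.length-map close (tuples (suc k))) (length-tuples (suc k)))) (∣m⇒∣m*n (length G ^ k) p∣G)
        constant : ∀ w → length w ≡ suc (suc k) × All (_∈ G) w × prod w ≡ 𝟏 → rot w ≡ w → w ≢ triv →
                   ∃ λ g → g ∈ G × g ^^ suc (suc k) ≡ 𝟏 × g ≢ 𝟏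
        constant (g ∷ v) (l , g∈ ∷ _ , pr) fx w≢ = g , g∈ , trans (sym (prod-replicate (suc (suc k)) g)) (trans (cong prod (sym const-w)) pr)
                    , λ { refl → w≢ const-w }
          where
          const-w : g ∷ v ≡ List.replicate (suc (suc k)) g
          const-w = cong (g ∷_) (trans (rot-fixed g v fx) (cong (λ m → List.replicate m g) (suc-injective l)))
        conclude : Dec (Any (λ w → w ≢ triv) F) → ∃ λ g → g ∈ G × g ^^ suc (suc k) ≡ 𝟏 × g ≢ 𝟏
        conclude (yes a) with find a
        ... | w , w∈ , w≢ with ∈-filter⁻ fix? {xs = X (suc k)} w∈
        ...   | w∈X , fx = constant w (∈X⁻ w∈X) fx w≢
        -- With only the trivial tuple fixed by the shift, p would divide a nonzero number that is
        -- at most 1.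
        conclude (no ¬a) = contradiction (≤-trans (∣⇒≤ {{ℕ.>-nonZero (∈-length′ triv∈)}} p∣F) short) λ { (s≤s ()) }
          where
          ∈-length′ : ∀ {A : Set} {x : A} {xs : List A} → x ∈ xs → 0 < length xs
          ∈-length′ (here _)  = s≤s z≤n
          ∈-length′ (there _) = s≤s z≤n
          short : length F ≤ 1
          short = ⊆-length {ys = triv ∷ []} (Uniqueₚ.filter⁺ fix? (map-unique close (λ _ _ e → proj₂ (Listₚ.∷-injective e)) (unique-tuples (suc k))))
            λ {w} w∈ → here (decidable-stable (Listₚ.≡-dec _≟ₚ_ w triv) (λ ne → ¬a (Any.map (λ { refl → ne }) w∈)))

    cauchy : ∀ {p} → Prime p → p ∣ length G → ∃ λ g → g ∈ G × g ^^ p ≡ 𝟏 × g ≢ 𝟏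
    cauchy {zero}        pp = contradiction pp ¬prime[0]
    cauchy {suc zero}    pp = contradiction pp ¬prime[1]
    cauchy {suc (suc k)} pp = cauchy′ pp k refl

-- Symmetric (v, 16, 3) designs

∑-*∑ : ∀ {m n} (f : Fin m → ℕ) (g : Fin n → ℕ) → ∑ f * ∑ g ≡ ∑ (λ i → ∑ (λ j → f i * g j))
∑-*∑ f g = trans (*-comm (∑ f) (∑ g)) (trans (sym (∑-*ˡ (∑ g) f)) (∑-cong λ i → trans (*-comm (∑ g) (f i)) (sym (∑-*ˡ (f i) g))))

∑-≡ : ∀ {n} (j : Fin n) (f : Fin n → ℕ) → ∑ (λ i → ι (i Finₚ.≟ j) * f i) ≡ f j
∑-≡ j f = trans (∑-cong at) (trans (∑-*ˡ (f j) _) (trans (cong (f j *_) (#-≡ j)) (*-identityʳ _)))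
  where
  at : ∀ i → ι (i Finₚ.≟ j) * f i ≡ f j * ι (i Finₚ.≟ j)
  at i with i Finₚ.≟ j
  ... | yes refl = *-comm 1 (f i)
  ... | no _     = sym (*-zeroʳ (f j))

module _ {n : ℕ} {P : Fin n → Set} (P? : Decidable P) where

  -- As λ = 3, two known elements of an intersection of blocks, or of the set of blocks joining two
  -- points, leave exactly one more. A group that fixes the two then fixes the third.
  record Third (a b : Fin n) : Set where
    constructor mkThird
    field
      c    : Fin n
      Pc   : P c
      c≢a  : c ≢ a
      c≢b  : c ≢ b
      only : ∀ {w} → P w → w ≡ a ⊎ w ≡ b ⊎ w ≡ c

  third : # P? ≡ 3 → ∀ {a b} → P a → P b → b ≢ a → Third a b
  third e {a} {b} pa pb b≢a = build (#-witness Q? (≡⇒≥ #Q))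
    where
    P₁? : Decidable (λ y → P y × ¬ (y ≡ a))
    P₁? y = P? y ×-dec ¬? (y Finₚ.≟ a)
    Q? : Decidable (λ y → (P y × ¬ (y ≡ a)) × ¬ (y ≡ b))
    Q? y = P₁? y ×-dec ¬? (y Finₚ.≟ b)
    #Q : # Q? ≡ 1
    #Q = suc-injective (suc-injective (trans (cong suc (sym (#-remove P₁? b (pb , b≢a)))) (trans (sym (#-remove P? a pa)) e)))
    build : ∃ (λ y → (P y × ¬ (y ≡ a)) × ¬ (y ≡ b)) → Third a b
    build (c , (pc , c≢a) , c≢b) = mkThird c pc c≢a c≢b only
      where
      only : ∀ {w} → P w → w ≡ a ⊎ w ≡ b ⊎ w ≡ c
      only {w} pw with w Finₚ.≟ a | w Finₚ.≟ b | w Finₚ.≟ c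
      ... | yes e | _     | _     = inj₁ e
      ... | no _  | yes e | _     = inj₂ (inj₁ e)
      ... | no _  | no _  | yes e = inj₂ (inj₂ e)
      ... | no w≢a | no w≢b | no w≢c = contradiction ((pw , w≢a) , w≢b , w≢c)
            (λ { (p , q , r) → #-zero⇒ _ (suc-injective (trans (sym (#-remove Q? c ((pc , c≢a) , c≢b))) #Q)) w ((p , q) , r) })

  all-three : # P? ≡ 3 → ∀ {a b c} → P a → P b → P c → b ≢ a → c ≢ a → c ≢ b → ∀ {w} → P w → w ≡ a ⊎ w ≡ b ⊎ w ≡ c
  all-three e pa pb pc b≢a c≢a c≢b pw with third e pa pb b≢a
  ... | mkThird d _ _ _ only with only pc
  ...   | inj₁ e′         = contradiction e′ c≢a
  ...   | inj₂ (inj₁ e′)  = contradiction e′ c≢b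
  ...   | inj₂ (inj₂ refl) = only pw

-- Incidence is an abstract relation rather than membership in a subset, so that points and blocks
-- are interchangeable and `dual` is a mere renaming.
record Design (v : ℕ) : Set₁ where
  field
    Inc      : Fin v → Fin v → Set
    inc?     : ∀ x j → Dec (Inc x j)
    blk-size : ∀ j → # (λ x → inc? x j) ≡ 16
    pt-size  : ∀ x → # (λ j → inc? x j) ≡ 16
    blk-pair : ∀ {i j} → j ≢ i → # (λ x → inc? x i ×-dec inc? x j) ≡ 3
    pt-pair  : ∀ {x y} → y ≢ x → # (λ j → inc? x j ×-dec inc? y j) ≡ 3

dual : ∀ {v} → Design v → Design v
dual D = record
  { Inc = λ x j → Inc j x ; inc? = λ x j → inc? j x
  ; blk-size = pt-size ; pt-size = blk-size ; blk-pair = pt-pair ; pt-pair = blk-pair }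
  where open Design D

module Counting {v} (D : Design v) where
  open Design D public

  meet? : ∀ i j → Decidable (λ x → Inc x i × Inc x j)
  meet? i j x = inc? x i ×-dec inc? x j

  join? : ∀ x y → Decidable (λ j → Inc x j × Inc y j)
  join? x y j = inc? x j ×-dec inc? y j

  meet-third : ∀ {i j} → j ≢ i → ∀ {x y} → Inc x i × Inc x j → Inc y i × Inc y j → y ≢ x → Third (meet? i j) x y
  meet-third {i} {j} j≢i = third (meet? i j) (blk-pair j≢i)

  join-third : ∀ {x y} → y ≢ x → ∀ {i j} → Inc x i × Inc y i → Inc x j × Inc y j → j ≢ i → Third (join? x y) i j
  join-third {x} {y} y≢x = third (join? x y) (pt-pair y≢x)

  -- The Gram matrix 3 J + 13 I of the blocks, with 13 = 16 - 3.
  meet-size : ∀ i j → # (meet? i j) ≡ 3 + 13 * ι (i Finₚ.≟ j)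
  meet-size i j with i Finₚ.≟ j
  ... | yes refl = trans (#-cong (meet? i i) (λ x → inc? x i) proj₁ (λ p → p , p)) (blk-size i)
  ... | no i≢j   = blk-pair (i≢j ∘ sym)

  module _ {B : Fin v → Set} (B? : Decidable B) where

    deg : Fin v → ℕ
    deg x = # (λ j → B? j ×-dec inc? x j)

    ∑-deg : ∑ deg ≡ 16 * # B?
    ∑-deg = trans (∑-swap _) (trans (∑-cong at) (∑-*ˡ 16 _))
      where
      at : ∀ j → ∑ (λ x → ι (B? j ×-dec inc? x j)) ≡ 16 * ι (B? j)
      at j = trans (∑-cong (λ x → ι-× (B? j) (inc? x j))) (trans (∑-*ˡ (ι (B? j)) _) (trans (cong (ι (B? j) *_) (blk-size j)) (*-comm (ι (B? j)) 16)))

    -- Counts the triples (x, i, j) with i and j in `B` and x on both, summed over x last by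
    -- `meet-size`.
    ∑-deg² : ∑ (λ x → deg x * deg x) ≡ 3 * (# B? * # B?) + 13 * # B?
    ∑-deg² = begin
        ∑ (λ x → deg x * deg x)
      ≡⟨ ∑-cong (λ x → ∑-*∑ _ _) ⟩
        ∑ (λ x → ∑ (λ i → ∑ (λ j → ι (B? i ×-dec inc? x i) * ι (B? j ×-dec inc? x j))))
      ≡⟨ trans (∑-swap _) (∑-cong (λ i → ∑-swap _)) ⟩
        ∑ (λ i → ∑ (λ j → ∑ (λ x → ι (B? i ×-dec inc? x i) * ι (B? j ×-dec inc? x j))))
      ≡⟨ ∑-cong (λ i → ∑-cong (λ j → pair i j)) ⟩
        ∑ (λ i → ∑ (λ j → ι (B? i) * (3 * ι (B? j) + 13 * (ι (j Finₚ.≟ i) * ι (B? j)))))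
      ≡⟨ ∑-cong inner ⟩
        ∑ (λ i → 3 * # B? * ι (B? i) + 13 * ι (B? i))
      ≡⟨ trans (∑-+ _ _) (cong₂ _+_ (trans (∑-*ˡ (3 * # B?) (λ i → ι (B? i))) (*-assoc 3 (# B?) (# B?))) (∑-*ˡ 13 (λ i → ι (B? i)))) ⟩
        3 * (# B? * # B?) + 13 * # B? ∎
      where
      open ≡-Reasoning
      rearrange : ∀ a b c d → a * b * (c * d) ≡ a * c * (b * d)
      rearrange = solve-∀
      pair : ∀ i j → ∑ (λ x → ι (B? i ×-dec inc? x i) * ι (B? j ×-dec inc? x j)) ≡ ι (B? i) * (3 * ι (B? j) + 13 * (ι (j Finₚ.≟ i) * ι (B? j)))
      pair i j = trans (∑-cong (λ x → trans (cong₂ _*_ (ι-× (B? i) (inc? x i)) (ι-× (B? j) (inc? x j)))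
          (trans (rearrange (ι (B? i)) _ (ι (B? j)) _) (cong (ι (B? i) * ι (B? j) *_) (sym (ι-× (inc? x i) (inc? x j)))))))
        (trans (∑-*ˡ (ι (B? i) * ι (B? j)) _) (trans (cong (ι (B? i) * ι (B? j) *_) (meet-size i j))
          (trans (cong (λ z → ι (B? i) * ι (B? j) * (3 + 13 * z)) (ι-cong (i Finₚ.≟ j) (j Finₚ.≟ i) sym sym)) (poly (ι (B? i)) (ι (B? j)) (ι (j Finₚ.≟ i))))))
        where
        poly : ∀ a b c → a * b * (3 + 13 * c) ≡ a * (3 * b + 13 * (c * b))
        poly = solve-∀
      inner : ∀ i → ∑ (λ j → ι (B? i) * (3 * ι (B? j) + 13 * (ι (j Finₚ.≟ i) * ι (B? j)))) ≡ 3 * # B? * ι (B? i) + 13 * ι (B? i)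
      inner i = trans (∑-*ˡ (ι (B? i)) _) (trans (cong (ι (B? i) *_) (trans (∑-+ _ _) (cong₂ _+_ (∑-*ˡ 3 (λ j → ι (B? j))) (trans (∑-*ˡ 13 (λ j → ι (j Finₚ.≟ i) * ι (B? j))) (cong (13 *_) (∑-≡ i (λ j → ι (B? j))))))))
        (idem (B? i) (# B?)))
        where
        idem : ∀ {Q : Set} (q : Dec Q) n → ι q * (3 * n + 13 * ι q) ≡ 3 * n * ι q + 13 * ι q
        idem (yes _) n = solve n
          where
          solve : ∀ n → 1 * (3 * n + 13 * 1) ≡ 3 * n * 1 + 13 * 1
          solve = solve-∀
        idem (no _)  n = sym (trans (+-identityʳ _) (*-zeroʳ (3 * n)))

record Symmetry {v} (D : Design v) : Set where
  open Design D
  field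
    pt bl  : Fin v → Fin v
    inc⁺   : ∀ {x j} → Inc x j → Inc (pt x) (bl j)
    inc⁻   : ∀ {x j} → Inc (pt x) (bl j) → Inc x j
    pt-inj : Injective _≡_ _≡_ pt
    bl-inj : Injective _≡_ _≡_ bl

  fixpt? : Decidable (λ x → pt x ≡ x)
  fixpt? x = pt x Finₚ.≟ x

  fixbl? : Decidable (λ j → bl j ≡ j)
  fixbl? j = bl j Finₚ.≟ j

dual-symmetry : ∀ {v} {D : Design v} → Symmetry D → Symmetry (dual D)
dual-symmetry σ = record { pt = bl ; bl = pt ; inc⁺ = inc⁺ ; inc⁻ = inc⁻ ; pt-inj = bl-inj ; bl-inj = pt-inj }
  where open Symmetry σ

module _ {v} {D : Design v} (σ : Symmetry D) where
  open Counting D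
  open Symmetry σ

  -- Count the pairs (x, j) with both x and pt x on j, once by x and once by j.
  fixed-points≡fixed-blocks : # fixpt? ≡ # fixbl?
  fixed-points≡fixed-blocks = *-cancelˡ-≡ _ _ 13 (+-cancelˡ-≡ (v * 3) _ _ (trans (sym by-points) by-blocks))
    where
    total : ℕ
    total = ∑ (λ x → ∑ (λ j → ι (inc? x j ×-dec inc? (pt x) j)))
    shape : ∀ (f : Fin v → ℕ) → ∑ (λ x → 3 + 13 * f x) ≡ v * 3 + 13 * ∑ f
    shape f = trans (∑-+ _ _) (cong₂ _+_ (∑-const v 3) (∑-*ˡ 13 f))
    by-points : total ≡ v * 3 + 13 * # fixpt?
    by-points = trans (∑-cong at) (shape _)
      where
      at : ∀ x → ∑ (λ j → ι (inc? x j ×-dec inc? (pt x) j)) ≡ 3 + 13 * ι (fixpt? x)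
      at x with fixpt? x
      ... | yes e = trans (#-cong (join? x (pt x)) (inc? x) proj₁ (λ {j} p → p , subst (λ y → Inc y j) (sym e) p)) (pt-size x)
      ... | no ne = pt-pair ne
    by-blocks : total ≡ v * 3 + 13 * # fixbl?
    -- With j replaced by `bl j`, the points x such that x and `pt x` lie on `bl j` are the common
    -- points of `bl j` and j.
    by-blocks = trans (∑-swap _) (trans (sym (∑-reindex bl bl-inj _)) (trans (∑-cong at) (shape _)))
      where
      at : ∀ j → ∑ (λ x → ι (inc? x (bl j) ×-dec inc? (pt x) (bl j))) ≡ 3 + 13 * ι (fixbl? j)
      at j = trans (#-cong (λ x → inc? x (bl j) ×-dec inc? (pt x) (bl j)) (meet? (bl j) j) (λ (p , q) → p , inc⁻ q) (λ (p , q) → p , inc⁺ q)) (meet-size (bl j) j)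

-- Automorphisms of prime order p > 3

mod⇒% : ∀ {m n} d .{{_ : NonZero d}} → m ≡ n mod-via d → m % d ≡ n % d
mod⇒% {n = n} d (q , refl) = [m+kn]%n≡m%n n q d

#-sub-full : ∀ {n} {P Q : Fin n → Set} (P? : Decidable P) (Q? : Decidable Q) →
             # P? ≡ # (λ x → P? x ×-dec Q? x) → ∀ {x} → P x → Q x
#-sub-full P? Q? e {x} px = decidable-stable (Q? x) λ ¬qx →
  #-zero⇒ _ (+-cancelˡ-≡ (# (λ x → P? x ×-dec Q? x)) _ _ (trans (sym (#-split P? Q?)) (trans e (sym (+-identityʳ _))))) x (px , ¬qx)

#-two : ∀ {n} {P : Fin n → Set} (P? : Decidable P) → 2 ≤ # P? → ∀ {a} → P a → ∃ λ b → P b × b ≢ a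
#-two P? le {a} pa with #-witness (λ y → P? y ×-dec ¬? (y Finₚ.≟ a)) (ℕ.s≤s⁻¹ (subst (2 ≤_) (#-remove P? a pa) le))
... | b , pb , b≢a = b , pb , b≢a

mod-small : ∀ {m n d} → m ≡ n mod-via d → m < d → m ≡ n
mod-small {n = n} (zero , refl) _ = +-identityʳ n
mod-small {m} {n} {d} (suc q , e) lt = contradiction lt (ℕₚ.≤⇒≯ (subst (d ≤_) (sym e) (≤-trans (m≤m+n d (q * d)) (m≤n+m (d + q * d) n))))

HasOrderDividing : ∀ {v} {D : Design v} → Symmetry D → ℕ → Set
HasOrderDividing σ p = (∀ x → iter pt p x ≡ x) × (∀ j → iter bl p j ≡ j)
  where open Symmetry σ

module _ {v} {D : Design v} (σ : Symmetry D) where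
  open Counting D
  open Symmetry σ

  -- A symmetry of prime order p > 3 cannot move the 3 blocks joining two fixed points.
  join-fixed : ∀ {p} → Prime p → 3 < p → HasOrderDividing σ p → ∀ {x y j} → y ≢ x → pt x ≡ x → pt y ≡ y → Inc x j → Inc y j → bl j ≡ j
  join-fixed pp 3<p (_ , ord) {x} {y} y≢x fx fy ix iy =
    #-sub-full (join? x y) fixbl? (mod-small size (subst (_< _) (sym (pt-pair y≢x)) 3<p)) (ix , iy)
    where
    size : # (join? x y) ≡ # (λ j → join? x y j ×-dec fixbl? j) mod-via _
    size = prime-mod pp (join? x y) bl (λ (p , q) → subst (λ z → Inc z _) fx (inc⁺ p) , subst (λ z → Inc z _) fy (inc⁺ q)) (λ {j} _ → ord j)

module PrimeOrder {v} (v≡81 : v ≡ 81) {D : Design v} (σ : Symmetry D) {p} (pp : Prime p) (3<p : 3 < p)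
                  (ord : HasOrderDividing σ p) (moved : ∃ λ x → Symmetry.pt σ x ≢ x) where
  open Counting D
  open Symmetry σ

  f : ℕ
  f = # fixpt?

  fb≡f : # fixbl? ≡ f
  fb≡f = sym (fixed-points≡fixed-blocks σ)

  meet-fixed : ∀ {i j x} → j ≢ i → bl i ≡ i → bl j ≡ j → Inc x i → Inc x j → pt x ≡ x
  meet-fixed = join-fixed (dual-symmetry σ) pp 3<p (proj₂ ord , proj₁ ord)

  f-mod : 81 ≡ f mod-via p
  f-mod with prime-mod pp {λ _ → ⊤} (λ _ → yes tt) pt (λ _ → tt) (λ {x} _ → proj₁ ord x)
  ... | q , e = q , trans (sym (trans (#-all (λ _ → yes tt) (λ _ → tt)) v≡81)) (trans e (cong (_+ q * p) (#-cong (λ x → yes tt ×-dec fixpt? x) fixpt? proj₂ (tt ,_))))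

  on? : ∀ j → Decidable (λ x → Inc x j × pt x ≡ x)
  on? j x = inc? x j ×-dec fixpt? x

  κ : Fin v → ℕ
  κ j = # (on? j)

  κ-mod : ∀ {j} → bl j ≡ j → 16 ≡ κ j mod-via p
  κ-mod {j} fj with prime-mod pp (λ x → inc? x j) pt (λ i → subst (Inc _) fj (inc⁺ i)) (λ {x} _ → proj₁ ord x)
  ... | q , e = q , trans (sym (blk-size j)) e

  κ≤f : ∀ j → κ j ≤ f
  κ≤f j = #-mono (on? j) fixpt? proj₂

  -- If all points of a fixed block are fixed, every other block passes through two fixed points and
  -- is fixed; then there are as many fixed points as points, against `moved`.
  κ≢16 : ∀ {j} → bl j ≡ j → κ j ≢ 16
  κ≢16 {j} fj e = proj₂ moved (#-full⇒ fixpt? (trans (sym fb≡f) (#-all fixbl? all-fixed)) (proj₁ moved))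
    where
    on-j : ∀ {x} → Inc x j → pt x ≡ x
    on-j = #-sub-full (λ x → inc? x j) fixpt? (trans (blk-size j) (sym e))
    all-fixed : ∀ i → bl i ≡ i
    all-fixed i with i Finₚ.≟ j
    ... | yes refl = fj
    ... | no i≢j with #-witness (meet? j i) (subst (1 ≤_) (sym (blk-pair i≢j)) (s≤s z≤n))
    ...   | x , xj , xi with #-two (meet? j i) (subst (2 ≤_) (sym (blk-pair i≢j)) (s≤s (s≤s z≤n))) (xj , xi)
    ...     | y , (yj , yi) , y≢x = join-fixed σ pp 3<p ord y≢x (on-j xj) (on-j yj) xi yi

  other-block : 2 ≤ f → ∀ {j} → bl j ≡ j → ∃ λ i → bl i ≡ i × i ≢ j
  other-block 2≤f fj = #-two fixbl? (subst (2 ≤_) (sym fb≡f) 2≤f) fj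

  meet-on : ∀ {i j} → bl i ≡ i → bl j ≡ j → j ≢ i → # (λ x → on? i x ×-dec on? j x) ≡ 3
  meet-on {i} {j} fi fj j≢i = trans (#-cong (λ x → on? i x ×-dec on? j x) (meet? i j) (λ ((p , _) , q , _) → p , q)
    (λ (p , q) → let fx = meet-fixed j≢i fi fj p q in (p , fx) , q , fx)) (blk-pair j≢i)

  3≤κ : 2 ≤ f → ∀ {j} → bl j ≡ j → 3 ≤ κ j
  3≤κ 2≤f {j} fj = from (other-block 2≤f fj)
    where
    from : ∃ (λ i → bl i ≡ i × i ≢ j) → 3 ≤ κ j
    from (i , fi , i≢j) = ≤-trans (≡⇒≥ (meet-on fj fi i≢j)) (#-mono (λ x → on? j x ×-dec on? i x) (on? j) proj₁)

  -- Inclusion and exclusion: the 3 common points of two fixed blocks are all fixed.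
  κ+κ : ∀ {i j} → bl i ≡ i → bl j ≡ j → j ≢ i → κ i + κ j ≤ f + 3
  κ+κ {i} {j} fi fj j≢i = subst₂ _≤_ (∑-+ (λ x → ι (on? i x)) _) (trans (∑-+ (λ x → ι (fixpt? x)) _) (cong (f +_) (meet-on fi fj j≢i)))
    (∑-mono at)
    where
    at : ∀ x → ι (on? i x) + ι (on? j x) ≤ ι (fixpt? x) + ι (on? i x ×-dec on? j x)
    at x with inc? x i | inc? x j | fixpt? x
    ... | yes _ | yes _ | yes _ = ≤-refl
    ... | yes _ | no _  | yes _ = ≤-refl
    ... | no _  | yes _ | yes _ = ≤-refl
    ... | no _  | no _  | yes _ = z≤n
    ... | yes _ | yes _ | no _ = z≤n
    ... | yes _ | no _  | no _ = z≤n
    ... | no _  | yes _ | no _ = z≤n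
    ... | no _  | no _  | no _ = z≤n

  off? : ∀ j → Decidable (λ x → Inc x j × ¬ (pt x ≡ x))
  off? j x = inc? x j ×-dec ¬? (fixpt? x)

  -- A moved point lies on at most one fixed block.
  moved-points : ∀ c → (∀ {j} → bl j ≡ j → κ j + c ≤ 16) → c * f + f ≤ 81
  moved-points c h = ≤-trans (+-monoˡ-≤ f cover) (≤-reflexive (trans (+-comm (# unfixed?) f) count))
    where
    unfixed? : Decidable (λ x → ¬ (pt x ≡ x))
    unfixed? x = ¬? (fixpt? x)
    count : f + # unfixed? ≡ 81
    count = trans (cong₂ _+_ (#-cong fixpt? (λ x → yes tt ×-dec fixpt? x) (tt ,_) proj₂) (#-cong unfixed? (λ x → yes tt ×-dec unfixed? x) (tt ,_) proj₂))
      (trans (sym (#-split {P = λ _ → ⊤} (λ _ → yes tt) fixpt?)) (trans (#-all {P = λ _ → ⊤} (λ _ → yes tt) (λ _ → tt)) v≡81))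
    offs : ∀ j → bl j ≡ j → c ≤ # (off? j)
    offs j fj = ℕₚ.+-cancelˡ-≤ (κ j) c _ (≤-trans (h fj) (≤-reflexive (trans (sym (blk-size j)) (#-split (λ x → inc? x j) fixpt?))))
    cover : c * f ≤ # unfixed?
    cover = begin
        c * f                                                          ≡⟨ cong (c *_) (sym fb≡f) ⟩
        c * # fixbl?                                                   ≡⟨ sym (∑-*ˡ c (λ j → ι (fixbl? j))) ⟩
        ∑ (λ j → c * ι (fixbl? j))                                     ≤⟨ ∑-mono at-block ⟩
        ∑ (λ j → ∑ (λ x → ι (fixbl? j) * ι (off? j x)))                ≡⟨ ∑-swap _ ⟩
        ∑ (λ x → ∑ (λ j → ι (fixbl? j) * ι (off? j x)))                ≤⟨ ∑-mono at-point ⟩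
        # unfixed?                                                     ∎
      where
      open ℕₚ.≤-Reasoning
      at-block : ∀ j → c * ι (fixbl? j) ≤ ∑ (λ x → ι (fixbl? j) * ι (off? j x))
      at-block j with fixbl? j
      ... | yes fj = subst₂ _≤_ (sym (*-identityʳ c)) (∑-cong (λ x → sym (*-identityˡ (ι (off? j x))))) (offs j fj)
      ... | no _   = ≤-trans (≤-reflexive (*-zeroʳ c)) z≤n
      at-point : ∀ x → ∑ (λ j → ι (fixbl? j) * ι (off? j x)) ≤ ι (unfixed? x)
      at-point x with fixpt? x
      ... | yes fx = ≤-reflexive (∑-zero λ j → trans (cong (ι (fixbl? j) *_) (ι-no (inc? x j ×-dec no (λ q → q fx)) (λ (_ , q) → q fx))) (*-zeroʳ (ι (fixbl? j))))
      ... | no ¬fx = at-most-one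
        where
        Q? : Decidable (λ j → bl j ≡ j × Inc x j)
        Q? j = fixbl? j ×-dec inc? x j
        same : ∀ j → ι (fixbl? j) * ι (inc? x j ×-dec yes ¬fx) ≡ ι (Q? j)
        same j = trans (cong (ι (fixbl? j) *_) (ι-cong (inc? x j ×-dec yes ¬fx) (inc? x j) proj₁ (_, ¬fx))) (sym (ι-× (fixbl? j) (inc? x j)))
        at-most-one : ∑ (λ j → ι (fixbl? j) * ι (inc? x j ×-dec yes ¬fx)) ≤ 1
        at-most-one = subst (_≤ 1) (sym (∑-cong same)) (ℕₚ.≮⇒≥ λ 2≤ → two (#-witness Q? (<⇒≤ 2≤)) 2≤)
          where
          two : ∃ (λ j → bl j ≡ j × Inc x j) → ¬ (2 ≤ # Q?)
          two (j , fj , xj) 2≤ with #-two Q? 2≤ (fj , xj)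
          ... | i , (fi , xi) , i≢j = ¬fx (meet-fixed i≢j fj fi xj xi)

module _ {v} (v≡81 : v ≡ 81) {D : Design v} (σ : Symmetry D) {p} (pp : Prime p) (3<p : 3 < p)
         (ord : HasOrderDividing σ p) (moved : ∃ λ x → Symmetry.pt σ x ≢ x) where
  open Symmetry σ
  open PrimeOrder v≡81 σ pp 3<p ord moved

  private
    κ≤16 : ∀ {j} → bl j ≡ j → κ j < 17
    κ≤16 {j} fj = s≤s (subst (κ j ≤_) (sym (proj₂ (κ-mod fj))) (m≤m+n _ _))

    fixed-block : 1 ≤ f → ∃ λ j → bl j ≡ j
    fixed-block 1≤f = #-witness fixbl? (subst (1 ≤_) (sym fb≡f) 1≤f)

    -- If each of the f fixed blocks has c moved points of its own, then (c + 1) f ≤ 81.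
    f≤ : ∀ c n → (∀ {j} → bl j ≡ j → κ j + c ≤ 16) → {_ : True (81 <? c * suc n + suc n)} → f < suc n
    f≤ c n h {t} = ≰⇒> λ le → <⇒≱ (toWitness t) (≤-trans (+-mono-≤ (*-monoʳ-≤ c le) le) (moved-points c h))

  -- κ ≡ 16 mod 13 and κ ≠ 16 leave κ = 3, so a fixed block has 13 moved points and 14 f ≤ 81; of
  -- the values f ≡ 81 mod 13 only 3 is small enough.
  order-13 : p ≡ 13 → f ≡ 3
  order-13 refl = toWitness {a? = ℕₚ.allUpTo? (λ k → 81 % 13 ℕₚ.≟ k % 13 →-dec k ℕₚ.≟ 3) 6} tt
      (f≤ 13 5 (λ fj → κ-bound fj)) (mod⇒% 13 f-mod)
    where
    κ-bound : ∀ {j} → bl j ≡ j → κ j + 13 ≤ 16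
    κ-bound fj = toWitness {a? = ℕₚ.allUpTo? (λ k → 16 % 13 ℕₚ.≟ k % 13 →-dec ¬? (k ℕₚ.≟ 16) →-dec k + 13 ≤? 16) 17} tt
      (κ≤16 fj) (mod⇒% 13 (κ-mod fj)) (κ≢16 fj)

  -- Suppose f ≥ 2. Then κ is 6 or 11 and 6 f ≤ 81, so f ≤ 13. A block with κ = 11 and a second one
  -- give 17 ≤ f + 3, too much. Hence κ = 6 throughout, 11 f ≤ 81 and f ≤ 7, against 12 ≤ f + 3.
  order-5 : p ≡ 5 → f ≡ 1
  order-5 refl with 2 ≤? f
  ... | no ¬2 = toWitness {a? = ℕₚ.allUpTo? (λ k → 81 % 5 ℕₚ.≟ k % 5 →-dec k ℕₚ.≟ 1) 2} tt (≰⇒> ¬2) (mod⇒% 5 f-mod)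
  ... | yes 2≤ = ⊥-elim (clash (fixed-block (<⇒≤ 2≤)))
    where
    Values : ℕ → Set
    Values k = k ≡ 6 ⊎ k ≡ 11
    values : ∀ {j} → bl j ≡ j → Values (κ j)
    values fj = toWitness {a? = ℕₚ.allUpTo? (λ k → 16 % 5 ℕₚ.≟ k % 5 →-dec ¬? (k ℕₚ.≟ 16) →-dec 3 ≤? k →-dec (k ℕₚ.≟ 6 ⊎-dec k ℕₚ.≟ 11)) 17} tt
      (κ≤16 fj) (mod⇒% 5 (κ-mod fj)) (κ≢16 fj) (3≤κ 2≤ fj)
    f<14 : f < 14
    f<14 = f≤ 5 13 (λ fj → [ (λ e → subst (λ k → k + 5 ≤ 16) (sym e) (toWitness {a? = 11 ≤? 16} tt)) , (λ e → ≤-reflexive (cong (_+ 5) e)) ]′ (values fj))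
    κ≡6 : ∀ {j} → bl j ≡ j → κ j ≡ 6
    κ≡6 {j} fj = [ id , (λ e → ⊥-elim (not-11 e (other-block 2≤ fj))) ]′ (values fj)
      where
      not-11 : κ j ≡ 11 → ∃ (λ i → bl i ≡ i × i ≢ j) → ⊥
      not-11 e (i , fi , i≢j) = absurd {ρ = κ j ∷ κ i ∷ f ∷ []}
        (hyp 1 (v0 :+ v1) (v2 :+ con 3) (κ+κ fj fi i≢j) ∷ hyp 1 (con 11) v0 (≡⇒≥ e) ∷ hyp 1 (con 6) v1 ([ ≡⇒≥ , (λ e → subst (6 ≤_) (sym e) (toWitness {a? = 6 ≤? 11} tt)) ]′ (values fi)) ∷ hyp 1 (v2 :+ con 1) (con 14) (subst (_≤ 14) (+-comm 1 f) f<14) ∷ [])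
    f<8 : f < 8
    f<8 = f≤ 10 7 (λ fj → ≤-reflexive (cong (_+ 10) (κ≡6 fj)))
    clash : ∃ (λ j → bl j ≡ j) → ⊥
    clash (j , fj) = pair (other-block 2≤ fj)
      where
      pair : ∃ (λ i → bl i ≡ i × i ≢ j) → ⊥
      pair (i , fi , i≢j) = absurd {ρ = κ j ∷ κ i ∷ f ∷ []}
        (hyp 1 (v0 :+ v1) (v2 :+ con 3) (κ+κ fj fi i≢j) ∷ hyp 1 (con 6) v0 (≡⇒≥ (κ≡6 fj)) ∷ hyp 1 (con 6) v1 (≡⇒≥ (κ≡6 fi)) ∷ hyp 1 (v2 :+ con 1) (con 8) (subst (_≤ 8) (+-comm 1 f) f<8) ∷ [])

  private
    -- Here κ = 9, so 9 ≤ f and 8 f ≤ 81, but neither 9 nor 10 is congruent to 81 mod 7.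
    not-7 : p ≢ 7
    not-7 refl = clash (fixed-block (≤-trans (s≤s z≤n) 2≤))
      where
      2≤ : 2 ≤ f
      2≤ = ≮⇒≥ λ lt → toWitness {a? = ℕₚ.allUpTo? (λ k → ¬? (81 % 7 ℕₚ.≟ k % 7)) 2} tt lt (mod⇒% 7 f-mod)
      κ≡9 : ∀ {j} → bl j ≡ j → κ j ≡ 9
      κ≡9 fj = toWitness {a? = ℕₚ.allUpTo? (λ k → 16 % 7 ℕₚ.≟ k % 7 →-dec ¬? (k ℕₚ.≟ 16) →-dec 3 ≤? k →-dec k ℕₚ.≟ 9) 17} tt
        (κ≤16 fj) (mod⇒% 7 (κ-mod fj)) (κ≢16 fj) (3≤κ 2≤ fj)
      f<11 : f < 11
      f<11 = f≤ 7 10 (λ fj → ≤-reflexive (cong (_+ 7) (κ≡9 fj)))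
      clash : ∃ (λ j → bl j ≡ j) → ⊥
      clash (j , fj) = toWitness {a? = ℕₚ.allUpTo? (λ k → 81 % 7 ℕₚ.≟ k % 7 →-dec ¬? (9 ≤? k)) 11} tt f<11 (mod⇒% 7 f-mod) (subst (_≤ f) (κ≡9 fj) (κ≤f j))

    -- Here κ = 5, so 5 ≤ f and 12 f ≤ 81, but neither 5 nor 6 is congruent to 81 mod 11.
    not-11 : p ≢ 11
    not-11 refl = clash (fixed-block (≤-trans (s≤s z≤n) 2≤))
      where
      2≤ : 2 ≤ f
      2≤ = ≮⇒≥ λ lt → toWitness {a? = ℕₚ.allUpTo? (λ k → ¬? (81 % 11 ℕₚ.≟ k % 11)) 2} tt lt (mod⇒% 11 f-mod)
      κ≡5 : ∀ {j} → bl j ≡ j → κ j ≡ 5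
      κ≡5 fj = toWitness {a? = ℕₚ.allUpTo? (λ k → 16 % 11 ℕₚ.≟ k % 11 →-dec ¬? (k ℕₚ.≟ 16) →-dec k ℕₚ.≟ 5) 17} tt
        (κ≤16 fj) (mod⇒% 11 (κ-mod fj)) (κ≢16 fj)
      f<7 : f < 7
      f<7 = f≤ 11 6 (λ fj → ≤-reflexive (cong (_+ 11) (κ≡5 fj)))
      clash : ∃ (λ j → bl j ≡ j) → ⊥
      clash (j , fj) = toWitness {a? = ℕₚ.allUpTo? (λ k → 81 % 11 ℕₚ.≟ k % 11 →-dec ¬? (5 ≤? k)) 7} tt f<7 (mod⇒% 11 f-mod) (subst (_≤ f) (κ≡5 fj) (κ≤f j))

    -- For p > 16 the congruence κ ≡ 16 is an equality, which `κ≢16` forbids; without any fixed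
    -- point p would divide 81 = 3⁴.
    not-large : ¬ (16 < p)
    not-large 16<p = case 1 ≤? f of λ
      { (yes 1≤f) → let (j , fj) = fixed-block 1≤f in κ≢16 fj (sym (mod-small (κ-mod fj) 16<p))
      ; (no ¬1) → let (q , e) = f-mod in
          <⇒≱ (<-trans (toWitness {a? = 3 <? 16} tt) 16<p) (∣⇒≤ (p∣3 (divides q (trans e (cong (_+ q * p) (ℕₚ.n<1⇒n≡0 (≰⇒> ¬1))))))) }
      where
      p∣3 : p ∣ 81 → p ∣ 3
      p∣3 d with euclidsLemma 3 27 pp d
      ... | inj₁ d₁ = d₁
      ... | inj₂ d₂ with euclidsLemma 3 9 pp d₂
      ...   | inj₁ d₃ = d₃
      ...   | inj₂ d₄ with euclidsLemma 3 3 pp d₄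
      ...     | inj₁ d₅ = d₅
      ...     | inj₂ d₅ = d₅

  private
    no-factor : ∀ {d} → d ≢ 1 → d ≤ 3 → ¬ (d ∣ p)
    no-factor d≢1 d≤3 d∣p with prime⇒irreducible pp d∣p
    ... | inj₁ e    = d≢1 e
    ... | inj₂ refl = <⇒≱ 3<p d≤3

  prime-order : p ≡ 5 ⊎ p ≡ 13
  prime-order with toWitness {a? = ℕₚ.allUpTo? (λ k → (2 ∣? k) ⊎-dec (3 ∣? k) ⊎-dec (k ℕₚ.≟ 1) ⊎-dec (k ℕₚ.≟ 7) ⊎-dec (k ℕₚ.≟ 11) ⊎-dec (k ℕₚ.≟ 5) ⊎-dec (k ℕₚ.≟ 13)) 17} tt (s≤s (≮⇒≥ not-large))
  ... | inj₁ d                             = contradiction d (no-factor (λ ()) (s≤s (s≤s z≤n)))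
  ... | inj₂ (inj₁ d)                      = contradiction d (no-factor (λ ()) (s≤s (s≤s (s≤s z≤n))))
  ... | inj₂ (inj₂ (inj₁ e))               = contradiction 3<p (λ l → <⇒≱ l (≤-trans (≡⇒≤ e) (s≤s z≤n)))
  ... | inj₂ (inj₂ (inj₂ (inj₁ e)))        = contradiction e not-7
  ... | inj₂ (inj₂ (inj₂ (inj₂ (inj₁ e)))) = contradiction e not-11
  ... | inj₂ (inj₂ (inj₂ (inj₂ (inj₂ e)))) = e

-- Rational orthogonality

-- A linear form in k + 1 variables, the last coefficient being kept apart.
Form : ℕ → Set
Form k = Vec ℤ k × ℤ

dot : ∀ {k} → Vec ℤ k → Vec ℤ k → ℤ
dot []       []       = 0ℤ
dot (a ∷ as) (b ∷ bs) = a ℤ.* b ℤ.+ dot as bs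

apply : ∀ {k} → Form k → Form k → ℤ
apply (as , a) (us , t) = dot as us ℤ.+ a ℤ.* t

sq : ℤ → ℤ
sq a = a ℤ.* a

sumℤ : ∀ {A : Set} → List A → (A → ℤ) → ℤ
sumℤ []       g = 0ℤ
sumℤ (x ∷ xs) g = g x ℤ.+ sumℤ xs g

norm : ∀ {k} → Vec ℤ k → ℤ
norm us = dot us us

scale : ∀ {k} → ℤ → Vec ℤ k → Vec ℤ k
scale a = Vec.map (a ℤ.*_)

comb : ∀ {k} → ℤ → Form k → ℤ → Form k → Form k
comb a (us , s) b (ws , t) = zipWith (λ u w → a ℤ.* u ℤ.+ b ℤ.* w) us ws , a ℤ.* s ℤ.+ b ℤ.* t

apply-comb : ∀ {k} a (φ : Form k) b ψ u → apply (comb a φ b ψ) u ≡ a ℤ.* apply φ u ℤ.+ b ℤ.* apply ψ u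
apply-comb a ([] , s) b ([] , t) ([] , r) = base a s b t r
  where
  base : ∀ a s b t r → 0ℤ ℤ.+ (a ℤ.* s ℤ.+ b ℤ.* t) ℤ.* r ≡ a ℤ.* (0ℤ ℤ.+ s ℤ.* r) ℤ.+ b ℤ.* (0ℤ ℤ.+ t ℤ.* r)
  base = ℤ-Solver.solve-∀
apply-comb a (x ∷ xs , s) b (y ∷ ys , t) (u ∷ us , r) =
  trans (assoc (a ℤ.* x ℤ.+ b ℤ.* y) u _ _) (trans (cong (λ e → (a ℤ.* x ℤ.+ b ℤ.* y) ℤ.* u ℤ.+ e) (apply-comb a (xs , s) b (ys , t) (us , r)))
    (step a x b y u (dot xs us) (s ℤ.* r) (dot ys us) (t ℤ.* r)))
  where
  assoc : ∀ p u d e → p ℤ.* u ℤ.+ d ℤ.+ e ≡ p ℤ.* u ℤ.+ (d ℤ.+ e)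
  assoc = ℤ-Solver.solve-∀
  step : ∀ a x b y u d e d′ e′ → (a ℤ.* x ℤ.+ b ℤ.* y) ℤ.* u ℤ.+ (a ℤ.* (d ℤ.+ e) ℤ.+ b ℤ.* (d′ ℤ.+ e′))
         ≡ a ℤ.* (x ℤ.* u ℤ.+ d ℤ.+ e) ℤ.+ b ℤ.* (y ℤ.* u ℤ.+ d′ ℤ.+ e′)
  step = ℤ-Solver.solve-∀

dot-scaleʳ : ∀ {k} a (us ws : Vec ℤ k) → dot us (scale a ws) ≡ a ℤ.* dot us ws
dot-scaleʳ a [] [] = sym (ℤₚ.*-zeroʳ a)
dot-scaleʳ a (u ∷ us) (w ∷ ws) rewrite dot-scaleʳ a us ws = step a u w (dot us ws)
  where
  step : ∀ a u w d → u ℤ.* (a ℤ.* w) ℤ.+ a ℤ.* d ≡ a ℤ.* (u ℤ.* w ℤ.+ d)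
  step = ℤ-Solver.solve-∀

norm-scale : ∀ {k} a (us : Vec ℤ k) → norm (scale a us) ≡ sq a ℤ.* norm us
norm-scale a [] = sym (ℤₚ.*-zeroʳ (sq a))
norm-scale a (u ∷ us) rewrite norm-scale a us = step a u (norm us)
  where
  step : ∀ a u d → a ℤ.* u ℤ.* (a ℤ.* u) ℤ.+ a ℤ.* a ℤ.* d ≡ a ℤ.* a ℤ.* (u ℤ.* u ℤ.+ d)
  step = ℤ-Solver.solve-∀

sumℤ-cong : ∀ {A : Set} (xs : List A) {g h : A → ℤ} → (∀ x → g x ≡ h x) → sumℤ xs g ≡ sumℤ xs h
sumℤ-cong []       e = refl
sumℤ-cong (x ∷ xs) e = cong₂ ℤ._+_ (e x) (sumℤ-cong xs e)

sumℤ-map : ∀ {A B : Set} (f : A → B) (xs : List A) (g : B → ℤ) → sumℤ (map f xs) g ≡ sumℤ xs (g ∘ f)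
sumℤ-map f []       g = refl
sumℤ-map f (x ∷ xs) g = cong (λ e → g (f x) ℤ.+ e) (sumℤ-map f xs g)

sumℤ-comb : ∀ {A : Set} (xs : List A) a (g : A → ℤ) b h → sumℤ xs (λ x → a ℤ.* g x ℤ.+ b ℤ.* h x) ≡ a ℤ.* sumℤ xs g ℤ.+ b ℤ.* sumℤ xs h
sumℤ-comb []       a g b h = base a b
  where
  base : ∀ a b → 0ℤ ≡ a ℤ.* 0ℤ ℤ.+ b ℤ.* 0ℤ
  base = ℤ-Solver.solve-∀
sumℤ-comb (x ∷ xs) a g b h rewrite sumℤ-comb xs a g b h = step a b (g x) (h x) (sumℤ xs g) (sumℤ xs h)
  where
  step : ∀ a b p q s t → a ℤ.* p ℤ.+ b ℤ.* q ℤ.+ (a ℤ.* s ℤ.+ b ℤ.* t) ≡ a ℤ.* (p ℤ.+ s) ℤ.+ b ℤ.* (q ℤ.+ t)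
  step = ℤ-Solver.solve-∀

-- k linear forms in k + 1 variables agree up to sign with d times the first k variables
-- at a point whose last coordinate does not vanish: eliminate one variable at a time, using the sign that can be solved for.
eliminate : ∀ {k} (φs : List (Form k)) → length φs ≡ k → ∀ d → d ≢ 0ℤ →
            ∃ λ us → ∃ λ t → t ≢ 0ℤ × sumℤ φs (λ φ → sq (apply φ (us , t))) ≡ sq d ℤ.* norm us
eliminate {zero} [] refl d d≢0 = [] , 1ℤ , (λ ()) , sym (ℤₚ.*-zeroʳ (sq d))
eliminate {suc k} ((c ∷ cs , l) ∷ φs) e d d≢0 = solve (pivot (c ℤ.≟ d))
  where
  ψ : Form k
  ψ = cs , l
  -- Choice of a sign for which the first form can be solved: s = 1 and a = d - c unless c = d, and
  -- then s = -1 and a = 2 c. All other variables are multiplied by the nonzero denominator `a`,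
  -- which keeps the elimination in ℤ.
  Pivot : Set
  Pivot = ∃ λ a → ∃ λ s → a ≢ 0ℤ × s ℤ.* s ≡ 1ℤ × sq (c ℤ.* s ℤ.+ a) ≡ sq d
  pivot : Dec (c ≡ d) → Pivot
  pivot (no c≢d) = d ℤ.- c , 1ℤ , (λ z → c≢d (sym (ℤₚ.i-j≡0⇒i≡j d c z))) , refl , square c d
    where
    square : ∀ c d → (c ℤ.* 1ℤ ℤ.+ (d ℤ.- c)) ℤ.* (c ℤ.* 1ℤ ℤ.+ (d ℤ.- c)) ≡ d ℤ.* d
    square = ℤ-Solver.solve-∀
  pivot (yes refl) = c ℤ.+ c , ℤ.- 1ℤ , two-c , refl , square c
    where
    two-c : c ℤ.+ c ≢ 0ℤ
    two-c z = [ (λ ()) , d≢0 ]′ (ℤₚ.i*j≡0⇒i≡0∨j≡0 (pos 2) (trans (dbl c) z))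
      where
      dbl : ∀ c → pos 2 ℤ.* c ≡ c ℤ.+ c
      dbl = ℤ-Solver.solve-∀
    square : ∀ c → (c ℤ.* (ℤ.- 1ℤ) ℤ.+ (c ℤ.+ c)) ℤ.* (c ℤ.* (ℤ.- 1ℤ) ℤ.+ (c ℤ.+ c)) ≡ c ℤ.* c
    square = ℤ-Solver.solve-∀
  solve : Pivot → ∃ λ us → ∃ λ t → t ≢ 0ℤ × sumℤ ((c ∷ cs , l) ∷ φs) (λ φ → sq (apply φ (us , t))) ≡ sq d ℤ.* norm us
  solve (a , s , a≢0 , ss , sqd) = build (eliminate (map reduce φs) (trans (Listₚ.length-map reduce φs) (suc-injective e)) (d ℤ.* a) da≢0)
    where
    -- z is the value of the eliminated variable: c z + a ψ = ± d z for z = s ψ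
    reduce : Form (suc k) → Form k
    reduce (b ∷ bs , m) = comb (b ℤ.* s) ψ a (bs , m)
    da≢0 : d ℤ.* a ≢ 0ℤ
    da≢0 z = [ d≢0 , a≢0 ]′ (ℤₚ.i*j≡0⇒i≡0∨j≡0 d z)
    build : (∃ λ us → ∃ λ t → t ≢ 0ℤ × sumℤ (map reduce φs) (λ φ → sq (apply φ (us , t))) ≡ sq (d ℤ.* a) ℤ.* norm us) →
            ∃ λ us → ∃ λ t → t ≢ 0ℤ × sumℤ ((c ∷ cs , l) ∷ φs) (λ φ → sq (apply φ (us , t))) ≡ sq d ℤ.* norm us
    build (us , t , t≢0 , eq) = z ∷ scale a us , a ℤ.* t , (λ w → [ a≢0 , t≢0 ]′ (ℤₚ.i*j≡0⇒i≡0∨j≡0 a w)) ,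
        trans (cong₂ ℤ._+_ head-sq tail-sq) (trans (collect d z a (norm us)) (cong (λ n → sq d ℤ.* (z ℤ.* z ℤ.+ n)) (sym (norm-scale a us))))
      where
      z : ℤ
      z = s ℤ.* apply ψ (us , t)
      at : ∀ b bs m → apply (b ∷ bs , m) (z ∷ scale a us , a ℤ.* t) ≡ b ℤ.* z ℤ.+ a ℤ.* apply (bs , m) (us , t)
      at b bs m rewrite dot-scaleʳ a bs us = step b z a (dot bs us) m t
        where
        step : ∀ b z a d m t → b ℤ.* z ℤ.+ a ℤ.* d ℤ.+ m ℤ.* (a ℤ.* t) ≡ b ℤ.* z ℤ.+ a ℤ.* (d ℤ.+ m ℤ.* t)
        step = ℤ-Solver.solve-∀
      head-sq : sq (apply (c ∷ cs , l) (z ∷ scale a us , a ℤ.* t)) ≡ sq d ℤ.* sq z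
      head-sq = trans (cong sq (at c cs l)) (trans (poly c s a (apply ψ (us , t)))
        (trans (cong (λ e → e ℤ.* sq (apply ψ (us , t))) sqd) (trans (cong (λ e → sq d ℤ.* e) (sym (trans (poly₂ s (apply ψ (us , t))) (trans (cong (λ e → e ℤ.* sq (apply ψ (us , t))) ss) (ℤₚ.*-identityˡ _))))) refl)))
        where
        poly : ∀ c s a p → (c ℤ.* (s ℤ.* p) ℤ.+ a ℤ.* p) ℤ.* (c ℤ.* (s ℤ.* p) ℤ.+ a ℤ.* p) ≡ (c ℤ.* s ℤ.+ a) ℤ.* (c ℤ.* s ℤ.+ a) ℤ.* (p ℤ.* p)
        poly = ℤ-Solver.solve-∀
        poly₂ : ∀ s p → s ℤ.* p ℤ.* (s ℤ.* p) ≡ s ℤ.* s ℤ.* (p ℤ.* p)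
        poly₂ = ℤ-Solver.solve-∀
      reduced : ∀ φ → apply φ (z ∷ scale a us , a ℤ.* t) ≡ apply (reduce φ) (us , t)
      reduced (b ∷ bs , m) = trans (at b bs m) (trans (cong (λ e → e ℤ.+ a ℤ.* apply (bs , m) (us , t)) (sym (ℤₚ.*-assoc b s _)))
        (sym (apply-comb (b ℤ.* s) ψ a (bs , m) (us , t))))
      tail-sq : sumℤ φs (λ φ → sq (apply φ (z ∷ scale a us , a ℤ.* t))) ≡ sq (d ℤ.* a) ℤ.* norm us
      tail-sq = trans (sumℤ-cong φs (λ φ → cong sq (reduced φ))) (trans (sym (sumℤ-map reduce φs _)) eq)
      collect : ∀ d z a n → d ℤ.* d ℤ.* (z ℤ.* z) ℤ.+ d ℤ.* a ℤ.* (d ℤ.* a) ℤ.* n ≡ d ℤ.* d ℤ.* (z ℤ.* z ℤ.+ a ℤ.* a ℤ.* n)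
      collect = ℤ-Solver.solve-∀

-- Infinite descent: p divides a, then b, and b / p is the b of a smaller solution.
prime-not-square : ∀ {p} → Prime p → ∀ a b → a * a ≡ p * (b * b) → b ≡ 0
prime-not-square {p} pp a b = go b (<-wellFounded b) a
  where
  instance
    p≢0 : NonZero p
    p≢0 = prime⇒nonZero pp
  root : ∀ a → p ∣ a * a → ∃ λ c → a ≡ c * p
  root a d = case [ id , id ]′ (euclidsLemma a a pp d) of λ { (divides c e) → c , e }
  square : ∀ c p → c * p * (c * p) ≡ p * (p * (c * c))
  square = solve-∀
  go : ∀ b → Acc _<_ b → ∀ a → a * a ≡ p * (b * b) → b ≡ 0
  go b (acc rec) a e with b ℕₚ.≟ 0
  ... | yes z = z
  ... | no b≢0 = case root a (divides (b * b) (trans e (*-comm p (b * b)))) of λ { (c , a≡) →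
      let b² = *-cancelˡ-≡ (b * b) (p * (c * c)) p (trans (sym e) (trans (cong (λ z → z * z) a≡) (square c p)))
      in case root b (divides (c * c) (trans b² (*-comm p (c * c)))) of λ { (q , b≡) →
      let q≢0 : q ≢ 0
          q≢0 = λ q≡0 → b≢0 (trans b≡ (cong (_* p) q≡0))
          c² = *-cancelˡ-≡ (c * c) (p * (q * q)) p (trans (sym b²) (trans (cong (λ z → z * z) b≡) (square q p)))
      in ⊥-elim (q≢0 (go q (rec (subst (q <_) (sym b≡) (ℕₚ.m<m*n q p {{ℕ.≢-nonZero q≢0}} (ℕ.nonTrivial⇒n>1 p {{prime⇒nonTrivial pp}})))) c c²)) } }

-- 13 = 2² + 3²: rotating the variables in pairs multiplies the norm by 13.
rotate : ∀ m → Vec ℤ (m * 2) → Vec ℤ (m * 2)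
rotate zero    []           = []
rotate (suc m) (x ∷ y ∷ zs) = (pos 2 ℤ.* x ℤ.+ pos 3 ℤ.* y) ∷ (pos 3 ℤ.* x ℤ.- pos 2 ℤ.* y) ∷ rotate m zs

norm-rotate : ∀ m us → norm (rotate m us) ≡ pos 13 ℤ.* norm us
norm-rotate zero    []           = refl
norm-rotate (suc m) (x ∷ y ∷ zs) rewrite norm-rotate m zs = step x y (norm zs)
  where
  step : ∀ x y n → (pos 2 ℤ.* x ℤ.+ pos 3 ℤ.* y) ℤ.* (pos 2 ℤ.* x ℤ.+ pos 3 ℤ.* y) ℤ.+ ((pos 3 ℤ.* x ℤ.- pos 2 ℤ.* y) ℤ.* (pos 3 ℤ.* x ℤ.- pos 2 ℤ.* y) ℤ.+ pos 13 ℤ.* n)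
         ≡ pos 13 ℤ.* (x ℤ.* x ℤ.+ (y ℤ.* y ℤ.+ n))
  step = ℤ-Solver.solve-∀

dot-rotate : ∀ m us ws → dot (rotate m us) ws ≡ dot us (rotate m ws)
dot-rotate zero    []           []           = refl
dot-rotate (suc m) (x ∷ y ∷ zs) (u ∷ w ∷ ts) rewrite dot-rotate m zs ts = step x y u w (dot zs (rotate m ts))
  where
  step : ∀ x y u w d → (pos 2 ℤ.* x ℤ.+ pos 3 ℤ.* y) ℤ.* u ℤ.+ ((pos 3 ℤ.* x ℤ.- pos 2 ℤ.* y) ℤ.* w ℤ.+ d)
         ≡ x ℤ.* (pos 2 ℤ.* u ℤ.+ pos 3 ℤ.* w) ℤ.+ (y ℤ.* (pos 3 ℤ.* u ℤ.- pos 2 ℤ.* w) ℤ.+ d)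
  step = ℤ-Solver.solve-∀

-- Rotating the first 2m variables turns the right side into 13² ‖u‖² + 13 t². Eliminating with d =
-- 13 cancels all forms but `φ` against 13² ‖u‖², and φ² = 13 t² with t ≠ 0 remains.
no-odd-weighing : ∀ m (φs : List (Form (m * 2))) → length φs ≡ suc (m * 2) →
                  ¬ (∀ us t → sumℤ φs (λ φ → sq (apply φ (us , t))) ≡ pos 13 ℤ.* (norm us ℤ.+ sq t))
no-odd-weighing m (φ ∷ φs) e h = conclude (eliminate (map turn φs) (trans (Listₚ.length-map turn φs) (suc-injective e)) (pos 13) (λ ()))
  where
  turn : Form (m * 2) → Form (m * 2)
  turn (as , a) = rotate m as , a
  conclude : (∃ λ us → ∃ λ t → t ≢ 0ℤ × sumℤ (map turn φs) (λ φ → sq (apply φ (us , t))) ≡ sq (pos 13) ℤ.* norm us) → ⊥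
  conclude (us , t , t≢0 , eq) = t≢0 (ℤₚ.∣i∣≡0⇒i≡0 (prime-not-square (toWitness {a? = prime? 13} tt) ℤ.∣ A ∣ ℤ.∣ t ∣ (trans (sym (ℤₚ.abs-* A A)) (trans (cong ℤ.∣_∣ A²) (trans (ℤₚ.abs-* (pos 13) (t ℤ.* t)) (cong (13 *_) (ℤₚ.abs-* t t)))))))
    where
    A : ℤ
    A = apply φ (rotate m us , t)
    rest : sumℤ φs (λ φ → sq (apply φ (rotate m us , t))) ≡ sq (pos 13) ℤ.* norm us
    rest = trans (sumℤ-cong φs (λ { (as , a) → cong (λ d → sq (d ℤ.+ a ℤ.* t)) (sym (dot-rotate m as us)) })) (trans (sym (sumℤ-map turn φs _)) eq)
    cancelʳ : ∀ c a b → a ℤ.+ c ≡ b ℤ.+ c → a ≡ b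
    cancelʳ c a b eq = trans (undo a c) (trans (cong (λ e → e ℤ.- c) eq) (sym (undo b c)))
      where
      undo : ∀ a c → a ≡ a ℤ.+ c ℤ.- c
      undo = ℤ-Solver.solve-∀
    A² : sq A ≡ pos 13 ℤ.* (t ℤ.* t)
    A² = cancelʳ (sq (pos 13) ℤ.* norm us) (sq A) (pos 13 ℤ.* (t ℤ.* t))
      (trans (cong (λ e → sq A ℤ.+ e) (sym rest)) (trans (h (rotate m us) t) (trans (cong (λ n → pos 13 ℤ.* (n ℤ.+ sq t)) (norm-rotate m us)) (poly (norm us) t))))
      where
      poly : ∀ n t → pos 13 ℤ.* (pos 13 ℤ.* n ℤ.+ t ℤ.* t) ≡ pos 13 ℤ.* (t ℤ.* t) ℤ.+ pos 13 ℤ.* pos 13 ℤ.* n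
      poly = ℤ-Solver.solve-∀

module _ {A : Set} (qs : List A) where

  combine : ∀ {k} → Vec (A → ℤ) k → Vec ℤ k → A → ℤ
  combine ws us q = dot (Vec.map (λ w → w q) ws) us

  inner : (A → ℤ) → (A → ℤ) → ℤ
  inner g h = sumℤ qs (λ q → g q ℤ.* h q)

  inner-combine : ∀ {k} g (ws : Vec (A → ℤ) k) us → (∀ i → inner g (lookup ws i) ≡ 0ℤ) → inner g (combine ws us) ≡ 0ℤ
  inner-combine g [] [] _ = zeros qs
    where
    zeros : ∀ qs → sumℤ qs (λ q → g q ℤ.* 0ℤ) ≡ 0ℤ
    zeros []       = refl
    zeros (q ∷ qs) = cong₂ ℤ._+_ (ℤₚ.*-zeroʳ (g q)) (zeros qs)
  inner-combine g (w ∷ ws) (u ∷ us) o = trans (sumℤ-cong qs (λ q → spread (g q) (w q) u (combine ws us q)))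
    (trans (sumℤ-comb qs u (λ q → g q ℤ.* w q) 1ℤ (λ q → g q ℤ.* combine ws us q))
      (trans (cong₂ (λ a b → u ℤ.* a ℤ.+ 1ℤ ℤ.* b) (o zero) (inner-combine g ws us (o ∘ suc))) (cong (λ e → e ℤ.+ 0ℤ) (ℤₚ.*-zeroʳ u))))
    where
    spread : ∀ g w u c → g ℤ.* (w ℤ.* u ℤ.+ c) ≡ u ℤ.* (g ℤ.* w) ℤ.+ 1ℤ ℤ.* (g ℤ.* c)
    spread = ℤ-Solver.solve-∀

  orthogonal : ∀ {k} (ws : Vec (A → ℤ) k) us → (∀ i → inner (lookup ws i) (lookup ws i) ≡ pos 13) →
               (∀ i j → i ≢ j → inner (lookup ws i) (lookup ws j) ≡ 0ℤ) → sumℤ qs (λ q → sq (combine ws us q)) ≡ pos 13 ℤ.* norm us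
  orthogonal [] [] _ _ = zeros qs
    where
    zeros : ∀ qs → sumℤ qs (λ _ → 0ℤ) ≡ 0ℤ
    zeros []       = refl
    zeros (q ∷ qs) = cong (λ e → 0ℤ ℤ.+ e) (zeros qs)
  orthogonal (w ∷ ws) (u ∷ us) n o = trans (sumℤ-cong qs (λ q → spread (w q) u (combine ws us q)))
    (trans (sumℤ-comb qs (u ℤ.* u) (λ q → w q ℤ.* w q) 1ℤ (λ q → pos 2 ℤ.* u ℤ.* (w q ℤ.* combine ws us q) ℤ.+ 1ℤ ℤ.* sq (combine ws us q)))
      (trans (cong₂ (λ a b → u ℤ.* u ℤ.* a ℤ.+ 1ℤ ℤ.* b) (n zero)
        (trans (sumℤ-comb qs (pos 2 ℤ.* u) (λ q → w q ℤ.* combine ws us q) 1ℤ (λ q → sq (combine ws us q)))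
          (cong₂ (λ a b → pos 2 ℤ.* u ℤ.* a ℤ.+ 1ℤ ℤ.* b) (inner-combine w ws us (λ i → o zero (suc i) λ ()))
            (orthogonal ws us (n ∘ suc) (λ i j i≢j → o (suc i) (suc j) (i≢j ∘ Finₚ.suc-injective)))))) (collect u (norm us))))
    where
    spread : ∀ w u c → (w ℤ.* u ℤ.+ c) ℤ.* (w ℤ.* u ℤ.+ c) ≡ u ℤ.* u ℤ.* (w ℤ.* w) ℤ.+ 1ℤ ℤ.* (pos 2 ℤ.* u ℤ.* (w ℤ.* c) ℤ.+ 1ℤ ℤ.* (c ℤ.* c))
    spread = ℤ-Solver.solve-∀
    collect : ∀ u n → u ℤ.* u ℤ.* pos 13 ℤ.+ 1ℤ ℤ.* (pos 2 ℤ.* u ℤ.* 0ℤ ℤ.+ 1ℤ ℤ.* (pos 13 ℤ.* n)) ≡ pos 13 ℤ.* (u ℤ.* u ℤ.+ n)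
    collect = ℤ-Solver.solve-∀

  -- The columns of the matrix serve as linear forms: at u their squares add up to the norm of Σ uᵢ
  -- wᵢ, which is 13 ‖u‖² because the rows wᵢ are orthogonal.
  no-odd-orthogonal : ∀ m → length qs ≡ suc (m * 2) → (ws : Vec (A → ℤ) (suc (m * 2))) →
                      (∀ i → inner (lookup ws i) (lookup ws i) ≡ pos 13) → (∀ i j → i ≢ j → inner (lookup ws i) (lookup ws j) ≡ 0ℤ) → ⊥
  no-odd-orthogonal m l (w ∷ ws) n o = no-odd-weighing m (map form qs) (trans (Listₚ.length-map form qs) l) λ us t →
    trans (sumℤ-map form qs _) (trans (sumℤ-cong qs (λ q → cong sq (flip-+ (w q) t (combine ws us q))))
      (trans (orthogonal (w ∷ ws) (t ∷ us) n o) (cong (λ e → pos 13 ℤ.* e) (ℤₚ.+-comm (t ℤ.* t) (norm us)))))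
    where
    form : A → Form (m * 2)
    form q = Vec.map (λ w → w q) ws , w q
    flip-+ : ∀ w t c → c ℤ.+ w ℤ.* t ≡ w ℤ.* t ℤ.+ c
    flip-+ = ℤ-Solver.solve-∀

-- Involutions

enumerate : ∀ {v} n {P : Fin v → Set} (P? : Decidable P) → # P? ≡ n →
            ∃ λ (g : Fin n → Fin v) → (∀ i → P (g i)) × (∀ i j → g i ≡ g j → i ≡ j)
enumerate zero    P? e = (λ ()) , (λ ()) , λ ()
enumerate (suc n) {P} P? e = build (#-witness P? (subst (1 ≤_) (sym e) (s≤s z≤n)))
  where
  build : ∃ P → _
  build (x , px) = extend (enumerate n (λ y → P? y ×-dec ¬? (y Finₚ.≟ x)) (suc-injective (trans (sym (#-remove P? x px)) e)))
    where
    extend : (∃ λ g → (∀ i → P (g i) × ¬ (g i ≡ x)) × (∀ i j → g i ≡ g j → i ≡ j)) → _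
    extend (g , pg , inj) = h , ph , hinj
      where
      h : Fin (suc n) → Fin _
      h zero    = x
      h (suc i) = g i
      ph : ∀ i → P (h i)
      ph zero    = px
      ph (suc i) = proj₁ (pg i)
      hinj : ∀ i j → h i ≡ h j → i ≡ j
      hinj zero    zero    _ = refl
      hinj zero    (suc j) e = contradiction (sym e) (proj₂ (pg j))
      hinj (suc i) zero    e = contradiction e (proj₂ (pg i))
      hinj (suc i) (suc j) e = cong suc (inj i j e)

module _ {v} {P : Fin v → Set} (P? : Decidable P) where

  ∑On : (Fin v → ℕ) → ℕ
  ∑On g = ∑ (λ x → ι (P? x) * g x)

  ∑On-mono : ∀ {g h} → (∀ {x} → P x → g x ≤ h x) → ∑On g ≤ ∑On h
  ∑On-mono {g} {h} le = ∑-mono at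
    where
    at : ∀ x → ι (P? x) * g x ≤ ι (P? x) * h x
    at x with P? x
    ... | yes p = +-mono-≤ (le p) ≤-refl
    ... | no _  = ≤-refl

  ∑On-cong : ∀ {g h} → (∀ {x} → P x → g x ≡ h x) → ∑On g ≡ ∑On h
  ∑On-cong e = ≤-antisym (∑On-mono (λ p → ≡⇒≤ (e p))) (∑On-mono (λ p → ≡⇒≥ (e p)))

  ∑On-+ : ∀ g h → ∑On (λ x → g x + h x) ≡ ∑On g + ∑On h
  ∑On-+ g h = trans (∑-cong (λ x → *-distribˡ-+ (ι (P? x)) (g x) (h x))) (∑-+ _ _)

  ∑On-*ˡ : ∀ c g → ∑On (λ x → c * g x) ≡ c * ∑On g
  ∑On-*ˡ c g = trans (∑-cong (λ x → swap (ι (P? x)) c (g x))) (∑-*ˡ c _)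
    where
    swap : ∀ a b c → a * (b * c) ≡ b * (a * c)
    swap = solve-∀

  ∑On-const : ∀ c → ∑On (λ _ → c) ≡ c * # P?
  ∑On-const c = trans (∑-cong (λ x → *-comm (ι (P? x)) c)) (∑-*ˡ c (λ x → ι (P? x)))

  term≤∑On : ∀ g {x} → P x → g x ≤ ∑On g
  term≤∑On g {x} p = ≤-trans (≡⇒≥ (trans (cong (_* g x) (ι-yes (P? x) p)) (*-identityˡ (g x)))) (term≤∑ (λ x → ι (P? x) * g x) x)

∑-partition : ∀ {v} {P : Fin v → Set} (P? : Decidable P) (g : Fin v → ℕ) → ∑ g ≡ ∑On P? g + ∑On (λ x → ¬? (P? x)) g
∑-partition P? g = trans (∑-cong at) (∑-+ _ _)
  where
  at : ∀ x → g x ≡ ι (P? x) * g x + ι (¬? (P? x)) * g x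
  at x with P? x
  ... | yes _ = sym (trans (+-identityʳ _) (*-identityˡ (g x)))
  ... | no _  = sym (*-identityˡ (g x))

#-complement : ∀ {v} {P : Fin v → Set} (P? : Decidable P) → v ≡ # P? + # (λ x → ¬? (P? x))
#-complement {v} P? = trans (sym (trans (∑-const v 1) (*-identityʳ v))) (trans (∑-partition P? (λ _ → 1))
  (cong₂ _+_ (trans (∑On-const P? 1) (*-identityˡ _)) (trans (∑On-const (λ x → ¬? (P? x)) 1) (*-identityˡ _))))

module Halving {v} (τ : Fin v → Fin v) (τ² : ∀ x → τ (τ x) ≡ x) where

  fix? : Decidable (λ x → τ x ≡ x)
  fix? x = τ x Finₚ.≟ x

  lower? : Decidable (λ x → x Fin.< τ x)
  lower? x = x Finₚ.<? τ x

  τ-inj : Injective _≡_ _≡_ τ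
  τ-inj {x} {y} e = trans (sym (τ² x)) (trans (cong τ e) (τ² y))

  halve : ∀ g → (∀ x → g (τ x) ≡ g x) → ∑ g ≡ ∑On fix? g + ∑On lower? g * 2
  halve g inv = trans (∑-cong tri) (trans (∑-+ _ _) (cong (∑On fix? g +_) (trans (∑-+ _ _)
    (trans (cong (∑On lower? g +_) upper) (double (∑On lower? g))))))
    where
    double : ∀ m → m + m ≡ m * 2
    double = solve-∀
    upper? : Decidable (λ x → τ x Fin.< x)
    upper? x = τ x Finₚ.<? x
    upper : ∑ (λ x → ι (upper? x) * g x) ≡ ∑On lower? g
    upper = trans (∑-cong (λ x → cong₂ _*_ (ι-cong (upper? x) (lower? (τ x)) (subst (τ x Fin.<_) (sym (τ² x))) (subst (τ x Fin.<_) (τ² x))) (sym (inv x))))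
      (∑-reindex τ τ-inj (λ x → ι (lower? x) * g x))
    tri : ∀ x → g x ≡ ι (fix? x) * g x + (ι (lower? x) * g x + ι (upper? x) * g x)
    tri x = trans (sym (*-identityˡ (g x))) (trans (cong (_* g x) one) (dist (ι (fix? x)) (ι (lower? x)) (ι (upper? x)) (g x)))
      where
      dist : ∀ a b c g → (a + (b + c)) * g ≡ a * g + (b * g + c * g)
      dist = solve-∀
      one : 1 ≡ ι (fix? x) + (ι (lower? x) + ι (upper? x))
      one = [ at-lower , [ at-fixed , at-upper ]′ ]′ (cmp (Finₚ.<-cmp x (τ x)))
        where
        cmp : _ → x Fin.< τ x ⊎ (τ x ≡ x ⊎ τ x Fin.< x)
        cmp (tri< l _ _) = inj₁ l
        cmp (tri≈ _ e _) = inj₂ (inj₁ (sym e))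
        cmp (tri> _ _ u) = inj₂ (inj₂ u)
        combine′ : ∀ {a b c} → ι (fix? x) ≡ a → ι (lower? x) ≡ b → ι (upper? x) ≡ c → a + (b + c) ≡ 1 → 1 ≡ ι (fix? x) + (ι (lower? x) + ι (upper? x))
        combine′ refl refl refl e = sym e
        at-lower : x Fin.< τ x → _
        at-lower l = combine′ (ι-no (fix? x) (λ e → Finₚ.<⇒≢ l (sym e))) (ι-yes (lower? x) l) (ι-no (upper? x) (λ u → Finₚ.<-asym l u)) refl
        at-fixed : τ x ≡ x → _
        at-fixed e = combine′ (ι-yes (fix? x) e) (ι-no (lower? x) (λ l → Finₚ.<⇒≢ l (sym e))) (ι-no (upper? x) (λ u → Finₚ.<⇒≢ u e)) refl
        at-upper : τ x Fin.< x → _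
        at-upper u = combine′ (ι-no (fix? x) (λ e → Finₚ.<⇒≢ u e)) (ι-no (lower? x) (λ l → Finₚ.<-asym l u)) (ι-yes (upper? x) u) refl

opaque
  unfolding ∑

  sumℤ-filter : ∀ {v} {P : Fin v → Set} (P? : Decidable P) {n} (g : Fin n → Fin v) (a b : Fin v → ℕ) →
                sumℤ (filter P? (List.tabulate g)) (λ q → pos (a q) ℤ.- pos (b q))
                ≡ pos (∑ (λ i → ι (P? (g i)) * a (g i))) ℤ.- pos (∑ (λ i → ι (P? (g i)) * b (g i)))
  sumℤ-filter P? {zero}  g a b = refl
  sumℤ-filter P? {suc n} g a b with P? (g zero)
  ... | no _  = sumℤ-filter P? (g ∘ suc) a b
  ... | yes _ = trans (cong (λ e → (pos (a (g zero)) ℤ.- pos (b (g zero))) ℤ.+ e) (sumℤ-filter P? (g ∘ suc) a b))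
        (trans (shuffle (pos (a (g zero))) (pos (b (g zero))) (pos A) (pos B))
          (cong₂ ℤ._-_ (trans (sym (ℤₚ.pos-+ (a (g zero)) A)) (cong (λ z → pos (z + A)) (sym (*-identityˡ (a (g zero))))))
                       (trans (sym (ℤₚ.pos-+ (b (g zero)) B)) (cong (λ z → pos (z + B)) (sym (*-identityˡ (b (g zero))))))))
    where
    A B : ℕ
    A = ∑ (λ i → ι (P? (g (suc i))) * a (g (suc i)))
    B = ∑ (λ i → ι (P? (g (suc i))) * b (g (suc i)))
    shuffle : ∀ p q r s → (p ℤ.- q) ℤ.+ (r ℤ.- s) ≡ (p ℤ.+ r) ℤ.- (q ℤ.+ s)
    shuffle = ℤ-Solver.solve-∀

record Involution {v} (D : Design v) : Set where
  field
    symmetry : Symmetry D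
  open Symmetry symmetry public
  field
    pt² : ∀ x → pt (pt x) ≡ x
    bl² : ∀ j → bl (bl j) ≡ j

-- The signed incidence matrix on the moved orbits of an involution has orthogonal columns of norm 13,
-- so its size is even.
module Weighing {v} {D : Design v} (e : Involution D) where
  open Counting D
  open Involution e
  module HP = Halving pt pt²
  module HB = Halving bl bl²

  ε : Fin v → Fin v → ℕ
  ε p q = ι (inc? p q)

  ε-pt : ∀ p q → ε p (bl q) ≡ ε (pt p) q
  ε-pt p q = ι-cong (inc? p (bl q)) (inc? (pt p) q) (λ i → subst (Inc _) (bl² q) (inc⁺ i)) (λ i → subst (λ z → Inc z (bl q)) (pt² p) (inc⁺ i))

  ε-bl : ∀ p q → ε (pt p) (bl q) ≡ ε p q
  ε-bl p q = ι-cong (inc? (pt p) (bl q)) (inc? p q) inc⁻ inc⁺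

  w : Fin v → Fin v → ℤ
  w p q = pos (ε p q) ℤ.- pos (ε (pt p) q)

  -- The positive and the negative terms of the product of two entries of `w`, kept apart so that
  -- each can be counted in ℕ.
  agree differ : Fin v → Fin v → Fin v → ℕ
  agree  p p′ q = ε p q * ε p′ q + ε (pt p) q * ε (pt p′) q
  differ p p′ q = ε p q * ε (pt p′) q + ε (pt p) q * ε p′ q

  w-product : ∀ p p′ q → w p q ℤ.* w p′ q ≡ pos (agree p p′ q) ℤ.- pos (differ p p′ q)
  w-product p p′ q = trans (expand (pos (ε p q)) (pos (ε (pt p) q)) (pos (ε p′ q)) (pos (ε (pt p′) q))) (cong₂ ℤ._-_ (fold (ε p q) (ε p′ q) (ε (pt p) q) (ε (pt p′) q)) (fold (ε p q) (ε (pt p′) q) (ε (pt p) q) (ε p′ q)))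
    where
    expand : ∀ a b c d → (a ℤ.- b) ℤ.* (c ℤ.- d) ≡ (a ℤ.* c ℤ.+ b ℤ.* d) ℤ.- (a ℤ.* d ℤ.+ b ℤ.* c)
    expand = ℤ-Solver.solve-∀
    fold : ∀ a b c d → pos a ℤ.* pos b ℤ.+ pos c ℤ.* pos d ≡ pos (a * b + c * d)
    fold a b c d = trans (cong₂ ℤ._+_ (sym (ℤₚ.pos-* a b)) (sym (ℤₚ.pos-* c d))) (sym (ℤₚ.pos-+ (a * b) (c * d)))

  reps : List (Fin v)
  reps = filter HB.lower? (allFin v)

  inner-w : ∀ p p′ → inner reps (w p) (w p′) ≡ pos (∑On HB.lower? (agree p p′)) ℤ.- pos (∑On HB.lower? (differ p p′))
  inner-w p p′ = trans (sumℤ-cong reps (w-product p p′)) (sumℤ-filter HB.lower? id (agree p p′) (differ p p′))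

  join-size : ∀ x y → ∑ (λ q → ε x q * ε y q) ≡ 3 + 13 * ι (x Finₚ.≟ y)
  join-size x y = trans (∑-cong (λ q → sym (ι-× (inc? x q) (inc? y q)))) (Counting.meet-size (dual D) x y)

  -- On a fixed block the entries of `w` vanish, since it contains p exactly when it contains
  -- `pt p`.
  fixed-part : ∀ p p′ → ∑On HB.fix? (agree p p′) ≡ ∑On HB.fix? (differ p p′)
  fixed-part p p′ = ∑On-cong HB.fix? at
    where
    same : ∀ p {q} → bl q ≡ q → ε p q ≡ ε (pt p) q
    same p {q} fq = trans (cong (ε p) (sym fq)) (ε-pt p q)
    at : ∀ {q} → bl q ≡ q → agree p p′ q ≡ differ p p′ q
    at {q} fq = cong₂ _+_ (cong (ε p q *_) (same p′ fq)) (cong (ε (pt p) q *_) (sym (same p′ fq)))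

  agree-sum : ∀ p p′ → ∑On HB.fix? (differ p p′) + ∑On HB.lower? (agree p p′) * 2 ≡ (3 + 13 * ι (p Finₚ.≟ p′)) + (3 + 13 * ι (pt p Finₚ.≟ pt p′))
  agree-sum p p′ = trans (cong (_+ ∑On HB.lower? (agree p p′) * 2) (sym (fixed-part p p′))) (trans (sym (HB.halve (agree p p′) inv)) (trans (∑-+ _ _) (cong₂ _+_ (join-size p p′) (join-size (pt p) (pt p′)))))
    where
    inv : ∀ q → agree p p′ (bl q) ≡ agree p p′ q
    inv q = trans (cong₂ _+_ (cong₂ _*_ (ε-pt p q) (ε-pt p′ q)) (cong₂ _*_ (ε-bl p q) (ε-bl p′ q))) (+-comm (ε (pt p) q * ε (pt p′) q) _)

  differ-sum : ∀ p p′ → ∑On HB.fix? (differ p p′) + ∑On HB.lower? (differ p p′) * 2 ≡ (3 + 13 * ι (p Finₚ.≟ pt p′)) + (3 + 13 * ι (pt p Finₚ.≟ p′))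
  differ-sum p p′ = trans (sym (HB.halve (differ p p′) inv)) (trans (∑-+ _ _) (cong₂ _+_ (join-size p (pt p′)) (join-size (pt p) p′)))
    where
    inv : ∀ q → differ p p′ (bl q) ≡ differ p p′ q
    inv q = trans (cong₂ _+_ (cong₂ _*_ (ε-pt p q) (ε-bl p′ q)) (cong₂ _*_ (ε-bl p q) (ε-pt p′ q))) (+-comm (ε (pt p) q * ε p′ q) _)

  module _ {p p′} (lp : p Fin.< pt p) (lp′ : p′ Fin.< pt p′) where

    crossed : p ≢ pt p′ × pt p ≢ p′
    crossed = (λ { refl → Finₚ.<-asym lp′ (subst (pt p′ Fin.<_) (pt² p′) lp) }) , (λ { refl → Finₚ.<-asym lp (subst (pt p Fin.<_) (pt² p) lp′) })

    differ≡6 : ∑On HB.fix? (differ p p′) + ∑On HB.lower? (differ p p′) * 2 ≡ 6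
    differ≡6 = trans (differ-sum p p′) (cong₂ (λ a b → (3 + 13 * a) + (3 + 13 * b)) (ι-no (p Finₚ.≟ pt p′) (proj₁ crossed)) (ι-no (pt p Finₚ.≟ p′) (proj₂ crossed)))

  -- Over all blocks `agree` sums to 16 + 16 and `differ` to 3 + 3. The fixed blocks contribute
  -- equally to both, and the representatives carry half of the difference 26.
  norm-13 : ∀ {p} → p Fin.< pt p → inner reps (w p) (w p) ≡ pos 13
  norm-13 {p} lp = trans (inner-w p p) (trans (cong (λ z → pos z ℤ.- pos (∑On HB.lower? (differ p p))) excess) (trans (cong (λ z → z ℤ.- pos (∑On HB.lower? (differ p p))) (ℤₚ.pos-+ 13 _)) (cancel (pos 13) (pos (∑On HB.lower? (differ p p))))))
    where
    cancel : ∀ a b → a ℤ.+ b ℤ.- b ≡ a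
    cancel = ℤ-Solver.solve-∀
    agree≡32 : ∑On HB.fix? (differ p p) + ∑On HB.lower? (agree p p) * 2 ≡ 32
    agree≡32 = trans (agree-sum p p) (cong₂ (λ a b → (3 + 13 * a) + (3 + 13 * b)) (ι-yes (p Finₚ.≟ p) refl) (ι-yes (pt p Finₚ.≟ pt p) refl))
    excess : ∑On HB.lower? (agree p p) ≡ 13 + ∑On HB.lower? (differ p p)
    excess = half (∑On HB.fix? (differ p p)) (∑On HB.lower? (agree p p)) (∑On HB.lower? (differ p p)) agree≡32 (differ≡6 lp lp)
      where
      half : ∀ F a d → F + a * 2 ≡ 32 → F + d * 2 ≡ 6 → a ≡ 13 + d
      half F a d e₁ e₂ = *-cancelʳ-≡ a (13 + d) 2 (+-cancelˡ-≡ F _ _ (trans e₁ (trans (cong (λ z → 26 + z) (sym e₂)) (move F d))))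
        where
        move : ∀ F d → 26 + (F + d * 2) ≡ F + (13 + d) * 2
        move = solve-∀

  orthogonal-0 : ∀ {p p′} → p Fin.< pt p → p′ Fin.< pt p′ → p ≢ p′ → inner reps (w p) (w p′) ≡ 0ℤ
  orthogonal-0 {p} {p′} lp lp′ ne = trans (inner-w p p′) (trans (cong (λ z → pos z ℤ.- pos (∑On HB.lower? (differ p p′))) equal) (ℤₚ.+-inverseʳ (pos (∑On HB.lower? (differ p p′)))))
    where
    agree≡6 : ∑On HB.fix? (differ p p′) + ∑On HB.lower? (agree p p′) * 2 ≡ 6
    agree≡6 = trans (agree-sum p p′) (cong₂ (λ a b → (3 + 13 * a) + (3 + 13 * b)) (ι-no (p Finₚ.≟ p′) ne) (ι-no (pt p Finₚ.≟ pt p′) (ne ∘ pt-inj)))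
    equal : ∑On HB.lower? (agree p p′) ≡ ∑On HB.lower? (differ p p′)
    equal = *-cancelʳ-≡ (∑On HB.lower? (agree p p′)) (∑On HB.lower? (differ p p′)) 2 (+-cancelˡ-≡ (∑On HB.fix? (differ p p′)) _ _ (trans agree≡6 (sym (differ≡6 lp lp′))))

  moved-pairs : v ≡ # fixpt? + # HP.lower? * 2
  moved-pairs = trans (sym (trans (∑-const v 1) (*-identityʳ v))) (trans (HP.halve (λ _ → 1) (λ _ → refl))
    (cong₂ (λ a b → a + b * 2) (trans (∑On-const HP.fix? 1) (*-identityˡ _)) (trans (∑On-const HP.lower? 1) (*-identityˡ _))))

  moved-blocks : v ≡ # fixbl? + # HB.lower? * 2
  moved-blocks = trans (sym (trans (∑-const v 1) (*-identityʳ v))) (trans (HB.halve (λ _ → 1) (λ _ → refl))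
    (cong₂ (λ a b → a + b * 2) (trans (∑On-const HB.fix? 1) (*-identityˡ _)) (trans (∑On-const HB.lower? 1) (*-identityˡ _))))

  not-odd : ∀ m → # HP.lower? ≢ suc (m * 2)
  not-odd m odd = build (enumerate (suc (m * 2)) HP.lower? odd)
    where
    length-reps : length reps ≡ suc (m * 2)
    length-reps = trans (#-length HB.lower?) (trans (*-cancelʳ-≡ _ _ 2 (+-cancelˡ-≡ (# fixbl?) _ _ (trans (sym moved-blocks)
      (trans moved-pairs (cong (_+ # HP.lower? * 2) (fixed-points≡fixed-blocks symmetry)))))) odd)
    build : (∃ λ (g : Fin (suc (m * 2)) → Fin v) → (∀ i → g i Fin.< pt (g i)) × (∀ i j → g i ≡ g j → i ≡ j)) → ⊥
    build (g , lower , inj) = no-odd-orthogonal reps m length-reps (tabulate (w ∘ g))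
      (λ i → trans (cong (λ c → inner reps c c) (Vecₚ.lookup∘tabulate (w ∘ g) i)) (norm-13 (lower i)))
      (λ i j i≢j → trans (cong₂ (inner reps) (Vecₚ.lookup∘tabulate (w ∘ g) i) (Vecₚ.lookup∘tabulate (w ∘ g) j)) (orthogonal-0 (lower i) (lower j) (i≢j ∘ inj i j)))

  fixed-mod-4 : ∃ λ m → v ≡ # fixpt? + 4 * m
  fixed-mod-4 = split (parity (# HP.lower?))
    where
    parity : ∀ n → ∃ λ m → n ≡ m * 2 ⊎ n ≡ suc (m * 2)
    parity zero = 0 , inj₁ refl
    parity (suc n) = next (parity n)
      where
      next : (∃ λ m → n ≡ m * 2 ⊎ n ≡ suc (m * 2)) → ∃ λ m → suc n ≡ m * 2 ⊎ suc n ≡ suc (m * 2)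
      next (m , inj₁ e) = m , inj₂ (cong suc e)
      next (m , inj₂ e) = suc m , inj₁ (cong suc e)
    split : (∃ λ m → # HP.lower? ≡ m * 2 ⊎ # HP.lower? ≡ suc (m * 2)) → ∃ λ m → v ≡ # fixpt? + 4 * m
    split (m , inj₁ e) = m , trans moved-pairs (cong (# fixpt? +_) (trans (cong (_* 2) e) (quad m)))
      where
      quad : ∀ m → m * 2 * 2 ≡ 4 * m
      quad = solve-∀
    split (m , inj₂ e) = contradiction e (not-odd m)

-- Write s for the number of fixed blocks through a point. Moved points have s = 1 or 3, that is s² + 3 = 4 s.
module InvolutionFixed {v} (v≡81 : v ≡ 81) {D : Design v} (e : Involution D) (moved : ∃ λ x → Involution.pt e x ≢ x) where
  open Counting D
  open Involution e

  f : ℕ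
  f = # fixpt?

  moved? : Decidable (λ x → ¬ (pt x ≡ x))
  moved? x = ¬? (fixpt? x)

  s : Fin v → ℕ
  s = deg fixbl?

  private
    fb : # fixbl? ≡ f
    fb = sym (fixed-points≡fixed-blocks symmetry)

    S₀ S₁ Q₀ Q₁ : ℕ
    S₀ = ∑On fixpt? s
    S₁ = ∑On moved? s
    Q₀ = ∑On fixpt? (λ x → s x * s x)
    Q₁ = ∑On moved? (λ x → s x * s x)

    S-sum : S₀ + S₁ ≡ 16 * f
    S-sum = trans (sym (∑-partition fixpt? s)) (trans (∑-deg fixbl?) (cong (16 *_) fb))

    Q-sum : Q₀ + Q₁ ≡ 3 * (f * f) + 13 * f
    Q-sum = trans (sym (∑-partition fixpt? (λ x → s x * s x))) (trans (∑-deg² fixbl?) (cong (λ n → 3 * (n * n) + 13 * n) fb))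

    moved-count : f + # moved? ≡ 81
    moved-count = trans (sym (#-complement fixpt?)) v≡81

    -- A fixed block through x also contains `pt x`, and the involution permutes the 3 blocks
    -- joining these two points.
    one-or-three : ∀ {x} → pt x ≢ x → s x ≡ 1 ⊎ s x ≡ 3
    one-or-three {x} ne = odd (involution-mod2 (join? x (pt x)) bl swap (λ {j} _ → bl² j))
      where
      swap : ∀ {j} → Inc x j × Inc (pt x) j → Inc x (bl j) × Inc (pt x) (bl j)
      swap (i , i′) = subst (λ z → Inc z _) (pt² x) (inc⁺ i′) , inc⁺ i
      s≡ : s x ≡ # (λ j → join? x (pt x) j ×-dec fixbl? j)
      s≡ = #-cong (λ j → fixbl? j ×-dec inc? x j) (λ j → join? x (pt x) j ×-dec fixbl? j) (λ (fj , i) → (i , subst (Inc _) fj (inc⁺ i)) , fj) (λ ((i , _) , fj) → fj , i)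
      odd : # (join? x (pt x)) ≡ # (λ j → join? x (pt x) j ×-dec fixbl? j) mod-via 2 → s x ≡ 1 ⊎ s x ≡ 3
      odd m = toWitness {a? = ℕₚ.allUpTo? (λ k → 3 % 2 ℕₚ.≟ k % 2 →-dec (k ℕₚ.≟ 1 ⊎-dec k ℕₚ.≟ 3)) 4} tt
        (s≤s (subst (s x ≤_) (pt-pair ne) (subst (_≤ # (join? x (pt x))) (sym s≡) (#-mono _ (join? x (pt x)) proj₁))))
        (mod⇒% 2 (proj₁ m , trans (sym (pt-pair ne)) (trans (proj₂ m) (cong (_+ proj₁ m * 2) (sym s≡)))))

    Q₁-eq : Q₁ + 3 * # moved? ≡ 4 * S₁
    Q₁-eq = trans (cong (Q₁ +_) (sym (∑On-const moved? 3))) (trans (sym (∑On-+ moved? _ _)) (trans (∑On-cong moved? (λ ne → at (one-or-three ne))) (∑On-*ˡ moved? 4 s)))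
      where
      at : ∀ {k} → k ≡ 1 ⊎ k ≡ 3 → k * k + 3 ≡ 4 * k
      at (inj₁ refl) = refl
      at (inj₂ refl) = refl

    S₁≤ : S₁ ≤ 3 * # moved?
    S₁≤ = ≤-trans (∑On-mono moved? (λ ne → at (one-or-three ne))) (≡⇒≤ (∑On-const moved? 3))
      where
      at : ∀ {k} → k ≡ 1 ⊎ k ≡ 3 → k ≤ 3
      at (inj₁ refl) = s≤s z≤n
      at (inj₂ refl) = ≤-refl

    S₁≥ : # moved? ≤ S₁
    S₁≥ = ≤-trans (≡⇒≤ (sym (trans (∑On-const moved? 1) (*-identityˡ _)))) (∑On-mono moved? (λ ne → at (one-or-three ne)))
      where
      at : ∀ {k} → k ≡ 1 ⊎ k ≡ 3 → 1 ≤ k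
      at (inj₁ refl) = ≤-refl
      at (inj₂ refl) = s≤s z≤n

    square-≥ : ∀ t k → 2 * t * k ≤ k * k + t * t
    square-≥ t k = [ (λ le → go t k le) , (λ le → subst₂ _≤_ (flip₁ k t) (+-comm (t * t) (k * k)) (go k t le)) ]′ (≤-total t k)
      where
      flip₁ : ∀ k t → 2 * k * t ≡ 2 * t * k
      flip₁ = solve-∀
      expand : ∀ t d → (t + d) * (t + d) + t * t ≡ 2 * t * (t + d) + d * d
      expand = solve-∀
      go : ∀ t k → t ≤ k → 2 * t * k ≤ k * k + t * t
      go t k le = subst (λ k → 2 * t * k ≤ k * k + t * t) (m+[n∸m]≡n le) (subst (2 * t * (t + (k ∸ t)) ≤_) (sym (expand t (k ∸ t))) (m≤m+n _ _))

    variance : ∀ t → 2 * t * S₀ ≤ Q₀ + t * t * f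
    variance t = subst₂ _≤_ (∑On-*ˡ fixpt? (2 * t) s) (trans (∑On-+ fixpt? _ _) (cong (Q₀ +_) (∑On-const fixpt? (t * t)))) (∑On-mono fixpt? (λ {x} _ → square-≥ t (s x)))

    -- `variance` for t = 16 and t = 7, with S₁ ≤ 3 m. The first inequality fails for 29 < f < 81
    -- and the second for 20 ≤ f ≤ 45, so only f ≤ 19 and f = 81 survive.
    F²≥ : 330 * f ≤ 3 * (f * f) + 7047 × 195 * f ≤ 3 * (f * f) + 2673
    F²≥ = ≮⇒≥ (λ lt → absurd {ρ = f ∷ f * f ∷ S₀ ∷ S₁ ∷ Q₀ ∷ Q₁ ∷ # moved? ∷ []}
            (hyp 1 (con 1 :+ (3 :* v1 :+ con 7047)) (330 :* v0) lt ∷ hyp 1 (32 :* v2) (v4 :+ 256 :* v0) (variance 16) ∷ common 32 28))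
        , ≮⇒≥ (λ lt → absurd {ρ = f ∷ f * f ∷ S₀ ∷ S₁ ∷ Q₀ ∷ Q₁ ∷ # moved? ∷ []}
            (hyp 1 (con 1 :+ (3 :* v1 :+ con 2673)) (195 :* v0) lt ∷ hyp 1 (14 :* v2) (v4 :+ 49 :* v0) (variance 7) ∷ common 14 10))
      where
      v6 : ∀ {n} → Lin (7 + n)
      v6 = var (suc (suc (suc (suc (suc (suc zero))))))
      common : ℕ → ℕ → List (Hyp (f ∷ f * f ∷ S₀ ∷ S₁ ∷ Q₀ ∷ Q₁ ∷ # moved? ∷ []))
      common c d = hyp c (16 :* v0) (v2 :+ v3) (≡⇒≥ S-sum) ∷ hyp 1 (v4 :+ v5) (3 :* v1 :+ 13 :* v0) (≡⇒≤ Q-sum)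
        ∷ hyp 1 (4 :* v3) (v5 :+ 3 :* v6) (≡⇒≥ Q₁-eq) ∷ hyp d v3 (3 :* v6) S₁≤ ∷ hyp (3 * d + 3) (v0 :+ v6) (con 81) (≡⇒≤ moved-count) ∷ []

    -- Σ s = 16 is too small for 80 moved points with s ≥ 1.
    not-1 : f ≢ 1
    not-1 f≡1 = absurd {ρ = f ∷ S₀ ∷ S₁ ∷ # moved? ∷ []}
      (hyp 17 v0 (con 1) (≡⇒≤ f≡1) ∷ hyp 1 (v1 :+ v2) (16 :* v0) (≡⇒≤ S-sum) ∷ hyp 1 v3 v2 S₁≥ ∷ hyp 1 (con 81) (v0 :+ v3) (≡⇒≥ moved-count) ∷ [])

    S₀≤4 : f ≡ 5 → S₀ ≤ 4
    S₀≤4 f≡5 = ≮⇒≥ λ lt → absurd {ρ = f ∷ S₀ ∷ S₁ ∷ # moved? ∷ []}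
      (hyp 17 v0 (con 5) (≡⇒≤ f≡5) ∷ hyp 1 (v1 :+ v2) (16 :* v0) (≡⇒≤ S-sum) ∷ hyp 1 v3 v2 S₁≥ ∷ hyp 1 (con 81) (v0 :+ v3) (≡⇒≥ moved-count) ∷ hyp 1 (con 5) v1 lt ∷ [])

    -- The 76 moved points take all but 4 of Σ s = 80, so s ≤ 4 at fixed points and Q₀ ≤ 4 S₀. Then
    -- Σ s² ≤ 4 · 80 - 3 · 76 = 92, whereas it equals 140.
    not-5 : f ≢ 5
    not-5 f≡5 = absurd {ρ = f ∷ S₀ ∷ S₁ ∷ Q₀ ∷ Q₁ ∷ # moved? ∷ []}
      (hyp 64 v0 (con 5) (≡⇒≤ f≡5) ∷ hyp 1 (con 140) (v3 :+ v4) (≤-trans (≡⇒≥ (cong (λ n → 3 * (n * n) + 13 * n) f≡5)) (≡⇒≥ Q-sum)) ∷ hyp 1 v3 (4 :* v1) Q₀≤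
        ∷ hyp 1 (v4 :+ 3 :* v5) (4 :* v2) (≡⇒≤ Q₁-eq) ∷ hyp 4 (v1 :+ v2) (16 :* v0) (≡⇒≤ S-sum) ∷ hyp 3 (con 81) (v0 :+ v5) (≡⇒≥ moved-count) ∷ hyp 3 v0 (con 5) (≡⇒≤ f≡5) ∷ [])
      where
      Q₀≤ : Q₀ ≤ 4 * S₀
      Q₀≤ = ≤-trans (∑On-mono fixpt? (λ {x} fx → *-monoˡ-≤ (s x) (≤-trans (term≤∑On fixpt? s fx) (S₀≤4 f≡5)))) (≡⇒≤ (∑On-*ˡ fixpt? 4 s))

  f≢81 : f ≢ 81
  f≢81 e = proj₂ moved (#-full⇒ fixpt? (trans e (sym v≡81)) (proj₁ moved))

  fixed-count : f ≡ 9 ⊎ f ≡ 13 ⊎ f ≡ 17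
  fixed-count = pick (Weighing.fixed-mod-4 e)
    where
    pick : (∃ λ m → v ≡ f + 4 * m) → f ≡ 9 ⊎ f ≡ 13 ⊎ f ≡ 17
    pick (m , eq) = toWitness {a? = ℕₚ.allUpTo? (λ n → 81 % 4 ℕₚ.≟ n % 4 →-dec 330 * n ≤? 3 * (n * n) + 7047 →-dec 195 * n ≤? 3 * (n * n) + 2673
        →-dec ¬? (n ℕₚ.≟ 81) →-dec ¬? (n ℕₚ.≟ 1) →-dec ¬? (n ℕₚ.≟ 5) →-dec (n ℕₚ.≟ 9 ⊎-dec n ℕₚ.≟ 13 ⊎-dec n ℕₚ.≟ 17)) 82} tt
      (s≤s (subst (f ≤_) v≡81 (#≤n fixpt?))) (mod⇒% 4 (m , trans (sym v≡81) (trans eq (cong (f +_) (*-comm 4 m))))) (proj₁ F²≥) (proj₂ F²≥) f≢81 not-1 not-5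

-- Elementary abelian 2-groups

infixl 6 _⊕_

_⊕_ : ∀ {n} → Vec Bool n → Vec Bool n → Vec Bool n
_⊕_ = zipWith _xor_

𝟎 : ∀ {n} → Vec Bool n
𝟎 {n} = replicate n false

⊕-idˡ : ∀ {n} (u : Vec Bool n) → 𝟎 ⊕ u ≡ u
⊕-idˡ []      = refl
⊕-idˡ (b ∷ u) = cong (b ∷_) (⊕-idˡ u)

⊕-comm : ∀ {n} (u w : Vec Bool n) → u ⊕ w ≡ w ⊕ u
⊕-comm []      []      = refl
⊕-comm (b ∷ u) (c ∷ w) = cong₂ _∷_ (Boolₚ.xor-comm b c) (⊕-comm u w)

⊕-assoc : ∀ {n} (t u w : Vec Bool n) → (t ⊕ u) ⊕ w ≡ t ⊕ (u ⊕ w)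
⊕-assoc []      []      []      = refl
⊕-assoc (a ∷ t) (b ∷ u) (c ∷ w) = cong₂ _∷_ (Boolₚ.xor-assoc a b c) (⊕-assoc t u w)

⊕-self : ∀ {n} (u : Vec Bool n) → u ⊕ u ≡ 𝟎
⊕-self []      = refl
⊕-self (b ∷ u) = cong₂ _∷_ (Boolₚ.xor-same b) (⊕-self u)

⊕-interchange : ∀ {n} (a b c d : Vec Bool n) → (a ⊕ b) ⊕ (c ⊕ d) ≡ (a ⊕ c) ⊕ (b ⊕ d)
⊕-interchange a b c d = trans (⊕-assoc a b (c ⊕ d)) (trans (cong (a ⊕_) (trans (sym (⊕-assoc b c d)) (trans (cong (_⊕ d) (⊕-comm b c)) (⊕-assoc c b d)))) (sym (⊕-assoc a c (b ⊕ d))))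

∀Bool? : ∀ {n} {P : Vec Bool n → Set} → (∀ u → Dec (P u)) → Dec (∀ u → P u)
∀Bool? {zero}  P? = map′ (λ { p [] → p }) (λ h → h []) (P? [])
∀Bool? {suc n} P? = map′ (λ { (p , q) (false ∷ u) → p u ; (p , q) (true ∷ u) → q u }) (λ h → (λ u → h (false ∷ u)) , (λ u → h (true ∷ u)))
  (∀Bool? (λ u → P? (false ∷ u)) ×-dec ∀Bool? (λ u → P? (true ∷ u)))

⟨_,_⟩ : ∀ {n} → Vec Bool n → Vec Bool n → Bool
⟨ []    , []    ⟩ = false
⟨ b ∷ u , c ∷ w ⟩ = (b ∧ c) xor ⟨ u , w ⟩

linear-form : ∀ {n} (φ : Vec Bool n → Bool) → (∀ u w → φ (u ⊕ w) ≡ φ u xor φ w) → ∃ λ k → ∀ u → φ u ≡ ⟨ k , u ⟩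
linear-form {zero}  φ hom = [] , λ { [] → trans (hom [] []) (Boolₚ.xor-same (φ [])) }
linear-form {suc n} φ hom = build (linear-form (λ u → φ (false ∷ u)) (λ u w → hom (false ∷ u) (false ∷ w)))
  where
  build : (∃ λ k → ∀ u → φ (false ∷ u) ≡ ⟨ k , u ⟩) → ∃ λ k → ∀ u → φ u ≡ ⟨ k , u ⟩
  build (k , h) = φ (true ∷ 𝟎) ∷ k , at
    where
    at : ∀ u → φ u ≡ ⟨ φ (true ∷ 𝟎) ∷ k , u ⟩
    at (false ∷ u) = trans (h u) (cong (_xor ⟨ k , u ⟩) (sym (Boolₚ.∧-zeroʳ (φ (true ∷ 𝟎)))))
    at (true ∷ u)  = trans (cong (λ w → φ (true ∷ w)) (sym (⊕-idˡ u))) (trans (hom (true ∷ 𝟎) (false ∷ u))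
      (cong₂ _xor_ (sym (Boolₚ.∧-identityʳ (φ (true ∷ 𝟎)))) (h u)))

-- An elementary abelian group of order 2ⁿ is taken as the vector space F₂ⁿ, so that subgroups of
-- index two are kernels of linear forms.
record PAct (v n : ℕ) : Set where
  field
    act   : Vec Bool n → Fin v → Fin v
    act-⊕ : ∀ u w x → act (u ⊕ w) x ≡ act u (act w x)
    act-𝟎 : ∀ x → act 𝟎 x ≡ x

  act² : ∀ u x → act u (act u x) ≡ x
  act² u x = trans (sym (act-⊕ u u x)) (trans (cong (λ w → act w x) (⊕-self u)) (act-𝟎 x))

  act-comm : ∀ u w x → act u (act w x) ≡ act w (act u x)
  act-comm u w x = trans (sym (act-⊕ u w x)) (trans (cong (λ z → act z x) (⊕-comm u w)) (act-⊕ w u x))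

  act-inj : ∀ u → Injective _≡_ _≡_ (act u)
  act-inj u {x} {y} e = trans (sym (act² u x)) (trans (cong (act u) e) (act² u y))

  Fixed : Fin v → Set
  Fixed x = ∀ u → act u x ≡ x

  fixed? : Decidable Fixed
  fixed? x = ∀Bool? (λ u → act u x Finₚ.≟ x)

  Keeps : Fin v → Fin v → Set
  Keeps x y = ∀ u → (act u x ≡ x × act u y ≡ y) ⊎ (act u x ≡ y × act u y ≡ x)

  not-fixed : ∀ {x} → ¬ Fixed x → ∃ λ u → act u x ≢ x
  not-fixed {x} h = search (λ u → act u x Finₚ.≟ x) h
    where
    search : ∀ {n} {P : Vec Bool n → Set} → (∀ u → Dec (P u)) → ¬ (∀ u → P u) → ∃ λ u → ¬ P u
    search {zero}  P? h = [] , λ p → h λ { [] → p }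
    search {suc n} {P} P? h = pick (∀Bool? (λ u → P? (false ∷ u)))
      where
      pick : Dec (∀ u → P (false ∷ u)) → ∃ λ u → ¬ P u
      pick (no ¬p) = let (u , q) = search (λ u → P? (false ∷ u)) ¬p in false ∷ u , q
      pick (yes p) = let (u , q) = search (λ u → P? (true ∷ u)) (λ r → h λ { (false ∷ u) → p u ; (true ∷ u) → r u }) in true ∷ u , q

  -- A group preserving {x , y} acts on x through a linear form, the sign of the induced permutation.
  sign : ∀ {x y} → y ≢ x → Keeps x y → ∃ λ k → ∀ u → act u x ≡ x ⇔ ⟨ k , u ⟩ ≡ false
  sign {x} {y} y≢x keeps = build (linear-form φ hom)
    where
    φ : Vec Bool n → Bool
    φ u = not (does (act u x Finₚ.≟ x))
    fixes : ∀ {u} → act u x ≡ x → φ u ≡ false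
    fixes {u} e with act u x Finₚ.≟ x
    ... | yes _ = refl
    ... | no ¬e = contradiction e ¬e
    moves : ∀ {u} → act u x ≡ y → φ u ≡ true
    moves {u} e with act u x Finₚ.≟ x
    ... | yes e′ = contradiction (trans (sym e) e′) y≢x
    ... | no _   = refl
    Case : Vec Bool n → Set
    Case u = (act u x ≡ x × act u y ≡ y) ⊎ (act u x ≡ y × act u y ≡ x)
    hom : ∀ u w → φ (u ⊕ w) ≡ φ u xor φ w
    hom u w = go (keeps u) (keeps w)
      where
      go : Case u → Case w → φ (u ⊕ w) ≡ φ u xor φ w
      go (inj₁ (a , _)) (inj₁ (b , _)) = trans (fixes (trans (act-⊕ u w x) (trans (cong (act u) b) a))) (sym (cong₂ _xor_ (fixes a) (fixes b)))
      go (inj₁ (a , a′)) (inj₂ (b , _)) = trans (moves (trans (act-⊕ u w x) (trans (cong (act u) b) a′))) (sym (cong₂ _xor_ (fixes a) (moves b)))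
      go (inj₂ (a , _)) (inj₁ (b , _)) = trans (moves (trans (act-⊕ u w x) (trans (cong (act u) b) a))) (sym (cong₂ _xor_ (moves a) (fixes b)))
      go (inj₂ (a , a′)) (inj₂ (b , _)) = trans (fixes (trans (act-⊕ u w x) (trans (cong (act u) b) a′))) (sym (cong₂ _xor_ (moves a) (moves b)))
    back : ∀ {u} → φ u ≡ false → act u x ≡ x
    back {u} e with act u x Finₚ.≟ x
    ... | yes e′ = e′
    back {u} () | no _
    build : (∃ λ k → ∀ u → φ u ≡ ⟨ k , u ⟩) → ∃ λ k → ∀ u → act u x ≡ x ⇔ ⟨ k , u ⟩ ≡ false
    build (k , h) = k , λ u → mk⇔ (λ e → trans (sym (h u)) (fixes e)) (λ e → back (trans (h u) e))

sub : ∀ {v n} → PAct v (suc n) → PAct v n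
sub A = record { act = λ u → act (false ∷ u) ; act-⊕ = λ u w → act-⊕ (false ∷ u) (false ∷ w) ; act-𝟎 = act-𝟎 }
  where open PAct A

module _ {v : ℕ} where
  open PAct

  fixed-suc : ∀ {n} (A : PAct v (suc n)) {x} → Fixed (sub A) x → act A (true ∷ 𝟎) x ≡ x → Fixed A x
  fixed-suc A {x} fs fe (false ∷ u) = fs u
  fixed-suc A {x} fs fe (true ∷ u)  = trans (cong (λ w → act A (true ∷ w) x) (sym (⊕-idˡ u)))
    (trans (act-⊕ A (true ∷ 𝟎) (false ∷ u) x) (trans (cong (act A (true ∷ 𝟎)) (fs u)) fe))

  -- Induction on n: the generator `true ∷ 𝟎` acts as an involution on the points of `P` fixed by
  -- the subgroup `sub A`.
  fixed-mod2 : ∀ {n} (A : PAct v n) {P : Fin v → Set} (P? : Decidable P) → (∀ u {x} → P x → P (act A u x)) →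
               # P? ≡ # (λ x → P? x ×-dec fixed? A x) mod-via 2
  fixed-mod2 {zero} A P? inv = 0 , trans (#-cong P? (λ x → P? x ×-dec fixed? A x) (λ p → p , λ { [] → act-𝟎 A _ }) proj₁) (sym (+-identityʳ _))
  fixed-mod2 {suc n} A {P} P? inv = mod-trans (fixed-mod2 (sub A) P? (λ u → inv (false ∷ u)))
    (mod-trans (involution-mod2 P′? (act A e) inv′ (λ {x} _ → act² A e x))
      (0 , trans (#-cong (λ x → P′? x ×-dec (act A e x Finₚ.≟ x)) (λ x → P? x ×-dec fixed? A x) (λ ((p , fs) , fe) → p , fixed-suc A fs fe) (λ (p , fa) → (p , (λ u → fa (false ∷ u))) , fa e)) (sym (+-identityʳ _))))
    where
    e : Vec Bool (suc n)
    e = true ∷ 𝟎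
    P′? : Decidable (λ x → P x × Fixed (sub A) x)
    P′? x = P? x ×-dec fixed? (sub A) x
    inv′ : ∀ {x} → P x × Fixed (sub A) x → P (act A e x) × Fixed (sub A) (act A e x)
    inv′ {x} (p , fs) = inv e p , λ u → trans (act-comm A (false ∷ u) e x) (cong (act A e) (fs u))

record Action {v} (D : Design v) (n : ℕ) : Set where
  open Design D
  field
    P    : PAct v n
    B    : PAct v n
    inc⁺ : ∀ u {x j} → Inc x j → Inc (PAct.act P u x) (PAct.act B u j)

dual-action : ∀ {v} {D : Design v} {n} → Action D n → Action (dual D) n
dual-action A = record { P = B ; B = P ; inc⁺ = λ u i → inc⁺ u i }
  where open Action A

module Fixing {v} {D : Design v} {n} (A : Action D n) where
  open Counting D public
  open Action A public
  open PAct P public using () renaming (act to pt; act-⊕ to pt-⊕; act-𝟎 to pt-𝟎; act² to pt²; act-inj to pt-inj; act-comm to pt-comm; Fixed to FixedPt; fixed? to fixpt?; Keeps to KeepsPts; not-fixed to pt-not-fixed)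
  open PAct B public using () renaming (act to bl; act-⊕ to bl-⊕; act-𝟎 to bl-𝟎; act² to bl²; act-inj to bl-inj; act-comm to bl-comm; Fixed to FixedBl; fixed? to fixbl?)

  inc⁻ : ∀ u {x j} → Inc (pt u x) (bl u j) → Inc x j
  inc⁻ u {x} {j} i = subst₂ Inc (pt² u x) (bl² u j) (inc⁺ u i)

  involution : Vec Bool n → Involution D
  involution u = record
    { symmetry = record { pt = pt u ; bl = bl u ; inc⁺ = inc⁺ u ; inc⁻ = inc⁻ u ; pt-inj = pt-inj u ; bl-inj = bl-inj u }
    ; pt² = pt² u ; bl² = bl² u }

  f : ℕ
  f = # fixpt?

  s : Fin v → ℕ
  s = deg fixbl?

  fixed-inc : ∀ {x j} → FixedBl j → Inc x j → ∀ u → Inc (pt u x) j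
  fixed-inc fj i u = subst (Inc _) (fj u) (inc⁺ u i)

  inc-fixed : ∀ {x j} → FixedPt x → Inc x j → ∀ u → Inc x (bl u j)
  inc-fixed fx i u = subst (λ z → Inc z _) (fx u) (inc⁺ u i)

  -- The 16 blocks through a fixed point are permuted by a 2-group.
  s-even : ∀ {x} → FixedPt x → s x % 2 ≡ 0
  s-even {x} fx = sym (trans (cong (_% 2) (sym (pt-size x))) (trans (mod⇒% 2 (fixed-mod2 B (inc? x) (λ u i → inc-fixed fx i u)))
    (cong (_% 2) (#-cong (λ j → inc? x j ×-dec fixbl? j) (λ j → fixbl? j ×-dec inc? x j) (λ (a , b) → b , a) (λ (a , b) → b , a)))))

  s≤16 : ∀ x → s x ≤ 16
  s≤16 x = ≤-trans (#-mono (λ j → fixbl? j ×-dec inc? x j) (inc? x) proj₂) (≡⇒≤ (pt-size x))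

  -- This is (s - 4)(s - 6) ≥ 0, which fails only at the odd value 5.
  ten-s : ∀ {x} → FixedPt x → 10 * s x ≤ s x * s x + 24
  ten-s {x} fx = toWitness {a? = ℕₚ.allUpTo? (λ k → k % 2 ℕₚ.≟ 0 →-dec 10 * k ≤? k * k + 24) 17} tt (s≤s (s≤16 x)) (s-even fx)

  joinFix? : ∀ x y → Decidable (λ j → (Inc x j × Inc y j) × FixedBl j)
  joinFix? x y j = join? x y j ×-dec fixbl? j

  keeps-join : ∀ {x y} → KeepsPts x y → ∀ u {j} → Inc x j × Inc y j → Inc x (bl u j) × Inc y (bl u j)
  keeps-join {x} {y} k u (i , i′) = [ (λ (a , b) → subst (λ z → Inc z _) a (inc⁺ u i) , subst (λ z → Inc z _) b (inc⁺ u i′))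
                          , (λ (a , b) → subst (λ z → Inc z _) b (inc⁺ u i′) , subst (λ z → Inc z _) a (inc⁺ u i)) ]′ (k u)

  one-or-three : ∀ {k} → k ≤ 3 → 3 % 2 ≡ k % 2 → k ≡ 1 ⊎ k ≡ 3
  one-or-three le e = toWitness {a? = ℕₚ.allUpTo? (λ k → 3 % 2 ℕₚ.≟ k % 2 →-dec (k ℕₚ.≟ 1 ⊎-dec k ℕₚ.≟ 3)) 4} tt (s≤s le) e

  join-1-3 : ∀ {x y} → y ≢ x → KeepsPts x y → # (joinFix? x y) ≡ 1 ⊎ # (joinFix? x y) ≡ 3
  join-1-3 {x} {y} y≢x k = one-or-three (≤-trans (#-mono (joinFix? x y) (join? x y) proj₁) (≡⇒≤ (pt-pair y≢x)))
    (trans (cong (_% 2) (sym (pt-pair y≢x))) (mod⇒% 2 (fixed-mod2 B (join? x y) (keeps-join k))))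

  join-block : ∀ {x y} → y ≢ x → KeepsPts x y → ∃ λ j → (Inc x j × Inc y j) × FixedBl j
  join-block {x} {y} y≢x k = #-witness (joinFix? x y) ([ (λ e → ≡⇒≥ e) , (λ e → ≤-trans (s≤s z≤n) (≡⇒≥ e)) ]′ (join-1-3 y≢x k))

  fixed-keeps : ∀ {x y} → FixedPt x → FixedPt y → KeepsPts x y
  fixed-keeps fx fy u = inj₁ (fx u , fy u)

module Unfixed {v} {D : Design v} {n} (A : Action D n) where
  open Fixing A
  module Dual = Fixing (dual-action A)

  -- Two fixed blocks through x meet in 3 points, one of which, p, is fixed by parity. The group
  -- permutes the remaining two, x and q.
  mate : ∀ {x} → ¬ FixedPt x → 2 ≤ s x → ∃ λ q → q ≢ x × KeepsPts x q
  mate {x} nx 2≤s = from-first (#-witness on? (<⇒≤ 2≤s))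
    where
    on? : Decidable (λ j → FixedBl j × Inc x j)
    on? j = fixbl? j ×-dec inc? x j
    from-first : ∃ (λ j → FixedBl j × Inc x j) → ∃ λ q → q ≢ x × KeepsPts x q
    from-first (i , fi , xi) = from-second (#-two on? 2≤s (fi , xi))
      where
      from-second : (∃ λ j → (FixedBl j × Inc x j) × j ≢ i) → ∃ λ q → q ≢ x × KeepsPts x q
      from-second (j , (fj , xj) , j≢i) = from-point (Dual.join-block j≢i (λ u → inj₁ (fi u , fj u)))
        where
        from-point : (∃ λ p → (Inc p i × Inc p j) × FixedPt p) → ∃ λ q → q ≢ x × KeepsPts x q
        from-point (p , pij , fp) = from-third (meet-third j≢i (xi , xj) pij p≢x)
          where
          p≢x : p ≢ x
          p≢x refl = nx fp
          from-third : Third (meet? i j) x p → ∃ λ q → q ≢ x × KeepsPts x q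
          from-third (mkThird q qij q≢x q≢p only) = q , q≢x , keeps
            where
            in-meet : ∀ u {y} → Inc y i × Inc y j → Inc (pt u y) i × Inc (pt u y) j
            in-meet u (a , b) = fixed-inc fi a u , fixed-inc fj b u
            avoid-p : ∀ u {y} → y ≢ p → pt u y ≢ p
            avoid-p u y≢p e = y≢p (pt-inj u (trans e (sym (fp u))))
            cases : ∀ u {y} → Inc y i × Inc y j → y ≢ p → pt u y ≡ x ⊎ pt u y ≡ q
            cases u m y≢p = [ inj₁ , [ (λ e → contradiction e (avoid-p u y≢p)) , inj₂ ]′ ]′ (only (in-meet u m))
            keeps : KeepsPts x q
            keeps u = [ (λ ex → inj₁ (ex , [ (λ eq → contradiction (pt-inj u (trans eq (sym ex))) q≢x) , id ]′ (cases u qij q≢p)))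
                      , (λ ex → inj₂ (ex , trans (cong (pt u) (sym ex)) (pt² u x))) ]′ (cases u (xi , xj) (p≢x ∘ sym))

  -- Some element moves x to q, so the fixed blocks through x are the fixed ones among the 3 blocks
  -- joining x and q.
  mate-degree : ∀ {x q} → ¬ FixedPt x → q ≢ x → KeepsPts x q → s x ≡ 1 ⊎ s x ≡ 3
  mate-degree {x} {q} nx q≢x k = subst (λ m → m ≡ 1 ⊎ m ≡ 3) (sym s≡) (join-1-3 q≢x k)
    where
    moved : ∃ λ u → pt u x ≢ x
    moved = pt-not-fixed nx
    to-q : pt (proj₁ moved) x ≡ q
    to-q = [ (λ (e , _) → contradiction e (proj₂ moved)) , proj₁ ]′ (k (proj₁ moved))
    s≡ : s x ≡ # (joinFix? x q)
    s≡ = #-cong (λ j → fixbl? j ×-dec inc? x j) (joinFix? x q) (λ (fj , i) → (i , subst (λ z → Inc z _) to-q (fixed-inc fj i (proj₁ moved))) , fj) (λ ((i , _) , fj) → fj , i)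

  unfixed-degree : ∀ {x} → ¬ FixedPt x → s x ≡ 0 ⊎ s x ≡ 1 ⊎ s x ≡ 3
  unfixed-degree {x} nx = pick (2 ≤? s x)
    where
    small : ∀ k → k < 2 → k ≡ 0 ⊎ k ≡ 1 ⊎ k ≡ 3
    small zero    _ = inj₁ refl
    small (suc zero) _ = inj₂ (inj₁ refl)
    small (suc (suc _)) (s≤s (s≤s ()))
    pick : Dec (2 ≤ s x) → s x ≡ 0 ⊎ s x ≡ 1 ⊎ s x ≡ 3
    pick (no ¬2) = small (s x) (≰⇒> ¬2)
    pick (yes 2≤) = let (q , q≢x , k) = mate nx 2≤ in inj₂ (mate-degree nx q≢x k)

-- Parity and the equality of fixed points and fixed blocks over F₂

allVecs : ∀ n → List (Vec Bool n)
allVecs zero    = [] ∷ []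
allVecs (suc n) = map (false ∷_) (allVecs n) ++ map (true ∷_) (allVecs n)

length-allVecs : ∀ n → length (allVecs n) ≡ 2 ^ n
length-allVecs zero    = refl
length-allVecs (suc n) = trans (Listₚ.length-++ (map (false ∷_) (allVecs n))) (cong₂ _+_ (trans (Listₚ.length-map (false ∷_) (allVecs n)) (length-allVecs n))
  (trans (Listₚ.length-map (true ∷_) (allVecs n)) (trans (length-allVecs n) (sym (+-identityʳ _)))))

∈-allVecs : ∀ {n} (u : Vec Bool n) → u ∈ allVecs n
∈-allVecs []                = here refl
∈-allVecs {suc n} (false ∷ u) = ∈-++⁺ˡ (∈-map⁺ (false ∷_) (∈-allVecs u))
∈-allVecs {suc n} (true ∷ u)  = ∈-++⁺ʳ (map (false ∷_) (allVecs n)) (∈-map⁺ (true ∷_) (∈-allVecs u))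

unique-allVecs : ∀ n → Unique (allVecs n)
unique-allVecs zero    = [] ∷ []
unique-allVecs (suc n) = Uniqueₚ.++⁺ (Uniqueₚ.map⁺ Vecₚ.∷-injectiveʳ (unique-allVecs n)) (Uniqueₚ.map⁺ Vecₚ.∷-injectiveʳ (unique-allVecs n)) disjoint
  where
  disjoint : ∀ {u} → ¬ (u ∈ map (false ∷_) (allVecs n) × u ∈ map (true ∷_) (allVecs n))
  disjoint (p , q) with ∈-map⁻ (false ∷_) p | ∈-map⁻ (true ∷_) q
  ... | _ , _ , refl | _ , _ , ()

Vec-injection : ∀ {m n} (ψ : Vec Bool m → Vec Bool n) → (∀ {u w} → ψ u ≡ ψ w → u ≡ w) → m ≤ n
Vec-injection {m} {n} ψ inj = ≮⇒≥ λ n<m → <⇒≱ (ℕₚ.^-monoʳ-< 2 (s≤s (s≤s z≤n)) n<m)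
  (subst₂ _≤_ (trans (Listₚ.length-map ψ (allVecs m)) (length-allVecs m)) (length-allVecs n)
    (⊆-length (map-unique ψ (λ _ _ → inj) (unique-allVecs m)) (λ {u} _ → ∈-allVecs u)))

odd : ℕ → Bool
odd zero    = false
odd (suc n) = not (odd n)

odd-+ : ∀ m n → odd (m + n) ≡ odd m xor odd n
odd-+ zero    n = refl
odd-+ (suc m) n = trans (cong not (odd-+ m n)) (Boolₚ.not-distribˡ-xor (odd m) (odd n))

odd-* : ∀ m n → odd (m * n) ≡ odd m ∧ odd n
odd-* zero    n = refl
odd-* (suc m) n = trans (odd-+ n (m * n)) (trans (cong (odd n xor_) (odd-* m n)) (lemma (odd m) (odd n)))
  where
  lemma : ∀ a b → b xor (a ∧ b) ≡ not a ∧ b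
  lemma false false = refl
  lemma false true  = refl
  lemma true  false = refl
  lemma true  true  = refl

odd-double : ∀ q → odd (q * 2) ≡ false
odd-double q = trans (odd-* q 2) (Boolₚ.∧-zeroʳ (odd q))

odd-mod : ∀ {m n} → m ≡ n mod-via 2 → odd m ≡ odd n
odd-mod {n = n} (q , refl) = trans (odd-+ n (q * 2)) (trans (cong (odd n xor_) (odd-double q)) (Boolₚ.xor-identityʳ (odd n)))

opaque
  unfolding ∑

  odd-∑ : ∀ {n} {g h : Fin n → ℕ} → (∀ i → odd (g i) ≡ odd (h i)) → odd (∑ g) ≡ odd (∑ h)
  odd-∑ {zero}          e = refl
  odd-∑ {suc n} {g} {h} e = trans (odd-+ (g zero) _) (trans (cong₂ _xor_ (e zero) (odd-∑ (λ i → e (suc i)))) (sym (odd-+ (h zero) _)))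

  ∑-suc : ∀ {n} (g : Fin (suc n) → ℕ) → ∑ g ≡ g zero + ∑ (λ i → g (suc i))
  ∑-suc g = refl

odd-∑-false : ∀ {n} {g : Fin n → ℕ} → (∀ i → odd (g i) ≡ false) → odd (∑ g) ≡ false
odd-∑-false e = trans (odd-∑ {h = λ _ → 0} e) (cong odd (∑-zero (λ _ → refl)))

enumerate-∑ : ∀ {v} n {P : Fin v → Set} (P? : Decidable P) → # P? ≡ n →
              ∃ λ (g : Fin n → Fin v) → (∀ i → P (g i)) × (∀ i j → g i ≡ g j → i ≡ j) × (∀ F → ∑ (λ i → F (g i)) ≡ ∑On P? F)
enumerate-∑ {v} n {P} P? e = build (enumerate n P? e)
  where
  build : (∃ λ (g : Fin n → Fin v) → (∀ i → P (g i)) × (∀ i j → g i ≡ g j → i ≡ j)) → _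
  build (g , pg , inj) = g , pg , inj , λ F → begin
      ∑ (λ i → F (g i))
    ≡⟨ ∑-cong (λ i → sym (∑-≡ (g i) F)) ⟩
      ∑ (λ i → ∑ (λ x → ι (x Finₚ.≟ g i) * F x))
    ≡⟨ ∑-swap _ ⟩
      ∑ (λ x → ∑ (λ i → ι (x Finₚ.≟ g i) * F x))
    ≡⟨ ∑-cong (λ x → trans (∑-cong (λ i → *-comm (ι (x Finₚ.≟ g i)) (F x))) (trans (∑-*ˡ (F x) (λ i → ι (x Finₚ.≟ g i))) (trans (*-comm (F x) (hits x)) (cong (_* F x) (hits≡ x))))) ⟩
      ∑On P? F ∎
    where
    open ≡-Reasoning
    hits : Fin v → ℕ
    hits x = # (λ i → x Finₚ.≟ g i)
    hits≤ : ∀ x → hits x ≤ ι (P? x)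
    hits≤ x = case any? (λ i → x Finₚ.≟ g i) of λ
      { (no ¬h) → ≤-trans (≡⇒≤ (#-none (λ i → x Finₚ.≟ g i) (λ i q → ¬h (i , q)))) z≤n
      ; (yes (i , refl)) → ≡⇒≤ (trans (trans (#-cong (λ k → g i Finₚ.≟ g k) (Finₚ._≟ i) (λ {k} q → sym (inj i k q)) (λ { refl → refl })) (#-≡ i)) (sym (ι-yes (P? (g i)) (pg i)))) }
    total : ∑ hits ≡ # P?
    total = trans (sym (∑-swap (λ i x → ι (x Finₚ.≟ g i)))) (trans (∑-cong (λ i → #-≡ (g i))) (trans (∑-const n 1) (trans (*-identityʳ n) (sym e))))
    squeeze : ∀ {m} (a b : Fin m → ℕ) → (∀ i → a i ≤ b i) → ∑ a ≡ ∑ b → ∀ i → a i ≡ b i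
    squeeze a b le eq i = ≤-antisym (le i) (ℕₚ.≮⇒≥ λ lt → <-irrefl eq (strict a b le i lt))
      where
      strict : ∀ {m} (a b : Fin m → ℕ) → (∀ i → a i ≤ b i) → ∀ i → a i < b i → ∑ a < ∑ b
      strict {suc m} a b le zero    lt = subst₂ _<_ (sym (∑-suc a)) (sym (∑-suc b)) (+-mono-≤ lt (∑-mono (λ i → le (suc i))))
      strict {suc m} a b le (suc i) lt = subst₂ _<_ (sym (∑-suc a)) (sym (∑-suc b)) (ℕₚ.+-mono-≤-< (le zero) (strict (a ∘ suc) (b ∘ suc) (λ i → le (suc i)) i lt))
    hits≡ : ∀ x → hits x ≡ ι (P? x)
    hits≡ = squeeze hits (λ x → ι (P? x)) hits≤ total

-- Over F₂ the fixed blocks B, restricted to the fixed points, satisfy B · B = 0 and B · B′ = 1,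
-- so distinct even sets of fixed blocks have distinct sums.
module FixedCount {v} (v≡81 : v ≡ 81) {D : Design v} {n} (A : Action D n) where
  open Fixing A

  onFix? : ∀ i j → Decidable (λ x → (Inc x i × Inc x j) × FixedPt x)
  onFix? i j x = meet? i j x ×-dec fixpt? x

  meet-odd : ∀ {i j} → FixedBl i → FixedBl j → odd (# (onFix? i j)) ≡ not (does (i Finₚ.≟ j))
  meet-odd {i} {j} fi fj = trans (sym (odd-mod (fixed-mod2 P (meet? i j) (λ u (p , q) → fixed-inc fi p u , fixed-inc fj q u)))) (at (i Finₚ.≟ j))
    where
    at : (d : Dec (i ≡ j)) → odd (# (meet? i j)) ≡ not (does d)
    at (yes refl) = cong odd (trans (meet-size i i) (cong (λ z → 3 + 13 * z) (ι-yes (i Finₚ.≟ i) refl)))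
    at (no i≢j)   = cong odd (blk-pair (i≢j ∘ sym))

  odd-f : odd f ≡ true
  odd-f = trans (sym (odd-mod (mod-trans (fixed-mod2 P {λ _ → ⊤} (λ _ → yes tt) (λ _ _ → tt))
      (0 , trans (#-cong (λ x → yes tt ×-dec fixpt? x) fixpt? proj₂ (tt ,_)) (sym (+-identityʳ f))))))
    (cong odd (trans (#-all {P = λ _ → ⊤} (λ _ → yes tt) (λ _ → tt)) v≡81))

  blocks≤suc-points : ∀ {b} → # fixbl? ≡ suc b → b ≤ f
  blocks≤suc-points {b} eb = build (enumerate-∑ (suc b) fixbl? eb) (enumerate-∑ f fixpt? refl)
    where
    build : (∃ λ (g : Fin (suc b) → Fin v) → (∀ i → FixedBl (g i)) × (∀ i j → g i ≡ g j → i ≡ j) × (∀ F → ∑ (λ i → F (g i)) ≡ ∑On fixbl? F)) →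
            (∃ λ (h : Fin f → Fin v) → (∀ i → FixedPt (h i)) × (∀ i j → h i ≡ h j → i ≡ j) × (∀ F → ∑ (λ i → F (h i)) ≡ ∑On fixpt? F)) → b ≤ f
    build (g , fg , g-inj , _) (h , _ , _ , ∑h) = Vec-injection ψ ψ-inj
      where
      ε : Fin v → Fin (suc b) → ℕ
      ε x i = ι (inc? x (g i))
      value : (Fin (suc b) → ℕ) → Fin v → ℕ
      value t x = ∑ (λ i → t i * ε x i)
      -- If Σ tᵢ Bᵢ = 0 on the fixed points, pairing with Bⱼ gives Σ tᵢ = tⱼ modulo 2, and the left
      -- side is even.
      kernel : ∀ t → odd (∑ t) ≡ false → (∀ k → odd (value t (h k)) ≡ false) → ∀ j → odd (t j) ≡ false
      kernel t even zero-on j = trans (sym (cong (_xor odd (t j)) against)) (trans (sym total) even)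
        where
        m : Fin (suc b) → ℕ
        m i = # (onFix? (g i) (g j))
        against : odd (∑ (λ i → t i * m i)) ≡ false
        against = trans (cong odd swap) (odd-∑-false (λ k → trans (odd-* (ε (h k) j) (value t (h k))) (trans (cong (odd (ε (h k) j) ∧_) (zero-on k)) (Boolₚ.∧-zeroʳ _))))
          where
          swap : ∑ (λ i → t i * m i) ≡ ∑ (λ k → ε (h k) j * value t (h k))
          swap = begin
              ∑ (λ i → t i * m i)
            ≡⟨ ∑-cong (λ i → trans (cong (t i *_) (m≡ i)) (sym (∑-*ˡ (t i) (λ k → ε (h k) i * ε (h k) j)))) ⟩
              ∑ (λ i → ∑ (λ k → t i * (ε (h k) i * ε (h k) j)))
            ≡⟨ ∑-swap _ ⟩
              ∑ (λ k → ∑ (λ i → t i * (ε (h k) i * ε (h k) j)))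
            ≡⟨ ∑-cong (λ k → trans (∑-cong (λ i → rot (t i) (ε (h k) i) (ε (h k) j))) (∑-*ˡ (ε (h k) j) (λ i → t i * ε (h k) i))) ⟩
              ∑ (λ k → ε (h k) j * value t (h k)) ∎
            where
            open ≡-Reasoning
            rot : ∀ a b c → a * (b * c) ≡ c * (a * b)
            rot = solve-∀
            m≡ : ∀ i → m i ≡ ∑ (λ k → ε (h k) i * ε (h k) j)
            m≡ i = trans (∑-cong (λ x → trans (ι-× (meet? (g i) (g j) x) (fixpt? x)) (trans (cong (_* ι (fixpt? x)) (ι-× (inc? x (g i)) (inc? x (g j)))) (*-comm _ (ι (fixpt? x))))))
              (sym (∑h (λ x → ε x i * ε x j)))
        total : odd (∑ t) ≡ odd (∑ (λ i → t i * m i)) xor odd (t j)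
        total = trans (odd-∑ at) (trans (cong odd (∑-+ (λ i → t i * m i) (λ i → ι (i Finₚ.≟ j) * t i))) (trans (odd-+ (∑ (λ i → t i * m i)) _) (cong (λ z → odd (∑ (λ i → t i * m i)) xor odd z) (∑-≡ j t))))
          where
          at : ∀ i → odd (t i) ≡ odd (t i * m i + ι (i Finₚ.≟ j) * t i)
          at i = trans (bits (odd (t i)) (i Finₚ.≟ j)) (sym (trans (odd-+ (t i * m i) _) (cong₂ _xor_ (trans (odd-* (t i) (m i)) (cong (odd (t i) ∧_) odd-m)) (trans (odd-* (ι (i Finₚ.≟ j)) (t i)) refl))))
            where
            odd-m : odd (m i) ≡ not (does (i Finₚ.≟ j))
            odd-m = trans (meet-odd (fg i) (fg j)) (cong not (same (g i Finₚ.≟ g j) (i Finₚ.≟ j)))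
              where
              same : (d : Dec (g i ≡ g j)) (d′ : Dec (i ≡ j)) → does d ≡ does d′
              same (yes _) (yes _) = refl
              same (yes e) (no ¬e) = contradiction (g-inj i j e) ¬e
              same (no ¬e) (yes e) = contradiction (cong g e) ¬e
              same (no _)  (no _)  = refl
            bits : ∀ a (d : Dec (i ≡ j)) → a ≡ (a ∧ not (does d)) xor (odd (ι d) ∧ a)
            bits false (yes _) = refl
            bits false (no _)  = refl
            bits true  (yes _) = refl
            bits true  (no _)  = refl
      bit : Bool → ℕ
      bit c = if c then 1 else 0
      -- A set of the last b blocks is completed to an even one by block 0, taken as often as the
      -- set has elements.
      weight : Vec Bool b → Fin (suc b) → ℕ
      weight S zero    = ∑ (λ i → bit (lookup S i))
      weight S (suc i) = bit (lookup S i)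
      weight-even : ∀ S → odd (∑ (weight S)) ≡ false
      weight-even S = trans (cong odd (trans (∑-suc (weight S)) (double (∑ (λ i → bit (lookup S i)))))) (odd-double (∑ (λ i → bit (lookup S i))))
        where
        double : ∀ m → m + m ≡ m * 2
        double = solve-∀
      ψ : Vec Bool b → Vec Bool f
      ψ S = tabulate (λ k → odd (value (weight S) (h k)))
      ψ-inj : ∀ {S T} → ψ S ≡ ψ T → S ≡ T
      ψ-inj {S} {T} e = trans (sym (Vecₚ.tabulate∘lookup S)) (trans (Vecₚ.tabulate-cong (λ i → bits (lookup S i) (lookup T i) (trans (sym (odd-+ (bit (lookup S i)) _)) (kernel t even zero-on (suc i))))) (Vecₚ.tabulate∘lookup T))
        where
        t : Fin (suc b) → ℕ
        t i = weight S i + weight T i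
        even : odd (∑ t) ≡ false
        even = trans (cong odd (∑-+ (weight S) (weight T))) (trans (odd-+ (∑ (weight S)) _) (cong₂ _xor_ (weight-even S) (weight-even T)))
        zero-on : ∀ k → odd (value t (h k)) ≡ false
        zero-on k = trans (cong odd (trans (∑-cong (λ i → *-distribʳ-+ (ε (h k) i) (weight S i) (weight T i))) (∑-+ _ _)))
          (trans (odd-+ (value (weight S) (h k)) _) (trans (cong (odd (value (weight S) (h k)) xor_) (sym agree)) (Boolₚ.xor-same (odd (value (weight S) (h k))))))
          where
          agree : odd (value (weight S) (h k)) ≡ odd (value (weight T) (h k))
          agree = trans (sym (Vecₚ.lookup∘tabulate (λ k → odd (value (weight S) (h k))) k)) (trans (cong (λ u → lookup u k) e) (Vecₚ.lookup∘tabulate (λ k → odd (value (weight T) (h k))) k))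
        bits : ∀ a c → odd (bit a) xor odd (bit c) ≡ false → a ≡ c
        bits false false _ = refl
        bits true  true  _ = refl
        bits false true  ()
        bits true  false ()

same-parity-≤ : ∀ {b f} → odd b ≡ true → odd f ≡ true → b ≤ suc f → b ≤ f
same-parity-≤ ob of le = [ (λ lt → ℕ.s≤s⁻¹ lt) , (λ { refl → contradiction (trans (sym (cong not of)) ob) λ () }) ]′ (m≤n⇒m<n∨m≡n le)

module _ {v} (v≡81 : v ≡ 81) where

  private
    blocks≤points : ∀ {D : Design v} {n} (A : Action D n) → # (Fixing.fixbl? A) ≤ Fixing.f A
    blocks≤points A = by-cases (# (Fixing.fixbl? A)) refl
      where
      by-cases : ∀ b → # (Fixing.fixbl? A) ≡ b → b ≤ Fixing.f A
      by-cases zero    e = z≤n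
      by-cases (suc b) e = same-parity-≤ (trans (cong odd (sym e)) (FixedCount.odd-f v≡81 (dual-action A))) (FixedCount.odd-f v≡81 A) (s≤s (FixedCount.blocks≤suc-points v≡81 A e))

  fixed-blocks≡fixed-points : ∀ {D : Design v} {n} (A : Action D n) → # (Fixing.fixbl? A) ≡ Fixing.f A
  fixed-blocks≡fixed-points A = ≤-antisym (blocks≤points A) (blocks≤points (dual-action A))

-- Linear forms and the points fixed by a hyperplane of the group

infix 4 _≟ᵥ_

_≟ᵥ_ : ∀ {n} → DecidableEquality (Vec Bool n)
_≟ᵥ_ = Vecₚ.≡-dec Boolₚ._≟_

⟨,⟩-⊕ : ∀ {n} (k u w : Vec Bool n) → ⟨ k , u ⊕ w ⟩ ≡ ⟨ k , u ⟩ xor ⟨ k , w ⟩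
⟨,⟩-⊕ []      []      []      = refl
⟨,⟩-⊕ (a ∷ k) (b ∷ u) (c ∷ w) = trans (cong ((a ∧ (b xor c)) xor_) (⟨,⟩-⊕ k u w)) (bits a b c ⟨ k , u ⟩ ⟨ k , w ⟩)
  where
  bits : ∀ a b c p q → (a ∧ (b xor c)) xor (p xor q) ≡ ((a ∧ b) xor p) xor ((a ∧ c) xor q)
  bits false b     c     p     q     = refl
  bits true  false c     false q     = refl
  bits true  false false true  q     = refl
  bits true  false true  true  false = refl
  bits true  false true  true  true  = refl
  bits true  true  false p     q     = sym (Boolₚ.xor-assoc true p q)
  bits true  true  true  false false = refl
  bits true  true  true  false true  = refl
  bits true  true  true  true  false = refl
  bits true  true  true  true  true  = refl

⟨,𝟎⟩ : ∀ {n} (k : Vec Bool n) → ⟨ k , 𝟎 ⟩ ≡ false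
⟨,𝟎⟩ []      = refl
⟨,𝟎⟩ (a ∷ k) = trans (cong₂ _xor_ (Boolₚ.∧-zeroʳ a) (⟨,𝟎⟩ k)) refl

⟨𝟎,⟩ : ∀ {n} (u : Vec Bool n) → ⟨ 𝟎 , u ⟩ ≡ false
⟨𝟎,⟩ []      = refl
⟨𝟎,⟩ (a ∷ u) = ⟨𝟎,⟩ u

nondegenerate : ∀ {n} (k l : Vec Bool n) → (∀ u → ⟨ k , u ⟩ ≡ ⟨ l , u ⟩) → k ≡ l
nondegenerate []      []      h = refl
nondegenerate (a ∷ k) (b ∷ l) h = cong₂ _∷_
  (trans (sym (head a k)) (trans (h (true ∷ 𝟎)) (head b l)))
  (nondegenerate k l (λ u → trans (sym (rest a k u)) (trans (h (false ∷ u)) (rest b l u))))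
  where
  head : ∀ {n} a (k : Vec Bool n) → (a ∧ true) xor ⟨ k , 𝟎 ⟩ ≡ a
  head a k = trans (cong₂ _xor_ (Boolₚ.∧-identityʳ a) (⟨,𝟎⟩ k)) (Boolₚ.xor-identityʳ a)
  rest : ∀ {n} a (k : Vec Bool n) u → (a ∧ false) xor ⟨ k , u ⟩ ≡ ⟨ k , u ⟩
  rest a k u = cong (_xor ⟨ k , u ⟩) (Boolₚ.∧-zeroʳ a)

-- A linear parametrisation of the hyperplane ⟨ k , - ⟩ = false, for k ≢ 𝟎.
ker : ∀ {n} → Vec Bool (suc n) → Vec Bool n → Vec Bool (suc n)
ker (true ∷ k)          w       = ⟨ k , w ⟩ ∷ w
ker {zero}  (false ∷ k) w       = false ∷ w
ker {suc n} (false ∷ k) (b ∷ w) = b ∷ ker k w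

ker-⊕ : ∀ {n} (k : Vec Bool (suc n)) u w → ker k (u ⊕ w) ≡ ker k u ⊕ ker k w
ker-⊕ (true ∷ k)          u       w       = cong (_∷ (u ⊕ w)) (⟨,⟩-⊕ k u w)
ker-⊕ {zero}  (false ∷ k) u       w       = refl
ker-⊕ {suc n} (false ∷ k) (b ∷ u) (c ∷ w) = cong ((b xor c) ∷_) (ker-⊕ k u w)

ker-∈ : ∀ {n} (k : Vec Bool (suc n)) w → ⟨ k , ker k w ⟩ ≡ false
ker-∈ (true ∷ k)          w       = Boolₚ.xor-same ⟨ k , w ⟩
ker-∈ {zero}  (false ∷ []) []     = refl
ker-∈ {suc n} (false ∷ k) (b ∷ w) = ker-∈ k w

ker-𝟎 : ∀ {n} (k : Vec Bool (suc n)) → ker k 𝟎 ≡ 𝟎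
ker-𝟎 (true ∷ k)          = cong (_∷ 𝟎) (⟨,𝟎⟩ k)
ker-𝟎 {zero}  (false ∷ k) = refl
ker-𝟎 {suc n} (false ∷ k) = cong (false ∷_) (ker-𝟎 k)

ker-injective : ∀ {n} (k : Vec Bool (suc n)) w → ker k w ≡ 𝟎 → w ≡ 𝟎
ker-injective (true ∷ k)          w       e = Vecₚ.∷-injectiveʳ e
ker-injective {zero}  (false ∷ k) []      e = refl
ker-injective {suc n} (false ∷ k) (b ∷ w) e = cong₂ _∷_ (Vecₚ.∷-injectiveˡ e) (ker-injective k w (Vecₚ.∷-injectiveʳ e))

ker-surjective : ∀ {n} (k : Vec Bool (suc n)) → k ≢ 𝟎 → ∀ u → ⟨ k , u ⟩ ≡ false → ∃ λ w → ker k w ≡ u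
ker-surjective (true ∷ k) _ (b ∷ u) e = u , cong (_∷ u) (equal b ⟨ k , u ⟩ e)
  where
  equal : ∀ b c → b xor c ≡ false → c ≡ b
  equal false false _ = refl
  equal true  true  _ = refl
ker-surjective {zero}  (false ∷ []) ne u e = contradiction refl ne
ker-surjective {suc n} (false ∷ k) ne (b ∷ u) e = let (w , q) = ker-surjective k (λ k≡ → ne (cong (false ∷_) k≡)) u e in b ∷ w , cong (b ∷_) q

module Hyperplanes {v n} (A : PAct v n) where
  open PAct A

  -- Fixed by the kernel of the form k, a subgroup of index two, or the whole group for k = 𝟎.
  HF : Vec Bool n → Fin v → Set
  HF k x = ∀ u → ⟨ k , u ⟩ ≡ false → act u x ≡ x

  HF? : ∀ k → Decidable (HF k)
  HF? k x = ∀Bool? (λ u → (⟨ k , u ⟩ Boolₚ.≟ false) →-dec (act u x Finₚ.≟ x))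

  -- The stabiliser is exactly the kernel of k: it contains the kernel, whose index is at most two,
  -- and is not the whole group.
  Strict : Vec Bool n → Fin v → Set
  Strict k x = HF k x × ¬ Fixed x

  strict? : ∀ k → Decidable (Strict k)
  strict? k x = HF? k x ×-dec ¬? (fixed? x)

  fixed⇒HF : ∀ k {x} → Fixed x → HF k x
  fixed⇒HF k fx u _ = fx u

  private
    off : ∀ k {x u w} → HF k x → ⟨ k , w ⟩ ≡ true → ⟨ k , u ⟩ ≡ true → act u x ≡ act w x
    off k {x} {u} {w} h ew eu = trans (cong (act u) (sym (h (u ⊕ w) (trans (⟨,⟩-⊕ k u w) (cong₂ _xor_ eu ew)))))
      (trans (cong (act u) (act-⊕ u w x)) (act² u (act w x)))

    decide : ∀ b → b ≡ true ⊎ b ≡ false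
    decide true  = inj₁ refl
    decide false = inj₂ refl

  HF-moves : ∀ k {x} → Strict k x → ∀ {u} → ⟨ k , u ⟩ ≡ true → act u x ≢ x
  HF-moves k {x} (h , nf) {u} eu e = nf λ w → [ (λ ew → trans (off k h eu ew) e) , h w ]′ (decide ⟨ k , w ⟩)

  HF-keeps : ∀ k {x} → Strict k x → ∃ λ q → q ≢ x × Keeps x q
  HF-keeps k {x} (h , nf) = build (not-fixed nf)
    where
    build : (∃ λ w → act w x ≢ x) → ∃ λ q → q ≢ x × Keeps x q
    build (w , ne) = act w x , ne , λ u → [ (λ eu → inj₂ (off k h ew eu , trans (cong (act u) (sym (off k h ew eu))) (act² u x)))
                                         , (λ eu → inj₁ (h u eu , trans (act-comm u w x) (cong (act w) (h u eu)))) ]′ (decide ⟨ k , u ⟩)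
      where
      ew : ⟨ k , w ⟩ ≡ true
      ew = [ id , (λ e → contradiction (h w e) ne) ]′ (decide ⟨ k , w ⟩)

  -- Both kernels are the stabiliser of x, and over F₂ a form is determined by its kernel.
  HF-unique : ∀ k l {x} → Strict k x → HF l x → k ≡ l
  HF-unique k l {x} sk hl = nondegenerate k l λ u → agree (decide ⟨ k , u ⟩) (decide ⟨ l , u ⟩)
    where
    sl : Strict l x
    sl = hl , proj₂ sk
    agree : ∀ {u} → ⟨ k , u ⟩ ≡ true ⊎ ⟨ k , u ⟩ ≡ false → ⟨ l , u ⟩ ≡ true ⊎ ⟨ l , u ⟩ ≡ false → ⟨ k , u ⟩ ≡ ⟨ l , u ⟩
    agree (inj₁ a) (inj₁ b) = trans a (sym b)
    agree (inj₁ a) (inj₂ b) = contradiction (hl _ b) (HF-moves k sk a)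
    agree (inj₂ a) (inj₁ b) = contradiction (proj₁ sk _ a) (HF-moves l sl b)
    agree (inj₂ a) (inj₂ b) = trans a (sym b)

  keeps-HF : ∀ {x q} → ¬ Fixed x → q ≢ x → Keeps x q → ∃ λ k → k ≢ 𝟎 × Strict k x
  keeps-HF nf q≢x keeps = let (k , h) = sign q≢x keeps in
    k , (λ e → nf (λ u → Equivalence.from (h u) (trans (cong (λ z → ⟨ z , u ⟩) e) (⟨𝟎,⟩ u)))) , (λ u e → Equivalence.from (h u) e) , nf

  N : Vec Bool n → ℕ
  N k = # (strict? k)

  HF-count : ∀ k → # (HF? k) ≡ # fixed? + N k
  HF-count k = trans (#-split (HF? k) fixed?) (cong (_+ N k) (#-cong (λ x → HF? k x ×-dec fixed? x) fixed? proj₂ (λ fx → fixed⇒HF k fx , fx)))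

module _ {v} {K : Set} {P : K → Fin v → Set} (P? : ∀ k → Decidable (P k)) where

  fibres-≤ : ∀ {Q : Fin v → Set} (Q? : Decidable Q) ks → Unique ks → (∀ {k} → k ∈ ks → ∀ {x} → P k x → Q x) →
             (∀ {k l x} → P k x → P l x → k ≡ l) → List.foldr (λ k n → # (P? k) + n) 0 ks ≤ # Q?
  fibres-≤ Q? []       _        _ _ = z≤n
  fibres-≤ Q? (k ∷ ks) (k∉ ∷ u) s d = ≤-trans (+-monoʳ-≤ (# (P? k)) (fibres-≤ (λ x → Q? x ×-dec ¬? (P? k x)) ks u
      (λ l∈ p → s (there l∈) p , λ q → All.lookup k∉ l∈ (d q p)) d))
    (#-split≤ (P? k) (λ x → Q? x ×-dec ¬? (P? k x)) Q? (s (here refl)) proj₁ (λ p (_ , np) → np p))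

  fibres-≥ : ∀ {Q : Fin v → Set} (Q? : Decidable Q) ks → (∀ {x} → Q x → ∃ λ k → k ∈ ks × P k x) →
             # Q? ≤ List.foldr (λ k n → # (P? k) + n) 0 ks
  fibres-≥ Q? [] c = ≡⇒≤ (#-none Q? (λ x q → case proj₁ (proj₂ (c q)) of λ ()))
  fibres-≥ Q? (k ∷ ks) c = ≤-trans (≡⇒≤ (#-split Q? (P? k))) (+-mono-≤ (#-mono (λ x → Q? x ×-dec P? k x) (P? k) proj₂)
    (fibres-≥ (λ x → Q? x ×-dec ¬? (P? k x)) ks (λ (q , np) → rest (c q) np)))
    where
    rest : ∀ {x} → (∃ λ l → l ∈ k ∷ ks × P l x) → ¬ P k x → ∃ λ l → l ∈ ks × P l x
    rest (l , here refl , p) np = contradiction p np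
    rest (l , there l∈ , p)  np = l , l∈ , p

restrictP : ∀ {v m n} → PAct v n → (L : Vec Bool m → Vec Bool n) → (∀ u w → L (u ⊕ w) ≡ L u ⊕ L w) → L 𝟎 ≡ 𝟎 → PAct v m
restrictP A L L-⊕ L-𝟎 = record
  { act   = λ u → act (L u)
  ; act-⊕ = λ u w x → trans (cong (λ z → act z x) (L-⊕ u w)) (act-⊕ (L u) (L w) x)
  ; act-𝟎 = λ x → trans (cong (λ z → act z x) L-𝟎) (act-𝟎 x) }
  where open PAct A

restrict : ∀ {v} {D : Design v} {m n} → Action D n → (L : Vec Bool m → Vec Bool n) → (∀ u w → L (u ⊕ w) ≡ L u ⊕ L w) → L 𝟎 ≡ 𝟎 → Action D m
restrict A L L-⊕ L-𝟎 = record { P = restrictP P L L-⊕ L-𝟎 ; B = restrictP B L L-⊕ L-𝟎 ; inc⁺ = λ u → inc⁺ (L u) }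
  where open Action A

pullP : ∀ {v n} → PAct v (suc n) → Vec Bool (suc n) → PAct v n
pullP A k = restrictP A (ker k) (ker-⊕ k) (ker-𝟎 k)

pull : ∀ {v} {D : Design v} {n} → Action D (suc n) → Vec Bool (suc n) → Action D n
pull A k = restrict A (ker k) (ker-⊕ k) (ker-𝟎 k)

module _ {v n} (A : PAct v (suc n)) {k : Vec Bool (suc n)} (k≢𝟎 : k ≢ 𝟎) where
  open PAct
  open Hyperplanes A using (HF; HF?)

  pull⇒HF : ∀ {x} → Fixed (pullP A k) x → HF k x
  pull⇒HF {x} h u e = let (w , q) = ker-surjective k k≢𝟎 u e in subst (λ z → act A z x ≡ x) q (h w)

  HF⇒pull : ∀ {x} → HF k x → Fixed (pullP A k) x
  HF⇒pull h u = h (ker k u) (ker-∈ k u)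

  pull-count : # (fixed? (pullP A k)) ≡ # (HF? k)
  pull-count = #-cong (fixed? (pullP A k)) (HF? k) pull⇒HF HF⇒pull

Faithful : ∀ {v} {D : Design v} {n} → Action D n → Set
Faithful {n = n} A = ∀ (u : Vec Bool n) → u ≢ 𝟎 → ∃ λ x → PAct.act (Action.P A) u x ≢ x

pull-faithful : ∀ {v} {D : Design v} {n} (A : Action D (suc n)) k → Faithful A → Faithful (pull A k)
pull-faithful A k fa u u≢ = fa (ker k u) (λ e → u≢ (ker-injective k u e))

-- β and γ generate a four-group acting freely on `P`. On the representatives x < β x of the
-- β-orbits, γ induces the fixed-point-free involution `τ`, which picks the representative of the
-- β-orbit of γ x.
four-divides : ∀ {v} {P : Fin v → Set} (P? : Decidable P) (β γ : Fin v → Fin v) →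
               (∀ {x} → P x → P (β x)) → (∀ {x} → P x → P (γ x)) → (∀ x → β (β x) ≡ x) → (∀ x → γ (γ x) ≡ x) → (∀ x → β (γ x) ≡ γ (β x)) →
               (∀ {x} → P x → β x ≢ x × γ x ≢ x × β (γ x) ≢ x) → ∃ λ q → # P? ≡ q * 4
four-divides {v} {P} P? β γ invβ invγ β² γ² comm free = halves (involution-mod2 P′? τ inv τ²)
  where
  P′? : Decidable (λ x → P x × x Fin.< β x)
  P′? x = P? x ×-dec (x Finₚ.<? β x)
  select : ∀ {x} → Dec (γ x Fin.< β (γ x)) → Fin v
  select {x} (yes _) = γ x
  select {x} (no _)  = β (γ x)
  τ : Fin v → Fin v
  τ x = select {x} (γ x Finₚ.<? β (γ x))
  Choice : Fin v → Set
  Choice x = (τ x ≡ γ x × γ x Fin.< β (γ x)) ⊎ (τ x ≡ β (γ x) × ¬ (γ x Fin.< β (γ x)))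
  choice : ∀ x → Choice x
  choice x = by (γ x Finₚ.<? β (γ x))
    where
    by : (d : Dec (γ x Fin.< β (γ x))) → (select {x} d ≡ γ x × γ x Fin.< β (γ x)) ⊎ (select {x} d ≡ β (γ x) × ¬ (γ x Fin.< β (γ x)))
    by (yes l) = inj₁ (refl , l)
    by (no ¬l) = inj₂ (refl , ¬l)
  other : ∀ {x} → P x → ¬ (x Fin.< β x) → β x Fin.< x
  other {x} p ¬l = [ (λ l → contradiction l ¬l) , [ (λ e → contradiction (sym e) (proj₁ (free p))) , id ]′ ]′ (cmp (Finₚ.<-cmp x (β x)))
    where
    cmp : _ → x Fin.< β x ⊎ x ≡ β x ⊎ β x Fin.< x
    cmp (tri< a _ _) = inj₁ a
    cmp (tri≈ _ b _) = inj₂ (inj₁ b)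
    cmp (tri> _ _ c) = inj₂ (inj₂ c)
  inv : ∀ {x} → P x × x Fin.< β x → P (τ x) × τ x Fin.< β (τ x)
  inv {x} (p , l) = [ (λ (e , l′) → subst (λ z → P z × z Fin.< β z) (sym e) (invγ p , l′))
                    , (λ (e , ¬l) → subst (λ z → P z × z Fin.< β z) (sym e) (invβ (invγ p) , subst (β (γ x) Fin.<_) (sym (β² (γ x))) (other (invγ p) ¬l))) ]′ (choice x)
  τ² : ∀ {x} → P x × x Fin.< β x → τ (τ x) ≡ x
  τ² {x} (p , l) = [ (λ (e , l′) → trans (cong τ e) (at₁ (choice (γ x)))) , (λ (e , ¬l) → trans (cong τ e) (at₂ (choice (β (γ x))))) ]′ (choice x)
    where
    at₁ : Choice (γ x) → τ (γ x) ≡ x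
    at₁ (inj₁ (e , _)) = trans e (γ² x)
    at₁ (inj₂ (_ , ¬l)) = contradiction (subst (λ z → z Fin.< β z) (sym (γ² x)) l) ¬l
    γβγ : γ (β (γ x)) ≡ β x
    γβγ = trans (sym (comm (γ x))) (cong β (γ² x))
    at₂ : Choice (β (γ x)) → τ (β (γ x)) ≡ x
    at₂ (inj₁ (_ , l′)) = contradiction (subst₂ Fin._<_ γβγ (trans (cong β γβγ) (β² x)) l′) (Finₚ.<-asym l)
    at₂ (inj₂ (e , _)) = trans e (trans (cong β γβγ) (β² x))
  halves : # P′? ≡ # (λ x → P′? x ×-dec (τ x Finₚ.≟ x)) mod-via 2 → ∃ λ q → # P? ≡ q * 4
  halves (q , e) = q , trans (involution-fixed P? β invβ (λ {x} _ → β² x))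
    (trans (cong₂ (λ a b → a + b * 2) (#-none (λ x → P? x ×-dec (β x Finₚ.≟ x)) (λ x (p , e) → proj₁ (free p) e))
      (trans e (cong (_+ q * 2) (#-none (λ x → P′? x ×-dec (τ x Finₚ.≟ x)) (λ x ((p , _) , e) → no-fix p e))))) (quad q))
    where
    quad : ∀ q → 0 + (0 + q * 2) * 2 ≡ q * 4
    quad = solve-∀
    no-fix : ∀ {x} → P x → τ x ≢ x
    no-fix {x} p e = [ (λ (e′ , _) → proj₁ (proj₂ (free p)) (trans (sym e′) e)) , (λ (e′ , _) → proj₂ (proj₂ (free p)) (trans (sym e′) e)) ]′ (choice x)

-- Fixed-point bounds for elementary abelian groups of order 2, 4, 8 and 16

nonzero : ∀ n → List (Vec Bool n)
nonzero n = filter (λ k → ¬? (k ≟ᵥ 𝟎)) (allVecs n)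

∈-nonzero : ∀ {n} {k : Vec Bool n} → k ≢ 𝟎 → k ∈ nonzero n
∈-nonzero k≢𝟎 = ∈-filter⁺ (λ k → ¬? (k ≟ᵥ 𝟎)) (∈-allVecs _) k≢𝟎

nonzero⇒ : ∀ n {k : Vec Bool n} → k ∈ nonzero n → k ≢ 𝟎
nonzero⇒ n k∈ = proj₂ (∈-filter⁻ (λ k → ¬? (k ≟ᵥ 𝟎)) {xs = allVecs n} k∈)

unique-nonzero : ∀ n → Unique (nonzero n)
unique-nonzero n = Uniqueₚ.filter⁺ (λ k → ¬? (k ≟ᵥ 𝟎)) (unique-allVecs n)

module GroupSums {v} (v≡81 : v ≡ 81) {D : Design v} {n} (A : Action D n) where
  open Fixing A public
  open Unfixed A public using (mate; mate-degree; unfixed-degree)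
  open Hyperplanes P public

  unfixed? : Decidable (λ x → ¬ FixedPt x)
  unfixed? x = ¬? (fixpt? x)

  S₀ S₁ Q₀ Q₁ m : ℕ
  S₀ = ∑On fixpt? s
  S₁ = ∑On unfixed? s
  Q₀ = ∑On fixpt? (λ x → s x * s x)
  Q₁ = ∑On unfixed? (λ x → s x * s x)
  m  = # unfixed?

  fb≡f : # fixbl? ≡ f
  fb≡f = fixed-blocks≡fixed-points v≡81 A

  S-sum : S₀ + S₁ ≡ 16 * f
  S-sum = trans (sym (∑-partition fixpt? s)) (trans (∑-deg fixbl?) (cong (16 *_) fb≡f))

  Q-sum : Q₀ + Q₁ ≡ 3 * (f * f) + 13 * f
  Q-sum = trans (sym (∑-partition fixpt? (λ x → s x * s x))) (trans (∑-deg² fixbl?) (cong (λ n → 3 * (n * n) + 13 * n) fb≡f))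

  f+m : f + m ≡ 81
  f+m = trans (sym (#-complement fixpt?)) v≡81

  -- Sums (s - 1)(s - 3) ≥ 0, valid at the values 0, 1, 3 of s.
  four-S₁ : 4 * S₁ ≤ Q₁ + 3 * m
  four-S₁ = subst₂ _≤_ (∑On-*ˡ unfixed? 4 s) (trans (∑On-+ unfixed? _ _) (cong (Q₁ +_) (∑On-const unfixed? 3)))
    (∑On-mono unfixed? (λ nx → at (unfixed-degree nx)))
    where
    at : ∀ {k} → k ≡ 0 ⊎ k ≡ 1 ⊎ k ≡ 3 → 4 * k ≤ k * k + 3
    at (inj₁ refl)        = z≤n
    at (inj₂ (inj₁ refl)) = ≤-refl
    at (inj₂ (inj₂ refl)) = ≤-refl

  ten-S₀ : 10 * S₀ ≤ Q₀ + 24 * f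
  ten-S₀ = subst₂ _≤_ (∑On-*ˡ fixpt? 10 s) (trans (∑On-+ fixpt? _ _) (cong (Q₀ +_) (∑On-const fixpt? 24))) (∑On-mono fixpt? ten-s)

  odd-f : odd f ≡ true
  odd-f = FixedCount.odd-f v≡81 A

  paired? : Decidable (λ x → ¬ FixedPt x × 2 ≤ s x)
  paired? x = unfixed? x ×-dec (2 ≤? s x)

  S₁≤ : S₁ ≤ m + 2 * # paired?
  S₁≤ = subst₂ _≤_ refl (trans (∑-+ _ _) (cong (m +_) (∑-*ˡ 2 (λ x → ι (paired? x))))) (∑-mono λ x → at x (unfixed? x) (2 ≤? s x))
    where
    at : ∀ x (d : Dec (¬ FixedPt x)) (d′ : Dec (2 ≤ s x)) → ι d * s x ≤ ι d + 2 * ι (d ×-dec d′)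
    at x (no _) _ = z≤n
    at x (yes nx) (no ¬2) = ≤-trans (≡⇒≤ (*-identityˡ (s x))) (ℕ.s≤s⁻¹ (≰⇒> ¬2))
    at x (yes nx) (yes _) = ≤-trans (≡⇒≤ (*-identityˡ (s x))) (le (unfixed-degree nx))
      where
      le : ∀ {k} → k ≡ 0 ⊎ k ≡ 1 ⊎ k ≡ 3 → k ≤ 3
      le (inj₁ refl)        = z≤n
      le (inj₂ (inj₁ refl)) = s≤s z≤n
      le (inj₂ (inj₂ refl)) = ≤-refl

  -- The point and its mate form a pair preserved by the group, so the stabiliser is the kernel of
  -- the sign on this pair.
  paired⇒strict : ∀ {x} → ¬ FixedPt x × 2 ≤ s x → ∃ λ k → k ∈ nonzero n × Strict k x
  paired⇒strict (nx , 2≤s) = let (q , q≢x , keeps) = mate nx 2≤s ; (k , k≢𝟎 , st) = keeps-HF nx q≢x keeps in k , ∈-nonzero k≢𝟎 , st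

  N-sum : List (Vec Bool n) → ℕ
  N-sum = List.foldr (λ k c → N k + c) 0

  paired≤ : # paired? ≤ N-sum (nonzero n)
  paired≤ = fibres-≥ strict? paired? (nonzero n) paired⇒strict

  -- A point with stabiliser of index two is joined to the other point of its orbit by a fixed
  -- block, and there is only one.
  lone-block : f ≡ 1 → ∃ λ j₀ → ∀ {k x} → Strict k x → Inc x j₀
  lone-block f≡1 = build (#-witness fixbl? (≡⇒≥ #1))
    where
    #1 : # fixbl? ≡ 1
    #1 = trans fb≡f f≡1
    build : ∃ FixedBl → ∃ λ j₀ → ∀ {k x} → Strict k x → Inc x j₀
    build (j₀ , fj₀) = j₀ , λ {k} st → let (q , q≢x , keeps) = HF-keeps k st ; (j , (xj , _) , fj) = join-block q≢x keeps in subst (Inc _) (same fj) xj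
      where
      same : ∀ {j} → FixedBl j → j ≡ j₀
      same {j} fj = decidable-stable (j Finₚ.≟ j₀) λ ne → contradiction
        (subst (2 ≤_) #1 (subst (2 ≤_) (sym (#-remove fixbl? j₀ fj₀)) (s≤s (#-pos (λ i → fixbl? i ×-dec ¬? (i Finₚ.≟ j₀)) (fj , ne))))) (λ { (s≤s ()) })

  lone-sum : f ≡ 1 → ∀ ks → Unique ks → N-sum ks ≤ 16
  lone-sum f≡1 ks u = let (j₀ , on) = lone-block f≡1 in
    ≤-trans (fibres-≤ strict? (λ x → inc? x j₀) ks u (λ {k} _ st → on {k} st) (λ {k} {l} a b → HF-unique k l a (proj₁ b))) (≡⇒≤ (blk-size j₀))

  odd-3≤ : f ≢ 1 → 3 ≤ f
  odd-3≤ = three f odd-f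
    where
    three : ∀ k → odd k ≡ true → k ≢ 1 → 3 ≤ k
    three zero () _
    three (suc zero) _ ne = contradiction refl ne
    three (suc (suc zero)) () _
    three (suc (suc (suc k))) _ _ = s≤s (s≤s (s≤s z≤n))

module _ {v} (v≡81 : v ≡ 81) {D : Design v} where

  order-2-count : (A : Action D 1) → Faithful A → Fixing.f A ≡ 9 ⊎ Fixing.f A ≡ 13 ⊎ Fixing.f A ≡ 17
  order-2-count A fa = subst (λ k → k ≡ 9 ⊎ k ≡ 13 ⊎ k ≡ 17)
    (#-cong (λ x → pt (true ∷ []) x Finₚ.≟ x) fixpt? (λ { e (false ∷ []) → pt-𝟎 _ ; e (true ∷ []) → e }) (λ h → h (true ∷ [])))
    (InvolutionFixed.fixed-count v≡81 (involution (true ∷ [])) (fa (true ∷ []) λ ()))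
    where open Fixing A

  module _ {n} (A : Action D (suc n)) where
    open GroupSums v≡81 A

    hyperplane-count : ∀ {k} → k ≢ 𝟎 → Fixing.f (pull A k) ≡ f + N k
    hyperplane-count {k} k≢𝟎 = trans (pull-count P k≢𝟎) (HF-count k)

  -- For f = 1 each of the three involutions has N ≥ 8, but the N add up to at most 16. The upper
  -- bound uses f + N ≤ 17, which leaves few moved points with s = 3.
  order-4-count : (A : Action D 2) → Faithful A → 3 ≤ Fixing.f A × Fixing.f A ≤ 9
  order-4-count A fa = odd-3≤ not-1 , ≮⇒≥ not-large
    where
    open GroupSums v≡81 A
    inv-count : ∀ {k} → k ≢ 𝟎 → f + N k ≡ 9 ⊎ f + N k ≡ 13 ⊎ f + N k ≡ 17
    inv-count {k} k≢𝟎 = subst (λ c → c ≡ 9 ⊎ c ≡ 13 ⊎ c ≡ 17) (hyperplane-count A k≢𝟎) (order-2-count (pull A k) (pull-faithful A k fa))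
    9≤ : ∀ {k} → k ≢ 𝟎 → 9 ≤ f + N k
    9≤ k≢𝟎 = [ ≡⇒≥ , [ (λ e → ≤-trans (toWitness {a? = 9 ≤? 13} tt) (≡⇒≥ e)) , (λ e → ≤-trans (toWitness {a? = 9 ≤? 17} tt) (≡⇒≥ e)) ]′ ]′ (inv-count k≢𝟎)
    ≤17 : ∀ {k} → k ≢ 𝟎 → f + N k ≤ 17
    ≤17 k≢𝟎 = [ (λ e → ≤-trans (≡⇒≤ e) (toWitness {a? = 9 ≤? 17} tt)) , [ (λ e → ≤-trans (≡⇒≤ e) (toWitness {a? = 13 ≤? 17} tt)) , ≡⇒≤ ]′ ]′ (inv-count k≢𝟎)
    a b c : Vec Bool 2
    a = false ∷ true ∷ []
    b = true ∷ false ∷ []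
    c = true ∷ true ∷ []
    not-1 : f ≢ 1
    not-1 f≡1 = absurd {ρ = f ∷ N a ∷ N b ∷ N c ∷ []}
      (hyp 1 (v1 :+ (v2 :+ (v3 :+ con 0))) (con 16) (lone-sum f≡1 (nonzero 2) (unique-nonzero 2)) ∷ hyp 3 v0 (con 1) (≡⇒≤ f≡1)
       ∷ hyp 1 (con 9) (v0 :+ v1) (9≤ {a} λ ()) ∷ hyp 1 (con 9) (v0 :+ v2) (9≤ {b} λ ()) ∷ hyp 1 (con 9) (v0 :+ v3) (9≤ {c} λ ()) ∷ [])
    m₂≤ : # paired? + 3 * f ≤ 51
    m₂≤ = ≮⇒≥ λ lt → absurd {ρ = f ∷ N a ∷ N b ∷ N c ∷ # paired? ∷ []}
      (hyp 1 v4 (v1 :+ (v2 :+ (v3 :+ con 0))) paired≤ ∷ hyp 1 (v0 :+ v1) (con 17) (≤17 {a} λ ()) ∷ hyp 1 (v0 :+ v2) (con 17) (≤17 {b} λ ()) ∷ hyp 1 (v0 :+ v3) (con 17) (≤17 {c} λ ())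
       ∷ hyp 1 (con 52) (v4 :+ 3 :* v0) lt ∷ [])
    -- From (s - 4)(s - 6) ≥ 0 on fixed points and (s - 1)(s - 3) ≥ 0 on moved ones; at f = 10 it
    -- reads 1680 ≤ 1641, and it fails up to 17.
    F²≥ : 168 * f ≤ 3 * (f * f) + 1341
    F²≥ = ≮⇒≥ λ lt → absurd {ρ = f ∷ f * f ∷ S₀ ∷ S₁ ∷ Q₀ ∷ Q₁ ∷ m ∷ # paired? ∷ []}
      (hyp 1 (con 1 :+ (3 :* v1 :+ con 1341)) (168 :* v0) lt ∷ hyp 1 (10 :* v2) (v4 :+ 24 :* v0) ten-S₀ ∷ hyp 6 v3 (v6 :+ 2 :* v7) S₁≤ ∷ hyp 10 (16 :* v0) (v2 :+ v3) (≡⇒≥ S-sum)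
       ∷ hyp 1 (4 :* v3) (v5 :+ 3 :* v6) four-S₁ ∷ hyp 1 (v4 :+ v5) (3 :* v1 :+ 13 :* v0) (≡⇒≤ Q-sum) ∷ hyp 12 (v7 :+ 3 :* v0) (con 51) m₂≤ ∷ hyp 9 (v0 :+ v6) (con 81) (≡⇒≤ f+m) ∷ [])
      where
      v6 : ∀ {n} → Lin (7 + n)
      v6 = var (suc (suc (suc (suc (suc (suc zero))))))
      v7 : ∀ {n} → Lin (8 + n)
      v7 = var (suc (suc (suc (suc (suc (suc (suc zero)))))))
    not-large : ¬ (9 < f)
    not-large 9<f = toWitness {a? = ℕₚ.allUpTo? (λ k → 9 <? k →-dec (odd k Boolₚ.≟ true) →-dec ¬? (168 * k ≤? 3 * (k * k) + 1341)) 18} tt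
      (s≤s (≤-trans (m≤m+n f (N a)) (≤17 {a} λ ()))) 9<f odd-f F²≥

  order-8-count : (A : Action D 3) → Faithful A → 3 ≤ Fixing.f A × Fixing.f A ≤ 7
  order-8-count A fa = odd-3≤ not-1 , at-most-7 f odd-f (≤-trans (m≤m+n f (N (false ∷ false ∷ true ∷ []))) (≤9 {false ∷ false ∷ true ∷ []} (λ ()))) not-9
    where
    open GroupSums v≡81 A
    at-most-7 : ∀ k → odd k ≡ true → k ≤ 9 → k ≢ 9 → k ≤ 7
    at-most-7 k o l ne = toWitness {a? = ℕₚ.allUpTo? (λ k → (odd k Boolₚ.≟ true) →-dec ¬? (k ℕₚ.≟ 9) →-dec k ≤? 7) 10} tt (s≤s l) o ne
    bounds : ∀ {k} → k ≢ 𝟎 → 3 ≤ f + N k × f + N k ≤ 9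
    bounds {k} k≢𝟎 = subst (λ c → 3 ≤ c × c ≤ 9) (hyperplane-count A k≢𝟎) (order-4-count (pull A k) (pull-faithful A k fa))
    ≤9 : ∀ {k} → k ≢ 𝟎 → f + N k ≤ 9
    ≤9 k≢𝟎 = proj₂ (bounds k≢𝟎)
    -- Subgroups of order 4 fix at most 9 points, so here every N is 0, no moved point has s ≥ 2,
    -- and S₁ ≤ m. The moments then give 132 f ≤ 3 f² + 729, which is 1188 ≤ 972.
    not-9 : f ≢ 9
    not-9 f≡9 = absurd {ρ = f ∷ f * f ∷ S₀ ∷ S₁ ∷ Q₀ ∷ Q₁ ∷ m ∷ []}
      (hyp 1 (10 :* v2) (v4 :+ 24 :* v0) ten-S₀ ∷ hyp 6 v3 v6 S₁≤m ∷ hyp 10 (16 :* v0) (v2 :+ v3) (≡⇒≥ S-sum)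
       ∷ hyp 1 (4 :* v3) (v5 :+ 3 :* v6) four-S₁ ∷ hyp 1 (v4 :+ v5) (3 :* v1 :+ 13 :* v0) (≡⇒≤ Q-sum) ∷ hyp 9 (v0 :+ v6) (con 81) (≡⇒≤ f+m)
       ∷ hyp 132 (con 9) v0 (≡⇒≥ f≡9) ∷ hyp 3 v1 (con 81) (≡⇒≤ (cong (λ k → k * k) f≡9)) ∷ [])
      where
      v6 : ∀ {n} → Lin (7 + n)
      v6 = var (suc (suc (suc (suc (suc (suc zero))))))
      N≡0 : ∀ {k} → k ≢ 𝟎 → N k ≡ 0
      N≡0 {k} k≢𝟎 = ℕₚ.n≤0⇒n≡0 (ℕₚ.+-cancelˡ-≤ 9 (N k) 0 (subst (λ c → c + N k ≤ 9) f≡9 (≤9 k≢𝟎)))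
      S₁≤m : S₁ ≤ m
      S₁≤m = ≤-trans S₁≤ (≡⇒≤ (trans (cong (λ c → m + 2 * c) (#-none paired? (λ x p → let (k , k∈ , st) = paired⇒strict p in #-zero⇒ (strict? k) (N≡0 (nonzero⇒ 3 k∈)) x st))) (+-identityʳ m)))
    -- The seven hyperplanes form a Fano plane whose lines are the involutions, and `line` gives
    -- each line a sum of at least 8. Twice the total covers three lines, then `k₃`, `k₅`, `k₆` once
    -- more and `k₇` twice: 24 + 6 + 4 > 2 · 16.
    not-1 : f ≢ 1
    not-1 f≡1 = absurd {ρ = N k₁ ∷ N k₂ ∷ N k₃ ∷ N k₄ ∷ N k₅ ∷ N k₆ ∷ N k₇ ∷ []}
      (hyp 2 (v0 :+ (v1 :+ (v2 :+ (v3 :+ (v4 :+ (v5 :+ (v6 :+ con 0))))))) (con 16) (lone-sum f≡1 (nonzero 3) (unique-nonzero 3))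
       ∷ hyp 1 (con 8) (v0 :+ (v1 :+ v2)) (line e₁ e₂ e₃ k₁ k₂ k₃ (λ ()) (λ ()) (λ ()) (gen k₁ e₁ e₂) (gen k₂ e₁ e₃) (gen k₃ e₁ (e₂ ⊕ e₃)) refl refl refl (λ ()) (λ ()) (λ ()) (λ ()))
       ∷ hyp 1 (con 8) (v0 :+ (v3 :+ v4)) (line e₂ e₁ e₃ k₁ k₄ k₅ (λ ()) (λ ()) (λ ()) (gen k₁ e₂ e₁) (gen k₄ e₂ e₃) (gen k₅ e₂ (e₁ ⊕ e₃)) refl refl refl (λ ()) (λ ()) (λ ()) (λ ()))
       ∷ hyp 1 (con 8) (v1 :+ (v3 :+ v5)) (line e₃ e₁ e₂ k₂ k₄ k₆ (λ ()) (λ ()) (λ ()) (gen k₂ e₃ e₁) (gen k₄ e₃ e₂) (gen k₆ e₃ (e₁ ⊕ e₂)) refl refl refl (λ ()) (λ ()) (λ ()) (λ ()))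
       ∷ hyp 1 (con 2) v2 (2≤ k₃ λ ()) ∷ hyp 1 (con 2) v4 (2≤ k₅ λ ()) ∷ hyp 1 (con 2) v5 (2≤ k₆ λ ()) ∷ hyp 2 (con 2) v6 (2≤ k₇ λ ()) ∷ [])
      where
      v6 : ∀ {n} → Lin (7 + n)
      v6 = var (suc (suc (suc (suc (suc (suc zero))))))
      e₁ e₂ e₃ k₁ k₂ k₃ k₄ k₅ k₆ k₇ : Vec Bool 3
      e₁ = true ∷ false ∷ false ∷ []
      e₂ = false ∷ true ∷ false ∷ []
      e₃ = false ∷ false ∷ true ∷ []
      k₁ = false ∷ false ∷ true ∷ []
      k₂ = false ∷ true ∷ false ∷ []
      k₃ = false ∷ true ∷ true ∷ []
      k₄ = true ∷ false ∷ false ∷ []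
      k₅ = true ∷ false ∷ true ∷ []
      k₆ = true ∷ true ∷ false ∷ []
      k₇ = true ∷ true ∷ true ∷ []
      2≤ : ∀ k → k ≢ 𝟎 → 2 ≤ N k
      2≤ k k≢𝟎 = ℕ.s≤s⁻¹ (subst (λ c → 3 ≤ c + N k) f≡1 (proj₁ (bounds k≢𝟎)))
      Generated : Vec Bool 3 → Vec Bool 3 → Vec Bool 3 → Set
      Generated k u w = ∀ z → ⟨ k , z ⟩ ≡ false → z ≡ 𝟎 ⊎ z ≡ u ⊎ z ≡ w ⊎ z ≡ u ⊕ w
      gen : ∀ k u w {_ : True (∀Bool? (λ z → (⟨ k , z ⟩ Boolₚ.≟ false) →-dec ((z ≟ᵥ 𝟎) ⊎-dec (z ≟ᵥ u) ⊎-dec (z ≟ᵥ w) ⊎-dec (z ≟ᵥ u ⊕ w))))} → Generated k u w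
      gen k u w {t} = toWitness t
      generated : ∀ k u w → Generated k u w → ∀ {x} → pt u x ≡ x → pt w x ≡ x → HF k x
      generated k u w g {x} fu fw z e = [ (λ q → trans (cong (λ z → pt z x) q) (pt-𝟎 x)) , [ (λ q → trans (cong (λ z → pt z x) q) fu)
        , [ (λ q → trans (cong (λ z → pt z x) q) fw) , (λ q → trans (cong (λ z → pt z x) q) (trans (pt-⊕ u w x) (trans (cong (pt u) fw) fu))) ]′ ]′ ]′ (g z e)
      -- The points fixed by u but by no larger subgroup fall into regular orbits of ⟨ β , γ ⟩, hence N p + N q + N r is a multiple of 4.
      line : ∀ u β γ p q r → p ≢ 𝟎 → q ≢ 𝟎 → r ≢ 𝟎 → Generated p u β → Generated q u γ → Generated r u (β ⊕ γ) →
             ⟨ p , u ⟩ ≡ false → ⟨ q , u ⟩ ≡ false → ⟨ r , u ⟩ ≡ false →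
             p ≢ q → p ≢ r → q ≢ r → u ≢ 𝟎 → 8 ≤ N p + (N q + N r)
      line u β γ p q r p≢ q≢ r≢ gp gq gr pu qu ru p≢q p≢r q≢r u≢ = conclude (InvolutionFixed.fixed-count v≡81 (involution u) (fa u u≢)) (four-divides R? (pt β) (pt γ) (stable β) (stable γ) (pt² β) (pt² γ) (pt-comm β γ) free)
        where
        F? : Decidable (λ x → pt u x ≡ x)
        F? x = pt u x Finₚ.≟ x
        R₁? : Decidable (λ x → pt u x ≡ x × ¬ HF p x)
        R₁? x = F? x ×-dec ¬? (HF? p x)
        R₂? : Decidable (λ x → (pt u x ≡ x × ¬ HF p x) × ¬ HF q x)
        R₂? x = R₁? x ×-dec ¬? (HF? q x)
        R? : Decidable (λ x → ((pt u x ≡ x × ¬ HF p x) × ¬ HF q x) × ¬ HF r x)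
        R? x = R₂? x ×-dec ¬? (HF? r x)
        move : ∀ w k {x} → ¬ HF k x → ¬ HF k (pt w x)
        move w k nh h = nh λ z e → pt-inj w (trans (pt-comm w z _) (h z e))
        stable : ∀ w {x} → ((pt u x ≡ x × ¬ HF p x) × ¬ HF q x) × ¬ HF r x → ((pt u (pt w x) ≡ pt w x × ¬ HF p (pt w x)) × ¬ HF q (pt w x)) × ¬ HF r (pt w x)
        stable w {x} (((fu , np) , nq) , nr) = ((trans (pt-comm u w x) (cong (pt w) fu) , move w p np) , move w q nq) , move w r nr
        free : ∀ {x} → ((pt u x ≡ x × ¬ HF p x) × ¬ HF q x) × ¬ HF r x → pt β x ≢ x × pt γ x ≢ x × pt β (pt γ x) ≢ x
        free {x} (((fu , np) , nq) , nr) = (λ e → np (generated p u β gp fu e)) , (λ e → nq (generated q u γ gq fu e)) , (λ e → nr (generated r u (β ⊕ γ) gr fu (trans (pt-⊕ β γ x) e)))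
        count : # F? ≡ (f + N p) + (N q + (N r + # R?))
        count = trans (#-split F? (HF? p)) (cong₂ _+_ (trans (#-cong (λ x → F? x ×-dec HF? p x) (HF? p) proj₂ (λ h → h u pu , h)) (HF-count p))
          (trans (#-split R₁? (HF? q)) (cong₂ _+_ (#-cong (λ x → R₁? x ×-dec HF? q x) (strict? q)
              (λ ((_ , np) , h) → h , λ fx → np (fixed⇒HF p fx)) (λ (h , nf) → (h u qu , λ hp → p≢q (sym (HF-unique q p (h , nf) hp))) , h))
            (trans (#-split R₂? (HF? r)) (cong (_+ # R?) (#-cong (λ x → R₂? x ×-dec HF? r x) (strict? r)
              (λ (((_ , np) , _) , h) → h , λ fx → np (fixed⇒HF p fx))
              (λ (h , nf) → ((h u ru , λ hp → p≢r (sym (HF-unique r p (h , nf) hp))) , λ hq → q≢r (sym (HF-unique r q (h , nf) hq))) , h)))))))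
        conclude : # F? ≡ 9 ⊎ # F? ≡ 13 ⊎ # F? ≡ 17 → (∃ λ t → # R? ≡ t * 4) → 8 ≤ N p + (N q + N r)
        conclude c (t , e) = toWitness {a? = ℕₚ.allUpTo? (λ k → 0 % 4 ℕₚ.≟ k % 4 →-dec 6 ≤? k →-dec 8 ≤? k) 17} tt
            (small (N p + (N q + N r)) (≤-trans (m≤m+n _ (t * 4)) (≡⇒≥ total≡))) (sym (trans (sym (mod⇒% 4 (t , total≡))) (zero-mod c)))
            (+-mono-≤ (2≤ p p≢) (+-mono-≤ (2≤ q q≢) (2≤ r r≢)))
          where
          total : ℕ
          total = # F? ∸ 1
          total≡ : total ≡ N p + (N q + N r) + t * 4
          total≡ = trans (cong (_∸ 1) (trans count (cong₂ (λ a b → (a + N p) + (N q + (N r + b))) f≡1 e))) (shape (N p) (N q) (N r) (t * 4))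
            where
            shape : ∀ a b c d → a + (b + (c + d)) ≡ a + (b + c) + d
            shape = solve-∀
          small : ∀ k → k ≤ total → k < 17
          small k le = s≤s (≤-trans le (bound c))
            where
            bound : # F? ≡ 9 ⊎ # F? ≡ 13 ⊎ # F? ≡ 17 → total ≤ 16
            bound (inj₁ z)        = ≤-trans (≡⇒≤ (cong (_∸ 1) z)) (toWitness {a? = 8 ≤? 16} tt)
            bound (inj₂ (inj₁ z)) = ≤-trans (≡⇒≤ (cong (_∸ 1) z)) (toWitness {a? = 12 ≤? 16} tt)
            bound (inj₂ (inj₂ z)) = ≡⇒≤ (cong (_∸ 1) z)
          zero-mod : # F? ≡ 9 ⊎ # F? ≡ 13 ⊎ # F? ≡ 17 → total % 4 ≡ 0
          zero-mod (inj₁ z)        = cong (λ k → (k ∸ 1) % 4) z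
          zero-mod (inj₂ (inj₁ z)) = cong (λ k → (k ∸ 1) % 4) z
          zero-mod (inj₂ (inj₂ z)) = cong (λ k → (k ∸ 1) % 4) z

  -- For f = 1 each of the 15 subgroups of order 8 has N ≥ 2, while the N add up to at most 16.
  order-16-count : (A : Action D 4) → Faithful A → 3 ≤ Fixing.f A
  order-16-count A fa = odd-3≤ λ f≡1 → contradiction (≤-trans (twice f≡1 (nonzero 4) (λ k∈ → nonzero⇒ 4 k∈)) (lone-sum f≡1 (nonzero 4) (unique-nonzero 4)))
      (toWitness {a? = ¬? (30 ≤? 16)} tt)
    where
    open GroupSums v≡81 A
    twice : f ≡ 1 → ∀ ks → (∀ {k} → k ∈ ks → k ≢ 𝟎) → 2 * length ks ≤ N-sum ks
    twice f≡1 []       _  = z≤n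
    twice f≡1 (k ∷ ks) nz = subst (_≤ N-sum (k ∷ ks)) (sym (*-distribˡ-+ 2 1 (length ks)))
      (+-mono-≤ (ℕ.s≤s⁻¹ (subst (λ c → 3 ≤ c + N k) f≡1 (subst (3 ≤_) (hyperplane-count A (nz (here refl))) (proj₁ (order-8-count (pull A k) (pull-faithful A k fa)))))) (twice f≡1 ks (nz ∘ there)))

-- Groups of order 16

opaque
  unfolding ∑

  -- The handshake lemma: the entries off the diagonal come in equal pairs.
  symmetric-even : ∀ {n} (R : Fin n → Fin n → ℕ) → (∀ i j → R i j ≡ R j i) → (∀ i → R i i ≡ 0) → odd (∑ (λ i → ∑ (R i))) ≡ false
  symmetric-even {zero}  R sym-R irr = refl
  symmetric-even {suc n} R sym-R irr = trans (cong odd shape) (trans (odd-+ (∑ (λ j → R zero (suc j)) * 2) _)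
      (cong₂ _xor_ (odd-double (∑ (λ j → R zero (suc j)))) (symmetric-even (λ i j → R (suc i) (suc j)) (λ i j → sym-R (suc i) (suc j)) (λ i → irr (suc i)))))
    where
    row rest : ℕ
    row  = ∑ (λ j → R zero (suc j))
    rest = ∑ (λ i → ∑ (λ j → R (suc i) (suc j)))
    arrange : ∀ r t → 0 + r + (r + t) ≡ r * 2 + t
    arrange = solve-∀
    shape : R zero zero + row + ∑ (λ i → R (suc i) zero + ∑ (λ j → R (suc i) (suc j))) ≡ row * 2 + rest
    shape = trans (cong₂ (λ a b → a + row + b) (irr zero) (trans (∑-+ (λ i → R (suc i) zero) (λ i → ∑ (λ j → R (suc i) (suc j)))) (cong (_+ rest) (∑-cong (λ i → sym-R (suc i) zero)))))
      (arrange row rest)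

∑On-remove : ∀ {v} {P : Fin v → Set} (P? : Decidable P) (g : Fin v → ℕ) {x} → P x → ∑On P? g ≡ g x + ∑On (λ y → P? y ×-dec ¬? (y Finₚ.≟ x)) g
∑On-remove P? g {x} px = trans (∑-cong at) (trans (∑-+ _ _) (cong (_+ ∑On (λ y → P? y ×-dec ¬? (y Finₚ.≟ x)) g) (∑-≡ x g)))
  where
  at : ∀ y → ι (P? y) * g y ≡ ι (y Finₚ.≟ x) * g y + ι (P? y ×-dec ¬? (y Finₚ.≟ x)) * g y
  at y = trans (cong (_* g y) (split (P? y) (y Finₚ.≟ x) λ { refl → px })) (*-distribʳ-+ (g y) (ι (y Finₚ.≟ x)) _)
    where
    split : ∀ {A B : Set} (a : Dec A) (b : Dec B) → (B → A) → ι a ≡ ι b + ι (a ×-dec ¬? b)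
    split (yes _) (yes _) _ = refl
    split (yes _) (no _)  _ = refl
    split (no ¬a) (yes b) h = contradiction (h b) ¬a
    split (no _)  (no _)  _ = refl

sumOver : ∀ {v} → List (Fin v) → (Fin v → ℕ) → ℕ
sumOver L g = List.foldr (λ x c → g x + c) 0 L

sumOver-≤ : ∀ {v} {P : Fin v → Set} (P? : Decidable P) (g : Fin v → ℕ) L → Unique L → All P L → sumOver L g ≤ ∑On P? g
sumOver-≤ P? g []      _        _          = z≤n
sumOver-≤ P? g (x ∷ L) (x∉ ∷ u) (px ∷ ps) = subst (g x + sumOver L g ≤_) (sym (∑On-remove P? g px))
  (+-monoʳ-≤ (g x) (sumOver-≤ (λ y → P? y ×-dec ¬? (y Finₚ.≟ x)) g L u (All.zipWith (λ (p , ne) → p , λ e → ne (sym e)) (ps , x∉))))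

length≤# : ∀ {v} {P : Fin v → Set} (P? : Decidable P) L → Unique L → All P L → length L ≤ # P?
length≤# P? L u ps = subst₂ _≤_ (ones L) (trans (∑On-const P? 1) (*-identityˡ (# P?))) (sumOver-≤ P? (λ _ → 1) L u ps)
  where
  ones : ∀ L → sumOver L (λ _ → 1) ≡ length L
  ones []      = refl
  ones (x ∷ L) = cong suc (ones L)

all-listed : ∀ {v} {P : Fin v → Set} (P? : Decidable P) L → Unique L → All P L → # P? ≡ length L → ∀ {w} → P w → w ∈ L
all-listed P? L u ps e {w} pw = decidable-stable (Any.any? (w Finₚ.≟_) L) λ w∉ →
  1+n≰n (subst (suc (length L) ≤_) e (length≤# P? (w ∷ L) (Allₚ.¬Any⇒All¬ L w∉ ∷ u) (pw ∷ ps)))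

-- Two fixed blocks whose common points lie on no third block

record Tripod {v} {D : Design v} {n} (A : Action D n) (x y z a b : Fin v) : Set where
  open Fixing A
  field
    fx : FixedPt x
    fy : FixedPt y
    fz : FixedPt z
    fa : FixedBl a
    fb : FixedBl b
    xa : Inc x a
    xb : Inc x b
    ya : Inc y a
    yb : Inc y b
    za : Inc z a
    zb : Inc z b
    y≢x : y ≢ x
    z≢x : z ≢ x
    z≢y : z ≢ y
    b≢a : b ≢ a
    no-third : ∀ {c} → c ≢ a → c ≢ b → Inc x c → Inc y c → ¬ Inc z c

module FindTripod {v} (v≡81 : v ≡ 81) {D : Design v} {n} (A : Action D (suc n)) (2≤f : 2 ≤ Fixing.f A) where
  open Fixing A
  open PAct P using (sign)
  open Hyperplanes P using (HF)

  KernelTripod : Set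
  KernelTripod = ∃ λ k → k ≢ 𝟎 × ∃ λ x → ∃ λ y → ∃ λ z → ∃ λ a → ∃ λ b → Tripod (pull A k) x y z a b

  module _ {x d : Fin v} (fx : FixedPt x) (fd : FixedBl d) (xd : Inc x d) where

    Q : Fin v → Set
    Q j = (FixedBl j × Inc x j) × ¬ (j ≡ d)

    Q? : Decidable Q
    Q? j = (fixbl? j ×-dec inc? x j) ×-dec ¬? (j Finₚ.≟ d)

    Q-odd : odd (# Q?) ≡ true
    Q-odd = flip (trans (cong odd (sym (#-remove (λ j → fixbl? j ×-dec inc? x j) d (fd , xd)))) s-odd)
      where
      s-odd : odd (s x) ≡ false
      s-odd = trans (cong odd (#-cong (λ j → fixbl? j ×-dec inc? x j) (λ j → inc? x j ×-dec fixbl? j) (λ (p , q) → q , p) (λ (p , q) → q , p)))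
        (trans (sym (odd-mod (fixed-mod2 B (inc? x) (λ u i → inc-fixed fx i u)))) (cong odd (pt-size x)))
      flip : ∀ {b} → not b ≡ false → b ≡ true
      flip {true} _ = refl

    -- Two blocks of `Q` that cut d in the same three points.
    Pillow : Fin v → Fin v → Set
    Pillow i j = (Q i × Q j) × (i ≢ j × (∀ w → Inc w d × Inc w i → Inc w j) × (∀ w → Inc w d × Inc w j → Inc w i))

    pillow? : ∀ i j → Dec (Pillow i j)
    pillow? i j = (Q? i ×-dec Q? j) ×-dec (¬? (i Finₚ.≟ j) ×-dec all? (λ w → (inc? w d ×-dec inc? w i) →-dec inc? w j) ×-dec all? (λ w → (inc? w d ×-dec inc? w j) →-dec inc? w i))

    -- A partner is unique: d, i and the partner are already all the blocks joining x to a second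
    -- point of d ∩ i. If every block had a partner, the symmetric relation would pair off `Q`,
    -- whose size is odd.
    lonely : ∃ λ i → Q i × ∀ j → ¬ Pillow i j
    lonely = search (any? (λ i → Q? i ×-dec all? (λ j → ¬? (pillow? i j))))
      where
      search : Dec (∃ λ i → Q i × ∀ j → ¬ Pillow i j) → ∃ λ i → Q i × ∀ j → ¬ Pillow i j
      search (yes r) = r
      search (no ¬r) = contradiction (trans (sym Q-odd) (trans (cong odd (∑-cong row)) (symmetric-even (λ i j → ι (pillow? i j))
          (λ i j → ι-cong (pillow? i j) (pillow? j i) turn turn) (λ i → ι-no (pillow? i i) (λ (_ , ne , _) → ne refl))))) λ ()
        where
        turn : ∀ {i j} → Pillow i j → Pillow j i
        turn ((qi , qj) , ne , f , g) = (qj , qi) , (ne ∘ sym) , g , f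
        partner : ∀ {i} → Q i → ∃ (Pillow i)
        partner {i} qi = decidable-stable (any? (pillow? i)) λ none → ¬r (i , qi , λ j p → none (j , p))
        unique-partner : ∀ {i j k} → Pillow i j → Pillow i k → j ≡ k
        unique-partner {i} {j} {k} ((((_ , xi) , i≢d) , (_ , xj) , j≢d) , i≢j , ij , _) ((_ , (_ , xk) , k≢d) , i≢k , ik , _) =
          from (#-two (meet? d i) (subst (2 ≤_) (sym (blk-pair i≢d)) (s≤s (s≤s z≤n))) (xd , xi))
          where
          from : (∃ λ y → (Inc y d × Inc y i) × y ≢ x) → j ≡ k
          from (y , (yd , yi) , y≢x) = [ (λ e → contradiction (sym e) (j≢d ∘ sym)) , [ (λ e → contradiction (sym e) i≢j) , id ]′ ]′
            (all-three (join? x y) (pt-pair y≢x) (xd , yd) (xi , yi) (xk , ik y (yd , yi)) i≢d k≢d (i≢k ∘ sym) (xj , ij y (yd , yi)))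
        row : ∀ i → ι (Q? i) ≡ # (pillow? i)
        row i = at (Q? i)
          where
          at : (q : Dec (Q i)) → ι q ≡ # (pillow? i)
          at (no ¬q) = sym (#-none (pillow? i) (λ j ((qi , _) , _) → ¬q qi))
          at (yes q) = let (j , p) = partner q in sym (trans (#-cong (pillow? i) (Finₚ._≟ j) (λ p′ → unique-partner p′ p) (λ { refl → p })) (#-≡ j))

    from-lonely : (∃ λ i → Q i × ∀ j → ¬ Pillow i j) → KernelTripod
    from-lonely (i , qi@((fi , xi) , i≢d) , alone) = from (#-two (meet? d i) (subst (2 ≤_) (sym (blk-pair i≢d)) (s≤s (s≤s z≤n))) (xd , xi))
      where
      from : (∃ λ y → (Inc y d × Inc y i) × y ≢ x) → KernelTripod
      from (y , (yd , yi) , y≢x) = from-third (meet-third i≢d (xd , xi) (yd , yi) y≢x)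
        where
        from-third : Third (meet? d i) x y → KernelTripod
        from-third (mkThird z (zd , zi) z≢x z≢y only) = choose (sign z≢y keeps)
          where
          avoid-x : ∀ u {w} → w ≢ x → pt u w ≢ x
          avoid-x u w≢x e = w≢x (pt-inj u (trans e (sym (fx u))))
          cases : ∀ u {w} → Inc w d → Inc w i → w ≢ x → pt u w ≡ y ⊎ pt u w ≡ z
          cases u wd wi w≢x = [ (λ e → contradiction e (avoid-x u w≢x)) , id ]′ (only (fixed-inc fd wd u , fixed-inc fi wi u))
          keeps : KeepsPts y z
          keeps u = [ (λ ey → inj₁ (ey , [ (λ ez → contradiction (pt-inj u (trans ez (sym ey))) z≢y) , id ]′ (cases u zd zi z≢x)))
                    , (λ ey → inj₂ (ey , trans (cong (pt u) (sym ey)) (pt² u y))) ]′ (cases u yd yi y≢x)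
          no-third : ∀ {c} → c ≢ d → c ≢ i → Inc x c → Inc y c → ¬ Inc z c
          no-third {c} c≢d c≢i xc yc zc = alone c ((qi , (fc , xc) , c≢d) , (c≢i ∘ sym) , (λ w m → [ (λ { refl → xc }) , [ (λ { refl → yc }) , (λ { refl → zc }) ]′ ]′ (only m))
              , (λ w m → [ (λ { refl → xi }) , [ (λ { refl → yi }) , (λ { refl → zi }) ]′ ]′ (all-three (meet? d c) (blk-pair c≢d) (xd , xc) (yd , yc) (zd , zc) y≢x z≢x z≢y m)))
            where
            -- The group fixes x and preserves {y, z}, and c contains all three. So every image of c
            -- joins x and y, and it is neither d nor i.
            fc : FixedBl c
            fc u = [ (λ e → contradiction (bl-inj u (trans e (sym (fd u)))) c≢d) , [ (λ e → contradiction (bl-inj u (trans e (sym (fi u)))) c≢i) , id ]′ ]′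
              (all-three (join? x y) (pt-pair y≢x) (xd , yd) (xi , yi) (xc , yc) i≢d c≢d c≢i
                (inc-fixed fx xc u , [ (λ (ey , _) → subst (λ w → Inc w (bl u c)) ey (inc⁺ u yc)) , (λ (_ , ez) → subst (λ w → Inc w (bl u c)) ez (inc⁺ u zc)) ]′ (keeps u)))
          tripod : ∀ k → (∀ u → ⟨ k , u ⟩ ≡ false → pt u y ≡ y) → Tripod (pull A k) x y z d i
          tripod k h = record
            { fx = λ u → fx (ker k u) ; fy = λ u → h (ker k u) (ker-∈ k u)
            ; fz = λ u → [ proj₂ , (λ (ey , _) → contradiction (trans (sym ey) (h (ker k u) (ker-∈ k u))) z≢y) ]′ (keeps (ker k u))
            ; fa = λ u → fd (ker k u) ; fb = λ u → fi (ker k u)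
            ; xa = xd ; xb = xi ; ya = yd ; yb = yi ; za = zd ; zb = zi ; y≢x = y≢x ; z≢x = z≢x ; z≢y = z≢y ; b≢a = i≢d ; no-third = no-third }
          choose : (∃ λ k → ∀ u → pt u y ≡ y ⇔ ⟨ k , u ⟩ ≡ false) → KernelTripod
          choose (k , h) = by (k ≟ᵥ 𝟎)
            where
            by : Dec (k ≡ 𝟎) → KernelTripod
            by (no k≢𝟎)  = k , k≢𝟎 , x , y , z , d , i , tripod k (λ u e → Equivalence.from (h u) e)
            -- If y and z are already fixed by the whole group, any subgroup of index two serves.
            by (yes k≡𝟎) = true ∷ 𝟎 , (λ ()) , x , y , z , d , i , tripod (true ∷ 𝟎) (λ u _ → Equivalence.from (h u) (trans (cong (λ l → ⟨ l , u ⟩) k≡𝟎) (⟨𝟎,⟩ u)))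

  kernel-tripod : KernelTripod
  kernel-tripod = first (#-witness fixpt? (<⇒≤ 2≤f))
    where
    first : ∃ FixedPt → KernelTripod
    first (x , fx) = second (#-two fixpt? 2≤f fx)
      where
      second : (∃ λ y → FixedPt y × y ≢ x) → KernelTripod
      second (y , fy , y≢x) = let (d , (xd , _) , fd) = join-block y≢x (fixed-keeps fx fy) in from-lonely fx fd xd (lonely fx fd xd)

-- The incidence matrix of xs against ds is J − I of order 5.
record Pentad {v} {D : Design v} {n} (A : Action D n) : Set where
  open Fixing A
  field
    xs ds : Fin 5 → Fin v
    fxs   : ∀ i → FixedPt (xs i)
    fds   : ∀ i → FixedBl (ds i)
    on    : ∀ {i j} → i ≢ j → Inc (xs i) (ds j)
    off   : ∀ i → ¬ Inc (xs i) (ds i)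

module _ {v} {D : Design v} {n} (A : Action D n) where
  open Fixing A

  record JoinThird (x y a b : Fin v) : Set where
    field
      c    : Fin v
      xc   : Inc x c
      yc   : Inc y c
      c≢a  : c ≢ a
      c≢b  : c ≢ b
      fc   : FixedBl c
      only : ∀ {w} → Inc x w → Inc y w → w ≡ a ⊎ w ≡ b ⊎ w ≡ c

  opaque
    -- The group permutes the three blocks joining two fixed points; if two of them are fixed, so is
    -- the third.
    joinThird : ∀ {x y a b} → y ≢ x → FixedPt x → FixedPt y → FixedBl a → FixedBl b → Inc x a → Inc y a → Inc x b → Inc y b → b ≢ a → JoinThird x y a b
    joinThird {x} {y} {a} {b} y≢x fx fy fa fb xa ya xb yb b≢a = build (join-third y≢x (xa , ya) (xb , yb) b≢a)
      where
      build : Third (join? x y) a b → JoinThird x y a b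
      build (mkThird c (xc , yc) c≢a c≢b only) = record
        { c = c ; xc = xc ; yc = yc ; c≢a = c≢a ; c≢b = c≢b ; only = λ p q → only (p , q)
        ; fc = λ u → [ (λ e → contradiction (bl-inj u (trans e (sym (fa u)))) c≢a) , [ (λ e → contradiction (bl-inj u (trans e (sym (fb u)))) c≢b) , id ]′ ]′
                 (only (inc-fixed fx xc u , inc-fixed fy yc u)) }

module FromTripod {v} (v≡81 : v ≡ 81) {D : Design v} {n} (A : Action D n) (f≤7 : Fixing.f A ≤ 7) where
  open GroupSums v≡81 A
  open JoinThird

  private
    swap-xy : ∀ {x y z a b} → Tripod A x y z a b → Tripod A y x z a b
    swap-xy t = record
      { fx = fy ; fy = fx ; fz = fz ; fa = fa ; fb = fb ; xa = ya ; xb = yb ; ya = xa ; yb = xb ; za = za ; zb = zb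
      ; y≢x = y≢x ∘ sym ; z≢x = z≢y ; z≢y = z≢x ; b≢a = b≢a ; no-third = λ p q r s → no-third p q s r }
      where open Tripod t

    swap-yz : ∀ {x y z a b} → Tripod A x y z a b → Tripod A x z y a b
    swap-yz t = record
      { fx = fx ; fy = fz ; fz = fy ; fa = fa ; fb = fb ; xa = xa ; xb = xb ; ya = za ; yb = zb ; za = ya ; zb = yb
      ; y≢x = z≢x ; z≢x = y≢x ; z≢y = z≢y ∘ sym ; b≢a = b≢a ; no-third = λ p q r s u → no-third p q r u s }
      where open Tripod t

    through? : ∀ x → Decidable (λ j → FixedBl j × Inc x j)
    through? x j = fixbl? j ×-dec inc? x j

    even-≥4 : ∀ {x} → FixedPt x → ∀ {a b c} → b ≢ a → c ≢ a → c ≢ b → FixedBl a × Inc x a → FixedBl b × Inc x b → FixedBl c × Inc x c → 4 ≤ s x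
    even-≥4 {x} fx {a} {b} {c} b≢a c≢a c≢b pa pb pc = toWitness {a? = ℕₚ.allUpTo? (λ k → k % 2 ℕₚ.≟ 0 →-dec 3 ≤? k →-dec 4 ≤? k) 17} tt
      (s≤s (s≤16 x)) (s-even fx) (length≤# (through? x) (a ∷ b ∷ c ∷ []) (((b≢a ∘ sym) ∷ (c≢a ∘ sym) ∷ []) ∷ ((c≢b ∘ sym) ∷ []) ∷ [] ∷ []) (pa ∷ pb ∷ pc ∷ []))

    four-or-six : ∀ {x} → FixedPt x → 4 ≤ s x → s x ≡ 4 ⊎ 6 ≤ s x
    four-or-six {x} fx 4≤ = toWitness {a? = ℕₚ.allUpTo? (λ k → k % 2 ℕₚ.≟ 0 →-dec 4 ≤? k →-dec ((k ℕₚ.≟ 4) ⊎-dec (6 ≤? k))) 17} tt (s≤s (s≤16 x)) (s-even fx) 4≤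

    -- The square (k - 2)² in ℕ: of the two truncated differences one is 0.
    spread : ℕ → ℕ
    spread k = (k ∸ 2) * (k ∸ 2) + (2 ∸ k) * (2 ∸ k)

    spread-eq : ∀ x → s x * s x + 4 ≡ 4 * s x + spread (s x)
    spread-eq x = toWitness {a? = ℕₚ.allUpTo? (λ k → k * k + 4 ℕₚ.≟ 4 * k + spread k) 17} tt (s≤s (s≤16 x))

    spread-4 : ∀ x → 4 ≤ s x → 4 ≤ spread (s x)
    spread-4 x = toWitness {a? = ℕₚ.allUpTo? (λ k → 4 ≤? k →-dec 4 ≤? spread k) 17} tt (s≤s (s≤16 x))

    spread-6 : ∀ x → 6 ≤ s x → 16 ≤ spread (s x)
    spread-6 x = toWitness {a? = ℕₚ.allUpTo? (λ k → 6 ≤? k →-dec 16 ≤? spread k) 17} tt (s≤s (s≤16 x))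

    E : ℕ
    E = ∑On fixpt? (λ x → spread (s x))

    E-eq : Q₀ + 4 * f ≡ 4 * S₀ + E
    E-eq = trans (cong (Q₀ +_) (sym (∑On-const fixpt? 4))) (trans (sym (∑On-+ fixpt? _ _)) (trans (∑On-cong fixpt? (λ {x} _ → spread-eq x))
      (trans (∑On-+ fixpt? _ _) (cong (_+ E) (∑On-*ˡ fixpt? 4 s)))))

    s≤f : ∀ x → s x ≤ f
    s≤f x = ≤-trans (#-mono (through? x) fixbl? proj₁) (≡⇒≤ fb≡f)

    -- E = Q₀ - 4 S₀ + 4 f, and `four-S₁` bounds Q₁ from below: E ≤ 238 + 222 + 28 - 448 at f = 7.
    E≤40 : f ≡ 7 → E ≤ 40
    E≤40 f≡7 = ≮⇒≥ λ lt → absurd {ρ = f ∷ f * f ∷ S₀ ∷ S₁ ∷ Q₀ ∷ Q₁ ∷ m ∷ E ∷ []}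
      (hyp 1 (con 41) v7 lt ∷ hyp 1 (4 :* v2 :+ v7) (v4 :+ 4 :* v0) (≡⇒≥ E-eq) ∷ hyp 4 (16 :* v0) (v2 :+ v3) (≡⇒≥ S-sum)
       ∷ hyp 1 (4 :* v3) (v5 :+ 3 :* v6) four-S₁ ∷ hyp 1 (v4 :+ v5) (3 :* v1 :+ 13 :* v0) (≡⇒≤ Q-sum) ∷ hyp 3 (v0 :+ v6) (con 81) (≡⇒≤ f+m)
       ∷ hyp 50 (con 7) v0 (≡⇒≥ f≡7) ∷ hyp 3 v1 (con 49) (≡⇒≤ (cong (λ k → k * k) f≡7)) ∷ [])
      where
      v6 : ∀ {n} → Lin (7 + n)
      v6 = var (suc (suc (suc (suc (suc (suc zero))))))
      v7 : ∀ {n} → Lin (8 + n)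
      v7 = var (suc (suc (suc (suc (suc (suc (suc zero)))))))

  module Around {x y z a b} (t : Tripod A x y z a b) where
    open Tripod t

    -- The configuration closes up from here: `tc`, `te`, `tg` supply a third fixed block on each of
    -- the pairs xy, xz, yz, and `tp`, `tq` a third fixed point on the first of these together with
    -- b and with a.
    tc : JoinThird A x y a b
    tc = joinThird A y≢x fx fy fa fb xa ya xb yb b≢a
    te : JoinThird A x z a b
    te = joinThird A z≢x fx fz fa fb xa za xb zb b≢a
    tg : JoinThird A y z a b
    tg = joinThird A z≢y fy fz fa fb ya za yb zb b≢a

    z∉c : ¬ Inc z (c tc)
    z∉c = no-third (c≢a tc) (c≢b tc) (xc tc) (yc tc)
    y∉e : ¬ Inc y (c te)
    y∉e ye = no-third (c≢a te) (c≢b te) (xc te) ye (yc te)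
    x∉g : ¬ Inc x (c tg)
    x∉g xg = no-third (c≢a tg) (c≢b tg) xg (xc tg) (yc tg)

    tp : JoinThird (dual-action A) b (c tc) x y
    tp = joinThird (dual-action A) (c≢b tc) fb (fc tc) fx fy xb (xc tc) yb (yc tc) y≢x
    tq : JoinThird (dual-action A) a (c tc) x y
    tq = joinThird (dual-action A) (c≢a tc) fa (fc tc) fx fy xa (xc tc) ya (yc tc) y≢x

    p q : Fin v
    p = c tp
    q = c tq

    p≢z : p ≢ z
    p≢z e = z∉c (subst (λ w → Inc w (c tc)) e (yc tp))
    q≢z : q ≢ z
    q≢z e = z∉c (subst (λ w → Inc w (c tc)) e (yc tq))
    p∉a : ¬ Inc p a
    p∉a pa = [ c≢a tp , [ c≢b tp , p≢z ]′ ]′ (all-three (meet? a b) (blk-pair b≢a) (xa , xb) (ya , yb) (za , zb) y≢x z≢x z≢y (pa , xc tp))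
    q∉b : ¬ Inc q b
    q∉b qb = [ c≢a tq , [ c≢b tq , q≢z ]′ ]′ (all-three (meet? a b) (blk-pair b≢a) (xa , xb) (ya , yb) (za , zb) y≢x z≢x z≢y (xc tq , qb))

    q≢p : q ≢ p
    q≢p e = p∉a (subst (λ w → Inc w a) e (xc tq))

    e≢c : c te ≢ c tc
    e≢c e = z∉c (subst (Inc z) e (yc te))
    g≢c : c tg ≢ c tc
    g≢c e = z∉c (subst (Inc z) e (yc tg))

    4≤x : 4 ≤ s x
    4≤x = even-≥4 fx b≢a (c≢a tc) (c≢b tc) (fa , xa) (fb , xb) (fc tc , xc tc)
    4≤y : 4 ≤ s y
    4≤y = even-≥4 fy b≢a (c≢a tc) (c≢b tc) (fa , ya) (fb , yb) (fc tc , yc tc)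
    4≤z : 4 ≤ s z
    4≤z = even-≥4 fz b≢a (c≢a te) (c≢b te) (fa , za) (fb , zb) (fc te , yc te)

    xp : JoinThird A x p b (c tc)
    xp = joinThird A (c≢a tp) fx (fc tp) fb (fc tc) xb (xc tp) (xc tc) (yc tp) (c≢b tc)
    xq : JoinThird A x q a (c tc)
    xq = joinThird A (c≢a tq) fx (fc tq) fa (fc tc) xa (xc tq) (xc tc) (yc tq) (c≢a tc)
    yp : JoinThird A y p b (c tc)
    yp = joinThird A (c≢b tp) fy (fc tp) fb (fc tc) yb (xc tp) (yc tc) (yc tp) (c≢b tc)
    yq : JoinThird A y q a (c tc)
    yq = joinThird A (c≢b tq) fy (fc tq) fa (fc tc) ya (xc tq) (yc tc) (yc tq) (c≢a tc)

    4≤p : 4 ≤ s p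
    4≤p = even-≥4 (fc tp) (c≢b tc) (c≢a xp) (c≢b xp) (fb , xc tp) (fc tc , yc tp) (fc xp , yc xp)
    4≤q : 4 ≤ s q
    4≤q = even-≥4 (fc tq) (c≢a tc) (c≢a xq) (c≢b xq) (fa , xc tq) (fc tc , yc tq) (fc xq , yc xq)

    five : List (Fin v)
    five = x ∷ y ∷ z ∷ p ∷ q ∷ []

    five-unique : Unique five
    five-unique = ((y≢x ∘ sym) ∷ (z≢x ∘ sym) ∷ (c≢a tp ∘ sym) ∷ (c≢a tq ∘ sym) ∷ []) ∷ ((z≢y ∘ sym) ∷ (c≢b tp ∘ sym) ∷ (c≢b tq ∘ sym) ∷ [])
      ∷ ((p≢z ∘ sym) ∷ (q≢z ∘ sym) ∷ []) ∷ ((q≢p ∘ sym) ∷ []) ∷ [] ∷ []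

    five-fixed : All FixedPt five
    five-fixed = fx ∷ fy ∷ fz ∷ fc tp ∷ fc tq ∷ []

    5-or-7 : f ≡ 5 ⊎ f ≡ 7
    5-or-7 = toWitness {a? = ℕₚ.allUpTo? (λ k → 5 ≤? k →-dec (odd k Boolₚ.≟ true) →-dec ((k ℕₚ.≟ 5) ⊎-dec (k ℕₚ.≟ 7))) 8} tt
      (s≤s f≤7) (length≤# fixpt? five five-unique five-fixed) odd-f

    -- For f = 5 no s exceeds 5. For f = 7 the five points would contribute 16 + 16 + 4 + 4 + 4 > 40
    -- to `E`.
    not-both : 6 ≤ s x → 6 ≤ s y → ⊥
    not-both 6≤x 6≤y = [ (λ f≡5 → 1+n≰n (≤-trans 6≤x (≤-trans (s≤f x) (≡⇒≤ f≡5)))) , (λ f≡7 → contradiction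
        (≤-trans (≤-trans (+-mono-≤ (spread-6 x 6≤x) (+-mono-≤ (spread-6 y 6≤y) (+-mono-≤ (spread-4 z 4≤z) (+-mono-≤ (spread-4 p 4≤p) (+-mono-≤ (spread-4 q 4≤q) z≤n)))))
          (sumOver-≤ fixpt? (λ w → spread (s w)) five five-unique five-fixed)) (E≤40 f≡7)) (toWitness {a? = ¬? (44 ≤? 40)} tt)) ]′ 5-or-7

    -- All fixed blocks through x and through y are now known. The third block joining x to p or q
    -- can only be `c te`, and the third one joining y to p or q only `c tg`, which gives the four
    -- missing incidences.
    pentad : s x ≡ 4 → s y ≡ 4 → Pentad A
    pentad sx sy = record { xs = lookup (x ∷ y ∷ z ∷ p ∷ q ∷ []) ; ds = lookup (c tg ∷ c te ∷ c tc ∷ a ∷ b ∷ []) ; fxs = fxs ; fds = fds ; on = on ; off = off }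
      where
      at-x : ∀ {j} → FixedBl j → Inc x j → j ∈ a ∷ b ∷ c tc ∷ c te ∷ []
      at-x fj xj = all-listed (through? x) (a ∷ b ∷ c tc ∷ c te ∷ [])
        (((b≢a ∘ sym) ∷ (c≢a tc ∘ sym) ∷ (c≢a te ∘ sym) ∷ []) ∷ ((c≢b tc ∘ sym) ∷ (c≢b te ∘ sym) ∷ []) ∷ ((e≢c ∘ sym) ∷ []) ∷ [] ∷ [])
        ((fa , xa) ∷ (fb , xb) ∷ (fc tc , xc tc) ∷ (fc te , xc te) ∷ []) sx (fj , xj)
      at-y : ∀ {j} → FixedBl j → Inc y j → j ∈ a ∷ b ∷ c tc ∷ c tg ∷ []
      at-y fj yj = all-listed (through? y) (a ∷ b ∷ c tc ∷ c tg ∷ [])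
        (((b≢a ∘ sym) ∷ (c≢a tc ∘ sym) ∷ (c≢a tg ∘ sym) ∷ []) ∷ ((c≢b tc ∘ sym) ∷ (c≢b tg ∘ sym) ∷ []) ∷ ((g≢c ∘ sym) ∷ []) ∷ [] ∷ [])
        ((fa , ya) ∷ (fb , yb) ∷ (fc tc , yc tc) ∷ (fc tg , xc tg) ∷ []) sy (fj , yj)
      -- the third block joining two of the points is the fourth one through x (or y)
      last : ∀ {l j w} → j ∈ a ∷ b ∷ c tc ∷ l ∷ [] → Inc w j → (Inc w a → j ≢ a) → (Inc w b → j ≢ b) → j ≢ c tc → Inc w l
      last (here refl)                         i na _ _  = contradiction refl (na i)
      last (there (here refl))                 i _ nb _  = contradiction refl (nb i)
      last (there (there (here refl)))         i _ _  nc = contradiction refl nc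
      last (there (there (there (here refl)))) i _ _  _  = i
      pe : Inc p (c te)
      pe = last (at-x (fc xp) (xc xp)) (yc xp) (λ pa _ → p∉a pa) (λ _ → c≢a xp) (c≢b xp)
      qe : Inc q (c te)
      qe = last (at-x (fc xq) (xc xq)) (yc xq) (λ _ → c≢a xq) (λ qb _ → q∉b qb) (c≢b xq)
      pg : Inc p (c tg)
      pg = last (at-y (fc yp) (xc yp)) (yc yp) (λ pa _ → p∉a pa) (λ _ → c≢a yp) (c≢b yp)
      qg : Inc q (c tg)
      qg = last (at-y (fc yq) (xc yq)) (yc yq) (λ _ → c≢a yq) (λ qb _ → q∉b qb) (c≢b yq)
      fxs : ∀ i → FixedPt (lookup (x ∷ y ∷ z ∷ p ∷ q ∷ []) i)
      fxs 0F = fx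
      fxs 1F = fy
      fxs 2F = fz
      fxs 3F = fc tp
      fxs 4F = fc tq
      fds : ∀ i → FixedBl (lookup (c tg ∷ c te ∷ c tc ∷ a ∷ b ∷ []) i)
      fds 0F = fc tg
      fds 1F = fc te
      fds 2F = fc tc
      fds 3F = fa
      fds 4F = fb
      off : ∀ i → ¬ Inc (lookup (x ∷ y ∷ z ∷ p ∷ q ∷ []) i) (lookup (c tg ∷ c te ∷ c tc ∷ a ∷ b ∷ []) i)
      off 0F = x∉g
      off 1F = y∉e
      off 2F = z∉c
      off 3F = p∉a
      off 4F = q∉b
      on : ∀ {i j} → i ≢ j → Inc (lookup (x ∷ y ∷ z ∷ p ∷ q ∷ []) i) (lookup (c tg ∷ c te ∷ c tc ∷ a ∷ b ∷ []) j)
      on {0F} {0F} ne = contradiction refl ne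
      on {0F} {1F} _  = xc te
      on {0F} {2F} _  = xc tc
      on {0F} {3F} _  = xa
      on {0F} {4F} _  = xb
      on {1F} {0F} _  = xc tg
      on {1F} {1F} ne = contradiction refl ne
      on {1F} {2F} _  = yc tc
      on {1F} {3F} _  = ya
      on {1F} {4F} _  = yb
      on {2F} {0F} _  = yc tg
      on {2F} {1F} _  = yc te
      on {2F} {2F} ne = contradiction refl ne
      on {2F} {3F} _  = za
      on {2F} {4F} _  = zb
      on {3F} {0F} _  = pg
      on {3F} {1F} _  = pe
      on {3F} {2F} _  = yc tp
      on {3F} {3F} ne = contradiction refl ne
      on {3F} {4F} _  = xc tp
      on {4F} {0F} _  = qg
      on {4F} {1F} _  = qe
      on {4F} {2F} _  = yc tq
      on {4F} {3F} _  = xc tq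
      on {4F} {4F} ne = contradiction refl ne

  -- By `not-both` at most one of the three degrees exceeds 4, and the roles of x, y, z can be
  -- exchanged to put the other two in front.
  tripod⇒pentad : ∀ {x y z a b} → Tripod A x y z a b → Pentad A
  tripod⇒pentad {x} {y} {z} t = pick (four-or-six (Tripod.fx t) T₁.4≤x) (four-or-six (Tripod.fy t) T₁.4≤y) (four-or-six (Tripod.fz t) T₁.4≤z)
    where
    module T₁ = Around t
    module T₂ = Around (swap-yz t)
    module T₃ = Around (swap-yz (swap-xy t))
    pick : s x ≡ 4 ⊎ 6 ≤ s x → s y ≡ 4 ⊎ 6 ≤ s y → s z ≡ 4 ⊎ 6 ≤ s z → Pentad A
    pick (inj₁ sx) (inj₁ sy) _         = T₁.pentad sx sy
    pick (inj₁ sx) (inj₂ _)  (inj₁ sz) = T₂.pentad sx sz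
    pick (inj₂ _)  (inj₁ sy) (inj₁ sz) = T₃.pentad sy sz
    pick (inj₂ 6x) (inj₂ 6y) _         = ⊥-elim (T₁.not-both 6x 6y)
    pick (inj₂ 6x) (inj₁ _)  (inj₂ 6z) = ⊥-elim (T₂.not-both 6x 6z)
    pick (inj₁ _)  (inj₂ 6y) (inj₂ 6z) = ⊥-elim (T₃.not-both 6y 6z)

-- Fixed blocks around a configuration of type J - I

disjoint-∑ : ∀ {v m} {P : Fin m → Fin v → Set} (P? : ∀ k → Decidable (P k)) {Q : Fin v → Set} (Q? : Decidable Q) →
             (∀ {k x} → P k x → Q x) → (∀ {k l x} → P k x → P l x → k ≡ l) → ∑ (λ k → # (P? k)) ≤ # Q?
disjoint-∑ {v} {m} {P} P? {Q} Q? s d = ≤-trans (≡⇒≤ (∑-swap (λ k x → ι (P? k x)))) (∑-mono at)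
  where
  at : ∀ x → # (λ k → P? k x) ≤ ι (Q? x)
  at x = case any? (λ k → P? k x) of λ
    { (no none) → ≤-trans (≡⇒≤ (#-none (λ k → P? k x) (λ k p → none (k , p)))) z≤n
    ; (yes (k , p)) → ≤-trans (#-mono (λ l → P? l x) (Finₚ._≟ k) (λ q → d q p)) (≤-trans (≡⇒≤ (#-≡ k)) (≡⇒≥ (ι-yes (Q? x) (s p)))) }

gram : ∀ {l m} (w : Fin l → ℕ) (u : Fin l → Fin m → ℕ) →
       ∑ (λ β → ∑ (λ γ → ∑ (λ k → w k * (u k β * u k γ)))) ≡ ∑ (λ k → w k * (∑ (u k) * ∑ (u k)))
gram w u = trans (∑-cong (λ β → ∑-swap (λ γ k → w k * (u k β * u k γ)))) (trans (∑-swap (λ β k → ∑ (λ γ → w k * (u k β * u k γ))))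
  (∑-cong λ k → trans (∑-cong (λ β → ∑-*ˡ (w k) (λ γ → u k β * u k γ))) (trans (∑-*ˡ (w k) (λ β → ∑ (λ γ → u k β * u k γ))) (cong (w k *_) (sym (∑-*∑ (u k) (u k)))))))

#-others : ∀ {n} (i : Fin (suc n)) → # (λ j → ¬? (j Finₚ.≟ i)) ≡ n
#-others i = sym (suc-injective (trans (#-complement (Finₚ._≟ i)) (cong (_+ # (λ j → ¬? (j Finₚ.≟ i))) (#-≡ i))))

dual-pentad : ∀ {v} {D : Design v} {n} {A : Action D n} → Pentad A → Pentad (dual-action A)
dual-pentad J = record { xs = ds ; ds = xs ; fxs = fds ; fds = fxs ; on = λ ne → on (ne ∘ sym) ; off = off }
  where open Pentad J

module PentadBasics {v} {D : Design v} {n} (A : Action D n) (J : Pentad A) where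
  open Fixing A
  open Pentad J

  IsX : Fin v → Set
  IsX w = ∃ λ i → w ≡ xs i

  isX? : Decidable IsX
  isX? w = any? (λ i → w Finₚ.≟ xs i)

  xs-inj : ∀ {i j} → xs i ≡ xs j → i ≡ j
  xs-inj {i} {j} e = decidable-stable (i Finₚ.≟ j) λ ne → off j (subst (λ w → Inc w (ds j)) e (on ne))

  isX⇒fixed : ∀ {w} → IsX w → FixedPt w
  isX⇒fixed (i , e) = subst FixedPt (sym e) (fxs i)

  ∑-image : ∀ g → ∑On isX? g ≡ ∑ (λ i → g (xs i))
  ∑-image g = sym (trans (∑-cong (λ i → sym (∑-≡ (xs i) g))) (trans (∑-swap (λ i w → ι (w Finₚ.≟ xs i) * g w))
    (∑-cong λ w → trans (∑-cong (λ i → *-comm (ι (w Finₚ.≟ xs i)) (g w))) (trans (∑-*ˡ (g w) (λ i → ι (w Finₚ.≟ xs i))) (trans (*-comm (g w) _) (cong (_* g w) (hits w)))))))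
    where
    hits : ∀ w → # (λ i → w Finₚ.≟ xs i) ≡ ι (isX? w)
    hits w = at (isX? w)
      where
      at : (d : Dec (IsX w)) → # (λ i → w Finₚ.≟ xs i) ≡ ι d
      at (no ¬x) = #-none (λ i → w Finₚ.≟ xs i) (λ i e → ¬x (i , e))
      at (yes (i , e)) = trans (#-cong (λ k → w Finₚ.≟ xs k) (Finₚ._≟ i) (λ q → xs-inj (trans (sym q) e)) (λ { refl → e })) (#-≡ i)

  #-image : ∀ {P : Fin v → Set} (P? : Decidable P) → # (λ w → isX? w ×-dec P? w) ≡ # (λ i → P? (xs i))
  #-image P? = trans (∑-cong (λ w → ι-× (isX? w) (P? w))) (∑-image (λ w → ι (P? w)))

  -- Two of the five blocks already share three of the five points, and λ = 3.
  two-ds : ∀ {i j u} → i ≢ j → Inc u (ds i) → Inc u (ds j) → IsX u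
  two-ds {i} {j} {u} i≢j ui uj = let (k , _ , e) = ∈-map⁻ xs {xs = others} u∈ in k , e
    where
    other? : Decidable (λ k → (k ≢ i) × (k ≢ j))
    other? k = ¬? (k Finₚ.≟ i) ×-dec ¬? (k Finₚ.≟ j)
    others : List (Fin 5)
    others = filter other? (allFin 5)
    three : length others ≡ 3
    three = toWitness {a? = all? (λ i → all? (λ j → ¬? (i Finₚ.≟ j) →-dec (length (filter (λ k → ¬? (k Finₚ.≟ i) ×-dec ¬? (k Finₚ.≟ j)) (allFin 5)) ℕₚ.≟ 3)))} tt i j i≢j
    ds≢ : ds j ≢ ds i
    ds≢ e = off j (subst (Inc (xs j)) (sym e) (on (i≢j ∘ sym)))
    u∈ : u ∈ map xs others
    u∈ = all-listed (meet? (ds i) (ds j)) (map xs others)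
        (map-unique xs (λ _ _ → xs-inj) (Uniqueₚ.filter⁺ other? (Uniqueₚ.allFin⁺ 5)))
        (Allₚ.map⁺ (All.tabulate λ {k} k∈ → let (_ , k≢i , k≢j) = ∈-filter⁻ other? {xs = allFin 5} k∈ in on k≢i , on k≢j))
        (trans (blk-pair ds≢) (sym (trans (Listₚ.length-map xs others) three))) (ui , uj)

module PentadTheory {v} (v≡81 : v ≡ 81) {D : Design v} {n} (A : Action D n) (J : Pentad A) where
  open GroupSums v≡81 A
  open Pentad J
  open PentadBasics A J public
  open PentadBasics (dual-action A) (dual-pentad J) public using () renaming (IsX to IsD; isX? to isD?; two-ds to two-xs; #-image to #-image-ds)
  private module Dual = Fixing (dual-action A)

  pass-mate : ∀ {z q γ} → ¬ FixedPt z → q ≢ z → KeepsPts z q → FixedBl γ → Inc z γ → Inc q γ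
  pass-mate {z} {q} nz q≢z keeps fγ zγ = let (u , ne) = pt-not-fixed nz in
    subst (λ w → Inc w _) ([ (λ (e , _) → contradiction e ne) , proj₁ ]′ (keeps u)) (fixed-inc fγ zγ u)

  through? : ∀ x → Decidable (λ j → FixedBl j × Inc x j)
  through? x j = fixbl? j ×-dec inc? x j

  unlisted? : Decidable (λ x → FixedPt x × ¬ IsX x)
  unlisted? x = fixpt? x ×-dec ¬? (isX? x)

  unlisted-count : f ≡ 5 + # unlisted?
  unlisted-count = trans (#-split fixpt? isX?) (cong (_+ # unlisted?) (trans (#-cong (λ x → fixpt? x ×-dec isX? x) (λ x → isX? x ×-dec yes tt) (λ (_ , x) → x , tt) (λ (x , _) → isX⇒fixed x , x))
    (trans (#-image {P = λ _ → ⊤} (λ _ → yes tt)) (#-all {P = λ _ → ⊤} (λ _ → yes tt) (λ _ → tt)))))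

  module _ (f≤9 : f ≤ 9) {a : Fin v} (fa : FixedBl a) (na : ¬ IsD a) where

    private
      ds≢a : ∀ j → ds j ≢ a
      ds≢a j e = na (j , sym e)

      t : Fin 5 → ℕ
      t j = # (Dual.joinFix? a (ds j))

      Extra : Fin v → Set
      Extra β = FixedBl β × ¬ (IsD β ⊎ β ≡ a)

      extra? : Decidable Extra
      extra? β = fixbl? β ×-dec ¬? (isD? β ⊎-dec (β Finₚ.≟ a))

      -- A further fixed block through a moved point of a ∩ `ds j`. Such blocks make up for the
      -- fixed points missing from this intersection.
      Near : Fin 5 → Fin v → Set
      Near j β = Extra β × ∃ λ z → ¬ FixedPt z × Inc z a × Inc z (ds j) × Inc z β

      near? : ∀ j → Decidable (Near j)
      near? j β = extra? β ×-dec any? (λ z → ¬? (fixpt? z) ×-dec inc? z a ×-dec inc? z (ds j) ×-dec inc? z β)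

      unfixed-ds : ∀ {z i j} → ¬ FixedPt z → Inc z (ds i) → Inc z (ds j) → i ≡ j
      unfixed-ds {i = i} {j} nz zi zj = decidable-stable (i Finₚ.≟ j) λ ne → nz (isX⇒fixed (two-ds ne zi zj))

      -- A moved point z of a ∩ `ds j` lies on two fixed blocks, hence on exactly three. The third
      -- is no `ds k`, because a point on two of the `ds` is one of the `xs` and thus fixed.
      near-exists : ∀ j → t j ≡ 1 → 1 ≤ # (near? j)
      near-exists j t≡1 = from (#-witness moved? (≤-trans (s≤s z≤n) (≡⇒≥ #moved)))
        where
        moved? : Decidable (λ z → (Inc z a × Inc z (ds j)) × ¬ FixedPt z)
        moved? z = meet? a (ds j) z ×-dec ¬? (fixpt? z)
        #moved : # moved? ≡ 2
        #moved = suc-injective (trans (cong (_+ # moved?) (sym t≡1)) (trans (sym (#-split (meet? a (ds j)) fixpt?)) (blk-pair (ds≢a j))))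
        from : (∃ λ z → (Inc z a × Inc z (ds j)) × ¬ FixedPt z) → 1 ≤ # (near? j)
        from (z , (za , zj) , nz) = with-mate (mate nz 2≤s)
          where
          2≤s : 2 ≤ s z
          2≤s = length≤# (through? z) (a ∷ ds j ∷ []) (((ds≢a j ∘ sym) ∷ []) ∷ [] ∷ []) ((fa , za) ∷ (fds j , zj) ∷ [])
          with-mate : (∃ λ q → q ≢ z × KeepsPts z q) → 1 ≤ # (near? j)
          with-mate (q , q≢z , keeps) = [ (λ e → contradiction (subst (2 ≤_) e 2≤s) (λ { (s≤s ()) })) , (λ e → with-third (third (through? z) e (fa , za) (fds j , zj) (ds≢a j))) ]′ (mate-degree nz q≢z keeps)
            where
            with-third : Third (through? z) a (ds j) → 1 ≤ # (near? j)
            with-third (mkThird β (fβ , zβ) β≢a β≢j _) = #-pos (near? j) {β} ((fβ , [ (λ (k , e) → β≢j (trans e (cong ds (unfixed-ds nz (subst (Inc z) e zβ) zj)))) , β≢a ]′) , z , nz , za , zj , zβ)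

      three≤ : ∀ j → 3 ≤ t j + 2 * # (near? j)
      three≤ j = [ (λ e → ≤-trans (+-monoʳ-≤ 1 (*-monoʳ-≤ 2 (near-exists j e))) (≡⇒≥ (cong (_+ 2 * # (near? j)) e))) , (λ e → ≤-trans (m≤m+n 3 _) (≡⇒≥ (cong (_+ 2 * # (near? j)) e))) ]′
        (Dual.join-1-3 (ds≢a j) (λ u → inj₁ (fa u , fds j u)))

      -- Otherwise a and β share a moved point and its mate on `ds i`, and another such pair on
      -- `ds j`: four points instead of three.
      near-disjoint : ∀ {i j β} → Near i β → Near j β → i ≡ j
      near-disjoint {i} {j} {β} ((fβ , nβ) , z , nz , za , zi , zβ) (_ , w , nw , wa , wj , wβ) = decidable-stable (i Finₚ.≟ j) λ i≢j →
          four i≢j (mate nz (2≤s nz za zβ)) (mate nw (2≤s nw wa wβ))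
        where
        β≢a : β ≢ a
        β≢a e = nβ (inj₂ e)
        2≤s : ∀ {z} → ¬ FixedPt z → Inc z a → Inc z β → 2 ≤ s z
        2≤s {z} nz za zβ = length≤# (through? z) (a ∷ β ∷ []) (((β≢a ∘ sym) ∷ []) ∷ [] ∷ []) ((fa , za) ∷ (fβ , zβ) ∷ [])
        four : i ≢ j → (∃ λ q → q ≢ z × KeepsPts z q) → (∃ λ q → q ≢ w × KeepsPts w q) → ⊥
        four i≢j (q , q≢z , kz) (r , r≢w , kw) = contradiction
          (subst (4 ≤_) (blk-pair β≢a) (length≤# (meet? a β) (z ∷ q ∷ w ∷ r ∷ [])
            (((q≢z ∘ sym) ∷ apart nz zi wj ∷ apart nz zi (pass nw r≢w kw (fds j) wj) ∷ []) ∷ (apart nq qi wj ∷ apart nq qi (pass nw r≢w kw (fds j) wj) ∷ []) ∷ ((r≢w ∘ sym) ∷ []) ∷ [] ∷ [])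
            ((za , zβ) ∷ (pass nz q≢z kz fa za , pass nz q≢z kz fβ zβ) ∷ (wa , wβ) ∷ (pass nw r≢w kw fa wa , pass nw r≢w kw fβ wβ) ∷ [])))
          (toWitness {a? = ¬? (4 ≤? 3)} tt)
          where
          pass : ∀ {z q γ} → ¬ FixedPt z → q ≢ z → KeepsPts z q → FixedBl γ → Inc z γ → Inc q γ
          pass = pass-mate
          qi : Inc q (ds i)
          qi = pass nz q≢z kz (fds i) zi
          nq : ¬ FixedPt q
          nq fq = let (u , ne) = pt-not-fixed nz in q≢z ([ (λ (e , _) → contradiction e ne) , (λ (_ , e) → trans (sym (fq u)) e) ]′ (kz u))
          apart : ∀ {z w} → ¬ FixedPt z → Inc z (ds i) → Inc w (ds j) → z ≢ w
          apart nz zi wj refl = i≢j (unfixed-ds nz zi wj)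

      near-sum : ∑ (λ j → # (near? j)) + 6 ≤ f
      near-sum = subst₂ _≤_ refl (trans (+-comm (# extra?) _) (trans (sym (#-split fixbl? (λ β → isD? β ⊎-dec (β Finₚ.≟ a)))) fb≡f))
        (+-mono-≤ (disjoint-∑ near? extra? proj₁ near-disjoint)
          (length≤# (λ β → fixbl? β ×-dec (isD? β ⊎-dec (β Finₚ.≟ a))) (a ∷ map ds (allFin 5))
            (Allₚ.map⁺ (All.tabulate (λ {j} _ e → ds≢a j (sym e))) ∷ map-unique ds (λ _ _ → PentadBasics.xs-inj (dual-action A) (dual-pentad J)) (Uniqueₚ.allFin⁺ 5))
            ((fa , inj₂ refl) ∷ Allₚ.map⁺ (All.tabulate (λ {j} _ → fds j , inj₁ (j , refl))))))

      inX? inM? : ∀ j → Decidable _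
      inX? j x = Dual.joinFix? a (ds j) x ×-dec isX? x
      inM? j x = Dual.joinFix? a (ds j) x ×-dec ¬? (isX? x)

      inM-sum : ∑ (λ j → # (inM? j)) ≤ # unlisted?
      inM-sum = disjoint-∑ inM? unlisted? (λ ((_ , fx) , nx) → fx , nx) (λ {i} {j} (((_ , xi) , _) , nx) (((_ , xj) , _) , _) → decidable-stable (i Finₚ.≟ j) λ ne → nx (two-ds ne xi xj))

      -- At most one of the `xs` lies on a, since two of them lie together only on the `ds`; that
      -- one is on four of the `ds`.
      inX-sum : ∑ (λ j → # (inX? j)) ≤ 4
      inX-sum = case any? (λ i → inc? (xs i) a) of λ
        { (no none) → ≤-trans (≡⇒≤ (∑-zero (λ j → #-none (inX? j) (λ { x (((xa , _) , _) , i , e) → none (i , subst (λ w → Inc w a) e xa) })))) z≤n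
        ; (yes (i , ia)) → ≤-trans (∑-mono (λ j → bound i ia j)) (≡⇒≤ (#-others i)) }
        where
        bound : ∀ i → Inc (xs i) a → ∀ j → # (inX? j) ≤ ι (¬? (j Finₚ.≟ i))
        bound i ia j = at (j Finₚ.≟ i)
          where
          only : ∀ {x} → ((Inc x a × Inc x (ds j)) × FixedPt x) × IsX x → x ≡ xs i
          only (((xa , _) , _) , k , e) = trans e (cong xs (decidable-stable (k Finₚ.≟ i) λ ne → na (two-xs ne (subst (λ w → Inc w a) e xa) ia)))
          at : (d : Dec (j ≡ i)) → # (inX? j) ≤ ι (¬? d)
          at (yes refl) = ≡⇒≤ (#-none (inX? i) (λ x p → off i (subst (λ w → Inc w (ds i)) (only p) (proj₂ (proj₁ (proj₁ p))))))
          at (no _)     = ≤-trans (#-mono (inX? j) (Finₚ._≟ xs i) only) (≡⇒≤ (#-≡ (xs i)))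

      t-sum : ∑ t ≤ # unlisted? + 4
      t-sum = subst (_≤ # unlisted? + 4) (sym (trans (∑-cong (λ j → trans (#-split (Dual.joinFix? a (ds j)) isX?) (+-comm (# (inX? j)) (# (inM? j))))) (∑-+ (λ j → # (inM? j)) (λ j → # (inX? j))))) (+-mono-≤ inM-sum inX-sum)

      fifteen : 15 ≤ ∑ t + 2 * ∑ (λ j → # (near? j))
      fifteen = subst₂ _≤_ (∑-const 5 3) (trans (∑-+ t _) (cong (∑ t +_) (∑-*ˡ 2 (λ j → # (near? j))))) (∑-mono three≤)

    -- 15 ≤ Σ t + 2 Σ near ≤ (f - 5 + 4) + 2 (f - 6) = 3 f - 13, which requires f ≥ 10.
    no-other-block : ⊥
    no-other-block = absurd {ρ = f ∷ ∑ t ∷ ∑ (λ j → # (near? j)) ∷ # unlisted? ∷ []}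
      (hyp 1 (con 15) (v1 :+ 2 :* v2) fifteen ∷ hyp 1 v1 (v3 :+ con 4) t-sum ∷ hyp 2 (v2 :+ con 6) v0 near-sum ∷ hyp 1 (con 5 :+ v3) v0 (≡⇒≥ unlisted-count) ∷ hyp 3 v0 (con 9) f≤9 ∷ [])

  only-ds : f ≤ 9 → ∀ {a} → FixedBl a → IsD a
  only-ds f≤9 {a} fa = decidable-stable (isD? a) (no-other-block f≤9 fa)

module _ {v} {D : Design v} {n} (A : Action D n) (J : Pentad A) where
  open Fixing A
  open Pentad J

  ds-degree : ∀ j → # (λ i → inc? (xs i) (ds j)) ≡ 4
  ds-degree j = trans (#-cong (λ i → inc? (xs i) (ds j)) (λ i → ¬? (i Finₚ.≟ j)) (λ i∈ e → off j (subst (λ k → Inc (xs k) (ds j)) e i∈)) on) (#-others j)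

  xs-degree : ∀ i → # (λ j → inc? (xs i) (ds j)) ≡ 4
  xs-degree i = trans (#-cong (λ j → inc? (xs i) (ds j)) (λ j → ¬? (j Finₚ.≟ i)) (λ j∈ e → off i (subst (λ k → Inc (xs i) (ds k)) e j∈)) (λ ne → on (ne ∘ sym))) (#-others i)

module Covering {v} (v≡81 : v ≡ 81) {D : Design v} {n} (A : Action D n) (J : Pentad A) (f≡13 : Fixing.f A ≡ 13) where
  open PentadTheory v≡81 A J
  open Fixing A
  open Pentad J
  private module Dual = Fixing (dual-action A)

  eight : # unlisted? ≡ 8
  eight = +-cancelˡ-≡ 5 (# unlisted?) 8 (trans (sym unlisted-count) f≡13)

  -- A block β missing all the `xs` meets each `ds j` in a fixed point outside them. As `ds j` has
  -- four of the `xs` and an even number of fixed points, it has at least two such points. No point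
  -- is on two `ds`, so 10 ≤ 8.
  covered : ∀ {β} → FixedBl β → ¬ IsD β → ∃ λ i → Inc (xs i) β
  covered {β} fβ nβ = case any? (λ i → inc? (xs i) β) of λ
    { (yes p) → p
    ; (no none) → contradiction (≤-trans (∑-mono (two none)) (≤-trans (disjoint-∑ on-ds? unlisted? proj₁ apart) (≡⇒≤ eight))) (λ le → contradiction (subst (_≤ 8) (∑-const 5 2) le) (toWitness {a? = ¬? (10 ≤? 8)} tt)) }
    where
    on-ds? : ∀ j → Decidable (λ y → (FixedPt y × ¬ IsX y) × Inc y (ds j))
    on-ds? j y = unlisted? y ×-dec inc? y (ds j)
    apart : ∀ {i j y} → (FixedPt y × ¬ IsX y) × Inc y (ds i) → (FixedPt y × ¬ IsX y) × Inc y (ds j) → i ≡ j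
    apart {i} {j} ((_ , ny) , yi) (_ , yj) = decidable-stable (i Finₚ.≟ j) λ ne → ny (two-ds ne yi yj)
    split : ∀ j → Dual.s (ds j) ≡ 4 + # (on-ds? j)
    split j = trans (#-split (λ y → fixpt? y ×-dec inc? y (ds j)) isX?) (cong₂ _+_
      (trans (#-cong (λ y → (fixpt? y ×-dec inc? y (ds j)) ×-dec isX? y) (λ y → isX? y ×-dec inc? y (ds j)) (λ ((_ , i) , x) → x , i) (λ (x , i) → (isX⇒fixed x , i) , x))
        (trans (#-image {P = λ y → Inc y (ds j)} (λ y → inc? y (ds j))) (ds-degree A J j)))
      (#-cong (λ y → (fixpt? y ×-dec inc? y (ds j)) ×-dec ¬? (isX? y)) (on-ds? j) (λ ((a , b) , c) → (a , c) , b) (λ ((a , c) , b) → (a , b) , c)))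
    even-pos : ∀ k → (4 + k) % 2 ≡ 0 → 1 ≤ k → 2 ≤ k
    even-pos zero _ ()
    even-pos (suc zero) () _
    even-pos (suc (suc k)) _ _ = s≤s (s≤s z≤n)
    two : (¬ ∃ λ i → Inc (xs i) β) → ∀ j → 2 ≤ # (on-ds? j)
    two none j = even-pos (# (on-ds? j)) (trans (cong (_% 2) (sym (split j))) (Dual.s-even (fds j))) (from (Dual.join-block ds≢β (λ u → inj₁ (fβ u , fds j u))))
      where
      ds≢β : ds j ≢ β
      ds≢β e = nβ (j , sym e)
      from : (∃ λ y → (Inc y β × Inc y (ds j)) × FixedPt y) → 1 ≤ # (on-ds? j)
      from (y , (yβ , yj) , fy) = #-pos (on-ds? j) ((fy , λ (i , e) → none (i , subst (λ w → Inc w β) e yβ)) , yj)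

module Cross {v} (v≡81 : v ≡ 81) {D : Design v} {n} (A : Action D n) (J : Pentad A) (f≡13 : Fixing.f A ≡ 13) where
  open GroupSums v≡81 A
  open Pentad J
  open PentadTheory v≡81 A J using (IsX; isX?; isX⇒fixed; ∑-image; #-image; #-image-ds; two-ds; two-xs; IsD; isD?; unlisted?)
  open Covering v≡81 A J f≡13
  open PentadTheory v≡81 (dual-action A) (dual-pentad J) using () renaming (unlisted? to other?)
  private module Dual = Fixing (dual-action A)
  open Covering v≡81 (dual-action A) (dual-pentad J) (trans fb≡f f≡13) using () renaming (covered to dual-covered; eight to dual-eight)

  t : Fin v → Fin v → ℕ
  t x β = ι (other? β) * ι (inc? x β)

  Ω z₂ : Fin v → ℕ
  Ω x = ∑ (t x)
  z₂ x = Ω x * Ω x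

  -- At least one by `covered`; at most one because two of the `xs` are joined by three of the `ds`
  -- already.
  xs-on : ∀ {β} → FixedBl β × ¬ IsD β → # (λ i → inc? (xs i) β) ≡ 1
  xs-on {β} (fβ , nβ) = from (covered fβ nβ)
    where
    from : (∃ λ i → Inc (xs i) β) → # (λ i → inc? (xs i) β) ≡ 1
    from (i , i∈) = trans (#-cong (λ k → inc? (xs k) β) (Finₚ._≟ i) (λ {k} k∈ → decidable-stable (k Finₚ.≟ i) λ ne → nβ (two-xs ne k∈ i∈)) (λ { refl → i∈ })) (#-≡ i)

  ds-on : ∀ {y} → FixedPt y × ¬ IsX y → # (λ j → inc? y (ds j)) ≡ 1
  ds-on {y} (fy , ny) = from (dual-covered fy ny)
    where
    from : (∃ λ j → Inc y (ds j)) → # (λ j → inc? y (ds j)) ≡ 1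
    from (j , j∈) = trans (#-cong (λ k → inc? y (ds k)) (Finₚ._≟ j) (λ {k} k∈ → decidable-stable (k Finₚ.≟ j) λ ne → ny (two-ds ne k∈ j∈)) (λ { refl → j∈ })) (#-≡ j)

  weight : ∀ {Q : Set} (d : Dec Q) {a b} → (Q → a ≡ b) → ι d * a ≡ ι d * b
  weight (yes q) e = cong (1 *_) (e q)
  weight (no _)  e = refl

  weight-≤ : ∀ {Q : Set} (d : Dec Q) {a b} → (Q → a ≤ b) → ι d * a ≤ ι d * b
  weight-≤ (yes q) e = *-monoʳ-≤ 1 (e q)
  weight-≤ (no _)  e = z≤n

  s-split : ∀ x → s x ≡ # (λ j → inc? x (ds j)) + Ω x
  s-split x = trans (#-split (λ β → fixbl? β ×-dec inc? x β) isD?) (cong₂ _+_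
    (trans (#-cong (λ β → (fixbl? β ×-dec inc? x β) ×-dec isD? β) (λ β → isD? β ×-dec inc? x β) (λ ((_ , i) , d) → d , i) (λ ((j , e) , i) → (subst FixedBl (sym e) (fds j) , i) , j , e)) (#-image-ds {P = Inc x} (inc? x)))
    (trans (#-cong (λ β → (fixbl? β ×-dec inc? x β) ×-dec ¬? (isD? β)) (λ β → other? β ×-dec inc? x β) (λ ((a , b) , c) → (a , c) , b) (λ ((a , c) , b) → (a , b) , c))
      (∑-cong (λ β → ι-× (other? β) (inc? x β)))))

  fixed-split : ∀ g → ∑On fixpt? g ≡ ∑ (λ i → g (xs i)) + ∑On unlisted? g
  fixed-split g = trans (∑-cong at) (trans (∑-+ (λ x → ι (isX? x) * g x) (λ x → ι (unlisted? x) * g x)) (cong (_+ ∑On unlisted? g) (∑-image g)))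
    where
    at : ∀ x → ι (fixpt? x) * g x ≡ ι (isX? x) * g x + ι (unlisted? x) * g x
    at x = trans (cong (_* g x) (trans (ι-split (fixpt? x) (isX? x)) (cong (_+ ι (unlisted? x)) (ι-cong (fixpt? x ×-dec isX? x) (isX? x) proj₂ (λ p → isX⇒fixed p , p)))))
      (*-distribʳ-+ (g x) (ι (isX? x)) (ι (unlisted? x)))

  -- `ζ₂` and `τ₂` are the second moments of `Ω` over the five `xs` and over the eight other fixed
  -- points, `τ` is the first moment over the latter, and `α` the second moment of the numbers
  -- `a i y` of further fixed blocks joining `xs i` and y.
  ζ₂ τ τ₂ α : ℕ
  ζ₂ = ∑ (λ i → z₂ (xs i))
  τ  = ∑On unlisted? Ω
  τ₂ = ∑On unlisted? z₂

  a : Fin 5 → Fin v → ℕ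
  a i y = ∑ (λ β → ι (inc? y β) * t (xs i) β)

  α = ∑ (λ i → ∑On unlisted? (λ y → a i y * a i y))

  T-xs : ∑ (λ i → Ω (xs i)) ≡ 8
  T-xs = trans (∑-swap (λ i β → t (xs i) β)) (trans (∑-cong at) dual-eight)
    where
    at : ∀ β → ∑ (λ i → t (xs i) β) ≡ ι (other? β)
    at β = trans (∑-*ˡ (ι (other? β)) (λ i → ι (inc? (xs i) β))) (trans (weight (other? β) xs-on) (*-identityʳ (ι (other? β))))

  T-sum : ∀ y → ∑ (λ i → a i y) ≡ Ω y
  T-sum y = trans (∑-swap (λ i β → ι (inc? y β) * t (xs i) β)) (∑-cong at)
    where
    flip : ∀ p q → p * (q * 1) ≡ q * p
    flip = solve-∀
    at : ∀ β → ∑ (λ i → ι (inc? y β) * t (xs i) β) ≡ t y β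
    at β = trans (∑-*ˡ (ι (inc? y β)) (λ i → t (xs i) β)) (trans (cong (ι (inc? y β) *_) (trans (∑-*ˡ (ι (other? β)) (λ i → ι (inc? (xs i) β))) (weight (other? β) xs-on)))
      (flip (ι (inc? y β)) (ι (other? β))))

  S₀≡ : S₀ ≡ 36 + τ
  S₀≡ = trans (fixed-split s) (trans (cong₂ _+_
      (trans (∑-cong (λ i → trans (s-split (xs i)) (cong (_+ Ω (xs i)) (xs-degree A J i)))) (trans (∑-+ (λ _ → 4) (λ i → Ω (xs i))) (cong₂ _+_ (∑-const 5 4) T-xs)))
      (trans (∑-cong (λ y → weight (unlisted? y) (λ m → trans (s-split y) (cong (_+ Ω y) (ds-on m))))) (trans (∑On-+ unlisted? (λ _ → 1) Ω) (cong (_+ τ) (trans (∑On-const unlisted? 1) (cong (1 *_) eight))))))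
    refl)

  Q₀≡ : Q₀ ≡ 152 + ζ₂ + 2 * τ + τ₂
  Q₀≡ = trans (fixed-split (λ x → s x * s x)) (trans (cong₂ _+_
      (trans (∑-cong (λ i → trans (cong (λ k → k * k) (trans (s-split (xs i)) (cong (_+ Ω (xs i)) (xs-degree A J i)))) (sq₄ (Ω (xs i)))))
        (trans (∑-+ (λ i → 16 + 8 * Ω (xs i)) (λ i → z₂ (xs i))) (cong (_+ ζ₂) (trans (∑-+ (λ _ → 16) (λ i → 8 * Ω (xs i))) (cong₂ _+_ (∑-const 5 16) (trans (∑-*ˡ 8 (λ i → Ω (xs i))) (cong (8 *_) T-xs)))))))
      (trans (∑-cong (λ y → weight (unlisted? y) (λ m → trans (cong (λ k → k * k) (trans (s-split y) (cong (_+ Ω y) (ds-on m)))) (sq₁ (Ω y)))))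
        (trans (∑On-+ unlisted? (λ y → 1 + 2 * Ω y) z₂) (cong (_+ τ₂) (trans (∑On-+ unlisted? (λ _ → 1) (λ y → 2 * Ω y)) (cong₂ _+_ (trans (∑On-const unlisted? 1) (cong (1 *_) eight)) (∑On-*ˡ unlisted? 2 Ω)))))))
    (collect ζ₂ (2 * τ) τ₂))
    where
    sq₄ : ∀ k → (4 + k) * (4 + k) ≡ 16 + 8 * k + k * k
    sq₄ = solve-∀
    sq₁ : ∀ k → (1 + k) * (1 + k) ≡ 1 + 2 * k + k * k
    sq₁ = solve-∀
    collect : ∀ x y z → 144 + x + (8 + y + z) ≡ 152 + x + y + z
    collect = solve-∀

  join-a : ∀ i y → # (joinFix? (xs i) y) ≡ # (λ j → inc? (xs i) (ds j) ×-dec inc? y (ds j)) + a i y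
  join-a i y = trans (#-split (joinFix? (xs i) y) isD?) (cong₂ _+_
    (trans (#-cong (λ β → joinFix? (xs i) y β ×-dec isD? β) (λ β → isD? β ×-dec join? (xs i) y β) (λ ((p , _) , d) → d , p) (λ ((j , e) , p) → (p , subst FixedBl (sym e) (fds j)) , j , e)) (#-image-ds {P = λ β → Inc (xs i) β × Inc y β} (join? (xs i) y)))
    (∑-cong λ β → trans (ι-cong (joinFix? (xs i) y β ×-dec ¬? (isD? β)) (inc? y β ×-dec other? β ×-dec inc? (xs i) β) (λ (((a , b) , c) , d) → b , (c , d) , a) (λ (b , (c , d) , a) → ((a , b) , c) , d))
      (trans (ι-× (inc? y β) (other? β ×-dec inc? (xs i) β)) (cong (ι (inc? y β) *_) (ι-× (other? β) (inc? (xs i) β))))))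

  -- `xs i` and y are joined by r + a fixed blocks, r ≤ 1 of them among the `ds`, and r + a is 1 or
  -- 3. On these values 2 a + r ≤ a² + 1; the five r add up to 4.
  2T≤ : ∀ {y} → FixedPt y × ¬ IsX y → 2 * Ω y ≤ ∑ (λ i → a i y * a i y) + 1
  2T≤ {y} (fy , ny) = absurd-le
    where
    r : Fin 5 → ℕ
    r i = # (λ j → inc? (xs i) (ds j) ×-dec inc? y (ds j))
    r-sum : ∑ r ≡ 4
    r-sum = trans (∑-swap (λ i j → ι (inc? (xs i) (ds j) ×-dec inc? y (ds j)))) (trans (∑-cong at) (trans (∑-*ˡ 4 (λ j → ι (inc? y (ds j)))) (cong (4 *_) (ds-on (fy , ny)))))
      where
      at : ∀ j → ∑ (λ i → ι (inc? (xs i) (ds j) ×-dec inc? y (ds j))) ≡ 4 * ι (inc? y (ds j))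
      at j = trans (∑-cong (λ i → trans (ι-× (inc? (xs i) (ds j)) (inc? y (ds j))) (*-comm (ι (inc? (xs i) (ds j))) (ι (inc? y (ds j))))))
        (trans (∑-*ˡ (ι (inc? y (ds j))) (λ i → ι (inc? (xs i) (ds j)))) (trans (cong (ι (inc? y (ds j)) *_) (ds-degree A J j)) (*-comm (ι (inc? y (ds j))) 4)))
    small : ∀ {r a} → r ≤ 1 → r + a ≡ 1 ⊎ r + a ≡ 3 → 2 * a + r ≤ a * a + 1
    small {zero} {_} _ (inj₁ refl) = toWitness {a? = 2 ≤? 2} tt
    small {zero} {_} _ (inj₂ refl) = toWitness {a? = 6 ≤? 10} tt
    small {suc zero} {_} _ (inj₁ refl) = ≤-refl
    small {suc zero} {_} _ (inj₂ refl) = ≤-refl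
    small {suc (suc _)} (s≤s ()) _
    r≤1 : ∀ i → r i ≤ 1
    r≤1 i = ≤-trans (#-mono (λ j → inc? (xs i) (ds j) ×-dec inc? y (ds j)) (λ j → inc? y (ds j)) proj₂) (≡⇒≤ (ds-on (fy , ny)))
    each : ∀ i → 2 * a i y + r i ≤ a i y * a i y + 1
    each i = small (r≤1 i) (subst (λ k → k ≡ 1 ⊎ k ≡ 3) (join-a i y) (join-1-3 (λ e → ny (i , e)) (fixed-keeps (fxs i) fy)))
    summed : 2 * Ω y + 4 ≤ ∑ (λ i → a i y * a i y) + 5
    summed = subst₂ _≤_ (trans (∑-+ (λ i → 2 * a i y) r) (cong₂ _+_ (trans (∑-*ˡ 2 (λ i → a i y)) (cong (2 *_) (T-sum y))) r-sum)) (trans (∑-+ (λ i → a i y * a i y) (λ _ → 1)) (cong (∑ (λ i → a i y * a i y) +_) (∑-const 5 1))) (∑-mono each)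
    absurd-le : 2 * Ω y ≤ ∑ (λ i → a i y * a i y) + 1
    absurd-le = ≮⇒≥ λ lt → absurd {ρ = Ω y ∷ ∑ (λ i → a i y * a i y) ∷ []} (hyp 1 (con 1 :+ (v1 :+ con 1)) (2 :* v0) lt ∷ hyp 1 (2 :* v0 :+ con 4) (v1 :+ con 5) summed ∷ [])

  τ≤ : 2 * τ ≤ α + 8
  τ≤ = subst₂ _≤_ (∑On-*ˡ unlisted? 2 Ω) (trans (∑On-+ unlisted? (λ y → ∑ (λ i → a i y * a i y)) (λ _ → 1)) (cong₂ _+_ α≡ (trans (∑On-const unlisted? 1) (cong (1 *_) eight))))
    (∑On-mono unlisted? 2T≤)
    where
    α≡ : ∑On unlisted? (λ y → ∑ (λ i → a i y * a i y)) ≡ α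
    α≡ = trans (∑-cong (λ y → sym (∑-*ˡ (ι (unlisted? y)) (λ i → a i y * a i y)))) (∑-swap (λ y i → ι (unlisted? y) * (a i y * a i y)))

  -- Σ over β, γ of 1 + r c ≤ r + c, where r counts the common xs of β and γ and c their other common fixed points.
  cross : 64 + α ≤ ζ₂ + τ₂
  cross = subst₂ _≤_
    (trans (pull-out (λ β γ → p β * p γ) _) (cong₂ _+_ (trans (sym (∑-*∑ p p)) (cong (λ k → k * k) dual-eight)) (trans (swap-in _) (∑-cong (λ i → gram w (λ y β → ι (inc? y β) * t (xs i) β))))))
    (trans (pull-out _ _) (cong₂ _+_ (trans (gram (λ _ → 1) (λ i → t (xs i))) (∑-cong (λ i → *-identityˡ (z₂ (xs i))))) (gram w t)))
    (∑-mono λ β → ∑-mono λ γ → pointwise β γ)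
    where
    p : Fin v → ℕ
    p β = ι (other? β)
    w : Fin v → ℕ
    w y = ι (unlisted? y)
    pull-out : ∀ (g h : Fin v → Fin v → ℕ) → ∑ (λ β → ∑ (λ γ → g β γ + h β γ)) ≡ ∑ (λ β → ∑ (g β)) + ∑ (λ β → ∑ (h β))
    pull-out g h = trans (∑-cong (λ β → ∑-+ (g β) (h β))) (∑-+ (λ β → ∑ (g β)) (λ β → ∑ (h β)))
    swap-in : ∀ (g : Fin v → Fin v → Fin 5 → ℕ) → ∑ (λ β → ∑ (λ γ → ∑ (g β γ))) ≡ ∑ (λ i → ∑ (λ β → ∑ (λ γ → g β γ i)))
    swap-in g = trans (∑-cong (λ β → ∑-swap (g β))) (∑-swap (λ β i → ∑ (λ γ → g β γ i)))
    pointwise : ∀ β γ → p β * p γ + ∑ (λ i → ∑ (λ y → w y * ((ι (inc? y β) * t (xs i) β) * (ι (inc? y γ) * t (xs i) γ)))) ≤ ∑ (λ i → 1 * (t (xs i) β * t (xs i) γ)) + ∑ (λ y → w y * (t y β * t y γ))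
    pointwise β γ = subst₂ _≤_ lhs rhs (weight-≤ (other? β) (λ β∈ → weight-≤ (other? γ) (λ γ∈ → local β∈ γ∈)))
      where
      common? : Decidable (λ i → Inc (xs i) β × Inc (xs i) γ)
      common? i = inc? (xs i) β ×-dec inc? (xs i) γ
      meetM? : Decidable (λ y → (FixedPt y × ¬ IsX y) × Inc y β × Inc y γ)
      meetM? y = unlisted? y ×-dec inc? y β ×-dec inc? y γ
      r c : ℕ
      r = # common?
      c = # meetM?
      local : FixedBl β × ¬ IsD β → FixedBl γ × ¬ IsD γ → 1 + r * c ≤ r + c
      local (fβ , nβ) (fγ , nγ) = by r c r≤1 c-pos
        where
        r≤1 : r ≤ 1
        r≤1 = ≤-trans (#-mono common? (λ i → inc? (xs i) β) proj₁) (≡⇒≤ (xs-on (fβ , nβ)))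
        by : ∀ r c → r ≤ 1 → (r ≡ 0 → 1 ≤ c) → 1 + r * c ≤ r + c
        by zero c _ positive = positive refl
        by (suc zero) c _ _ = s≤s (≡⇒≤ (*-identityˡ c))
        by (suc (suc _)) _ (s≤s ()) _
        c-pos : r ≡ 0 → 1 ≤ c
        c-pos r≡0 = from (Dual.join-block γ≢β (λ u → inj₁ (fβ u , fγ u)))
          where
          no-common : ∀ i → ¬ (Inc (xs i) β × Inc (xs i) γ)
          no-common = #-zero⇒ common? r≡0
          γ≢β : γ ≢ β
          γ≢β e = let (i , i∈) = covered fβ nβ in no-common i (i∈ , subst (Inc (xs i)) (sym e) i∈)
          from : (∃ λ y → (Inc y β × Inc y γ) × FixedPt y) → 1 ≤ c
          from (y , (yβ , yγ) , fy) = #-pos meetM? {y} ((fy , λ (i , e) → no-common i (subst (λ w → Inc w β) e yβ , subst (λ w → Inc w γ) e yγ)) , yβ , yγ)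
      ring₁ : ∀ pβ pγ w y y′ x x′ → w * ((y * (pβ * x)) * (y′ * (pγ * x′))) ≡ (pβ * pγ * (x * x′)) * (w * (y * y′))
      ring₁ = solve-∀
      ring₂ : ∀ pβ pγ x x′ → 1 * ((pβ * x) * (pγ * x′)) ≡ pβ * pγ * (x * x′)
      ring₂ = solve-∀
      ring₃ : ∀ pβ pγ w y y′ → w * ((pβ * y) * (pγ * y′)) ≡ pβ * pγ * (w * (y * y′))
      ring₃ = solve-∀
      dist₁ : ∀ pβ pγ r c → pβ * (pγ * (1 + r * c)) ≡ pβ * pγ + (pβ * pγ * r) * c
      dist₁ = solve-∀
      dist₂ : ∀ pβ pγ r c → pβ * (pγ * (r + c)) ≡ pβ * pγ * r + pβ * pγ * c
      dist₂ = solve-∀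
      r≡ : ∑ (λ i → ι (inc? (xs i) β) * ι (inc? (xs i) γ)) ≡ r
      r≡ = ∑-cong (λ i → sym (ι-× (inc? (xs i) β) (inc? (xs i) γ)))
      c≡ : ∑ (λ y → w y * (ι (inc? y β) * ι (inc? y γ))) ≡ c
      c≡ = ∑-cong (λ y → sym (trans (ι-× (unlisted? y) (inc? y β ×-dec inc? y γ)) (cong (w y *_) (ι-× (inc? y β) (inc? y γ)))))
      lhs : p β * (p γ * (1 + r * c)) ≡ p β * p γ + ∑ (λ i → ∑ (λ y → w y * ((ι (inc? y β) * t (xs i) β) * (ι (inc? y γ) * t (xs i) γ))))
      lhs = trans (dist₁ (p β) (p γ) r c) (cong (p β * p γ +_) (sym (trans
        (∑-cong (λ i → trans (∑-cong (λ y → ring₁ (p β) (p γ) (w y) (ι (inc? y β)) (ι (inc? y γ)) (ι (inc? (xs i) β)) (ι (inc? (xs i) γ))))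
          (trans (∑-*ˡ (p β * p γ * (ι (inc? (xs i) β) * ι (inc? (xs i) γ))) (λ y → w y * (ι (inc? y β) * ι (inc? y γ)))) (trans (cong (p β * p γ * (ι (inc? (xs i) β) * ι (inc? (xs i) γ)) *_) c≡) (*-comm (p β * p γ * (ι (inc? (xs i) β) * ι (inc? (xs i) γ))) c)))))
        (trans (∑-*ˡ c (λ i → p β * p γ * (ι (inc? (xs i) β) * ι (inc? (xs i) γ)))) (trans (cong (c *_) (trans (∑-*ˡ (p β * p γ) (λ i → ι (inc? (xs i) β) * ι (inc? (xs i) γ))) (cong (p β * p γ *_) r≡))) (*-comm c (p β * p γ * r)))))))
      rhs : p β * (p γ * (r + c)) ≡ ∑ (λ i → 1 * (t (xs i) β * t (xs i) γ)) + ∑ (λ y → w y * (t y β * t y γ))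
      rhs = trans (dist₂ (p β) (p γ) r c) (sym (cong₂ _+_
        (trans (∑-cong (λ i → ring₂ (p β) (p γ) (ι (inc? (xs i) β)) (ι (inc? (xs i) γ)))) (trans (∑-*ˡ (p β * p γ) (λ i → ι (inc? (xs i) β) * ι (inc? (xs i) γ))) (cong (p β * p γ *_) r≡)))
        (trans (∑-cong (λ y → ring₃ (p β) (p γ) (w y) (ι (inc? y β)) (ι (inc? y γ)))) (trans (∑-*ˡ (p β * p γ) (λ y → w y * (ι (inc? y β) * ι (inc? y γ)))) (cong (p β * p γ *_) c≡)))))

  -- The two moments with `four-S₁` give ζ₂ + τ₂ ≤ 2 τ + 40, hence at most α + 48 by `τ≤`, while
  -- `cross` demands 64 + α.
  no-13 : ⊥
  no-13 = absurd {ρ = α ∷ ζ₂ ∷ τ ∷ τ₂ ∷ S₁ ∷ Q₁ ∷ []}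
    (hyp 1 (con 64 :+ v0) (v1 :+ v3) cross ∷ hyp 1 (2 :* v2) (v0 :+ con 8) τ≤
     ∷ hyp 4 (con 208) (con 36 :+ v2 :+ v4) (≡⇒≥ (trans (sym (cong (_+ S₁) S₀≡)) (trans S-sum (cong (16 *_) f≡13))))
     ∷ hyp 1 (con 152 :+ v1 :+ 2 :* v2 :+ v3 :+ v5) (con 676) (≡⇒≤ (trans (sym (cong (_+ Q₁) Q₀≡)) (trans Q-sum (cong (λ n → 3 * (n * n) + 13 * n) f≡13))))
     ∷ hyp 1 (4 :* v4) (v5 :+ con 204) (subst (λ k → 4 * S₁ ≤ Q₁ + 3 * k) m≡68 four-S₁) ∷ [])
    where
    m≡68 : m ≡ 68
    m≡68 = +-cancelˡ-≡ 13 m 68 (trans (cong (_+ m) (sym f≡13)) f+m)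

-- Restriction to involutions and four-groups, and the exclusion of order 16

times : ∀ {n} → Bool → Vec Bool n → Vec Bool n
times true  u = u
times false u = 𝟎

⊕-idʳ : ∀ {n} (u : Vec Bool n) → u ⊕ 𝟎 ≡ u
⊕-idʳ u = trans (⊕-comm u 𝟎) (⊕-idˡ u)

times-xor : ∀ {n} b c (u : Vec Bool n) → times (b xor c) u ≡ times b u ⊕ times c u
times-xor false c     u = sym (⊕-idˡ (times c u))
times-xor true  false u = sym (⊕-idʳ u)
times-xor true  true  u = sym (⊕-self u)

⊕≡𝟎 : ∀ {n} {u w : Vec Bool n} → u ⊕ w ≡ 𝟎 → u ≡ w
⊕≡𝟎 {u = u} {w} e = trans (sym (⊕-idʳ u)) (trans (cong (u ⊕_) (sym (⊕-self w))) (trans (sym (⊕-assoc u w w)) (trans (cong (_⊕ w) e) (⊕-idˡ w))))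

span₁ : ∀ {n} → Vec Bool n → Vec Bool 1 → Vec Bool n
span₁ u (b ∷ []) = times b u

span₂ : ∀ {n} → Vec Bool n → Vec Bool n → Vec Bool 2 → Vec Bool n
span₂ u w (b ∷ c ∷ []) = times b u ⊕ times c w

foldr-≥ : ∀ {K : Set} (g : K → ℕ) c ks → (∀ {k} → k ∈ ks → c ≤ g k) → length ks * c ≤ List.foldr (λ k n → g k + n) 0 ks
foldr-≥ g c []       h = z≤n
foldr-≥ g c (k ∷ ks) h = +-mono-≤ (h (here refl)) (foldr-≥ g c ks (h ∘ there))

module _ {v} {D : Design v} {n} (A : Action D n) where

  on₁ : Vec Bool n → Action D 1
  on₁ u = restrict A (span₁ u) (λ { (b ∷ []) (c ∷ []) → times-xor b c u }) refl

  on₂ : Vec Bool n → Vec Bool n → Action D 2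
  on₂ u w = restrict A (span₂ u w)
    (λ { (b ∷ c ∷ []) (b′ ∷ c′ ∷ []) → trans (cong₂ _⊕_ (times-xor b b′ u) (times-xor c c′ w)) (⊕-interchange (times b u) (times b′ u) (times c w) (times c′ w)) })
    (⊕-idˡ 𝟎)

  on₁-faithful : Faithful A → ∀ {u} → u ≢ 𝟎 → Faithful (on₁ u)
  on₁-faithful fa u≢ (true ∷ [])  _  = fa _ u≢
  on₁-faithful fa u≢ (false ∷ []) ne = contradiction refl ne

  on₂-faithful : Faithful A → ∀ {u w} → u ≢ 𝟎 → w ≢ 𝟎 → u ≢ w → Faithful (on₂ u w)
  on₂-faithful fa {u} u≢ w≢ u≢w (true ∷ true ∷ [])   _  = fa _ (u≢w ∘ ⊕≡𝟎)
  on₂-faithful fa {u} u≢ w≢ u≢w (true ∷ false ∷ [])  _  = fa _ (λ e → u≢ (trans (sym (⊕-idʳ u)) e))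
  on₂-faithful fa {u} {w} u≢ w≢ u≢w (false ∷ true ∷ []) _ = fa _ (λ e → w≢ (trans (sym (⊕-idˡ w)) e))
  on₂-faithful fa u≢ w≢ u≢w (false ∷ false ∷ []) ne = contradiction refl ne

restrict-pentad : ∀ {v} {D : Design v} {m n} {A : Action D n} (L : Vec Bool m → Vec Bool n) (L-⊕ : ∀ u w → L (u ⊕ w) ≡ L u ⊕ L w) (L-𝟎 : L 𝟎 ≡ 𝟎) →
                  Pentad A → Pentad (restrict A L L-⊕ L-𝟎)
restrict-pentad L _ _ J = record { xs = xs ; ds = ds ; fxs = λ i u → fxs i (L u) ; fds = λ i u → fds i (L u) ; on = on ; off = off }
  where open Pentad J

module _ {v} (v≡81 : v ≡ 81) {D : Design v} where

  seventeen : (A : Action D 1) → Faithful A → Pentad A → Fixing.f A ≡ 17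
  seventeen A fa J = [ (λ e → ⊥-elim (not-9 e)) , [ (λ e → ⊥-elim (Cross.no-13 v≡81 A J e)) , id ]′ ]′ (order-2-count v≡81 A fa)
    where
    open PentadTheory v≡81 (dual-action A) (dual-pentad J) using (unlisted?; unlisted-count)
    -- Nine fixed points leave only the five `ds` as fixed blocks, but there must be nine of these
    -- too.
    not-9 : Fixing.f A ≢ 9
    not-9 e = contradiction (trans (sym (trans (GroupSums.fb≡f v≡81 A) e)) (trans unlisted-count (cong (5 +_) (#-none unlisted? λ β (fβ , nβ) → nβ (PentadTheory.only-ds v≡81 A J (≡⇒≤ e) fβ))))) (λ ())

  -- Each of the 7 involutions fixes 12 further blocks, no two of them a common one, but only 76 are available.
  no-pentad : (A : Action D 3) → Faithful A → ¬ Pentad A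
  no-pentad A fa J = contradiction (≤-trans (foldr-≥ (λ u → # (fixed-other? u)) 12 (nonzero 3) (λ u∈ → twelve (nonzero⇒ 3 u∈)))
      (≤-trans (fibres-≤ fixed-other? other? (nonzero 3) (unique-nonzero 3) (λ _ (_ , _ , nd) → nd) unique) (≡⇒≤ seventy-six))) (toWitness {a? = ¬? (84 ≤? 76)} tt)
    where
    open Fixing A
    open PentadBasics (dual-action A) (dual-pentad J) using () renaming (IsX to IsD; isX? to isD?; #-image to #-image-ds)
    other? : Decidable (λ β → ¬ IsD β)
    other? β = ¬? (isD? β)
    Fixed-other : Vec Bool 3 → Fin v → Set
    Fixed-other u β = u ≢ 𝟎 × bl u β ≡ β × ¬ IsD β
    fixed-other? : ∀ u → Decidable (Fixed-other u)
    fixed-other? u β = ¬? (u ≟ᵥ 𝟎) ×-dec (bl u β Finₚ.≟ β) ×-dec other? β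
    seventy-six : # other? ≡ 76
    seventy-six = +-cancelˡ-≡ 5 (# other?) 76 (trans (cong (_+ # other?) (sym #D)) (trans (sym (#-complement isD?)) v≡81))
      where
      #D : # isD? ≡ 5
      #D = trans (#-cong isD? (λ β → isD? β ×-dec yes tt) (_, tt) proj₁) (trans (#-image-ds {P = λ _ → ⊤} (λ _ → yes tt)) (#-all {P = λ _ → ⊤} (λ _ → yes tt) (λ _ → tt)))
    twelve : ∀ {u} → u ≢ 𝟎 → 12 ≤ # (fixed-other? u)
    twelve {u} u≢ = ≤-trans (≡⇒≥ (+-cancelˡ-≡ 5 (# unlisted?) 12 (trans (sym unlisted-count) (trans (GroupSums.fb≡f v≡81 A₁) (seventeen A₁ (on₁-faithful A fa u≢) J₁)))))
      (#-mono unlisted? (fixed-other? u) (λ (fβ , nβ) → u≢ , fβ (true ∷ []) , nβ))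
      where
      A₁ : Action D 1
      A₁ = on₁ A u
      J₁ : Pentad A₁
      J₁ = restrict-pentad {A = A} (span₁ u) _ _ J
      open PentadTheory v≡81 (dual-action A₁) (dual-pentad J₁) using (unlisted?; unlisted-count)
    unique : ∀ {u w β} → Fixed-other u β → Fixed-other w β → u ≡ w
    unique {u} {w} {β} (u≢ , ub , nd) (w≢ , wb , _) = decidable-stable (u ≟ᵥ w) λ u≢w →
      nd (PentadTheory.only-ds v≡81 (on₂ A u w) (restrict-pentad {A = A} (span₂ u w) _ _ J) (proj₂ (order-4-count v≡81 (on₂ A u w) (on₂-faithful A fa u≢ w≢ u≢w)))
        (λ { (b ∷ c ∷ []) → trans (bl-⊕ (times b u) (times c w) β) (trans (cong (bl (times b u)) (fix c wb)) (fix b ub)) }))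
      where
      fix : ∀ b {u} → bl u β ≡ β → bl (times b u) β ≡ β
      fix true  e = e
      fix false e = bl-𝟎 β

  no-order-16 : (A : Action D 4) → ¬ Faithful A
  no-order-16 A fa = from (FindTripod.kernel-tripod v≡81 A (≤-trans (n≤1+n 2) (order-16-count v≡81 A fa)))
    where
    from : FindTripod.KernelTripod v≡81 A (≤-trans (n≤1+n 2) (order-16-count v≡81 A fa)) → ⊥
    from (k , _ , _ , _ , _ , _ , _ , t) = no-pentad (pull A k) (pull-faithful A k fa)
      (FromTripod.tripod⇒pentad v≡81 (pull A k) (proj₂ (order-8-count v≡81 (pull A k) (pull-faithful A k fa))) t)

-- Automorphism groups of the design

card : ∀ {n} (p : Subset n) → ∣ p ∣ ≡ # (λ x → lookup p x Boolₚ.≟ true)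
card []          = sym (∑-zero {0} λ ())
card (true ∷ p)  = trans (cong suc (card p)) (sym (∑-suc (λ x → ι (lookup (true ∷ p) x Boolₚ.≟ true))))
card (false ∷ p) = trans (card p) (sym (∑-suc (λ x → ι (lookup (false ∷ p) x Boolₚ.≟ true))))

card-∩ : ∀ {n} (p q : Subset n) → ∣ p ∩ q ∣ ≡ # (λ x → lookup p x Boolₚ.≟ true ×-dec lookup q x Boolₚ.≟ true)
card-∩ p q = trans (card (p ∩ q)) (#-cong (λ x → lookup (p ∩ q) x Boolₚ.≟ true) (λ x → lookup p x Boolₚ.≟ true ×-dec lookup q x Boolₚ.≟ true)
  (λ {x} e → split (lookup p x) (lookup q x) (trans (sym (Vecₚ.lookup-zipWith _∧_ x p q)) e))
  (λ {x} (a , b) → trans (Vecₚ.lookup-zipWith _∧_ x p q) (cong₂ _∧_ a b)))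
  where
  split : ∀ a b → a ∧ b ≡ true → a ≡ true × b ≡ true
  split true true _ = refl , refl

module FromSubsets {v} (S : SymmetricDesign v 16 3) where
  open SymmetricDesign S

  private
    through : ∀ x j → lookup (blocksThrough block x) j ≡ lookup (block j) x
    through x = Vecₚ.lookup∘tabulate (λ j → lookup (block j) x)

  design : Design v
  design = record
    { Inc      = λ x j → lookup (block j) x ≡ true
    ; inc?     = λ x j → lookup (block j) x Boolₚ.≟ true
    ; blk-size = λ j → trans (sym (card (block j))) (block-size j)
    ; pt-size  = λ x → trans (#-cong (λ j → lookup (block j) x Boolₚ.≟ true) (λ j → lookup (blocksThrough block x) j Boolₚ.≟ true)
                   (λ {j} → trans (through x j)) (λ {j} → trans (sym (through x j)))) (trans (sym (card (blocksThrough block x))) (point-degree x))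
    ; blk-pair = λ {i} {j} j≢i → trans (sym (card-∩ (block i) (block j))) (block-intersection i j (j≢i ∘ sym))
    ; pt-pair  = λ {x} {y} y≢x → trans (#-cong (λ j → lookup (block j) x Boolₚ.≟ true ×-dec lookup (block j) y Boolₚ.≟ true)
                   (λ j → lookup (blocksThrough block x) j Boolₚ.≟ true ×-dec lookup (blocksThrough block y) j Boolₚ.≟ true)
                   (λ {j} (a , b) → trans (through x j) a , trans (through y j) b) (λ {j} (a , b) → trans (sym (through x j)) a , trans (sym (through y j)) b))
                   (trans (sym (card-∩ (blocksThrough block x) (blocksThrough block y))) (point-pair x y (y≢x ∘ sym))) }

  open Counting design

  blocks-ext : ∀ {i j} → (∀ x → Inc x i → Inc x j) → (∀ x → Inc x j → Inc x i) → i ≡ j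
  blocks-ext {i} {j} f g = blocks-distinct i j (trans (sym (Vecₚ.tabulate∘lookup (block i))) (trans (Vecₚ.tabulate-cong (λ x → same (f x) (g x))) (Vecₚ.tabulate∘lookup (block j))))
    where
    same : ∀ {a b} → (a ≡ true → b ≡ true) → (b ≡ true → a ≡ true) → a ≡ b
    same {false} {false} _ _ = refl
    same {false} {true}  _ g = g refl
    same {true}  {b}     f _ = sym (f refl)

  record Aut (σ : Perm v) : Set where
    constructor mkAut
    field isAut : IsAut S σ

  toSymmetry : ∀ {σ} → Aut σ → Symmetry design
  toSymmetry {σ} (mkAut (inj , image)) = record
    { pt = lookup σ ; bl = bl ; inc⁺ = fw ; inc⁻ = bw ; pt-inj = inj
    ; bl-inj = λ {i} {j} e → blocks-ext (λ x i∈ → bw (subst (Inc (lookup σ x)) e (fw i∈))) (λ x j∈ → bw (subst (Inc (lookup σ x)) (sym e) (fw j∈))) }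
    where
    bl : Fin v → Fin v
    bl i = proj₁ (image i)
    fw : ∀ {x j} → Inc x j → Inc (lookup σ x) (bl j)
    fw {x} {j} i = Vecₚ.[]=⇒lookup (Equivalence.to (proj₂ (image j) x) (Vecₚ.lookup⇒[]= x (block j) i))
    bw : ∀ {x j} → Inc (lookup σ x) (bl j) → Inc x j
    bw {x} {j} i = Vecₚ.[]=⇒lookup (Equivalence.from (proj₂ (image j) x) (Vecₚ.lookup⇒[]= (lookup σ x) (block (bl j)) i))

  fromSymmetry : (s : Symmetry design) → ∀ {σ} → (∀ x → lookup σ x ≡ Symmetry.pt s x) → Aut σ
  fromSymmetry s {σ} e = mkAut ((λ {x} {y} q → pt-inj (trans (sym (e x)) (trans q (e y)))) , λ i → bl i , λ x → mk⇔
      (λ m → Vecₚ.lookup⇒[]= (lookup σ x) (block (bl i)) (subst (λ y → Inc y (bl i)) (sym (e x)) (inc⁺ (Vecₚ.[]=⇒lookup m))))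
      (λ m → Vecₚ.lookup⇒[]= x (block i) (inc⁻ (subst (λ y → Inc y (bl i)) (e x) (Vecₚ.[]=⇒lookup m)))))
    where open Symmetry s

  identity : Symmetry design
  identity = record { pt = id ; bl = id ; inc⁺ = id ; inc⁻ = id ; pt-inj = id ; bl-inj = id }

  compose : Symmetry design → Symmetry design → Symmetry design
  compose s t = record
    { pt = s.pt ∘ t.pt ; bl = s.bl ∘ t.bl ; inc⁺ = s.inc⁺ ∘ t.inc⁺ ; inc⁻ = t.inc⁻ ∘ s.inc⁻ ; pt-inj = t.pt-inj ∘ s.pt-inj ; bl-inj = t.bl-inj ∘ s.bl-inj }
    where
    module s = Symmetry s
    module t = Symmetry t

  power : Symmetry design → ℕ → Symmetry design
  power s zero    = identity
  power s (suc m) = compose s (power s m)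

  -- The 16 points of the image of a block would lie in the intersection of two distinct blocks.
  bl-unique : (s t : Symmetry design) → (∀ x → Symmetry.pt s x ≡ Symmetry.pt t x) → ∀ j → Symmetry.bl s j ≡ Symmetry.bl t j
  bl-unique s t e j = decidable-stable (s.bl j Finₚ.≟ t.bl j) λ ne → contradiction
      (subst₂ _≤_ (blk-size j) (blk-pair (ne ∘ sym)) (≤-trans
        (#-mono (λ x → inc? x j) (λ x → meet? (s.bl j) (t.bl j) (s.pt x)) (λ {x} i → s.inc⁺ i , subst (λ y → Inc y (t.bl j)) (sym (e x)) (t.inc⁺ i)))
        (≡⇒≤ (∑-reindex s.pt s.pt-inj (λ x → ι (meet? (s.bl j) (t.bl j) x))))))
      (toWitness {a? = ¬? (16 ≤? 3)} tt)
    where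
    module s = Symmetry s
    module t = Symmetry t

  power-pt : ∀ s m x → Symmetry.pt (power s m) x ≡ iter (Symmetry.pt s) m x
  power-pt s zero    x = refl
  power-pt s (suc m) x = cong (Symmetry.pt s) (power-pt s m x)

  power-bl : ∀ s m j → Symmetry.bl (power s m) j ≡ iter (Symmetry.bl s) m j
  power-bl s zero    j = refl
  power-bl s (suc m) j = cong (Symmetry.bl s) (power-bl s m j)

  order-dividing : ∀ {σ} (a : Aut σ) {m} → σ ^^ m ≡ 𝟏 → HasOrderDividing (toSymmetry a) m
  order-dividing {σ} a {m} e = pts , λ j → trans (sym (power-bl (toSymmetry a) m j)) (bl-unique (power (toSymmetry a) m) identity (λ x → trans (power-pt (toSymmetry a) m x) (pts x)) j)
    where
    pts : ∀ x → iter (lookup σ) m x ≡ x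
    pts x = trans (sym (lookup-^ σ m x)) (trans (cong (λ τ → lookup τ x) e) (lookup-id x))

  moved : ∀ {σ : Perm v} → σ ≢ 𝟏 → ∃ λ x → lookup σ x ≢ x
  moved {σ} ne = ¬∀⟶∃¬ v (λ x → lookup σ x ≡ x) (λ x → lookup σ x Finₚ.≟ x) λ h → ne (perm-ext λ x → trans (h x) (sym (lookup-id x)))

  aut-𝟏 : Aut 𝟏
  aut-𝟏 = fromSymmetry identity lookup-id

  aut-· : ∀ {σ τ} → Aut σ → Aut τ → Aut (σ · τ)
  aut-· {σ} {τ} a b = fromSymmetry (compose (toSymmetry a) (toSymmetry b)) (lookup-∘ σ τ)

  aut-^ : ∀ {σ} → Aut σ → ∀ m → Aut (σ ^^ m)
  aut-^ a zero    = aut-𝟏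
  aut-^ a (suc m) = aut-· a (aut-^ a m)

  fix? : (σ : Perm v) → Decidable (λ x → lookup σ x ≡ x)
  fix? σ x = lookup σ x Finₚ.≟ x

  action : ∀ {n} (ρ : Vec Bool n → Perm v) → (∀ u → Aut (ρ u)) → (∀ u w → ρ (u ⊕ w) ≡ ρ u · ρ w) → ρ 𝟎 ≡ 𝟏 → Action design n
  action ρ aut ρ-⊕ ρ-𝟎 = record
    { P = record { act = λ u → lookup (ρ u) ; act-⊕ = pt-⊕ ; act-𝟎 = pt-𝟎 }
    ; B = record { act = λ u → Symmetry.bl (sy u) ; act-⊕ = λ u w → bl-unique (sy (u ⊕ w)) (compose (sy u) (sy w)) (pt-⊕ u w) ; act-𝟎 = bl-unique (sy 𝟎) identity pt-𝟎 }
    ; inc⁺ = λ u → Symmetry.inc⁺ (sy u) }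
    where
    sy : ∀ u → Symmetry design
    sy u = toSymmetry (aut u)
    pt-⊕ : ∀ u w x → lookup (ρ (u ⊕ w)) x ≡ lookup (ρ u) (lookup (ρ w) x)
    pt-⊕ u w x = trans (cong (λ σ → lookup σ x) (ρ-⊕ u w)) (lookup-∘ (ρ u) (ρ w) x)
    pt-𝟎 : ∀ x → lookup (ρ 𝟎) x ≡ x
    pt-𝟎 x = trans (cong (λ σ → lookup σ x) ρ-𝟎) (lookup-id x)

  module _ (v≡81 : v ≡ 81) where

    fixed-by-order-5 : ∀ {σ} → Aut σ → σ ^^ 5 ≡ 𝟏 → σ ≢ 𝟏 → # (fix? σ) ≡ 1
    fixed-by-order-5 a e ne = order-5 v≡81 (toSymmetry a) (toWitness {a? = prime? 5} tt) (toWitness {a? = 4 ≤? 5} tt) (order-dividing a {5} e) (moved ne) refl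

    fixed-by-order-13 : ∀ {σ} → Aut σ → σ ^^ 13 ≡ 𝟏 → σ ≢ 𝟏 → # (fix? σ) ≡ 3
    fixed-by-order-13 a e ne = order-13 v≡81 (toSymmetry a) (toWitness {a? = prime? 13} tt) (toWitness {a? = 4 ≤? 13} tt) (order-dividing a {13} e) (moved ne) refl

    fixed-by-order-2 : ∀ {σ} → Aut σ → σ · σ ≡ 𝟏 → σ ≢ 𝟏 → # (fix? σ) ≡ 9 ⊎ # (fix? σ) ≡ 13 ⊎ # (fix? σ) ≡ 17
    fixed-by-order-2 {σ} a e ne = InvolutionFixed.fixed-count v≡81
        (record { symmetry = toSymmetry a ; pt² = pt² ; bl² = bl-unique (compose (toSymmetry a) (toSymmetry a)) identity pt² }) (moved ne)
      where
      pt² : ∀ x → lookup σ (lookup σ x) ≡ x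
      pt² x = trans (sym (lookup-∘ σ σ x)) (trans (cong (λ τ → lookup τ x) e) (lookup-id x))

    primes : ∀ {σ p} → Prime p → Aut σ → σ ^^ p ≡ 𝟏 → σ ≢ 𝟏 → p ≡ 2 ⊎ p ≡ 3 ⊎ p ≡ 5 ⊎ p ≡ 13
    primes {σ} {0} pp _ _ _ = contradiction pp ¬prime[0]
    primes {σ} {1} pp _ _ _ = contradiction pp ¬prime[1]
    primes {σ} {2} _ _ _ _ = inj₁ refl
    primes {σ} {3} _ _ _ _ = inj₂ (inj₁ refl)
    primes {σ} {p@(suc (suc (suc (suc _))))} pp a e ne = inj₂ (inj₂ (prime-order v≡81 (toSymmetry a) pp (s≤s (s≤s (s≤s (s≤s z≤n)))) (order-dividing a {p} e) (moved ne)))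

-- Group orders, and elements of order 10 and 26

smooth : ∀ ps → All (λ p → p ≡ 2 ⊎ p ≡ 3 ⊎ p ≡ 5 ⊎ p ≡ 13) ps → ∃ λ α → ∃ λ β → ∃ λ γ → ∃ λ σ → product ps ≡ 2 ^ α * 3 ^ β * 5 ^ γ * 13 ^ σ
smooth []       []       = 0 , 0 , 0 , 0 , refl
smooth (p ∷ ps) (c ∷ cs) = step c (smooth ps cs)
  where
  Smooth : ℕ → Set
  Smooth n = ∃ λ α → ∃ λ β → ∃ λ γ → ∃ λ σ → n ≡ 2 ^ α * 3 ^ β * 5 ^ γ * 13 ^ σ
  at₂ : ∀ a b c d → 2 * (a * b * c * d) ≡ 2 * a * b * c * d
  at₂ = solve-∀
  at₃ : ∀ a b c d → 3 * (a * b * c * d) ≡ a * (3 * b) * c * d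
  at₃ = solve-∀
  at₅ : ∀ a b c d → 5 * (a * b * c * d) ≡ a * b * (5 * c) * d
  at₅ = solve-∀
  at₁₃ : ∀ a b c d → 13 * (a * b * c * d) ≡ a * b * c * (13 * d)
  at₁₃ = solve-∀
  step : p ≡ 2 ⊎ p ≡ 3 ⊎ p ≡ 5 ⊎ p ≡ 13 → Smooth (product ps) → Smooth (p * product ps)
  step (inj₁ refl) (α , β , γ , σ , e)               = suc α , β , γ , σ , trans (cong (2 *_) e) (at₂ (2 ^ α) (3 ^ β) (5 ^ γ) (13 ^ σ))
  step (inj₂ (inj₁ refl)) (α , β , γ , σ , e)        = α , suc β , γ , σ , trans (cong (3 *_) e) (at₃ (2 ^ α) (3 ^ β) (5 ^ γ) (13 ^ σ))
  step (inj₂ (inj₂ (inj₁ refl))) (α , β , γ , σ , e) = α , β , suc γ , σ , trans (cong (5 *_) e) (at₅ (2 ^ α) (3 ^ β) (5 ^ γ) (13 ^ σ))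
  step (inj₂ (inj₂ (inj₂ refl))) (α , β , γ , σ , e) = α , β , γ , suc σ , trans (cong (13 *_) e) (at₁₃ (2 ^ α) (3 ^ β) (5 ^ γ) (13 ^ σ))

exponent≤1 : ∀ m p e {n} → n ≡ m * p ^ e → ¬ (p * p ∣ n) → e ≤ 1
exponent≤1 m p 0 _ _ = z≤n
exponent≤1 m p 1 _ _ = ≤-refl
exponent≤1 m p (suc (suc e)) n≡ ¬d = contradiction (divides (m * p ^ e) (trans n≡ (regroup m p (p ^ e)))) ¬d
  where
  regroup : ∀ m p q → m * (p * (p * q)) ≡ m * q * (p * p)
  regroup = solve-∀

module Orders {v} (v≡81 : v ≡ 81) (S : SymmetricDesign v 16 3) where
  open FromSubsets S

  record AutGroup (G : List (Perm v)) : Set where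
    field
      isGroup : IsGroup G
      auts    : ∀ {σ} → σ ∈ G → Aut σ

  prime-divisors : ∀ {G} → AutGroup G → ∀ {p} → Prime p → p ∣ length G → p ≡ 2 ⊎ p ≡ 3 ⊎ p ≡ 5 ⊎ p ≡ 13
  prime-divisors {G} A pp p∣ = let (g , g∈ , e , ne) = cauchy pp p∣ in primes v≡81 pp (auts g∈) e ne
    where
    open AutGroup A
    open GroupTheory isGroup

  avoid? : (xs : List (Fin v)) → Decidable (_∉ xs)
  avoid? xs x = ¬? (Any.any? (x Finₚ.≟_) xs)

  avoid-size : ∀ xs → Unique xs → # (avoid? xs) + length xs ≡ 81
  avoid-size [] _ = trans (+-identityʳ _) (trans (#-all (avoid? []) (λ _ ())) v≡81)
  avoid-size (x ∷ xs) (x∉ ∷ u) = trans (+-suc (# (avoid? (x ∷ xs))) (length xs)) (trans (cong (_+ length xs) (sym (trans (#-remove (avoid? xs) x (λ x∈ → All.lookup x∉ x∈ refl))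
      (cong suc (#-cong (λ y → avoid? xs y ×-dec ¬? (y Finₚ.≟ x)) (avoid? (x ∷ xs)) (λ { (n , _) (there m) → n m ; (_ , n) (here e) → n e }) (λ n → n ∘ there , n ∘ here)))))) (avoid-size xs u))

  module SylowSquare {p} (pp : Prime p) where

    -- Plays the part of a Sylow subgroup: a group of order divisible by p² that fixes `xs`,
    -- replaced by a point stabiliser each time a further fixed point is gained.
    record Fixer (xs : List (Fin v)) : Set where
      field
        G       : List (Perm v)
        group   : AutGroup G
        fixes   : ∀ {σ x} → σ ∈ G → x ∈ xs → lookup σ x ≡ x
        p²∣     : p * p ∣ length G

    module _ {xs} (F : Fixer xs) (u : Unique xs) where
      open Fixer F
      open AutGroup group
      open GroupTheory isGroup

      avoids : ∀ {g x} → g ∈ G → x ∉ xs → lookup g x ∉ xs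
      avoids {g} {x} g∈ x∉ gx∈ = x∉ (subst (_∈ xs) (perms g∈ (fixes g∈ gx∈)) gx∈)

      stab-fixes : ∀ x {σ y} → σ ∈ Stab x → y ∈ x ∷ xs → lookup σ y ≡ y
      stab-fixes x σ∈ (here refl) = proj₂ (∈Stab x σ∈)
      stab-fixes x σ∈ (there y∈)  = fixes (proj₁ (∈Stab x σ∈)) y∈

      stab-aut : ∀ x → AutGroup (Stab x)
      stab-aut x = record { isGroup = stab-group x ; auts = λ σ∈ → auts (proj₁ (∈Stab x σ∈)) }

      -- If p does not divide the number of remaining points, some point among them has a stabiliser
      -- whose order still contains p².
      extend : ¬ (p ∣ # (avoid? xs)) → ∃ λ x → x ∉ xs × Fixer (x ∷ xs)
      extend ¬d = let (x , x∉ , d) = point-stabilizer (avoid? xs) avoids pp p²∣ ¬d in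
        x , x∉ , record { G = Stab x ; group = stab-aut x ; fixes = stab-fixes x ; p²∣ = d }

      -- Once `xs` has as many points as an element of order p can fix, Cauchy's theorem makes the
      -- stabiliser of any further point of order prime to p.
      semiregular : (∀ {σ} → Aut σ → σ ^^ p ≡ 𝟏 → σ ≢ 𝟏 → # (fix? σ) ≤ length xs) → p * p ∣ # (avoid? xs)
      semiregular bound = p′-stabilizers (avoid? xs) avoids pp p²∣ λ {x} x∉ d →
        let (g , g∈ , e , ne) = GroupTheory.cauchy (stab-group x) pp d in
        <⇒≱ (length≤# (fix? g) (x ∷ xs) (All.tabulate (λ y∈ e → x∉ (subst (_∈ xs) (sym e) y∈)) ∷ u) (All.tabulate (stab-fixes x g∈)))
          (bound (auts (proj₁ (∈Stab x g∈))) e ne)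

    start : ∀ {G} → AutGroup G → p * p ∣ length G → Fixer []
    start {G} A d = record { G = G ; group = A ; fixes = λ _ () ; p²∣ = d }

  size : ∀ xs c → Unique xs → c + length xs ≡ 81 → # (avoid? xs) ≡ c
  size xs c u e = +-cancelʳ-≡ (length xs) (# (avoid? xs)) c (trans (avoid-size xs u) (sym e))

  fresh : ∀ {x} {xs : List (Fin v)} → x ∉ xs → Unique xs → Unique (x ∷ xs)
  fresh x∉ u = All.tabulate (λ y∈ e → x∉ (subst (_∈ _) (sym e) y∈)) ∷ u

  -- Since 5 does not divide 81, one point can be fixed; an element of order 5 fixes no other, so 25
  -- would divide 80.
  ¬25∣ : ∀ {G} → AutGroup G → ¬ (25 ∣ length G)
  ¬25∣ A d = from (extend (start A d) [] (λ q → contradiction (subst (5 ∣_) (size [] 81 [] refl) q) (toWitness {a? = ¬? (5 ∣? 81)} tt)))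
    where
    open SylowSquare {5} (toWitness {a? = prime? 5} tt)
    from : (∃ λ x → x ∉ [] × Fixer (x ∷ [])) → ⊥
    from (x , _ , F) = contradiction (subst (25 ∣_) (size (x ∷ []) 80 ([] ∷ []) refl) (semiregular F ([] ∷ []) (λ a e ne → ≡⇒≤ (fixed-by-order-5 v≡81 a e ne)))) (toWitness {a? = ¬? (25 ∣? 80)} tt)

  -- Since 13 divides none of 81, 80, 79, three points can be fixed one after the other; an element
  -- of order 13 fixes no more, so 169 would divide 78.
  ¬169∣ : ∀ {G} → AutGroup G → ¬ (169 ∣ length G)
  ¬169∣ A d = first (extend (start A d) [] (λ q → contradiction (subst (13 ∣_) (size [] 81 [] refl) q) (toWitness {a? = ¬? (13 ∣? 81)} tt)))
    where
    open SylowSquare {13} (toWitness {a? = prime? 13} tt)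
    third′ : ∀ {xs} → Unique xs → length xs ≡ 2 → (∃ λ x → x ∉ xs × Fixer (x ∷ xs)) → ⊥
    third′ {xs} u l (x , x∉ , F) = contradiction (subst (169 ∣_) (size (x ∷ xs) 78 (fresh x∉ u) (cong (λ k → 78 + suc k) l))
      (semiregular F (fresh x∉ u) (λ a e ne → ≡⇒≤ (trans (fixed-by-order-13 v≡81 a e ne) (cong suc (sym l)))))) (toWitness {a? = ¬? (169 ∣? 78)} tt)
    second : ∀ {xs} → Unique xs → length xs ≡ 1 → (∃ λ x → x ∉ xs × Fixer (x ∷ xs)) → ⊥
    second {xs} u l (x , x∉ , F) = third′ (fresh x∉ u) (cong suc l)
      (extend F (fresh x∉ u) (λ q → contradiction (subst (13 ∣_) (size (x ∷ xs) 79 (fresh x∉ u) (cong (λ k → 79 + suc k) l)) q) (toWitness {a? = ¬? (13 ∣? 79)} tt)))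
    first : (∃ λ x → x ∉ [] × Fixer (x ∷ [])) → ⊥
    first (x , x∉ , F) = second ([] ∷ []) refl (extend F ([] ∷ []) (λ q → contradiction (subst (13 ∣_) (size (x ∷ []) 80 ([] ∷ []) refl) q) (toWitness {a? = ¬? (13 ∣? 80)} tt)))

  group-order : ∀ {G} → AutGroup G → ∃ λ α → ∃ λ β → ∃ λ γ → ∃ λ σ → length G ≡ 2 ^ α * 3 ^ β * 5 ^ γ * 13 ^ σ × γ ≤ 1 × σ ≤ 1
  group-order {G} A = build (smooth factors (All.tabulate λ {p} p∈ → prime-divisors A (All.lookup factorsPrime p∈) (subst (p ∣_) (sym isFactorisation) (∈⇒∣product p∈))))
    where
    instance
      nonZero : NonZero (length G)
      nonZero = ℕ.>-nonZero (≤-trans (s≤s z≤n) (⊆-length {xs = 𝟏 ∷ []} {ys = G} ([] ∷ []) (λ { (here refl) → IsGroup.id∈ (AutGroup.isGroup A) })))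
    open PrimeFactorisation (factorise (length G))
    swap : ∀ a b c → a * b * c ≡ a * c * b
    swap = solve-∀
    build : (∃ λ α → ∃ λ β → ∃ λ γ → ∃ λ σ → product factors ≡ 2 ^ α * 3 ^ β * 5 ^ γ * 13 ^ σ) → ∃ λ α → ∃ λ β → ∃ λ γ → ∃ λ σ → length G ≡ 2 ^ α * 3 ^ β * 5 ^ γ * 13 ^ σ × γ ≤ 1 × σ ≤ 1
    build (α , β , γ , σ , e) = α , β , γ , σ , n≡ , exponent≤1 (2 ^ α * 3 ^ β * 13 ^ σ) 5 γ (trans n≡ (swap (2 ^ α * 3 ^ β) (5 ^ γ) (13 ^ σ))) (¬25∣ A) , exponent≤1 (2 ^ α * 3 ^ β * 5 ^ γ) 13 σ n≡ (¬169∣ A)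
      where
      n≡ : length G ≡ 2 ^ α * 3 ^ β * 5 ^ γ * 13 ^ σ
      n≡ = trans isFactorisation e

  power-fixes : ∀ (σ : Perm v) m → σ ^^ m ≡ 𝟏 → ∀ x → iter (lookup σ) m x ≡ x
  power-fixes σ m q x = trans (sym (lookup-^ σ m x)) (trans (cong (λ τ → lookup τ x) q) (lookup-id x))

  order-divides : ∀ {G} → IsGroup G → ∀ {p g} → Prime p → g ∈ G → g ^^ p ≡ 𝟏 → g ≢ 𝟏 → p ∣ length G
  order-divides {G} isG {p} {g} pp g∈ e ne = decidable-stable (p ∣? length G) λ ¬d → ne (perm-ext λ x →
      trans (iter-coprime (lookup g) (coprime ¬d) (power-fixes g p e x) (power-fixes g (length G) (GroupTheory.order-∣ isG g∈) x)) (sym (lookup-id x)))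
    where
    coprime : ¬ (p ∣ length G) → Coprime p (length G)
    coprime ¬d (d∣p , d∣n) = [ id , (λ { refl → contradiction d∣n ¬d }) ]′ (prime⇒irreducible pp d∣p)

  -- The orbit of a point fixed by an element of order 13 has at most 5 points, so it is fixed pointwise.
  no-order-65 : ∀ {G} → AutGroup G → length G ≢ 65
  no-order-65 {G} A n≡ = clash (cauchy p13 (subst (13 ∣_) (sym n≡) (toWitness {a? = 13 ∣? 65} tt))) (cauchy p5 (subst (5 ∣_) (sym n≡) (toWitness {a? = 5 ∣? 65} tt)))
    where
    open AutGroup A
    open GroupTheory isGroup
    p13 : Prime 13
    p13 = toWitness {a? = prime? 13} tt
    p5 : Prime 5
    p5 = toWitness {a? = prime? 5} tt
    clash : (∃ λ g → g ∈ G × g ^^ 13 ≡ 𝟏 × g ≢ 𝟏) → (∃ λ h → h ∈ G × h ^^ 5 ≡ 𝟏 × h ≢ 𝟏) → ⊥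
    clash (g , g∈ , eg , ng) (h , h∈ , eh , nh) = contradiction (subst₂ _≤_ three one (#-mono both? (fix? h) proj₂)) (toWitness {a? = ¬? (3 ≤? 1)} tt)
      where
      both? : Decidable (λ x → lookup g x ≡ x × lookup h x ≡ x)
      both? x = fix? g x ×-dec fix? h x
      one : # (fix? h) ≡ 1
      one = fixed-by-order-5 v≡81 (auts h∈) eh nh
      -- 13 divides the order of the stabiliser, so an orbit of 13 points would force |G| ≥ 169.
      small-orbit : ∀ {x} → lookup g x ≡ x → # (orb? x) < 13
      small-orbit {x} fx = ≰⇒> λ 13≤ → contradiction (subst (169 ≤_) (trans (sym (orbit-stabilizer x)) n≡) (*-mono-≤ 13≤ 13≤s)) (toWitness {a? = ¬? (169 ≤? 65)} tt)
        where
        g∈S : g ∈ Stab x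
        g∈S = ∈-filter⁺ (stab? x) g∈ fx
        13≤s : 13 ≤ length (Stab x)
        13≤s = ∣⇒≤ {{ℕ.>-nonZero (≤-trans (s≤s z≤n) (⊆-length {xs = g ∷ []} {ys = Stab x} ([] ∷ []) (λ { (here refl) → g∈S })))}} (order-divides (stab-group x) p13 g∈S eg ng)
      orbit-fixed : ∀ {x y} → lookup g x ≡ x → Orb x y → lookup g y ≡ y
      orbit-fixed {x} fx = #-sub-full (orb? x) (fix? g) (mod-small (prime-mod p13 (orb? x) (lookup g) closed (λ {y} _ → power-fixes g 13 eg y)) (small-orbit fx))
        where
        closed : ∀ {y} → Orb x y → Orb x (lookup g y)
        closed o = let (k , k∈ , e) = find o in Any.map (λ { refl → trans (lookup-∘ g k x) (cong (lookup g) e) }) (comp g∈ k∈)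
      -- h permutes the three fixed points of g with cycles of length 1 or 5, so it fixes them all,
      -- yet it has a single fixed point.
      three : # both? ≡ 3
      three = trans (sym (mod-small (prime-mod p5 (fix? g) (lookup h) (λ fx → orbit-fixed fx (Any.map (λ { refl → refl }) h∈)) (λ {x} _ → power-fixes h 5 eh x)) (subst (_< 5) (sym f≡3) (toWitness {a? = 3 <? 5} tt)))) f≡3
        where
        f≡3 : # (fix? g) ≡ 3
        f≡3 = fixed-by-order-13 v≡81 (auts g∈) eg ng

  -- With a = σ², b = σᵖ: the common fixed points are counted modulo p through a on Fix b, and modulo 2 through b on Fix a.
  double-order : ∀ {σ p} → Prime p → Aut σ → σ ^^ (2 * p) ≡ 𝟏 → σ ^^ 2 ≢ 𝟏 → σ ^^ p ≢ 𝟏 →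
                 ∃ λ k → ∃ λ c → (k ≡ 9 ⊎ k ≡ 13 ⊎ k ≡ 17) × k ≡ c mod-via p × # (fix? (σ ^^ 2)) ≡ c mod-via 2 × c ≤ # (fix? (σ ^^ 2))
  double-order {σ} {p} pp A e na nb = # (fix? b) , # (λ x → fix? b x ×-dec fix? a x)
      , fixed-by-order-2 v≡81 (aut-^ A p) b² nb
      , prime-mod pp (fix? b) (lookup a) (λ {x} → commute a b ab x) (λ {x} _ → power-fixes a p aᵖ x)
      , mod-trans (involution-mod2 (fix? a) (lookup b) (λ {x} → commute b a (sym ab) x) (λ {x} _ → trans (sym (lookup-∘ b b x)) (trans (cong (λ τ → lookup τ x) b²) (lookup-id x))))
          (0 , trans (#-cong (λ x → fix? a x ×-dec fix? b x) (λ x → fix? b x ×-dec fix? a x) (λ (q , r) → r , q) (λ (q , r) → r , q)) (sym (+-identityʳ _)))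
      , #-mono (λ x → fix? b x ×-dec fix? a x) (fix? a) proj₂
    where
    a b : Perm v
    a = σ ^^ 2
    b = σ ^^ p
    ab : a · b ≡ b · a
    ab = trans (sym (^-+ σ 2 p)) (trans (cong (σ ^^_) (+-comm 2 p)) (^-+ σ p 2))
    aᵖ : a ^^ p ≡ 𝟏
    aᵖ = trans (^-* σ 2 p) (trans (cong (σ ^^_) (*-comm p 2)) e)
    b² : b · b ≡ 𝟏
    b² = trans (sym (^-+ σ p p)) (trans (cong (λ k → σ ^^ (p + k)) (sym (+-identityʳ p))) e)
    commute : ∀ a b → a · b ≡ b · a → ∀ x → lookup b x ≡ x → lookup b (lookup a x) ≡ lookup a x
    commute a b q x fx = trans (sym (lookup-∘ b a x)) (trans (cong (λ τ → lookup τ x) (sym q)) (trans (lookup-∘ a b x) (cong (lookup a) fx)))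

  order-powers : ∀ {σ : Perm v} {m} → HasOrder σ m → (σ ^^ m ≡ 𝟏) × (∀ j → 1 ≤ j → suc j ≤ m → σ ^^ j ≢ 𝟏)
  order-powers {σ} {m} (_ , e , min) = trans (^^-def σ m) (trans e (sym 𝟏-def)) , λ j 1≤j j<m q → min j 1≤j j<m (trans (sym (^^-def σ j)) (trans q 𝟏-def))

  -- σ² fixes one point, so c = 1; but 9, 13 and 17 are 4, 3 and 2 modulo 5.
  no-element-10 : ∀ {σ} → Aut σ → ¬ HasOrder σ 10
  no-element-10 {σ} A o = clash (double-order {σ} {5} (toWitness {a? = prime? 5} tt) A e na nb)
    where
    e = proj₁ (order-powers o)
    na = proj₂ (order-powers o) 2 (s≤s z≤n) (toWitness {a? = 3 ≤? 10} tt)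
    nb = proj₂ (order-powers o) 5 (s≤s z≤n) (toWitness {a? = 6 ≤? 10} tt)
    f≡1 : # (fix? (σ ^^ 2)) ≡ 1
    f≡1 = fixed-by-order-5 v≡81 (aut-^ A 2) (trans (^-* σ 2 5) e) na
    clash : (∃ λ k → ∃ λ c → (k ≡ 9 ⊎ k ≡ 13 ⊎ k ≡ 17) × k ≡ c mod-via 5 × # (fix? (σ ^^ 2)) ≡ c mod-via 2 × c ≤ # (fix? (σ ^^ 2))) → ⊥
    clash (k , c , k∈ , km , cm , c≤) = values k∈ (trans (mod⇒% 5 km) (cong (_% 5) c≡1))
      where
      c≡1 : c ≡ 1
      c≡1 = sym (trans (sym f≡1) (mod-small cm (subst (_< 2) (sym f≡1) (s≤s (s≤s z≤n)))))
      values : ∀ {k} → k ≡ 9 ⊎ k ≡ 13 ⊎ k ≡ 17 → k % 5 ≢ 1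
      values (inj₁ refl) ()
      values (inj₂ (inj₁ refl)) ()
      values (inj₂ (inj₂ refl)) ()

  -- σ² fixes three points, so c is 1 or 3; but 9, 13 and 17 are 9, 0 and 4 modulo 13.
  no-element-26 : ∀ {σ} → Aut σ → ¬ HasOrder σ 26
  no-element-26 {σ} A o = clash (double-order {σ} {13} (toWitness {a? = prime? 13} tt) A e na nb)
    where
    e = proj₁ (order-powers o)
    na = proj₂ (order-powers o) 2 (s≤s z≤n) (toWitness {a? = 3 ≤? 26} tt)
    nb = proj₂ (order-powers o) 13 (s≤s z≤n) (toWitness {a? = 14 ≤? 26} tt)
    f≡3 : # (fix? (σ ^^ 2)) ≡ 3
    f≡3 = fixed-by-order-13 v≡81 (aut-^ A 2) (trans (^-* σ 2 13) e) na
    clash : (∃ λ k → ∃ λ c → (k ≡ 9 ⊎ k ≡ 13 ⊎ k ≡ 17) × k ≡ c mod-via 13 × # (fix? (σ ^^ 2)) ≡ c mod-via 2 × c ≤ # (fix? (σ ^^ 2))) → ⊥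
    clash (k , c , k∈ , km , cm , c≤) = values k∈ (toWitness {a? = ℕₚ.allUpTo? (λ c → 3 % 2 ℕₚ.≟ c % 2 →-dec (c % 13 ℕₚ.≟ 1 ⊎-dec c % 13 ℕₚ.≟ 3)) 4} tt
        (s≤s (subst (c ≤_) f≡3 c≤)) (trans (cong (_% 2) (sym f≡3)) (mod⇒% 2 cm))) (mod⇒% 13 km)
      where
      values : ∀ {k r} → k ≡ 9 ⊎ k ≡ 13 ⊎ k ≡ 17 → r ≡ 1 ⊎ r ≡ 3 → k % 13 ≢ r
      values (inj₁ refl) (inj₁ refl) ()
      values (inj₁ refl) (inj₂ refl) ()
      values (inj₂ (inj₁ refl)) (inj₁ refl) ()
      values (inj₂ (inj₁ refl)) (inj₂ refl) ()
      values (inj₂ (inj₂ refl)) (inj₁ refl) ()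
      values (inj₂ (inj₂ refl)) (inj₂ refl) ()

-- Abelian 2-groups

choose : ∀ {n} → Bool → Perm n → Perm n
choose true  σ = σ
choose false σ = 𝟏

span : ∀ {n} (S : List (Perm n)) → Vec Bool (length S) → Perm n
span []      []      = 𝟏
span (σ ∷ S) (b ∷ u) = choose b σ · span S u

span-𝟎 : ∀ {n} (S : List (Perm n)) → span S 𝟎 ≡ 𝟏
span-𝟎 []      = refl
span-𝟎 (σ ∷ S) = trans (∘-idˡ (span S 𝟎)) (span-𝟎 S)

module _ {n : ℕ} where

  interchange : ∀ (a b c d : Perm n) → b · c ≡ c · b → (a · b) · (c · d) ≡ (a · c) · (b · d)
  interchange a b c d e = trans (∘-assoc a b (c · d)) (trans (cong (a ·_) (trans (sym (∘-assoc b c d)) (trans (cong (_· d) e) (∘-assoc c b d)))) (sym (∘-assoc a c (b · d))))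

  trivial : IsGroup {n} (𝟏 ∷ [])
  trivial = record
    { unique = [] ∷ [] ; perms = λ { (here refl) {x} {y} e → trans (sym (lookup-id x)) (trans e (lookup-id y)) }
    ; id∈ = here refl ; comp = λ { (here refl) (here refl) → here (∘-idˡ 𝟏) } }

  -- The quotient A / N is a vector space over F₂, handled through representatives in A. It is
  -- needed both for H modulo its squares and for the elements of order at most 2 modulo 𝟏.
  module Modulo {A N : List (Perm n)} (isA : IsGroup A) (isN : IsGroup N) (N⊆A : ∀ {σ} → σ ∈ N → σ ∈ A)
                (commutes : ∀ {σ τ} → σ ∈ A → τ ∈ A → σ · τ ≡ τ · σ) (squares : ∀ {σ} → σ ∈ A → σ · σ ∈ N) where
    private
      module A = GroupTheory isA
      module N = GroupTheory isN

    span∈ : ∀ {S} → All (_∈ A) S → ∀ u → span S u ∈ A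
    span∈ []       []          = A.id∈
    span∈ (σ∈ ∷ a) (true ∷ u)  = A.comp σ∈ (span∈ a u)
    span∈ (σ∈ ∷ a) (false ∷ u) = A.comp A.id∈ (span∈ a u)

    choose-xor : ∀ {σ} → σ ∈ A → ∀ b c → ∃ λ ν → ν ∈ N × choose b σ · choose c σ ≡ choose (b xor c) σ · ν
    choose-xor {σ} σ∈ true  true  = σ · σ , squares σ∈ , sym (∘-idˡ (σ · σ))
    choose-xor {σ} σ∈ true  false = 𝟏 , N.id∈ , refl
    choose-xor {σ} σ∈ false true  = 𝟏 , N.id∈ , trans (∘-idˡ σ) (sym (∘-idʳ σ))
    choose-xor {σ} σ∈ false false = 𝟏 , N.id∈ , refl

    choose∈ : ∀ {σ} → σ ∈ A → ∀ b → choose b σ ∈ A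
    choose∈ σ∈ true  = σ∈
    choose∈ σ∈ false = A.id∈

    span-⊕ : ∀ {S} → All (_∈ A) S → ∀ u w → ∃ λ ν → ν ∈ N × span S u · span S w ≡ span S (u ⊕ w) · ν
    span-⊕ []             []      []      = 𝟏 , N.id∈ , refl
    span-⊕ {σ ∷ S} (σ∈ ∷ a) (b ∷ u) (c ∷ w) = build (choose-xor σ∈ b c) (span-⊕ a u w)
      where
      build : (∃ λ ν → ν ∈ N × choose b σ · choose c σ ≡ choose (b xor c) σ · ν) → (∃ λ ν → ν ∈ N × span S u · span S w ≡ span S (u ⊕ w) · ν) →
              ∃ λ ν → ν ∈ N × (choose b σ · span S u) · (choose c σ · span S w) ≡ (choose (b xor c) σ · span S (u ⊕ w)) · ν
      build (ν , ν∈ , e) (μ , μ∈ , q) = ν · μ , N.comp ν∈ μ∈ , trans (interchange (choose b σ) (span S u) (choose c σ) (span S w) (commutes (span∈ a u) (choose∈ σ∈ c)))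
        (trans (cong₂ _·_ e q) (interchange (choose (b xor c) σ) ν (span S (u ⊕ w)) μ (commutes (N⊆A ν∈) (span∈ a (u ⊕ w)))))

    divide : ∀ {σ ν} → ν ∈ N → σ · ν ∈ N → σ ∈ N
    divide {σ} {ν} ν∈ e = let (μ , μ∈ , νμ , _) = N.inverse ν∈ in subst (_∈ N) (trans (∘-assoc σ ν μ) (trans (cong (σ ·_) νμ) (∘-idʳ σ))) (N.comp e μ∈)

    Independent Covers : List (Perm n) → Set
    Independent S = ∀ u → span S u ∈ N → u ≡ 𝟎
    Covers S = ∀ {σ} → σ ∈ A → ∃ λ u → ∃ λ ν → ν ∈ N × σ ≡ span S u · ν

    InSpan : List (Perm n) → Perm n → Set
    InSpan S σ = Any (λ u → Any (λ ν → σ ≡ span S u · ν) N) (allVecs (length S))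

    inSpan? : ∀ S → Decidable (InSpan S)
    inSpan? S σ = Any.any? (λ u → Any.any? (λ ν → σ ≟ₚ span S u · ν) N) (allVecs (length S))

    -- If N contains τ · U for some U in the span, then τ = U · (τ · U · U⁻²) lies in the span
    -- modulo N, because U² is in N.
    extend-independent : ∀ {S τ} → All (_∈ A) S → Independent S → τ ∈ A → ¬ InSpan S τ → Independent (τ ∷ S)
    extend-independent {S} {τ} a ind τ∈ out (false ∷ u) e = cong (false ∷_) (ind u (subst (_∈ N) (∘-idˡ (span S u)) e))
    extend-independent {S} {τ} a ind τ∈ out (true ∷ u)  e = contradiction (inside (N.inverse (squares U∈))) out
      where
      U : Perm n
      U = span S u
      U∈ : U ∈ A
      U∈ = span∈ a u
      inside : (∃ λ μ → μ ∈ N × (U · U) · μ ≡ 𝟏 × μ · (U · U) ≡ 𝟏) → InSpan S τ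
      inside (μ , μ∈ , q , _) = Any.map (λ { refl → Any.map (λ { refl → τ≡ }) (N.comp e μ∈) }) (∈-allVecs u)
        where
        τ≡ : τ ≡ U · ((τ · U) · μ)
        τ≡ = trans (sym (∘-idʳ τ)) (trans (cong (τ ·_) (sym q)) (trans (sym (∘-assoc τ (U · U) μ)) (trans (cong (_· μ) (trans (sym (∘-assoc τ U U)) (commutes (A.comp τ∈ U∈) U∈))) (∘-assoc U (τ · U) μ))))

    grow : ∀ m → (∃ λ S → length S < m × All (_∈ A) S × Covers S) ⊎ (∃ λ S → length S ≡ m × All (_∈ A) S × Independent S)
    grow zero    = inj₂ ([] , refl , [] , λ { [] _ → refl })
    grow (suc m) = [ (λ (S , l , rest) → inj₁ (S , ≤-trans l (n≤1+n m) , rest)) , (λ (S , l , a , ind) → step l a ind (All.all? (inSpan? S) A)) ]′ (grow m)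
      where
      step : ∀ {S} → length S ≡ m → All (_∈ A) S → Independent S → Dec (All (InSpan S) A) →
             (∃ λ S → length S < suc m × All (_∈ A) S × Covers S) ⊎ (∃ λ S → length S ≡ suc m × All (_∈ A) S × Independent S)
      step {S} l a ind (yes all) = inj₁ (S , s≤s (≡⇒≤ l) , a , λ σ∈ → let (u , _ , i) = find (All.lookup all σ∈) ; (ν , ν∈ , e) = find i in u , ν , ν∈ , e)
      step {S} l a ind (no ¬all) = let (τ , τ∈ , out) = find (Allₚ.¬All⇒Any¬ (inSpan? S) A ¬all) in
        inj₂ (τ ∷ S , cong suc l , τ∈ ∷ a , extend-independent a ind τ∈ out)

    -- The cosets `span S u · N` are disjoint: U φ = W ψ gives U W φ = W² ψ in N, and U W is
    -- `span S (u ⊕ w)` up to an element of N.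
    independent-count : ∀ {S} → All (_∈ A) S → Independent S → 2 ^ length S * length N ≤ length A
    independent-count {S} a ind = subst (_≤ length A) (trans (Listₚ.length-map place pairs) (trans (length-product (allVecs (length S)) N) (cong (_* length N) (length-allVecs (length S)))))
      (⊆-length (map-unique place injective (Uniqueₚ.cartesianProduct⁺ (unique-allVecs (length S)) N.unique)) inA)
      where
      place : Vec Bool (length S) × Perm n → Perm n
      place (u , φ) = span S u · φ
      pairs : List (Vec Bool (length S) × Perm n)
      pairs = cartesianProduct (allVecs (length S)) N
      inA : ∀ {σ} → σ ∈ map place pairs → σ ∈ A
      inA σ∈ = let ((u , φ) , p∈ , e) = ∈-map⁻ place σ∈ in subst (_∈ A) (sym e) (A.comp (span∈ a u) (N⊆A (proj₂ (∈-cartesianProduct⁻ (allVecs (length S)) N p∈))))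
      injective : ∀ {p q} → p ∈ pairs → q ∈ pairs → place p ≡ place q → p ≡ q
      injective {u , φ} {w , ψ} p∈ q∈ e = conclude (⊕≡𝟎 (ind (u ⊕ w) (divide ν∈ (subst (_∈ N) (proj₂ (proj₂ sum)) (divide φ∈ (subst (_∈ N) UWφ (N.comp (squares W∈) ψ∈)))))))
        where
        φ∈ : φ ∈ N
        φ∈ = proj₂ (∈-cartesianProduct⁻ (allVecs (length S)) N p∈)
        ψ∈ : ψ ∈ N
        ψ∈ = proj₂ (∈-cartesianProduct⁻ (allVecs (length S)) N q∈)
        U∈ : span S u ∈ A
        U∈ = span∈ a u
        W∈ : span S w ∈ A
        W∈ = span∈ a w
        sum : ∃ λ ν → ν ∈ N × span S u · span S w ≡ span S (u ⊕ w) · ν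
        sum = span-⊕ a u w
        ν∈ : proj₁ sum ∈ N
        ν∈ = proj₁ (proj₂ sum)
        UWφ : (span S w · span S w) · ψ ≡ (span S u · span S w) · φ
        UWφ = trans (∘-assoc (span S w) (span S w) ψ) (trans (cong (span S w ·_) (sym e)) (trans (sym (∘-assoc (span S w) (span S u) φ)) (cong (_· φ) (commutes W∈ U∈))))
        conclude : u ≡ w → (u , φ) ≡ (w , ψ)
        conclude refl = cong (u ,_) (∘-cancelˡ (span S u) (A.perms U∈) e)

module AbelianTwoGroup {n} {H : List (Perm n)} (isH : IsGroup H) (commutes : ∀ {σ τ} → σ ∈ H → τ ∈ H → σ · τ ≡ τ · σ) where
  open GroupTheory isH

  private
    square? : Decidable (λ σ → Any (λ κ → σ ≡ κ · κ) H)
    square? σ = Any.any? (λ κ → σ ≟ₚ κ · κ) H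

    order-2? : Decidable (λ (σ : Perm n) → σ · σ ≡ 𝟏)
    order-2? σ = σ · σ ≟ₚ 𝟏

  -- The kernel and the image of squaring; in an abelian 2-group these are the socle `Ω` and the
  -- Frattini subgroup `Φ`.
  Φ Ω : List (Perm n)
  Φ = filter square? H
  Ω = filter order-2? H

  ∈Φ : ∀ {σ} → σ ∈ Φ → σ ∈ H × Any (λ κ → σ ≡ κ · κ) H
  ∈Φ = ∈-filter⁻ square? {xs = H}

  ∈Ω : ∀ {σ} → σ ∈ Ω → σ ∈ H × σ · σ ≡ 𝟏
  ∈Ω = ∈-filter⁻ order-2? {xs = H}

  square∈ : ∀ {σ} → σ ∈ H → σ · σ ∈ Φ
  square∈ σ∈ = ∈-filter⁺ square? (comp σ∈ σ∈) (Any.map (λ { refl → refl }) σ∈)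

  square-· : ∀ {σ τ} → σ ∈ H → τ ∈ H → (σ · σ) · (τ · τ) ≡ (σ · τ) · (σ · τ)
  square-· {σ} {τ} σ∈ τ∈ = interchange σ σ τ τ (commutes σ∈ τ∈)

  Φ-group : IsGroup Φ
  Φ-group = record
    { unique = Uniqueₚ.filter⁺ square? unique ; perms = λ σ∈ → perms (proj₁ (∈Φ σ∈))
    ; id∈ = subst (_∈ Φ) (∘-idˡ 𝟏) (square∈ id∈)
    ; comp = λ σ∈ τ∈ → let (κ , κ∈ , e) = find (proj₂ (∈Φ σ∈)) ; (l , l∈ , q) = find (proj₂ (∈Φ τ∈)) in
        subst (_∈ Φ) (sym (trans (cong₂ _·_ e q) (square-· κ∈ l∈))) (square∈ (comp κ∈ l∈)) }

  Ω-group : IsGroup Ω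
  Ω-group = record
    { unique = Uniqueₚ.filter⁺ order-2? unique ; perms = λ σ∈ → perms (proj₁ (∈Ω σ∈))
    ; id∈ = ∈-filter⁺ order-2? id∈ (∘-idˡ 𝟏)
    ; comp = λ σ∈ τ∈ → let (σ∈H , e) = ∈Ω σ∈ ; (τ∈H , q) = ∈Ω τ∈ in
        ∈-filter⁺ order-2? (comp σ∈H τ∈H) (trans (sym (square-· σ∈H τ∈H)) (trans (cong₂ _·_ e q) (∘-idˡ 𝟏))) }

  𝟏∈Ω : ∀ {σ} → σ ∈ 𝟏 ∷ [] → σ ∈ Ω
  𝟏∈Ω (here refl) = IsGroup.id∈ Ω-group

  module Frattini = Modulo isH Φ-group (λ σ∈ → proj₁ (∈Φ σ∈)) commutes square∈
  module Socle = Modulo Ω-group trivial 𝟏∈Ω (λ σ∈ τ∈ → commutes (proj₁ (∈Ω σ∈)) (proj₁ (∈Ω τ∈))) (λ σ∈ → here (proj₂ (∈Ω σ∈)))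

  root : Perm n → Perm n
  root φ = pick (square? φ)
    where
    pick : Dec (Any (λ κ → φ ≡ κ · κ) H) → Perm n
    pick (yes a) = proj₁ (find a)
    pick (no _)  = 𝟏

  root-spec : ∀ {φ} → φ ∈ Φ → root φ ∈ H × φ ≡ root φ · root φ
  root-spec {φ} φ∈ with square? φ
  ... | yes a = proj₂ (find a)
  ... | no ¬a = contradiction (proj₂ (∈Φ φ∈)) ¬a

  -- h ↦ (h · root (h · h)⁻¹ , h · h) embeds H into Ω × Φ.
  kernel-image : length H ≤ length Ω * length Φ
  kernel-image = subst (length H ≤_) (trans (Listₚ.length-map place (cartesianProduct Ω Φ)) (length-product Ω Φ)) (⊆-length unique inside)
    where
    place : Perm n × Perm n → Perm n
    place (ω , φ) = ω · root φ
    inside : ∀ {h} → h ∈ H → h ∈ map place (cartesianProduct Ω Φ)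
    inside {h} h∈ = build (root-spec (square∈ h∈))
      where
      build : root (h · h) ∈ H × h · h ≡ root (h · h) · root (h · h) → h ∈ map place (cartesianProduct Ω Φ)
      build (r∈ , e) = let (ρ , ρ∈ , rρ , ρr) = inverse r∈ in
        subst (_∈ map place (cartesianProduct Ω Φ)) (trans (∘-assoc h ρ (root (h · h))) (trans (cong (h ·_) ρr) (∘-idʳ h)))
          (∈-map⁺ place (∈-cartesianProduct⁺ (∈-filter⁺ order-2? (comp h∈ ρ∈)
            (trans (sym (square-· h∈ ρ∈)) (trans (cong (_· (ρ · ρ)) e) (trans (square-· r∈ ρ∈) (trans (cong₂ _·_ rρ rρ) (∘-idˡ 𝟏)))))) (square∈ h∈)))

  ^-· : ∀ {σ τ} → σ ∈ H → τ ∈ H → ∀ m → (σ · τ) ^^ m ≡ (σ ^^ m) · (τ ^^ m)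
  ^-· σ∈ τ∈ zero    = sym (∘-idˡ 𝟏)
  ^-· {σ} {τ} σ∈ τ∈ (suc m) = trans (cong ((σ · τ) ·_) (^-· σ∈ τ∈ m)) (interchange σ τ (σ ^^ m) (τ ^^ m) (commutes τ∈ (^∈ σ∈ m)))

  module Generation {S} (S⊆H : All (_∈ H) S) (covers : Frattini.Covers S) where

    gen-· : ∀ {σ τ} → Gen S σ → Gen S τ → Gen S (σ · τ)
    gen-· {σ} {τ} a b = subst (Gen S) (sym (·-def σ τ)) (gen-comp a b)

    gen-𝟏 : Gen S 𝟏
    gen-𝟏 = subst (Gen S) (sym 𝟏-def) gen-id

    gen-^ : ∀ {σ} → Gen S σ → ∀ m → Gen S (σ ^^ m)
    gen-^ g zero    = gen-𝟏
    gen-^ g (suc m) = gen-· g (gen-^ g m)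

    gen-span : ∀ T → (∀ {σ} → σ ∈ T → σ ∈ S) → ∀ u → Gen S (span T u)
    gen-span []      _ []          = gen-𝟏
    gen-span (σ ∷ T) s (true ∷ u)  = gen-· (gen-mem (s (here refl))) (gen-span T (s ∘ there) u)
    gen-span (σ ∷ T) s (false ∷ u) = gen-· gen-𝟏 (gen-span T (s ∘ there) u)

    -- Since H = ⟨S⟩ H², a power 2ᵉ of H lies in ⟨S⟩ as soon as the power 2ᵉ⁺¹ does.
    descend : ∀ e → (∀ {κ} → κ ∈ H → Gen S (κ ^^ (2 ^ e))) → ∀ {κ} → κ ∈ H → Gen S κ
    descend zero    h {κ} κ∈ = subst (Gen S) (∘-idʳ κ) (h κ∈)
    descend (suc e) h κ∈ = descend e (λ κ∈ → step κ∈ (covers κ∈)) κ∈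
      where
      step : ∀ {κ} → κ ∈ H → (∃ λ u → ∃ λ ν → ν ∈ Φ × κ ≡ span S u · ν) → Gen S (κ ^^ (2 ^ e))
      step {κ} κ∈ (u , ν , ν∈ , q) = let (l , l∈ , ν≡) = find (proj₂ (∈Φ ν∈)) in
        subst (Gen S) (sym (trans (cong (_^^ (2 ^ e)) q) (^-· (Frattini.span∈ S⊆H u) (proj₁ (∈Φ ν∈)) (2 ^ e))))
          (gen-· (gen-^ (gen-span S id u) (2 ^ e)) (subst (Gen S) (sym (trans (cong (_^^ (2 ^ e)) (trans ν≡ (cong (l ·_) (sym (∘-idʳ l))))) (trans (^-* l 2 (2 ^ e)) (cong (l ^^_) (*-comm (2 ^ e) 2))))) (h l∈)))

    generates : (∃ λ a → length H ≡ 2 ^ a) → ∀ σ → σ ∈ H ⇔ Gen S σ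
    -- The descent starts at the exponent a with 2ᵃ = |H|, where all powers are 𝟏.
    generates (a , n≡) σ = mk⇔ (descend a (λ {κ} κ∈ → subst (Gen S) (sym (trans (cong (κ ^^_) (sym n≡)) (order-∣ κ∈))) gen-𝟏)) inside
      where
      inside : ∀ {σ} → Gen S σ → σ ∈ H
      inside gen-id         = subst (_∈ H) 𝟏-def id∈
      inside (gen-mem σ∈)   = All.lookup S⊆H σ∈
      inside (gen-comp {σ} {τ} g h) = subst (_∈ H) (·-def σ τ) (comp (inside g) (inside h))

  covers-bound : ∀ S → Socle.Covers S → length Ω ≤ 2 ^ length S
  covers-bound S covers = subst (length Ω ≤_) (trans (Listₚ.length-map (span S) (allVecs (length S))) (length-allVecs (length S)))
    (⊆-length (IsGroup.unique Ω-group) λ σ∈ → at (covers σ∈))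
    where
    at : ∀ {σ} → (∃ λ u → ∃ λ ν → ν ∈ 𝟏 ∷ [] × σ ≡ span S u · ν) → σ ∈ map (span S) (allVecs (length S))
    at (u , ν , here refl , e) = subst (_∈ map (span S) (allVecs (length S))) (sym (trans e (∘-idʳ (span S u)))) (∈-map⁺ (span S) (∈-allVecs u))

  -- Rank above 3 gives 16 |Φ| ≤ |H|, and |H| ≤ |Ω| |Φ|; so `Ω` has at least 16 elements, whereas
  -- three involutions would span at most 8.
  four-involutions : (∃ λ a → length H ≡ 2 ^ a) → ¬ RankAtMost 3 H → ∃ λ S → length S ≡ 4 × All (_∈ Ω) S × Socle.Independent S
  four-involutions 2-group ¬rank = [ (λ (S , l , a , c) → ⊥-elim (clash S c l)) , id ]′ (Socle.grow 4)
    where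
    frattini : ∃ λ S → length S ≡ 4 × All (_∈ H) S × Frattini.Independent S
    frattini = [ (λ (S , l , a , c) → contradiction (S , ℕ.s≤s⁻¹ l , a , Generation.generates a c 2-group) ¬rank) , id ]′ (Frattini.grow 4)
    16≤ : 16 * length Φ ≤ length H
    16≤ = let (S , l , a , i) = frattini in subst (λ k → 2 ^ k * length Φ ≤ length H) l (Frattini.independent-count a i)
    1≤ : 1 ≤ length Φ
    1≤ = ⊆-length {xs = 𝟏 ∷ []} {ys = Φ} ([] ∷ []) (λ { (here refl) → IsGroup.id∈ Φ-group })
    clash : ∀ S → Socle.Covers S → length S < 4 → ⊥
    clash S c l = absurd {ρ = length Φ ∷ length H ∷ []} (hyp 1 (16 :* v0) v1 16≤ ∷ hyp 1 v1 (8 :* v0)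
      (≤-trans kernel-image (*-monoˡ-≤ (length Φ) (≤-trans (covers-bound S c) (ℕₚ.^-monoʳ-≤ 2 (ℕ.s≤s⁻¹ l))))) ∷ hyp 8 (con 1) v0 1≤ ∷ [])

-- The five restrictions on the automorphism group

module _ {v} (v≡81 : v ≡ 81) (S : SymmetricDesign v 16 3) where
  open FromSubsets S
  open Orders v≡81 S

  full-group : ∀ {L} → Unique L → (∀ σ → (σ ∈ L) ⇔ IsAut S σ) → AutGroup L
  full-group {L} u h = record { isGroup = record { unique = u ; perms = λ σ∈ → proj₁ (Aut.isAut (aut σ∈)) ; id∈ = mem aut-𝟏 ; comp = λ σ∈ τ∈ → mem (aut-· (aut σ∈) (aut τ∈)) } ; auts = aut }
    where
    aut : ∀ {σ} → σ ∈ L → Aut σ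
    aut {σ} σ∈ = mkAut (Equivalence.to (h σ) σ∈)
    mem : ∀ {σ} → Aut σ → σ ∈ L
    mem {σ} a = Equivalence.from (h σ) (Aut.isAut a)

  subgroup : ∀ {H} → IsSubgroup S H → AutGroup H
  subgroup {H} (u , auts , id∈ , comp , _) = record
    { isGroup = record { unique = u ; perms = λ σ∈ → proj₁ (All.lookup auts σ∈) ; id∈ = subst (_∈ H) (sym 𝟏-def) id∈ ; comp = λ {σ} {τ} σ∈ τ∈ → subst (_∈ H) (sym (·-def σ τ)) (comp σ τ σ∈ τ∈) }
    ; auts = λ σ∈ → mkAut (All.lookup auts σ∈) }

  no-abelian-2-group : ¬ HasAbelian2SubgroupOfRankAbove S 3
  no-abelian-2-group (H , sub , abelian , 2-group , ¬rank) = from (four-involutions 2-group ¬rank)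
    where
    open AutGroup (subgroup sub)
    commutes : ∀ {σ τ} → σ ∈ H → τ ∈ H → σ · τ ≡ τ · σ
    commutes {σ} {τ} σ∈ τ∈ = trans (·-def σ τ) (trans (abelian σ τ σ∈ τ∈) (sym (·-def τ σ)))
    open AbelianTwoGroup isGroup commutes
    from : (∃ λ T → length T ≡ 4 × All (_∈ Ω) T × Socle.Independent T) → ⊥
    from (T@(_ ∷ _ ∷ _ ∷ _ ∷ []) , refl , a , ind) = no-order-16 v≡81 (action (span T) (λ u → auts (proj₁ (∈Ω (Socle.span∈ a u)))) (λ u w → hom u w (Socle.span-⊕ a u w)) (span-𝟎 T))
        (λ u u≢ → moved (λ e → u≢ (ind u (here e))))
      where
      hom : ∀ u w → (∃ λ ν → ν ∈ 𝟏 ∷ [] × span T u · span T w ≡ span T (u ⊕ w) · ν) → span T (u ⊕ w) ≡ span T u · span T w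
      hom u w (_ , here refl , e) = sym (trans e (∘-idʳ (span T (u ⊕ w))))

  restrictions : (∀ n → AutOrder S n → ∃[ α ] ∃[ β ] ∃[ γ ] ∃[ σ ] (n ≡ 2 ^ α * 3 ^ β * 5 ^ γ * 13 ^ σ × γ ≤ 1 × σ ≤ 1)) ×
                 ¬ HasSubgroupOfOrder S 65 × ¬ HasElementOfOrder S 10 × ¬ HasElementOfOrder S 26 × ¬ HasAbelian2SubgroupOfRankAbove S 3
  restrictions = (λ { n (L , u , h , refl) → group-order (full-group u h) })
    , (λ (H , sub , n≡) → no-order-65 (subgroup sub) n≡)
    , (λ (σ , a , o) → no-element-10 (mkAut a) o)
    , (λ (σ , a , o) → no-element-26 (mkAut a) o)
    , no-abelian-2-group

theorem1p4 : (D : SymmetricDesign 81 16 3) →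
    (∀ n → AutOrder D n →
    ∃[ α ] ∃[ β ] ∃[ γ ] ∃[ σ ]
    (n ≡ 2 ^ α * 3 ^ β * 5 ^ γ * 13 ^ σ × γ ≤ 1 × σ ≤ 1)) ×
    ¬ HasSubgroupOfOrder D 65 ×
    ¬ HasElementOfOrder D 10 ×
    ¬ HasElementOfOrder D 26 ×
    ¬ HasAbelian2SubgroupOfRankAbove D 3
theorem1p4 D = restrictions refl D
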